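{- Let $\mathcal M=(V,E,(V_0,V_1))$ be a game with $n=|V|$, $m=|E|$, with winning condition given by $k$ generalized Rabin pairs $\{(F_1,\mathcal I_1),\ldots,(F_k,\mathcal I_k)\}$, and let $B=\prod_{i=1}^k[1..|\mathcal I_i|]$ be the corresponding degeneralization domain. The smallest good ranking can be computed in time $\mathcal O(m\,n^{k+1}\,k\,k!\cdot|B|)$ and space $\mathcal O(nk\cdot|B|)$.
   Context: Game. A game $(V,E,(V_0,V_1))$ consists of a finite directed graph $(V,E)$ in which every vertex has an outgoing edge and a partition $(V_0,V_1)$ of $V$ into player-0 and player-1 vertices. Generalized Rabin pairs. A generalized Rabin pair is $(F_i,\mathcal I_i)$ with $F_i\subseteq V$ and $\mathcal I_i=\{I_i^1,\ldots,I_i^{\ell_i}\}$, $I_i^j\subseteq V$, $\ell_i=|\mathcal I_i|$; assume $k>0$ and $\ell_i>0$ for all $i$. Degeneralization domain. $[1..\ell]=\{1,\ldots,\ell\}$ carries the cyclic successor $a\oplus 1=a+1$ for $a<\ell$ and $\ell\oplus1=1$. $B=\prod_{i=1}^k[1..\ell_i]$; for $b\in B$, $b(i)$ is its $i$th component. Rankings. The ranking domain is $R=\big(\{1,\ldots,k\}!\times\{0,\ldots,n\}^{k+1}\big)\cup\{\infty\}$, where $\{1,\ldots,k\}!$ is the set of permutations $\pi=\pi_1\cdots\pi_k$ of $\{1,\ldots,k\}$. A ranking is a function $r:V\times B\to R$. The total order $>_{lg}$ on $R$ compares elements $(\pi_1\cdots\pi_k,w_0w_1\cdots w_k)$ by the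 lexicographic order on $w_0\pi_1w_1\pi_2w_2\cdots\pi_kw_k$, with $\infty$ the greatest element. Rankings are ordered component-wise: $r_1$ is at least $r_2$ if $r_1(v,b)\ge_{lg}r_2(v,b)$ for all $v\in V$, $b\in B$; "smallest" refers to this order. For $v\in V$ define $\mathrm{next}_v:B\to B$ by $\mathrm{next}_v(b)(i)=b(i)$ if $v\notin I_i^{b(i)}$ and $\mathrm{next}_v(b)(i)=b(i)\oplus1$ if $v\in I_i^{b(i)}$. For a ranking $r$ define $\mathrm{next}:V\times B\to R$ by $\mathrm{next}(v,b)=\min_{(v,w)\in E}r(w,\mathrm{next}_v(b))$ if $v\in V_0$, and $\mathrm{next}(v,b)=\max_{(v,w)\in E}r(w,\mathrm{next}_v(b))$ if $v\in V_1$, with min and max w.r.t. $>_{lg}$. Good rankings. For $v\in V$, $b\in B$ define $(\pi_1\cdots\pi_k,w_0w_1\cdots w_k)>_{v,b}(\pi'_1\cdots\pi'_k,w'_0w'_1\cdots w'_k)$ to hold if either $w_0>w_0'$, or $w_0=w_0'$ and $>^1_{v,b}$ holds. Recursively, for $1\le\ell\le k$, $>^\ell_{v,b}$ holds if one of the following holds: (1) $\pi_\ell>\pi'_\ell$; (2) $\pi_\ell=\pi'_\ell$, $v\notin F_{\pi_\ell}$ and $w_\ell>w'_\ell$; (3) $\pi_\ell=\pi'_\ell$, $v\notin F_{\pi_\ell}$ and $v\in I_{\pi_\ell}^{b(\pi_\ell)}$; (4) $\pi_\ell=\pi'_\ell$, $v\notin F_{\pi_\ell}$, $w_\ell=w'_\ell$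 and $>^{\ell+1}_{v,b}$ holds; where $>^{k+1}_{v,b}$ never holds. An element of $R\setminus\{\infty\}$ is never $>_{v,b}\infty$. A ranking $r$ is good if for every $v\in V$, $b\in B$ with $r(v,b)\neq\infty$ we have $r(v,b)>_{v,b}\mathrm{next}(v,b)$. -}

module Defs where

open import Level using (0ℓ)
open import Data.Bool.Base using (Bool; true; false; if_then_else_)
open import Data.Empty using (⊥)
open import Data.Fin.Base as Fin using (Fin; zero; suc; toℕ; combine)
open import Data.Fin.Permutation using (Permutation′; _⟨$⟩ʳ_)
open import Data.Fin.Properties using (nonZeroIndex)
open import Data.Fin.Subset using (Subset; _∈_; _∉_; Nonempty; ∣_∣)
open import Data.Fin.Subset.Properties using (_∈?_)
open import Data.List.Base as List using (List; []; _∷_; _++_; allFin; concatMap; filter; length; map)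
open import Data.List.Extrema using (min; max)
open import Data.Nat.Base using (ℕ; zero; suc; _+_; _*_; _∸_; _≤_; _<_; _≡ᵇ_; NonZero)
open import Data.Nat.DivMod using (_mod_)
open import Data.Nat.ListAction using (sum)
open import Data.Nat.Properties using (<-strictTotalOrder)
open import Data.Product.Base using (Σ-syntax; ∃-syntax; _×_; _,_; proj₁)
open import Data.Sum.Base using (_⊎_)
open import Data.Vec.Base as Vec using (Vec; []; _∷_; lookup)
import Data.Vec.Relation.Binary.Lex.Strict as Lex
open import Data.Vec.Relation.Unary.All using (All; []; _∷_)
open import Data.Vec.Relation.Unary.All.Properties using (lookup⁺; lookup⁻)
open import Relation.Binary.Bundles using (TotalOrder)
import Relation.Binary.Construct.Add.Supremum.NonStrict as Supremum
import Relation.Binary.Construct.On as On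
open import Relation.Binary.PropositionalEquality using (_≡_)
open import Relation.Nullary.Construct.Add.Supremum using (_⁺; [_]; ⊤⁺)
open import Relation.Nullary.Decidable.Core using (does)

------------------------------------------------------------------------
-- Games and generalized Rabin pairs

-- The vertex set is Fin n, E v is the set of successors of v, and V₁ is
-- the complement of V₀.
record Game (n : ℕ) : Set where
  field
    E      : Fin n → Subset n
    V₀     : Subset n
    serial : ∀ v → Nonempty (E v)

  succs preds : Fin n → List (Fin n)
  succs v = filter (_∈? E v) (allFin n)
  preds w = filter (λ v → w ∈? E v) (allFin n)

  ∣E∣ : ℕ
  ∣E∣ = sum (map (λ v → ∣ E v ∣) (allFin n))

-- Indices are 0-based throughout: the pairs are numbered by Fin k and the
-- members of 𝓘ᵢ by Fin ℓᵢ, where ℓᵢ = lookup ℓ i.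
record GenRabin (n k : ℕ) : Set where
  field
    ℓ   : Vec ℕ k
    F   : Fin k → Subset n
    I   : (i : Fin k) → Fin (lookup ℓ i) → Subset n
    k>0 : NonZero k
    ℓ>0 : ∀ i → NonZero (lookup ℓ i)

------------------------------------------------------------------------
-- Degeneralization domain

Domain : ∀ {k} → Vec ℕ k → Set
Domain = All Fin

∣Domain∣ : ∀ {k} → Vec ℕ k → ℕ
∣Domain∣ = Vec.foldr _ _*_ 1

-- Mixed-radix numbering, last component least significant.
index : ∀ {k} {ℓ : Vec ℕ k} → Domain ℓ → Fin (∣Domain∣ ℓ)
index []      = zero
index (a ∷ b) = combine a (index b)

_⊕1 : ∀ {ℓ} → Fin ℓ → Fin ℓ
_⊕1 {ℓ} a = _mod_ (suc (toℕ a)) ℓ {{nonZeroIndex a}}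

------------------------------------------------------------------------
-- Ranking domain

Finite : ℕ → ℕ → Set
Finite n k = Permutation′ k × Vec (Fin (suc n)) (suc k)

R : ℕ → ℕ → Set
R n k = Finite n k ⁺

-- w₀ π₁ w₁ π₂ w₂ … π_k w_k
word : ∀ {n k} → Finite n k → Vec ℕ (suc (k * 2))
word (π , w₀ ∷ w) =
  toℕ w₀ ∷ Vec.concat (Vec.tabulate λ i → toℕ (π ⟨$⟩ʳ i) ∷ toℕ (lookup w i) ∷ [])

finite-totalOrder : ℕ → ℕ → TotalOrder 0ℓ 0ℓ 0ℓ
finite-totalOrder n k =
  On.totalOrder (Lex.≤-totalOrder <-strictTotalOrder (suc (k * 2))) (word {n} {k})

lg-totalOrder : ℕ → ℕ → TotalOrder 0ℓ 0ℓ 0ℓ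
lg-totalOrder n k = record
  { isTotalOrder = Supremum.≤⁺-isTotalOrder _≤ᶠ_ isTotalOrder }
  where open TotalOrder (finite-totalOrder n k) renaming (_≤_ to _≤ᶠ_)

_≤lg_ : ∀ {n k} → R n k → R n k → Set
_≤lg_ {n} {k} = TotalOrder._≤_ (lg-totalOrder n k)

------------------------------------------------------------------------
-- Good rankings

module Rankings {n k : ℕ} (G : Game n) (Ω : GenRabin n k) where
  open Game G
  open GenRabin Ω

  B : Set
  B = Domain ℓ

  ∣B∣ : ℕ
  ∣B∣ = ∣Domain∣ ℓ

  infixl 9 _!_
  _!_ : B → (i : Fin k) → Fin (lookup ℓ i)
  _!_ = lookup⁺

  Ranking : Set
  Ranking = Fin n → B → R n k

  nextB : Fin n → B → B
  nextB v b = lookup⁻ λ i → if does (v ∈? I i (b ! i)) then (b ! i) ⊕1 else b ! i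

  -- The first argument of min and max is the rank of one fixed successor
  -- of v, so the result is the extremum over the successors alone.
  next : Ranking → Fin n → B → R n k
  next r v b =
    if does (v ∈? V₀) then min (lg-totalOrder n k) some all
                      else max (lg-totalOrder n k) some all
    where
    rank : Fin n → R n k
    rank w = r w (nextB v b)

    some : R n k
    some = rank (proj₁ (serial v))

    all : List (R n k)
    all = map rank (succs v)

  module _ (v : Fin n) (b : B) where

    -- The relation >^ℓ, where the list holds the positions ℓ, ℓ+1, …, k.
    Above : List (Fin k) → Finite n k → Finite n k → Set
    Above []       _         _           = ⊥
    Above (l ∷ ls) x@(π , w) y@(π′ , w′) =
        πₗ Fin.> π′ₗ
      ⊎ (πₗ ≡ π′ₗ × v ∉ F πₗ × wₗ Fin.> w′ₗ)
      ⊎ (πₗ ≡ π′ₗ × v ∉ F πₗ × v ∈ I πₗ (b ! πₗ))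
      ⊎ (πₗ ≡ π′ₗ × v ∉ F πₗ × wₗ ≡ w′ₗ × Above ls x y)
      where
      πₗ π′ₗ : Fin k
      πₗ  = π  ⟨$⟩ʳ l
      π′ₗ = π′ ⟨$⟩ʳ l

      wₗ w′ₗ : Fin (suc n)
      wₗ  = lookup w  (suc l)
      w′ₗ = lookup w′ (suc l)

    Exceeds : Finite n k → R n k → Set
    Exceeds _              ⊤⁺                  = ⊥
    Exceeds x@(_ , w₀ ∷ _) [ y@(_ , w₀′ ∷ _) ] =
      w₀ Fin.> w₀′ ⊎ (w₀ ≡ w₀′ × Above (allFin k) x y)

  Good : Ranking → Set
  Good r = ∀ v b x → r v b ≡ [ x ] → Exceeds v b x (next r v b)

  SmallestGood : Ranking → Set
  SmallestGood r = Good r × (∀ r′ → Good r′ → ∀ v b → r v b ≤lg r′ v b)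

------------------------------------------------------------------------
-- Word RAM with structured control flow
--
-- A program has a read-only, randomly accessible input, finitely many
-- registers (those it names), and a working memory of `space` cells.
-- Registers and cells hold numbers up to `maxWord`.  Every node of an
-- evaluated expression and every executed assignment, store or test costs
-- one step.  Out-of-range accesses and overflows have no transition.

data Expr : Set where
  const   : ℕ → Expr
  reg     : ℕ → Expr
  mem     : Expr → Expr
  inp     : Expr → Expr
  _⟨+⟩_   : Expr → Expr → Expr
  _⟨∸⟩_   : Expr → Expr → Expr
  _⟨*⟩_   : Expr → Expr → Expr

data Program : Set where
  skip      : Program
  _:=_      : ℕ → Expr → Program
  store     : (address value : Expr) → Program
  _⨾_       : Program → Program → Program
  ifLess    : Expr → Expr → Program → Program → Program
  whileLess : Expr → Expr → Program → Program

infixr 4 _⨾_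
infix  5 _:=_

size : Expr → ℕ
size (const _) = 1
size (reg _)   = 1
size (mem e)   = 1 + size e
size (inp e)   = 1 + size e
size (e ⟨+⟩ f) = 1 + size e + size f
size (e ⟨∸⟩ f) = 1 + size e + size f
size (e ⟨*⟩ f) = 1 + size e + size f

record State : Set where
  constructor ⟨_,_⟩
  field
    regs : ℕ → ℕ
    cell : ℕ → ℕ
open State public

initial : State
initial = ⟨ (λ _ → 0) , (λ _ → 0) ⟩

_[_↦_] : (ℕ → ℕ) → ℕ → ℕ → ℕ → ℕ
(f [ a ↦ x ]) c = if c ≡ᵇ a then x else f c

module Machine (input : List ℕ) (space maxWord : ℕ) where

  data _⊢_⇓_ (σ : State) : Expr → ℕ → Set where
    const : ∀ {c} → c ≤ maxWord → σ ⊢ const c ⇓ c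
    reg   : ∀ {x} → σ ⊢ reg x ⇓ regs σ x
    mem   : ∀ {e a} → σ ⊢ e ⇓ a → a < space → σ ⊢ mem e ⇓ cell σ a
    inp   : ∀ {e} (i : Fin (length input)) → σ ⊢ e ⇓ toℕ i →
            List.lookup input i ≤ maxWord → σ ⊢ inp e ⇓ List.lookup input i
    _⟨+⟩_⟨_⟩ : ∀ {e f x y} → σ ⊢ e ⇓ x → σ ⊢ f ⇓ y → x + y ≤ maxWord →
               σ ⊢ e ⟨+⟩ f ⇓ (x + y)
    _⟨∸⟩_ : ∀ {e f x y} → σ ⊢ e ⇓ x → σ ⊢ f ⇓ y → σ ⊢ e ⟨∸⟩ f ⇓ (x ∸ y)
    _⟨*⟩_⟨_⟩ : ∀ {e f x y} → σ ⊢ e ⇓ x → σ ⊢ f ⇓ y → x * y ≤ maxWord →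
               σ ⊢ e ⟨*⟩ f ⇓ (x * y)

  -- Exec p σ t σ′: started in σ, p halts in σ′ after t steps.
  data Exec : Program → State → ℕ → State → Set where
    skip : ∀ {σ} → Exec skip σ 0 σ
    assign : ∀ {σ x e a} → σ ⊢ e ⇓ a →
      Exec (x := e) σ (1 + size e) ⟨ regs σ [ x ↦ a ] , cell σ ⟩
    store : ∀ {σ e f a x} → σ ⊢ e ⇓ a → σ ⊢ f ⇓ x → a < space →
      Exec (store e f) σ (1 + size e + size f) ⟨ regs σ , cell σ [ a ↦ x ] ⟩
    seq : ∀ {p q σ σ′ σ″ s t} → Exec p σ s σ′ → Exec q σ′ t σ″ →
      Exec (p ⨾ q) σ (s + t) σ″
    if-true : ∀ {e f p q σ σ′ x y t} →
      σ ⊢ e ⇓ x → σ ⊢ f ⇓ y → x < y → Exec p σ t σ′ →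
      Exec (ifLess e f p q) σ (1 + size e + size f + t) σ′
    if-false : ∀ {e f p q σ σ′ x y t} →
      σ ⊢ e ⇓ x → σ ⊢ f ⇓ y → y ≤ x → Exec q σ t σ′ →
      Exec (ifLess e f p q) σ (1 + size e + size f + t) σ′
    while-true : ∀ {e f p σ σ′ σ″ x y s t} →
      σ ⊢ e ⇓ x → σ ⊢ f ⇓ y → x < y →
      Exec p σ s σ′ → Exec (whileLess e f p) σ′ t σ″ →
      Exec (whileLess e f p) σ (1 + size e + size f + s + t) σ″
    while-false : ∀ {e f p σ x y} →
      σ ⊢ e ⇓ x → σ ⊢ f ⇓ y → y ≤ x →
      Exec (whileLess e f p) σ (1 + size e + size f) σ

------------------------------------------------------------------------
-- Input and output conventions

bits : ∀ {n} → Subset n → List ℕ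
bits s = map (λ x → if x then 1 else 0) (Vec.toList s)

-- All degrees, followed by all adjacency lists.
adjacency : ∀ {n} → (Fin n → List (Fin n)) → List ℕ
adjacency {n} f = map (λ v → length (f v)) (allFin n)
               ++ concatMap (λ v → map toℕ (f v)) (allFin n)

-- The graph is given by both its successor and its predecessor lists.
encode : ∀ {n k} → Game n → GenRabin n k → List ℕ
encode {n} {k} G Ω =
     n ∷ ∣E∣ ∷ k ∷ []
  ++ Vec.toList ℓ
  ++ bits V₀
  ++ concatMap (λ i → bits (F i)) (allFin k)
  ++ concatMap (λ i → concatMap (λ j → bits (I i j)) (allFin (lookup ℓ i))) (allFin k)
  ++ adjacency succs
  ++ adjacency preds
  where
  open Game G
  open GenRabin Ω

-- A flag (1 for ∞), followed for a finite rank by its word.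
cells : ∀ {n k} → R n k → List ℕ
cells ⊤⁺    = 1 ∷ []
cells [ x ] = 0 ∷ Vec.toList (word x)

module _ {n k : ℕ} (G : Game n) (Ω : GenRabin n k) where
  open Rankings G Ω

  -- The rank of (v , b) starts at cell (v · |B| + index b) · (2k + 2).
  Holds : (ℕ → ℕ) → Ranking → Set
  Holds M r = ∀ v b (j : Fin (length (cells (r v b)))) →
    M (toℕ (combine v (index b)) * (2 + k * 2) + toℕ j) ≡ List.lookup (cells (r v b)) j

  ComputesSmallestGood : Program → (time space maxWord : ℕ) → Set
  ComputesSmallestGood p time space maxWord =
    Σ[ r ∈ Ranking ] SmallestGood r ×
    ∃[ t ] ∃[ σ ] t ≤ time × Exec p initial t σ × Holds (cell σ) r
    where open Machine (encode G Ω) space maxWord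

{-# OPTIONS --safe #-}
module Submission where

-- A rank is coded as a word of pairs (key , weight), and the two orders on ranks become relations on
-- words.  Every good ranking can be lowered to a good one with all weights below n: replace the rank
-- at (v , b) by the least of the ranks at (v , b′), each weight being preceded by the cyclic distance
-- from b′ to b, and then each weight by the number of smaller ones that occur after the same prefix.
-- There remain k! n^(k+1) finite ranks.
--
-- The smallest good ranking is reached from below.  Each state (v , b) counts the successors that its
-- rank fails to exceed, and the states with too many failures form a worklist.  One step raises the
-- rank of such a state to its immediate lexicographic successor, recounts its failures and corrects
-- the counters of its predecessors; no rank ever passes a good ranking with weights below n.  Summed
-- over all states, one step at each costs O(m k |B|), and every rank is raised at most k! n^(k+1)
-- times.  The potential that pays for the run is the sum over the states of the cost of a step times
-- the number of ranks still above.

open import Defs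
open import Data.Bool.Base using (Bool; true; false; if_then_else_; T)
open import Data.Empty using (⊥-elim)
open import Data.Fin.Base as Fin using (Fin; zero; suc; toℕ; fromℕ<; combine; remQuot)
import Data.Fin.Properties as Finₚ
open import Data.Fin.Subset using (Subset)
open import Data.List.Base as List using (List; []; _∷_; _++_; allFin; concatMap; filter; length; map)
import Data.List.Properties as Listₚ
open import Data.List.Membership.Propositional using (_∈_; _∉_; find; lose)
import Data.List.Membership.Propositional.Properties as ∈ₚ
open import Data.List.Relation.Binary.Permutation.Propositional using (_↭_; ↭-refl; ↭-sym; prep; swap; refl) renaming (trans to tran)
import Data.List.Relation.Binary.Permutation.Propositional.Properties as ↭ₚ
open import Data.List.Relation.Unary.All as All using (All; []; _∷_)
import Data.List.Relation.Unary.All.Properties as Allₚ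
open import Data.List.Relation.Unary.AllPairs using (AllPairs; []; _∷_)
open import Data.List.Relation.Unary.Any using (here; there)
open import Data.List.Relation.Unary.Unique.Propositional using (Unique)
import Data.List.Relation.Unary.Unique.Propositional.Properties as Uniqueₚ
open import Data.Nat.Base hiding (less)
open import Data.Nat.Properties
open import Data.Nat.Solver using (module +-*-Solver)
open import Data.Product.Base using (Σ-syntax; ∃; ∃-syntax; _×_; _,_; proj₁; proj₂)
open import Data.Sum.Base using (_⊎_; inj₁; inj₂)
open import Data.Unit.Base using (⊤; tt)
open import Data.Vec.Base as Vec using (Vec; []; _∷_; lookup)
open import Function.Base using (_∘_; id; case_of_)
open import Relation.Binary.Definitions using (tri<; tri≈; tri>)
open import Relation.Binary.PropositionalEquality using (_≡_; _≢_; refl; sym; trans; cong; cong₂; subst; subst₂; module ≡-Reasoning)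
open import Relation.Nullary using (Dec; yes; no; ¬_; contradiction)
open import Data.Fin.Permutation using (Permutation′; _⟨$⟩ʳ_; _⟨$⟩ˡ_; permutation; inverseˡ; inverseʳ)
open import Data.List.Relation.Binary.BagAndSetEquality using (∼bag⇒↭)
open import Data.List.Membership.Propositional.Properties.WithK using (unique∧set⇒bag)
open import Data.Nat.DivMod using (m<n⇒m%n≡m; n%n≡0; %-congˡ)
open import Data.Vec.Properties using (lookup∘tabulate)
open import Function.Bundles using (mk⇔)
import Data.Fin.Subset as Subset
open import Data.Fin.Subset.Properties using (_∈?_)
import Data.Vec.Relation.Binary.Lex.Core as LexCore
import Data.Vec.Relation.Unary.All as VecAll
open import Data.Vec.Relation.Unary.All.Properties using (lookup⁺; lookup⁻)
open import Relation.Binary.Construct.Add.Supremum.NonStrict using ([_]; _≤⊤⁺)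
open import Relation.Nullary.Construct.Add.Supremum using ([_]; ⊤⁺)
open import Relation.Nullary.Decidable.Core using (does)
import Data.List.Extrema as Extrema
open import Data.Nat.DivMod using (_/_; _%_; m≡m%n+[m/n]*n; m%n<n; m<n*o⇒m/o<n)
open +-*-Solver using (_:+_; _:*_; con) renaming (solve to solveℕ; _:=_ to _:≡_)
open import Data.Nat.ListAction using (sum)
open import Data.Vec.Properties using (length-toList; toList-map; lookup-map; lookup⇒[]=; []=⇒lookup)

-- The bound is tight in two places. Counting smaller weights over all states would only bring the
-- weights of a good ranking below `n * |B|`; they fall below `n` because the distances make the
-- weight after a prefix depend on nothing but the vertex and the components named in the prefix, so
-- that different weights have different vertices as witnesses. And a step cannot afford to recount
-- every predecessor: the rank of a predecessor is only compared with the old and the new rank of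
-- the raised state. The predecessors of `(v , x)` at a vertex `u` are the `(u , y)` with
-- `next_u(y) = x`; a single `x` may have `|B|` of them, but for fixed `u` these sets partition `B`,
-- so linked lists of preimages keep the sum over all `x` at `|B|`.
--
-- The relation on ranks at `(v , b)` sees the state only through a class of each pair: 0 if `v`
-- lies in its `F`, 1 if `v` lies outside `F` but in the current member of its `I`, 2 otherwise.
-- Infinity is a word whose leading key has class 1: it exceeds every word, itself included, and
-- goodness can be asked of all states alike.

-- Ranks as words, and the two orders on them.

Letter : Set
Letter = ℕ × ℕ

Word : Set
Word = List Letter

keys : Word → List ℕ
keys = map proj₁

-- In class 0 only a larger key decides. In class 1 equal keys suffice whatever the weights, which
-- swallows the alternatives on weights and on later positions; these are left for class 2.
data Above (cl : ℕ → ℕ) : Word → Word → Set where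
  key>   : ∀ {p p′ w w′ xs ys} → p′ < p → Above cl ((p , w) ∷ xs) ((p′ , w′) ∷ ys)
  reset  : ∀ {p w w′ xs ys} → cl p ≡ 1 → Above cl ((p , w) ∷ xs) ((p , w′) ∷ ys)
  weight> : ∀ {p w w′ xs ys} → cl p ≡ 2 → w′ < w → Above cl ((p , w) ∷ xs) ((p , w′) ∷ ys)
  deeper : ∀ {p w xs ys} → cl p ≡ 2 → Above cl xs ys → Above cl ((p , w) ∷ xs) ((p , w) ∷ ys)

infix 4 _≼_

data _≼_ : Word → Word → Set where
  []     : [] ≼ []
  key<   : ∀ {p p′ w w′ xs ys} → p < p′ → (p , w) ∷ xs ≼ (p′ , w′) ∷ ys
  weight< : ∀ {p w w′ xs ys} → w < w′ → (p , w) ∷ xs ≼ (p , w′) ∷ ys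
  _∷≼_   : ∀ a {xs ys} → xs ≼ ys → a ∷ xs ≼ a ∷ ys

≼-refl : ∀ xs → xs ≼ xs
≼-refl []       = []
≼-refl (x ∷ xs) = x ∷≼ ≼-refl xs

≼-trans : ∀ {xs ys zs} → xs ≼ ys → ys ≼ zs → xs ≼ zs
≼-trans []          []          = []
≼-trans (key< p)    (key< q)    = key< (<-trans p q)
≼-trans (key< p)    (weight< q) = key< p
≼-trans (key< p)    (_ ∷≼ q)    = key< p
≼-trans (weight< p) (key< q)    = key< q
≼-trans (weight< p) (weight< q) = weight< (<-trans p q)
≼-trans (weight< p) (_ ∷≼ q)    = weight< p
≼-trans (_ ∷≼ p)    (key< q)    = key< q
≼-trans (_ ∷≼ p)    (weight< q) = weight< q
≼-trans (a ∷≼ p)    (_ ∷≼ q)    = a ∷≼ ≼-trans p q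

≼-total : ∀ xs ys → length xs ≡ length ys → xs ≼ ys ⊎ ys ≼ xs
≼-total [] [] _ = inj₁ []
≼-total ((p , w) ∷ xs) ((p′ , w′) ∷ ys) eq with <-cmp p p′
... | tri< lt _ _ = inj₁ (key< lt)
... | tri> _ _ gt = inj₂ (key< gt)
... | tri≈ _ refl _ with <-cmp w w′
...   | tri< lt _ _ = inj₁ (weight< lt)
...   | tri> _ _ gt = inj₂ (weight< gt)
...   | tri≈ _ refl _ with ≼-total xs ys (suc-injective eq)
...     | inj₁ le = inj₁ (_ ∷≼ le)
...     | inj₂ ge = inj₂ (_ ∷≼ ge)

-- The monotonicity on which everything rests: raising the rank of a successor can only turn a
-- success into a failure, and a minimum or maximum over successors can be replaced by a bound for
-- it.
Above-mono : ∀ {cl xs ys zs} → Above cl xs ys → zs ≼ ys → Above cl xs zs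
Above-mono (key> p)      (key< q)    = key> (<-trans q p)
Above-mono (key> p)      (weight< q) = key> p
Above-mono (key> p)      (_ ∷≼ q)    = key> p
Above-mono (reset c)     (key< q)    = key> q
Above-mono (reset c)     (weight< q) = reset c
Above-mono (reset c)     (_ ∷≼ q)    = reset c
Above-mono (weight> c p) (key< q)    = key> q
Above-mono (weight> c p) (weight< q) = weight> c (<-trans q p)
Above-mono (weight> c p) (_ ∷≼ q)    = weight> c p
Above-mono (deeper c p)  (key< q)    = key> q
Above-mono (deeper c p)  (weight< q) = weight> c q
Above-mono (deeper c p)  (_ ∷≼ q)    = deeper c (Above-mono p q)

above? : ∀ cl xs ys → Dec (Above cl xs ys)
above? cl [] _ = no λ ()
above? cl (_ ∷ _) [] = no λ ()
above? cl ((p , w) ∷ xs) ((p′ , w′) ∷ ys) with <-cmp p p′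
... | tri> _ _ gt = yes (key> gt)
... | tri< lt ≢ ≯ = no λ { (key> gt) → ≯ gt ; (reset _) → ≢ refl ; (weight> _ _) → ≢ refl ; (deeper _ _) →
  ≢ refl }
... | tri≈ ≮ refl ≯ with cl p ≟ 1
...   | yes c = yes (reset c)
...   | no c≢1 with cl p ≟ 2
...     | no c≢2 = no λ { (key> gt) → ≯ gt ; (reset c) → c≢1 c ; (weight> c _) → c≢2 c ; (deeper c _) → c≢2 c }
...     | yes c with <-cmp w w′
...       | tri> _ _ gt = yes (weight> c gt)
...       | tri< _ ≢ ≯′ = no λ { (key> gt) → ≯ gt ; (reset c) → c≢1 c ; (weight> _ gt) → ≯′ gt ; (deeper _ _) →
  ≢ refl }
...       | tri≈ _ refl ≯′ with above? cl xs ys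
...         | yes q = yes (deeper c q)
...         | no ¬q = no λ { (key> gt) → ≯ gt ; (reset c) → c≢1 c ; (weight> _ gt) → ≯′ gt ; (deeper _ q) →
  ¬q q }

least : ∀ {X : Set} (f : X → Word) → (∀ x y → length (f x) ≡ length (f y)) →
        ∀ x xs → Σ[ y ∈ X ] (∀ {z} → z ∈ x ∷ xs → f y ≼ f z)
least f len x [] = x , λ { (here refl) → ≼-refl _ }
least f len x (y ∷ ys) with least f len y ys
... | m , m≼ with ≼-total (f m) (f x) (len m x)
...   | inj₁ le = m , λ { (here refl) → le ; (there q) → m≼ q }
...   | inj₂ ge = x , λ { (here refl) → ≼-refl _ ; (there q) → ≼-trans ge (m≼ q) }

-- When `qs` are the keys to the right of `p`, this is the Lehmer digit of `p`.
less : ℕ → List ℕ → ℕ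
less p []       = 0
less p (q ∷ qs) = if q <ᵇ p then suc (less p qs) else less p qs

less-≤ : ∀ p qs → less p qs ≤ length qs
less-≤ p [] = z≤n
less-≤ p (q ∷ qs) with q <ᵇ p
... | true  = s≤s (less-≤ p qs)
... | false = m≤n⇒m≤1+n (less-≤ p qs)

less-yes : ∀ {p q} qs → q < p → less p (q ∷ qs) ≡ suc (less p qs)
less-yes {p} {q} qs lt with q <ᵇ p in eq
... | true  = refl
... | false = ⊥-elim (subst T eq (<⇒<ᵇ lt))

less-no : ∀ {p q} qs → p ≤ q → less p (q ∷ qs) ≡ less p qs
less-no {p} {q} qs p≤q with q <ᵇ p in eq
... | false = refl
... | true  = ⊥-elim (<⇒≱ (<ᵇ⇒< q p (subst T (sym eq) tt)) p≤q)

less-mono : ∀ {p p′} qs → p ≤ p′ → less p qs ≤ less p′ qs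
less-mono [] _ = z≤n
less-mono {p} {p′} (q ∷ qs) le with q <? p
... | yes lt = subst₂ _≤_ (sym (less-yes qs lt)) (sym (less-yes qs (≤-trans lt le))) (s≤s (less-mono qs le))
... | no ≮ = subst (_≤ less p′ (q ∷ qs)) (sym (less-no qs (≮⇒≥ ≮))) (≤-trans (less-mono qs le) (step q))
  where
  step : ∀ q → less p′ qs ≤ less p′ (q ∷ qs)
  step q with q <ᵇ p′
  ... | true  = n≤1+n _
  ... | false = ≤-refl

less-↭ : ∀ p {qs rs} → qs ↭ rs → less p qs ≡ less p rs
less-↭ p refl = refl
less-↭ p (prep q e) with q <ᵇ p
... | true  = cong suc (less-↭ p e)
... | false = less-↭ p e
less-↭ p (swap q r e) with q <ᵇ p | r <ᵇ p
... | true  | true  = cong 2+ (less-↭ p e)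
... | true  | false = cong suc (less-↭ p e)
... | false | true  = cong suc (less-↭ p e)
... | false | false = less-↭ p e
less-↭ p (tran e f) = trans (less-↭ p e) (less-↭ p f)

less-all≥ : ∀ {p} qs → All (p ≤_) qs → less p qs ≡ 0
less-all≥ [] [] = refl
less-all≥ (q ∷ qs) (le ∷ les) = trans (less-no qs le) (less-all≥ qs les)

less-all< : ∀ {p} qs → All (_< p) qs → less p qs ≡ length qs
less-all< [] [] = refl
less-all< (q ∷ qs) (lt ∷ lts) = trans (less-yes qs lt) (cong suc (less-all< qs lts))

-- The Lehmer numbering of words with weights below n.

module Numbering (n : ℕ) where

  words : ℕ → ℕ
  words zero    = 1
  words (suc j) = suc j * n * words j

  -- Lehmer digit and weight together form one digit of a mixed-radix number: before `j` further
  -- letters it has `suc j * n` values, so `words j` is `j ! * n ^ j`.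
  num : Word → ℕ
  num []             = 0
  num ((p , w) ∷ xs) = (less p (keys xs) * n + w) * words (length xs) + num xs

  Small : Word → Set
  Small = All (λ a → proj₂ a < n)

  digit≤ : ∀ {a c w} → a ≤ c → w < n → a * n + w < suc c * n
  digit≤ {a} {c} {w} a≤c w<n = begin-strict
    a * n + w <⟨ +-mono-≤-< (*-monoˡ-≤ n a≤c) w<n ⟩
    c * n + n ≡⟨ +-comm (c * n) n ⟩
    suc c * n ∎
    where open ≤-Reasoning

  num< : ∀ xs → Small xs → num xs < words (length xs)
  num< [] [] = s≤s z≤n
  num< ((p , w) ∷ xs) (w<n ∷ sm) = begin-strict
    d * c + num xs <⟨ +-monoʳ-< (d * c) (num< xs sm) ⟩
    d * c + c      ≡⟨ +-comm (d * c) c ⟩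
    suc d * c      ≤⟨ *-monoˡ-≤ c (digit≤ (subst (less p (keys xs) ≤_) (Listₚ.length-map proj₁ xs)
      (less-≤ p (keys xs))) w<n) ⟩
    words (suc (length xs)) ∎
    where
    open ≤-Reasoning
    d = less p (keys xs) * n + w
    c = words (length xs)

  digit-lift : ∀ {d d′} c {a b} → a < c → d < d′ → d * c + a < d′ * c + b
  digit-lift {d} {d′} c {a} {b} a<c d<d′ = begin-strict
    d * c + a  <⟨ +-monoʳ-< (d * c) a<c ⟩
    d * c + c  ≡⟨ +-comm (d * c) c ⟩
    suc d * c  ≤⟨ *-monoˡ-≤ c d<d′ ⟩
    d′ * c     ≤⟨ m≤m+n (d′ * c) b ⟩
    d′ * c + b ∎
    where open ≤-Reasoning

  ↭-length-keys : ∀ {xs ys} → keys xs ↭ keys ys → length xs ≡ length ys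
  ↭-length-keys {xs} {ys} e = trans (sym (Listₚ.length-map proj₁ xs)) (trans (↭ₚ.↭-length e) (Listₚ.length-map
    proj₁ ys))

  -- The keys after the first difference are permutations of each other up to the differing key, so
  -- the larger key has strictly more smaller keys to its right.
  ≼⇒num : ∀ {xs ys} → xs ≼ ys → keys xs ↭ keys ys → Small xs → xs ≡ ys ⊎ num xs < num ys
  ≼⇒num [] _ _ = inj₁ refl
  ≼⇒num (key< {p} {p′} {w} {w′} {xs} {ys} p<p′) e (w<n ∷ sm) =
    inj₂ (subst (λ l → (less p (keys xs) * n + w) * words (length xs) + num xs
                     < (less p′ (keys ys) * n + w′) * words l + num ys) len
          (digit-lift (words (length xs)) (num< xs sm) digits))
    where
    len : length xs ≡ length ys
    len = suc-injective (↭-length-keys {(p , w) ∷ xs} {(p′ , w′) ∷ ys} e)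
    count : suc (less p (keys xs)) ≤ less p′ (keys ys)
    count = begin
      suc (less p (keys xs))   ≤⟨ s≤s (less-mono (keys xs) (<⇒≤ p<p′)) ⟩
      suc (less p′ (keys xs))  ≡⟨ less-yes (keys xs) p<p′ ⟨
      less p′ (p ∷ keys xs)    ≡⟨ less-↭ p′ e ⟩
      less p′ (p′ ∷ keys ys)   ≡⟨ less-no (keys ys) ≤-refl ⟩
      less p′ (keys ys)        ∎
      where open ≤-Reasoning
    digits : less p (keys xs) * n + w < less p′ (keys ys) * n + w′
    digits = <-≤-trans (digit≤ {less p (keys xs)} ≤-refl w<n) (≤-trans (*-monoˡ-≤ n count) (m≤m+n _ w′))
  ≼⇒num (weight< {p} {w} {w′} {xs} {ys} w<w′) e (w<n ∷ sm) =
    inj₂ (subst₂ (λ l c → (less p (keys xs) * n + w) * words (length xs) + num xs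
                        < (c * n + w′) * words l + num ys)
            (suc-injective (↭-length-keys {(p , w) ∷ xs} {(p , w′) ∷ ys} e)) (less-↭ p (↭ₚ.drop-∷ e))
          (digit-lift (words (length xs)) (num< xs sm) (+-monoʳ-< (less p (keys xs) * n) w<w′)))
  ≼⇒num (_∷≼_ (p , w) {xs} {ys} le) e (_ ∷ sm) with ≼⇒num le (↭ₚ.drop-∷ e) sm
  ... | inj₁ refl = inj₁ refl
  ... | inj₂ lt = inj₂ (subst₂ (λ l c → (less p (keys xs) * n + w) * words (length xs) + num xs
                                      < (c * n + w) * words l + num ys)
            (↭-length-keys {xs} {ys} (↭ₚ.drop-∷ e)) (less-↭ p (↭ₚ.drop-∷ e))
            (+-monoʳ-< ((less p (keys xs) * n + w) * words (length xs)) lt))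

-- Lowering the weights of a good ranking below n.

Unique⇒lookup-injective : ∀ {X : Set} {xs : List X} → Unique xs → ∀ {i j} → List.lookup xs i ≡
  List.lookup xs j → i ≡ j
Unique⇒lookup-injective (_ ∷ _)  {zero}  {zero}  _  = refl
Unique⇒lookup-injective (x∉ ∷ _) {zero}  {suc j} eq = ⊥-elim (All.lookup x∉ (∈ₚ.∈-lookup j) eq)
Unique⇒lookup-injective (x∉ ∷ _) {suc i} {zero}  eq = ⊥-elim (All.lookup x∉ (∈ₚ.∈-lookup i) (sym eq))
Unique⇒lookup-injective (_ ∷ u)  {suc i} {suc j} eq = cong suc (Unique⇒lookup-injective u eq)

Unique⇒length≤ : ∀ {n} {xs : List (Fin n)} → Unique xs → length xs ≤ n
Unique⇒length≤ u = Finₚ.injective⇒≤ (Unique⇒lookup-injective u)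

-- Replaces every weight by the number of smaller weights attained, after the same prefix and with the
-- same values of the keys in it, by some entry.
module Compression {n : ℕ} {B : Set} (val : B → ℕ → ℕ) where

  Entry : Set
  Entry = Fin n × B × Word

  -- The residual of an entry list after one letter and one component value; iterated, it singles
  -- out the entries that share a prefix together with the components named in it.
  sub : ℕ → ℕ → ℕ → List Entry → List Entry
  sub y p W [] = []
  sub y p W ((u , b , []) ∷ Q) = sub y p W Q
  sub y p W ((u , b , (p′ , W′) ∷ xs) ∷ Q) with p′ ≟ p | W′ ≟ W | val b p ≟ y
  ... | yes _ | yes _ | yes _ = (u , b , xs) ∷ sub y p W Q
  ... | no _  | _     | _     = sub y p W Q
  ... | _     | no _  | _     = sub y p W Q
  ... | _     | _     | no _  = sub y p W Q

  sub⁺ : ∀ {y p W u b xs} Q → (u , b , (p , W) ∷ xs) ∈ Q → val b p ≡ y → (u , b , xs) ∈ sub y p W Q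
  sub⁺ {y} {p} {W} ((u , b , .((p , W) ∷ _)) ∷ Q) (here refl) eq with p ≟ p | W ≟ W | val b p ≟ y
  ... | yes _ | yes _ | yes _ = here refl
  ... | no ≢  | _     | _     = ⊥-elim (≢ refl)
  ... | yes _ | no ≢  | _     = ⊥-elim (≢ refl)
  ... | yes _ | yes _ | no ≢  = ⊥-elim (≢ eq)
  sub⁺ ((_ , _ , []) ∷ Q) (there e∈) eq = sub⁺ Q e∈ eq
  sub⁺ {y} {p} {W} ((_ , b , (p′ , W′) ∷ xs) ∷ Q) (there e∈) eq with p′ ≟ p | W′ ≟ W | val b p ≟ y
  ... | yes _ | yes _ | yes _ = there (sub⁺ Q e∈ eq)
  ... | no _  | _     | _     = sub⁺ Q e∈ eq
  ... | yes _ | no _  | _     = sub⁺ Q e∈ eq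
  ... | yes _ | yes _ | no _  = sub⁺ Q e∈ eq

  sub⁻ : ∀ {y p W u b xs} Q → (u , b , xs) ∈ sub y p W Q → (u , b , (p , W) ∷ xs) ∈ Q × val b p ≡ y
  sub⁻ ((_ , _ , []) ∷ Q) e∈ = let m , eq = sub⁻ Q e∈ in there m , eq
  sub⁻ {y} {p} {W} ((_ , b , (p′ , W′) ∷ xs) ∷ Q) e∈ with p′ ≟ p | W′ ≟ W | val b p ≟ y
  sub⁻ (_ ∷ Q) (here refl) | yes refl | yes refl | yes eq = here refl , eq
  sub⁻ (_ ∷ Q) (there e∈)  | yes _ | yes _ | yes _ = let m , eq = sub⁻ Q e∈ in there m , eq
  sub⁻ (_ ∷ Q) e∈ | no _  | _     | _    = let m , eq = sub⁻ Q e∈ in there m , eq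
  sub⁻ (_ ∷ Q) e∈ | yes _ | no _  | _    = let m , eq = sub⁻ Q e∈ in there m , eq
  sub⁻ (_ ∷ Q) e∈ | yes _ | yes _ | no _ = let m , eq = sub⁻ Q e∈ in there m , eq

  witness : List Entry → List (Fin n)
  witness []            = []
  witness ((u , _) ∷ _) = u ∷ []

  -- A list of witnesses rather than a bare count: each smaller weight that is attained is charged
  -- to one vertex attaining it, so that the number of weights can be bounded by the number of
  -- vertices.
  reps : ℕ → ℕ → ℕ → List Entry → List (Fin n)
  reps y p zero    Q = []
  reps y p (suc W) Q = witness (sub y p W Q) ++ reps y p W Q

  length-reps≤ : ∀ y p W Q → length (reps y p W Q) ≤ W
  length-reps≤ y p zero    Q = z≤n
  length-reps≤ y p (suc W) Q with sub y p W Q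
  ... | []    = m≤n⇒m≤1+n (length-reps≤ y p W Q)
  ... | _ ∷ _ = s≤s (length-reps≤ y p W Q)

  length-reps-mono : ∀ y p W W′ Q → W ≤ W′ → length (reps y p W Q) ≤ length (reps y p W′ Q)
  length-reps-mono y p W W′ Q le with m≤n⇒m<n∨m≡n le
  ... | inj₂ refl = ≤-refl
  length-reps-mono y p W (suc W′) Q le | inj₁ (s≤s lt) with sub y p W′ Q
  ... | []    = length-reps-mono y p W W′ Q lt
  ... | _ ∷ _ = m≤n⇒m≤1+n (length-reps-mono y p W W′ Q lt)

  length-reps-< : ∀ {y p W W′ Q e} → W′ < W → e ∈ sub y p W′ Q → length (reps y p W′ Q) < length (reps y p W Q)
  length-reps-< {y} {p} {W} {W′} {Q} lt e∈ = ≤-trans (go e∈) (length-reps-mono y p (suc W′) W Q lt)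
    where
    go : ∀ {e} → e ∈ sub y p W′ Q → length (reps y p W′ Q) < length (reps y p (suc W′) Q)
    go e∈ with sub y p W′ Q
    ... | _ ∷ _ = ≤-refl

  ∈reps : ∀ {y p u} W Q → u ∈ reps y p W Q →
          ∃[ W′ ] ∃[ b ] ∃[ xs ] W′ < W × (u , b , (p , W′) ∷ xs) ∈ Q × val b p ≡ y
  ∈reps {y} {p} {u} (suc W) Q u∈ with ∈ₚ.∈-++⁻ (witness (sub y p W Q)) u∈
  ... | inj₂ q = let W′ , b , xs , lt , m , eq = ∈reps W Q q in W′ , b , xs , m≤n⇒m≤1+n lt , m , eq
  ... | inj₁ q = let b , xs , m = first q in W , b , xs , ≤-refl , sub⁻ Q m
    where
    first : u ∈ witness (sub y p W Q) → ∃[ b ] ∃[ xs ] (u , b , xs) ∈ sub y p W Q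
    first q with sub y p W Q
    first (here refl) | (_ , b , xs) ∷ _ = b , xs , here refl

  -- Agreement of the weights for as long as the keys and their components agree. Between entries of
  -- the same vertex this is exactly what forbids one vertex to witness two weights.
  Coherent : B → Word → B → Word → Set
  Coherent b ((p , W) ∷ xs) c ((p′ , W′) ∷ ys) = p ≡ p′ → val b p ≡ val c p → W ≡ W′ × Coherent b xs c ys
  Coherent _ _ _ _ = ⊤

  Functional : List Entry → Set
  Functional Q = ∀ {u b xs c ys} → (u , b , xs) ∈ Q → (u , c , ys) ∈ Q → Coherent b xs c ys

  Functional-sub : ∀ {y p W} Q → Functional Q → Functional (sub y p W Q)
  Functional-sub Q f e∈ e′∈ =
    let m , eq = sub⁻ Q e∈ ; m′ , eq′ = sub⁻ Q e′∈ in proj₂ (f m m′ refl (trans eq (sym eq′)))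

  Unique-reps : ∀ {Q} → Functional Q → ∀ y p W → Unique (reps y p W Q)
  Unique-reps f y p zero = []
  Unique-reps {Q} f y p (suc W) = go
    where
    new : ∀ {u} → u ∈ witness (sub y p W Q) → u ∉ reps y p W Q
    new {u} u∈ u∈′ with sub y p W Q in eq
    new {u} (here refl) u∈′ | (_ , b , xs) ∷ _ with ∈reps W Q u∈′ | sub⁻ {y} {p} {W} {u} {b} {xs} Q (subst ((u ,
      b , xs) ∈_) (sym eq) (here refl))
    ... | W′ , c , ys , lt , m , e | m′ , e′ = <-irrefl (proj₁ (f m m′ refl (trans e (sym e′)))) lt
    go : Unique (reps y p (suc W) Q)
    go with sub y p W Q | new
    ... | [] | _ = Unique-reps f y p W
    ... | (u , _) ∷ _ | new′ = Allₚ.¬Any⇒All¬ _ (new′ (here refl)) ∷ Unique-reps f y p W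

  -- The vertex `v` attains `W` itself and hence witnesses no smaller weight. Added to the list it
  -- keeps the list free of repetitions, which turns "at most `n`" into "fewer than `n`".
  length-reps<n : ∀ {Q} → Functional Q → ∀ {v b p W xs} → (v , b , (p , W) ∷ xs) ∈ Q →
    length (reps (val b p) p W Q) < n
  length-reps<n {Q} f {v} {b} {p} {W} {xs} m =
    Unique⇒length≤ {xs = v ∷ reps (val b p) p W Q} (Allₚ.¬Any⇒All¬ _ v∉ ∷ Unique-reps f (val b p) p W)
    where
    v∉ : v ∉ reps (val b p) p W Q
    v∉ v∈ with ∈reps W Q v∈
    ... | W′ , c , ys , lt , m′ , e = <-irrefl (proj₁ (f m′ m refl e)) lt

  compress : List Entry → B → Word → Word
  compress Q b []             = []
  compress Q b ((p , W) ∷ xs) = (p , length (reps (val b p) p W Q)) ∷ compress (sub (val b p) p W Q) b xs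

  keys-compress : ∀ Q b xs → keys (compress Q b xs) ≡ keys xs
  keys-compress Q b []             = refl
  keys-compress Q b ((p , W) ∷ xs) = cong (p ∷_) (keys-compress _ b xs)

  -- Weights matter only at keys of class 2, whose components the move does not change; both words
  -- are therefore compressed against the same residual. The smaller weight must be attained by an
  -- entry, hence the membership of `ys`; nothing of the kind is needed for `xs`.
  compress-Above : ∀ {cl xs ys w b c} Q → (∀ p → cl p ≡ 2 → val c p ≡ val b p) →
                   Above cl xs ys → (w , c , ys) ∈ Q → Above cl (compress Q b xs) (compress Q c ys)
  compress-Above Q _    (key> lt)   _ = key> lt
  compress-Above Q _    (reset eq)  _ = reset eq
  compress-Above {b = b} {c} Q same (weight> {p} {W} {W′} eq lt) m rewrite same p eq =
    weight> eq (length-reps-< {e = _} lt (sub⁺ Q m (same p eq)))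
  compress-Above {b = b} {c} Q same (deeper {p} eq ab) m rewrite same p eq =
    deeper eq (compress-Above _ same ab (sub⁺ Q m (same p eq)))

  -- At most `W` weights lie below `W`, so no weight grows, and where one falls the comparison is
  -- decided.
  compress-≼ : ∀ Q b {xs ys} → xs ≼ ys → compress Q b xs ≼ ys
  compress-≼ Q b [] = []
  compress-≼ Q b (key< lt) = key< lt
  compress-≼ Q b (weight< {p} {W} lt) = weight< (≤-<-trans (length-reps≤ (val b p) p W Q) lt)
  compress-≼ Q b (_∷≼_ (p , W) le) with m≤n⇒m<n∨m≡n (length-reps≤ (val b p) p W Q)
  ... | inj₁ lt = weight< lt
  ... | inj₂ eq rewrite eq = _ ∷≼ compress-≼ _ b le

  compress-small : ∀ {v b xs} Q → Functional Q → (v , b , xs) ∈ Q → All (λ a → proj₂ a < n) (compress Q b xs)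
  compress-small {xs = []} Q f m = []
  compress-small {xs = _ ∷ _} Q f m = length-reps<n f m ∷ compress-small _ (Functional-sub Q f) (sub⁺ Q m refl)

-- Playing from (v , b) as if the index were b′ is compatible with the index b once every weight is
-- preceded by the distance from the component of b′ to that of b; minimising over b′ makes the
-- weight after a fixed prefix depend on the vertex only.
module Cap
  {n : ℕ} {B : Set} (K : ℕ) (bs : List B) (complete : ∀ b → b ∈ bs)
  (val : B → ℕ → ℕ) (dist : B → B → ℕ → ℕ) (cl : Fin n → B → ℕ → ℕ) (nx : Fin n → B → B)
  (cl≤2 : ∀ v b p → cl v b p ≤ 2)
  (cl-0 : ∀ v b b′ p → cl v b p ≡ 0 → cl v b′ p ≡ 0)
  (val-keep : ∀ v b p → cl v b p ≡ 2 → val (nx v b) p ≡ val b p)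
  (dist-refl : ∀ b p → dist b b p ≡ 0)
  (dist-val : ∀ b c c′ p → val c p ≡ val c′ p → dist b c p ≡ dist b c′ p)
  (dist-keep : ∀ v b c p → cl v b p ≡ 2 → cl v c p ≡ 2 → dist (nx v b) (nx v c) p ≡ dist b c p)
  (dist-drop : ∀ v b c p → cl v b p ≡ 1 → cl v c p ≡ 2 → dist (nx v b) (nx v c) p < dist b c p)
  (r : Fin n → B → Word) (r-length : ∀ v b v′ b′ → length (r v b) ≡ length (r v′ b′))
  (r-bound : ∀ v b → All (λ a → proj₂ a < K) (r v b))
  where
  open Compression {n} val

  retarget : B → B → Word → Word
  retarget b b′ = map λ (p , w) → p , dist b′ b p * K + w

  keys-retarget : ∀ b b′ xs → keys (retarget b b′ xs) ≡ keys xs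
  keys-retarget b b′ []       = refl
  keys-retarget b b′ (x ∷ xs) = cong (proj₁ x ∷_) (keys-retarget b b′ xs)

  retarget-self : ∀ b xs → retarget b b xs ≡ xs
  retarget-self b []             = refl
  retarget-self b ((p , w) ∷ xs) = cong₂ (λ d ys → (p , d * K + w) ∷ ys) (dist-refl b p) (retarget-self b xs)

  -- The one delicate case is a key that resets at `b′` but is plain at `b`. There the component of
  -- `b′` moves one step towards that of `b`, and since `K` exceeds all weights of `ys`, this single
  -- unit of distance outweighs any weight. If the key resets at `b`, nothing remains to be
  -- compared; if it is plain at both, the distance stays and the weights decide.
  retarget-Above : ∀ {v b b′ xs ys} → All (λ a → proj₂ a < K) ys → Above (cl v b′) xs ys →
                   Above (cl v b) (retarget b b′ xs) (retarget (nx v b) (nx v b′) ys)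
  retarget-Above _ (key> lt) = key> lt
  retarget-Above {v} {b} {b′} {_ ∷ xs} {_ ∷ ys} (w<K ∷ _) (reset {p} {w} {w′} eq) with cl v b p in
    c | cl≤2 v b p
  ... | 0 | _ = contradiction (trans (sym eq) (cl-0 v b b′ p c)) λ ()
  ... | 1 | _ = reset c
  ... | 2 | _ = weight> c (begin-strict
    dist (nx v b′) (nx v b) p * K + w′ <⟨ +-monoʳ-< (dist (nx v b′) (nx v b) p * K) w<K ⟩
    dist (nx v b′) (nx v b) p * K + K  ≡⟨ +-comm _ K ⟩
    suc (dist (nx v b′) (nx v b) p) * K ≤⟨ *-monoˡ-≤ K (dist-drop v b′ b p eq c) ⟩
    dist b′ b p * K                    ≤⟨ m≤m+n _ w ⟩
    dist b′ b p * K + w                ∎)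
    where open ≤-Reasoning
  ... | suc (suc (suc _)) | s≤s (s≤s ())
  retarget-Above {v} {b} {b′} _ (weight> {p} {w} {w′} eq lt) with cl v b p in c | cl≤2 v b p
  ... | 0 | _ = contradiction (trans (sym eq) (cl-0 v b b′ p c)) λ ()
  ... | 1 | _ = reset c
  ... | 2 | _ rewrite dist-keep v b′ b p eq c = weight> c (+-monoʳ-< (dist b′ b p * K) lt)
  ... | suc (suc (suc _)) | s≤s (s≤s ())
  retarget-Above {v} {b} {b′} (_ ∷ bd) (deeper {p} eq ab) with cl v b p in c | cl≤2 v b p
  ... | 0 | _ = contradiction (trans (sym eq) (cl-0 v b b′ p c)) λ ()
  ... | 1 | _ = reset c
  ... | 2 | _ rewrite dist-keep v b′ b p eq c = deeper c (retarget-Above bd ab)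
  ... | suc (suc (suc _)) | s≤s (s≤s ())

  -- As long as `b` and `c` agree on the components of the keys read, retargeting to either adds the
  -- same distances. The two hypotheses say that each word is minimal against the choice made for
  -- the other, so the common prefixes are at most each other and coincide.
  Coherent-retarget : ∀ b b′ c c′ xs ys → retarget b b′ xs ≼ retarget b c′ ys → retarget c c′ ys ≼
    retarget c b′ xs →
                      Coherent b (retarget b b′ xs) c (retarget c c′ ys)
  Coherent-retarget b b′ c c′ [] ys _ _ = tt
  Coherent-retarget b b′ c c′ (_ ∷ _) [] _ _ = tt
  Coherent-retarget b b′ c c′ ((p , w) ∷ xs) ((.p , w′) ∷ ys) le ge refl eq
    rewrite dist-val b′ b c p eq | dist-val c′ b c p eq = go le ge
    where
    go : ∀ {W W′} → (p , W) ∷ retarget b b′ xs ≼ (p , W′) ∷ retarget b c′ ys →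
         (p , W′) ∷ retarget c c′ ys ≼ (p , W) ∷ retarget c b′ xs →
         W ≡ W′ × Coherent b (retarget b b′ xs) c (retarget c c′ ys)
    go (key< lt)   _           = contradiction lt (<-irrefl refl)
    go (weight< _) (key< lt)   = contradiction lt (<-irrefl refl)
    go (weight< q) (weight< s) = contradiction s (<-asym q)
    go (weight< q) (_ ∷≼ _)    = contradiction q (<-irrefl refl)
    go (_ ∷≼ q)    (key< lt)   = contradiction lt (<-irrefl refl)
    go (_ ∷≼ q)    (weight< s) = contradiction s (<-irrefl refl)
    go (_ ∷≼ q)    (_ ∷≼ s)    = refl , Coherent-retarget b b′ c c′ xs ys q s

  best : ∀ v b → Σ[ c ∈ B ] (∀ {d} → d ∈ b ∷ bs → retarget b c (r v c) ≼ retarget b d (r v d))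
  best v b = least (λ c → retarget b c (r v c))
    (λ c d → trans (Listₚ.length-map _ (r v c)) (trans (r-length v c v d) (sym (Listₚ.length-map _ (r v d))))) b
      bs

  pretend : Fin n → B → B
  pretend v b = proj₁ (best v b)

  low : Fin n → B → Word
  low v b = retarget b (pretend v b) (r v (pretend v b))

  low≼ : ∀ v b d → low v b ≼ retarget b d (r v d)
  low≼ v b d = proj₂ (best v b) (there (complete d))

  entries : List Entry
  entries = concatMap (λ v → map (λ b → v , b , low v b) bs) (allFin n)

  ∈entries : ∀ v b → (v , b , low v b) ∈ entries
  ∈entries v b = ∈ₚ.∈-concatMap⁺ (λ v → map (λ b → v , b , low v b) bs)
    (lose (∈ₚ.∈-allFin v) (∈ₚ.∈-map⁺ (λ b → v , b , low v b) (complete b)))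

  entries-low : ∀ {v b xs} → (v , b , xs) ∈ entries → xs ≡ low v b
  entries-low e∈ with find (∈ₚ.∈-concatMap⁻ (λ v → map (λ b → v , b , low v b) bs) {xs = allFin n} e∈)
  ... | u , _ , e∈′ with ∈ₚ.∈-map⁻ (λ b → u , b , low u b) e∈′
  ... | _ , _ , refl = refl

  entries-Functional : Functional entries
  entries-Functional {u} {b} {xs} {c} {ys} e∈ e′∈ with entries-low e∈ | entries-low e′∈
  ... | refl | refl = Coherent-retarget b (pretend u b) c (pretend u c) (r u (pretend u b)) (r u (pretend u c))
    (low≼ u b (pretend u c)) (low≼ u c (pretend u b))

  capped : Fin n → B → Word
  capped v b = compress entries b (low v b)

  capped-≼ : ∀ v b → capped v b ≼ r v b
  capped-≼ v b = compress-≼ entries b (subst (low v b ≼_) (retarget-self b (r v b)) (low≼ v b b))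

  capped-small : ∀ v b → All (λ a → proj₂ a < n) (capped v b)
  capped-small v b = compress-small entries entries-Functional (∈entries v b)

  keys-capped : ∀ v b → keys (capped v b) ≡ keys (r v (pretend v b))
  keys-capped v b = trans (keys-compress entries b (low v b)) (keys-retarget b (pretend v b)
    (r v (pretend v b)))

  -- The move is really made from the index `pretend v b`, and its success is carried over to `b` by
  -- retargeting. The word of `w` obtained in this way is merely one competitor for the minimum at
  -- `nx v b`, so it may be replaced by `low`; compression comes last.
  capped-Above : ∀ v b w → Above (cl v (pretend v b)) (r v (pretend v b)) (r w (nx v (pretend v b))) →
                 Above (cl v b) (capped v b) (capped w (nx v b))
  capped-Above v b w ab = compress-Above entries (val-keep v b)
    (Above-mono (retarget-Above (r-bound w _) ab) (low≼ w (nx v b) (nx v (pretend v b)))) (∈entries w (nx v b))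

-- Tidy words, permutations and cyclic distances.

Unique-resp-↭ : ∀ {X : Set} {xs ys : List X} → xs ↭ ys → Unique xs → Unique ys
Unique-resp-↭ refl u = u
Unique-resp-↭ (prep x p) (x∉ ∷ u) = ↭ₚ.All-resp-↭ p x∉ ∷ Unique-resp-↭ p u
Unique-resp-↭ (swap x y p) ((x≢y ∷ x∉) ∷ y∉ ∷ u) =
  ((x≢y ∘ sym) ∷ ↭ₚ.All-resp-↭ p y∉) ∷ ↭ₚ.All-resp-↭ p x∉ ∷ Unique-resp-↭ p u
Unique-resp-↭ (tran p q) u = Unique-resp-↭ q (Unique-resp-↭ p u)

-- Pair `i` has key `i + 2`: the keys 0 and 1 are reserved for the head letter of a finite and of an
-- infinite rank.
base : ℕ → List ℕ
base k = map 2+ (List.upTo k)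

flat : List ℕ → Word
flat = map (_, 0)

keys-flat : ∀ ps → keys (flat ps) ≡ ps
keys-flat []       = refl
keys-flat (p ∷ ps) = cong (p ∷_) (keys-flat ps)

-- The tail says nothing about infinity; it gives all words the length `suc k` and is what the
-- increment leaves behind when the finite words are exhausted.
∞word : ℕ → Word
∞word k = (1 , 0) ∷ flat (base k)

length-base : ∀ k → length (base k) ≡ k
length-base k = trans (Listₚ.length-map 2+ (List.upTo k)) (Listₚ.length-upTo k)

-- The weights of an infinite word are left free, so that a capped word counts as infinite by its
-- keys alone; `∞word` is the least of the infinite words.
data Tidy (n k : ℕ) : Word → Set where
  infinite : ∀ {w xs} → keys xs ≡ base k → Tidy n k ((1 , w) ∷ xs)
  finite   : ∀ {w xs} → w < n → All (λ a → proj₂ a < n) xs → keys xs ↭ base k → Tidy n k ((0 , w) ∷ xs)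

flat-≼ : ∀ {ps} xs → keys xs ≡ ps → flat ps ≼ xs
flat-≼ [] refl = []
flat-≼ ((p , zero) ∷ xs) refl = _ ∷≼ flat-≼ xs refl
flat-≼ ((p , suc w) ∷ xs) refl = weight< z<s

∞word-≼ : ∀ {k w xs} → keys xs ≡ base k → ∞word k ≼ (1 , w) ∷ xs
∞word-≼ {w = zero}  eq = _ ∷≼ flat-≼ _ eq
∞word-≼ {w = suc _} eq = weight< z<s

Tidy-length : ∀ {n k x} → Tidy n k x → length x ≡ suc k
Tidy-length {k = k} (infinite {xs = xs} eq) = cong suc (trans (sym (Listₚ.length-map proj₁ xs))
  (trans (cong length eq) (length-base k)))
Tidy-length {k = k} (finite {xs = xs} _ _ p) = cong suc (trans (sym (Listₚ.length-map proj₁ xs))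
  (trans (↭ₚ.↭-length p) (length-base k)))

tabulate-upTo : ∀ {X : Set} (f : ℕ → X) k → List.tabulate {n = k} (f ∘ toℕ) ≡ List.applyUpTo f k
tabulate-upTo f zero    = refl
tabulate-upTo f (suc k) = cong (f 0 ∷_) (tabulate-upTo (f ∘ suc) k)

injective⇒surjective : ∀ {k} (f : Fin k → Fin k) → (∀ {i j} → f i ≡ f j → i ≡ j) → ∀ y → ∃[ x ] f x ≡ y
injective⇒surjective {suc k} f inj y with Finₚ.any? (λ x → f x Finₚ.≟ y)
... | yes p = p
... | no ¬p = contradiction
  (Finₚ.injective⇒≤ {f = λ x → Fin.punchOut {i = y} {j = f x} (λ eq → ¬p (x , sym eq))} (λ eq →
    inj (Finₚ.punchOut-injective {i = y} (λ e → ¬p (_ , sym e)) (λ e → ¬p (_ , sym e)) eq)))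
  1+n≰n

injective⇒permutation : ∀ {k} (f : Fin k → Fin k) → (∀ {i j} → f i ≡ f j → i ≡ j) →
                        Σ[ π ∈ Permutation′ k ] ∀ i → π ⟨$⟩ʳ i ≡ f i
injective⇒permutation f inj =
  permutation f (λ y → proj₁ (sur y)) (λ y → proj₂ (sur y)) (λ x → inj (proj₂ (sur (f x)))) , λ _ → refl
  where sur = injective⇒surjective f inj

tabulate-permutation : ∀ {k} (π : Permutation′ k) → List.tabulate (λ l → 2+ (toℕ (π ⟨$⟩ʳ l))) ↭ base k
tabulate-permutation {k} π = subst₂ _↭_
  (Listₚ.map-tabulate (π ⟨$⟩ʳ_) (2+ ∘ toℕ))
  (trans (Listₚ.map-tabulate id (2+ ∘ toℕ)) (trans (tabulate-upTo 2+ k) (sym (Listₚ.map-upTo 2+ k))))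
  (↭ₚ.map⁺ (2+ ∘ toℕ) (∼bag⇒↭ (unique∧set⇒bag (Uniqueₚ.tabulate⁺ inj) (Uniqueₚ.allFin⁺ k) (mk⇔ (λ _ →
    ∈ₚ.∈-allFin _) (λ _ → covers _)))))
  where
  inj : ∀ {i j} → π ⟨$⟩ʳ i ≡ π ⟨$⟩ʳ j → i ≡ j
  inj {i} {j} eq = trans (sym (inverseˡ π)) (trans (cong (π ⟨$⟩ˡ_) eq) (inverseˡ π))
  covers : ∀ i → i ∈ List.tabulate (π ⟨$⟩ʳ_)
  covers i = subst (_∈ List.tabulate (π ⟨$⟩ʳ_)) (inverseʳ π) (∈ₚ.∈-tabulate⁺ (π ⟨$⟩ˡ i))

permutation-of : ∀ {k} n xs → k ≡ length xs → keys xs ↭ base k → All (λ a → proj₂ a < n) xs →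
  Σ[ π ∈ Permutation′ k ] Σ[ ws ∈ Vec (Fin (suc n)) k ]
    List.tabulate (λ l → 2+ (toℕ (π ⟨$⟩ʳ l)) , toℕ (lookup ws l)) ≡ xs
permutation-of n xs refl perm small = π , Vec.tabulate weight ,
  trans (Listₚ.tabulate-cong λ l → cong₂ _,_
    (trans (cong (2+ ∘ toℕ) (π≡ l)) (trans (cong 2+ (Finₚ.toℕ-fromℕ< (proj₁ (proj₂ (key l)))))
      (sym (proj₂ (proj₂ (key l))))))
    (trans (cong toℕ (lookup∘tabulate weight l)) (Finₚ.toℕ-fromℕ< _)))
  (Listₚ.tabulate-lookup xs)
  where
  key : ∀ l → ∃[ i ] i < length xs × proj₁ (List.lookup xs l) ≡ 2+ i
  key l with ∈ₚ.∈-map⁻ 2+ (↭ₚ.∈-resp-↭ perm (∈ₚ.∈-map⁺ proj₁ (∈ₚ.∈-lookup {xs = xs} l)))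
  ... | i , i∈ , eq = i , ∈ₚ.∈-upTo⁻ i∈ , eq
  unique : Unique (keys xs)
  unique = Unique-resp-↭ (↭-sym perm) (Uniqueₚ.map⁺ (λ { refl → refl }) (Uniqueₚ.upTo⁺ (length xs)))
  unmap : ∀ (ys : Word) → Unique (keys ys) → ∀ i j → proj₁ (List.lookup ys i) ≡ proj₁ (List.lookup ys j) → i ≡ j
  unmap (y ∷ ys) (y∉ ∷ u) zero    zero    eq = refl
  unmap (y ∷ ys) (y∉ ∷ u) zero    (suc j) eq =
    contradiction eq (All.lookup y∉ (∈ₚ.∈-map⁺ proj₁ (∈ₚ.∈-lookup {xs = ys} j)))
  unmap (y ∷ ys) (y∉ ∷ u) (suc i) zero    eq =
    contradiction (sym eq) (All.lookup y∉ (∈ₚ.∈-map⁺ proj₁ (∈ₚ.∈-lookup {xs = ys} i)))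
  unmap (y ∷ ys) (y∉ ∷ u) (suc i) (suc j) eq = cong suc (unmap ys u i j eq)
  f : Fin (length xs) → Fin (length xs)
  f l = fromℕ< (proj₁ (proj₂ (key l)))
  inj : ∀ {i j} → f i ≡ f j → i ≡ j
  inj {i} {j} eq = unmap xs unique i j (trans (proj₂ (proj₂ (key i))) (trans (cong 2+
    (trans (sym (Finₚ.toℕ-fromℕ< _)) (trans (cong toℕ eq) (Finₚ.toℕ-fromℕ< _)))) (sym (proj₂ (proj₂ (key j))))))
  π = proj₁ (injective⇒permutation f inj)
  π≡ = proj₂ (injective⇒permutation f inj)
  weight : Fin (length xs) → Fin (suc n)
  weight l = fromℕ< (m≤n⇒m≤1+n (All.lookup small (∈ₚ.∈-lookup {xs = xs} l)))

-- The statements about the machine speak of bare numbers, to which finite data are extended by a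
-- default.
ext : ∀ {X : Set} {k} → (Fin k → X) → X → ℕ → X
ext {k = k} f d i with i <? k
... | yes i<k = f (fromℕ< i<k)
... | no _    = d

ext-toℕ : ∀ {X : Set} {k} (f : Fin k → X) d i → ext f d (toℕ i) ≡ f i
ext-toℕ {k = k} f d i with toℕ i <? k
... | yes i<k = cong f (Finₚ.fromℕ<-toℕ i i<k)
... | no ≮ = contradiction (Finₚ.toℕ<n i) ≮

ext-elim : ∀ {X : Set} {k} (P : X → Set) (f : Fin k → X) d → (∀ i → P (f i)) → P d → ∀ i → P (ext f d i)
ext-elim {k = k} P f d pf pd i with i <? k
... | yes i<k = pf (fromℕ< i<k)
... | no _    = pd

byFin : ∀ {k} (P : ℕ → Set) → (∀ (i : Fin k) → P (toℕ i)) → ∀ {i} → i < k → P i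
byFin P f i<k = subst P (Finₚ.toℕ-fromℕ< i<k) (f (fromℕ< i<k))

-- Number of steps of the cyclic successor from the first argument to the second.
cyc : ∀ {ℓ} → Fin ℓ → Fin ℓ → ℕ
cyc {ℓ} a c with toℕ a ≤? toℕ c
... | yes _ = toℕ c ∸ toℕ a
... | no _  = (ℓ ∸ toℕ a) + toℕ c

cyc-refl : ∀ {ℓ} (a : Fin ℓ) → cyc a a ≡ 0
cyc-refl a with toℕ a ≤? toℕ a
... | yes _ = n∸n≡0 (toℕ a)
... | no ≰  = contradiction ≤-refl ≰

toℕ-⊕1-< : ∀ {ℓ} (a : Fin ℓ) → suc (toℕ a) < ℓ → toℕ (a ⊕1) ≡ suc (toℕ a)
toℕ-⊕1-< {ℓ} a lt = trans (Finₚ.toℕ-fromℕ< _) (m<n⇒m%n≡m {{Finₚ.nonZeroIndex a}} lt)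

toℕ-⊕1-≡ : ∀ {ℓ} (a : Fin ℓ) → suc (toℕ a) ≡ ℓ → toℕ (a ⊕1) ≡ 0
toℕ-⊕1-≡ {ℓ} a eq = trans (Finₚ.toℕ-fromℕ< _)
  (trans (%-congˡ {o = ℓ} {{Finₚ.nonZeroIndex a}} eq) (n%n≡0 ℓ {{Finₚ.nonZeroIndex a}}))

-- At the last value the successor is 0, from where `c` is `toℕ c` steps away; before, the
-- wrap-around cost one step more.
cyc-⊕1 : ∀ {ℓ} (a c : Fin ℓ) → a ≢ c → cyc (a ⊕1) c < cyc a c
cyc-⊕1 {ℓ} a c a≢c with m≤n⇒m<n∨m≡n (Finₚ.toℕ<n a) | toℕ a ≤? toℕ c | toℕ (a ⊕1) ≤? toℕ c
... | inj₁ lt | yes a≤c | yes _ rewrite toℕ-⊕1-< a lt =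
  ∸-monoʳ-< (n<1+n _) (≤∧≢⇒< a≤c (a≢c ∘ Finₚ.toℕ-injective))
... | inj₁ lt | yes a≤c | no ≰ rewrite toℕ-⊕1-< a lt = contradiction (≤∧≢⇒< a≤c (a≢c ∘ Finₚ.toℕ-injective)) ≰
... | inj₁ lt | no ≰    | yes le rewrite toℕ-⊕1-< a lt = contradiction (<⇒≤ le) ≰
... | inj₁ lt | no _    | no _ rewrite toℕ-⊕1-< a lt = +-monoˡ-< (toℕ c) (∸-monoʳ-< (n<1+n _) (<⇒≤ lt))
... | inj₂ eq | yes a≤c | _ = contradiction (Finₚ.toℕ-injective (≤-antisym a≤c (s≤s⁻¹ (subst (suc (toℕ c) ≤_)
  (sym eq) (Finₚ.toℕ<n c))))) a≢c
... | inj₂ eq | no _    | yes _ rewrite toℕ-⊕1-≡ a eq = m<n+m (toℕ c) (m<n⇒0<n∸m (Finₚ.toℕ<n a))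
... | inj₂ eq | no _    | no ≰ rewrite toℕ-⊕1-≡ a eq = contradiction z≤n ≰

*+-unique : ∀ P {q q′ r r′} → r < P → r′ < P → q * P + r ≡ q′ * P + r′ → q ≡ q′ × r ≡ r′
*+-unique P {q} {q′} {r} {r′} r<P r′<P eq with <-cmp q q′
... | tri< lt _ _ = contradiction eq (<⇒≢ (bound r<P lt))
  where
  bound : ∀ {q q′ r r′} → r < P → q < q′ → q * P + r < q′ * P + r′
  bound {q} {q′} {r} {r′} r<P lt = begin-strict
    q * P + r   <⟨ +-monoʳ-< (q * P) r<P ⟩
    q * P + P   ≡⟨ +-comm (q * P) P ⟩
    suc q * P   ≤⟨ *-monoˡ-≤ P lt ⟩
    q′ * P      ≤⟨ m≤m+n (q′ * P) r′ ⟩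
    q′ * P + r′ ∎
    where open ≤-Reasoning
... | tri≈ _ refl _ = refl , +-cancelˡ-≡ (q * P) r r′ eq
... | tri> _ _ gt = contradiction (sym eq) (<⇒≢ (bound r′<P gt))
  where
  bound : ∀ {q q′ r r′} → r < P → q < q′ → q * P + r < q′ * P + r′
  bound {q} {q′} {r} {r′} r<P lt = begin-strict
    q * P + r   <⟨ +-monoʳ-< (q * P) r<P ⟩
    q * P + P   ≡⟨ +-comm (q * P) P ⟩
    suc q * P   ≤⟨ *-monoˡ-≤ P lt ⟩
    q′ * P      ≤⟨ m≤m+n (q′ * P) r′ ⟩
    q′ * P + r′ ∎
    where open ≤-Reasoning

≡ᵇ-refl : ∀ i → (i ≡ᵇ i) ≡ true
≡ᵇ-refl zero    = refl
≡ᵇ-refl (suc i) = ≡ᵇ-refl i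

≢⇒≡ᵇ : ∀ {i j} → i ≢ j → (i ≡ᵇ j) ≡ false
≢⇒≡ᵇ {i} {j} i≢j with i ≡ᵇ j in eq
... | false = refl
... | true  = contradiction (≡ᵇ⇒≡ i j (subst T (sym eq) tt)) i≢j

put-≡ : ∀ (f : ℕ → ℕ) i x → (f [ i ↦ x ]) i ≡ x
put-≡ f i x rewrite ≡ᵇ-refl i = refl

put-≢ : ∀ (f : ℕ → ℕ) {i j} x → j ≢ i → (f [ i ↦ x ]) j ≡ f j
put-≢ f x j≢i rewrite ≢⇒≡ᵇ j≢i = refl

-- Abstract machine states and a logic for running times.

-- The memory split into the region of the ranks and a family of arrays. Stores into different
-- regions commute by construction, and address arithmetic is confined to `Rep`.
record St : Set where
  constructor st
  field
    var : ℕ → ℕ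
    rnk : ℕ → ℕ
    arr : ℕ → ℕ → ℕ
open St public

infixl 10 _⟦_≔_⟧ _⟦rnk_≔_⟧ _⟦arr_,_≔_⟧

_⟦_≔_⟧ : St → ℕ → ℕ → St
(st v r A) ⟦ x ≔ a ⟧ = st (v [ x ↦ a ]) r A

_⟦rnk_≔_⟧ : St → ℕ → ℕ → St
(st v r A) ⟦rnk i ≔ a ⟧ = st v (r [ i ↦ a ]) A

_⟦arr_,_≔_⟧ : St → ℕ → ℕ → ℕ → St
(st v r A) ⟦arr a , i ≔ x ⟧ = st v r λ b → if b ≡ᵇ a then A b [ i ↦ x ] else A b

-- A purely syntactic size in which all constants of the running time are gathered.
weight : Program → ℕ
weight skip              = 0
weight (_ := e)          = 1 + size e
weight (store e f)       = 1 + size e + size f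
weight (p ⨾ q)           = weight p + weight q
weight (ifLess e f p q)  = 1 + size e + size f + (weight p + weight q)
weight (whileLess e f p) = 1 + size e + size f + weight p

-- Register 4 holds the start of the arrays, which lie interleaved behind the ranks.
cellE : ℕ → Expr → Expr
cellE a e = reg 4 ⟨+⟩ ((e ⟨*⟩ const 16) ⟨+⟩ const a)

arrE : ℕ → Expr → Expr
arrE a e = mem (cellE a e)

setArr : ℕ → Expr → Expr → Program
setArr a e f = store (cellE a e) f

incr : ℕ → Program
incr x = x := const 1 ⟨+⟩ reg x

For : ℕ → Expr → Program → Program
For x e p = whileLess (reg x) e (p ⨾ incr x)

At : List ℕ → ℕ → ℕ → Set
At xs i x = Σ[ j ∈ Fin (length xs) ] toℕ j ≡ i × List.lookup xs j ≡ x

module Logic (input : List ℕ) (space W base₀ L : ℕ) (100≤W : 100 ≤ W)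
             (fits : base₀ + L * 16 ≤ space) (space≤W : space ≤ W)
             (input≤W : ∀ {i x} → At input i x → x ≤ W) where
  open Machine input space W

  Rep : (ℕ → ℕ) → St → Set
  Rep M σ = (∀ {i} → i < base₀ → M i ≡ rnk σ i) × (∀ a i → a < 16 → M (base₀ + (i * 16 + a)) ≡ arr σ a i)

  record Ev (σ : St) (e : Expr) (a : ℕ) : Set where
    constructor ev
    field eval : ∀ M → Rep M σ → ⟨ var σ , M ⟩ ⊢ e ⇓ a
  open Ev

  -- Time is bounded by the size of the text times `suc u`, with `u` an upper bound for the work of
  -- the loops. Sequencing adds weights and keeps `u`, so phases of different lengths need only be
  -- brought under a common `u`, and a program of fixed text takes `O(1 + u)`.
  record Run (p : Program) (σ : St) (u : ℕ) (Q : St → Set) : Set where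
    constructor run
    field exec : ∀ M → Rep M σ → ∃[ t ] ∃[ M′ ] Σ[ σ′ ∈ St ]
                 t ≤ weight p * suc u × Exec p ⟨ var σ , M ⟩ t ⟨ var σ′ , M′ ⟩ × Rep M′ σ′ × Q σ′
  open Run public

  k# : ∀ {σ} c {_ : T (c ≤ᵇ 100)} → Ev σ (const c) c
  k# c {p} = ev λ M _ → const (≤-trans (≤ᵇ⇒≤ c 100 p) 100≤W)

  v# : ∀ {σ} x {a} → var σ x ≡ a → Ev σ (reg x) a
  v# x refl = ev λ M _ → reg

  infixl 6 _+#_[_] _∸#_
  infixl 7 _*#_[_]
  _+#_[_] : ∀ {σ e f x y} → Ev σ e x → Ev σ f y → x + y ≤ W → Ev σ (e ⟨+⟩ f) (x + y)
  p +# q [ le ] = ev λ M rep → eval p M rep ⟨+⟩ eval q M rep ⟨ le ⟩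

  _∸#_ : ∀ {σ e f x y} → Ev σ e x → Ev σ f y → Ev σ (e ⟨∸⟩ f) (x ∸ y)
  p ∸# q = ev λ M rep → eval p M rep ⟨∸⟩ eval q M rep

  _*#_[_] : ∀ {σ e f x y} → Ev σ e x → Ev σ f y → x * y ≤ W → Ev σ (e ⟨*⟩ f) (x * y)
  p *# q [ le ] = ev λ M rep → eval p M rep ⟨*⟩ eval q M rep ⟨ le ⟩

  cell<space : ∀ a i → a < 16 → i < L → base₀ + (i * 16 + a) < space
  cell<space a i a<16 i<L = begin-strict
    base₀ + (i * 16 + a)  <⟨ +-monoʳ-< base₀ (+-monoʳ-< (i * 16) a<16) ⟩
    base₀ + (i * 16 + 16) ≡⟨ cong (base₀ +_) (+-comm (i * 16) 16) ⟩
    base₀ + suc i * 16    ≤⟨ +-monoʳ-≤ base₀ (*-monoˡ-≤ 16 i<L) ⟩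
    base₀ + L * 16        ≤⟨ fits ⟩
    space                 ∎
    where open ≤-Reasoning

  cell# : ∀ {σ e i} a {_ : T (a <ᵇ 16)} → var σ 4 ≡ base₀ → Ev σ e i → i < L →
    Ev σ (cellE a e) (base₀ + (i * 16 + a))
  cell# {i = i} a {p} b q i<L = v# 4 b +# (q *# k# 16 [ ≤-trans (≤-trans (m≤m+n _ a) (m≤n+m _ base₀)) le
    ]) +# ev (λ M _ → const (≤-trans (<⇒≤ (<ᵇ⇒< a 16 p)) (≤-trans (≤ᵇ⇒≤ 16 100 tt) 100≤W))) [ ≤-trans
      (m≤n+m _ base₀) le ] [ le ]
    where
    le : base₀ + (i * 16 + a) ≤ W
    le = ≤-trans (<⇒≤ (cell<space a i (<ᵇ⇒< a 16 p) i<L)) space≤W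

  a# : ∀ {σ e i} a {p : T (a <ᵇ 16)} → var σ 4 ≡ base₀ → Ev σ e i → i < L → Ev σ (arrE a e) (arr σ a i)
  a# {σ} {e} {i} a {p} b q i<L = ev λ M rep → subst (⟨ var σ , M ⟩ ⊢ arrE a e ⇓_) (proj₂ rep a i (<ᵇ⇒< a 16 p))
    (mem (eval (cell# a {p} b q i<L) M rep) (cell<space a i (<ᵇ⇒< a 16 p) i<L))

  m# : ∀ {σ e i} → Ev σ e i → i < base₀ → Ev σ (mem e) (rnk σ i)
  m# {σ} {e} q i<b = ev λ M rep → subst (⟨ var σ , M ⟩ ⊢ mem e ⇓_) (proj₁ rep i<b)
    (mem (eval q M rep) (<-≤-trans i<b (≤-trans (m≤m+n base₀ _) fits)))

  i# : ∀ {σ e i x} → Ev σ e i → At input i x → Ev σ (inp e) x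
  i# {σ} q at@(j , refl , refl) = ev λ M rep → inp j (eval q M rep) (input≤W at)

  ev-≡ : ∀ {σ e a b} → a ≡ b → Ev σ e a → Ev σ e b
  ev-≡ refl q = q

  weaken# : ∀ {p σ u u′ Q} → u ≤ u′ → Run p σ u Q → Run p σ u′ Q
  weaken# {p} le (run f) = run λ M rep → let t , M′ , σ′ , t≤ , rest = f M rep in
    t , M′ , σ′ , ≤-trans t≤ (*-monoʳ-≤ (weight p) (s≤s le)) , rest

  post# : ∀ {p σ u P Q} → Run p σ u P → (∀ {σ′} → P σ′ → Q σ′) → Run p σ u Q
  post# (run f) g = run λ M rep → let t , M′ , σ′ , t≤ , ex , rep′ , q = f M rep in
    t , M′ , σ′ , t≤ , ex , rep′ , g q

  once : ∀ w u → w ≤ w * suc u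
  once w u = m≤m*n w (suc u)

  skip# : ∀ {σ u Q} → Q σ → Run skip σ u Q
  skip# q = run λ M rep → 0 , M , _ , z≤n , skip , rep , q

  :=# : ∀ {x e σ u a Q} → Ev σ e a → Q (σ ⟦ x ≔ a ⟧) → Run (x := e) σ u Q
  :=# {e = e} {u = u} p q = run λ M rep → _ , M , _ , once _ u , assign (eval p M rep) , rep , q

  rnk:=# : ∀ {e f σ u i x Q} → Ev σ e i → i < base₀ → Ev σ f x → Q (σ ⟦rnk i ≔ x ⟧) → Run (store e f) σ u Q
  rnk:=# {σ = σ} {u} {i} {x} p i<b q r = run λ M rep → _ , M [ i ↦ x ] , _ , once _ u ,
    store (eval p M rep) (eval q M rep) (<-≤-trans i<b (≤-trans (m≤m+n base₀ _) fits)) , rep′ M rep , r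
    where
    rep′ : ∀ M → Rep M σ → Rep (M [ i ↦ x ]) (σ ⟦rnk i ≔ x ⟧)
    rep′ M (f , g) = (λ {j} j<b → cong (λ y → if j ≡ᵇ i then x else y) (f j<b)) ,
      λ a j a<16 → trans (put-≢ M x (λ eq → <⇒≱ i<b (subst (base₀ ≤_) eq (m≤m+n base₀ _)))) (g a j a<16)

  arr:=# : ∀ {e f σ u i x Q} a {p : T (a <ᵇ 16)} → var σ 4 ≡ base₀ → Ev σ e i → i < L → Ev σ f x →
           Q (σ ⟦arr a , i ≔ x ⟧) → Run (setArr a e f) σ u Q
  arr:=# {σ = σ} {u} {i} {x} a {p} b q i<L r s = run λ M rep → _ , M [ base₀ + (i * 16 + a) ↦ x ] , _ ,
    once _ u ,
    store (eval (cell# a {p} b q i<L) M rep) (eval r M rep) (cell<space a i (<ᵇ⇒< a 16 p) i<L) , rep′ M rep , s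
    where
    rep′ : ∀ M → Rep M σ → Rep (M [ base₀ + (i * 16 + a) ↦ x ]) (σ ⟦arr a , i ≔ x ⟧)
    rep′ M (f , g) = (λ j<b → trans (put-≢ M x (λ eq → <⇒≱ j<b (subst (base₀ ≤_) (sym eq) (m≤m+n base₀ _)))) (f
      j<b)) , h
      where
      h : ∀ c j → c < 16 → (M [ base₀ + (i * 16 + a) ↦ x ]) (base₀ + (j * 16 + c)) ≡ arr (σ ⟦arr a ,
        i ≔ x ⟧) c j
      h c j c<16 with c ≟ a
      ... | no c≢a rewrite ≢⇒≡ᵇ c≢a = trans (put-≢ M x λ eq →
        c≢a (proj₂ (*+-unique 16 {j} {i} c<16 (<ᵇ⇒< a 16 p) (+-cancelˡ-≡ base₀ _ _ eq)))) (g c j c<16)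
      ... | yes refl rewrite ≡ᵇ-refl c with j ≟ i
      ...   | yes refl rewrite ≡ᵇ-refl j = put-≡ M (base₀ + (j * 16 + c)) x
      ...   | no j≢i rewrite ≢⇒≡ᵇ j≢i = trans (put-≢ M x λ eq →
        j≢i (proj₁ (*+-unique 16 {j} {i} c<16 (<ᵇ⇒< a 16 p) (+-cancelˡ-≡ base₀ _ _ eq)))) (g c j c<16)

  infixr 5 _⨾#_
  _⨾#_ : ∀ {p q σ u P Q} → Run p σ u P → (∀ {σ′} → P σ′ → Run q σ′ u Q) → Run (p ⨾ q) σ u Q
  _⨾#_ {p} {q} {u = u} (run f) g = run λ M rep →
    let t , M′ , σ′ , t≤ , ex , rep′ , pσ = f M rep
        t′ , M″ , σ″ , t′≤ , ex′ , rep″ , qσ = exec (g pσ) M′ rep′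
    in t + t′ , M″ , σ″ , ≤-trans (+-mono-≤ t≤ t′≤) (≤-reflexive (sym (*-distribʳ-+ (suc u) (weight p)
      (weight q)))) , seq ex ex′ , rep″ , qσ

  :=⨾ : ∀ {x e q σ u a Q} → Ev σ e a → Run q (σ ⟦ x ≔ a ⟧) u Q → Run (x := e ⨾ q) σ u Q
  :=⨾ {x} {σ = σ} {a = a} p r = :=# {Q = σ ⟦ x ≔ a ⟧ ≡_} p refl ⨾# λ { refl → r }

  rnk⨾ : ∀ {e f q σ u i x Q} → Ev σ e i → i < base₀ → Ev σ f x → Run q (σ ⟦rnk i ≔ x ⟧) u Q → Run (store e f ⨾
    q) σ u Q
  rnk⨾ {σ = σ} {i = i} {x} p lt q r = rnk:=# {Q = σ ⟦rnk i ≔ x ⟧ ≡_} p lt q refl ⨾# λ { refl → r }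

  arr⨾ : ∀ {e f q σ u i x Q} a {p : T (a <ᵇ 16)} → var σ 4 ≡ base₀ → Ev σ e i → i < L → Ev σ f x →
         Run q (σ ⟦arr a , i ≔ x ⟧) u Q → Run (setArr a e f ⨾ q) σ u Q
  arr⨾ {σ = σ} {i = i} {x} a {p} b e lt f r = arr:=# {Q = σ ⟦arr a , i ≔ x ⟧ ≡_} a {p} b e lt f refl ⨾#
    λ { refl → r }

  if# : ∀ {e f p q σ u x y Q} → Ev σ e x → Ev σ f y → (x < y → Run p σ u Q) → (y ≤ x → Run q σ u Q) →
        Run (ifLess e f p q) σ u Q
  if# {e} {f} {p} {q} {σ} {u} {x} {y} a b yes# no# = run go
    where
    c = 1 + size e + size f
    bound : ∀ {t} w w′ → t ≤ w * suc u → c + t ≤ (c + (w + w′)) * suc u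
    bound {t} w w′ t≤ = begin
      c + t ≤⟨ +-mono-≤ (once c u) t≤ ⟩
      c * suc u + w * suc u ≡⟨ *-distribʳ-+ (suc u) c w ⟨
      (c + w) * suc u ≤⟨ *-monoˡ-≤ (suc u) (+-monoʳ-≤ c (m≤m+n w w′)) ⟩
      (c + (w + w′)) * suc u ∎
      where open ≤-Reasoning
    go : ∀ M → Rep M σ → _
    go M rep with x <? y
    ... | yes lt = let t , M′ , σ′ , t≤ , ex , rest = exec (yes# lt) M rep in
      _ , M′ , σ′ , bound (weight p) (weight q) t≤ , if-true (eval a M rep) (eval b M rep) lt ex , rest
    ... | no ≮ = let t , M′ , σ′ , t≤ , ex , rest = exec (no# (≮⇒≥ ≮)) M rep in
      _ , M′ , σ′ , subst (λ w → c + t ≤ (c + w) * suc u) (+-comm (weight q) (weight p)) (bound (weight q)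
        (weight p) t≤) , if-false (eval a M rep) (eval b M rep) (≮⇒≥ ≮) ex , rest

  -- Inv φ σ: the potential φ pays for the remaining iterations started in σ.
  while# : ∀ {e f p} {Q : St → Set} (Inv : ℕ → St → Set) →
    (∀ {φ σ} → Inv φ σ → ∃[ x ] ∃[ y ] Ev σ e x × Ev σ f y ×
      (x < y → ∃[ u ] Run p σ u λ σ′ → ∃[ φ′ ] Inv φ′ σ′ × suc u + φ′ ≤ φ) × (y ≤ x → Q σ)) →
    ∀ {φ σ} → Inv φ σ → Run (whileLess e f p) σ φ Q
  while# {e} {f} {p} {Q} Inv step {φ} {σ} inv = run (λ M rep → go φ ≤-refl inv M rep)
    where
    c = 1 + size e + size f
    w = c + weight p
    bound : ∀ {t t′ u φ φ′} → t ≤ weight p * suc u → t′ ≤ w * suc φ′ → suc u + φ′ ≤ φ → c + t + t′ ≤ w * suc φ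
    bound {t} {t′} {u} {φ} {φ′} t≤ t′≤ le = begin
      c + t + t′ ≤⟨ +-mono-≤ (+-mono-≤ (once c u) t≤) t′≤ ⟩
      c * suc u + weight p * suc u + w * suc φ′ ≡⟨ cong (_+ w * suc φ′) (*-distribʳ-+ (suc u) c (weight p)) ⟨
      w * suc u + w * suc φ′ ≡⟨ *-distribˡ-+ w (suc u) (suc φ′) ⟨
      w * (suc u + suc φ′) ≡⟨ cong (w *_) (+-suc (suc u) φ′) ⟩
      w * suc (suc u + φ′) ≤⟨ *-monoʳ-≤ w (s≤s le) ⟩
      w * suc φ ∎
      where open ≤-Reasoning
    -- Each iteration lowers the potential by at least one, so a bound on it serves as the
    -- structural recursion argument.
    go : ∀ fuel {φ σ} → φ ≤ fuel → Inv φ σ → ∀ M → Rep M σ → ∃[ t ] ∃[ M′ ] Σ[ σ′ ∈ St ]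
         t ≤ w * suc φ × Exec (whileLess e f p) ⟨ var σ , M ⟩ t ⟨ var σ′ , M′ ⟩ × Rep M′ σ′ × Q σ′
    go fuel {φ} {σ} φ≤ inv M rep with step inv
    ... | x , y , a , b , body , end with x <? y
    ...   | no ≮ = c , M , σ , ≤-trans (m≤m+n c (weight p)) (once w φ) ,
      while-false (eval a M rep) (eval b M rep) (≮⇒≥ ≮) , rep , end (≮⇒≥ ≮)
    ...   | yes lt with body lt
    ...     | u , r with exec r M rep
    go zero φ≤ inv M rep | x , y , a , b , body , end | yes lt | u , r | t , M′ , σ′ , t≤ , ex , rep′ , φ′ ,
      inv′ , le
      = contradiction (≤-trans le φ≤) λ ()
    go (suc fuel) φ≤ inv M rep | x , y , a , b , body , end | yes lt | u , r | t , M′ , σ′ , t≤ , ex , rep′ ,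
      φ′ , inv′ , le
      with go fuel (≤-trans (m≤n+m φ′ u) (s≤s⁻¹ (≤-trans le φ≤))) inv′ M′ rep′
    ... | t′ , M″ , σ″ , t′≤ , ex′ , rest = c + t + t′ , M″ , σ″ , bound t≤ t′≤ le ,
          while-true (eval a M rep) (eval b M rep) lt ex ex′ , rest

  for# : ∀ {x e p σ N u} {Q : St → Set} (Inv : ℕ → St → Set) →
    (∀ {i σ} → Inv i σ → var σ x ≡ i) → (∀ {i σ} → Inv i σ → Ev σ e N) → N ≤ W →
    (∀ {i σ} → i < N → Inv i σ → Run p σ u λ σ′ → var σ′ x ≡ i × Inv (suc i) (σ′ ⟦ x ≔ suc i ⟧)) →
    ∀ {i} → i ≤ N → Inv i σ → (∀ {σ′} → Inv N σ′ → Q σ′) → Run (For x e p) σ (N * suc u) Q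
  for# {x} {e} {p} {σ} {N} {u} {Q} Inv counter limit N≤W body {i} i≤N inv end =
    weaken# (*-monoˡ-≤ (suc u) (m∸n≤m N i)) (while# {Q = Q} Inv′ step (i , i≤N , inv , refl))
    where
    Inv′ : ℕ → St → Set
    Inv′ φ σ = ∃[ i ] i ≤ N × Inv i σ × (N ∸ i) * suc u ≡ φ
    step : ∀ {φ σ} → Inv′ φ σ → ∃[ y ] ∃[ z ] Ev σ (reg x) y × Ev σ e z ×
      (y < z → ∃[ v ] Run (p ⨾ incr x) σ v λ σ′ → ∃[ φ′ ] Inv′ φ′ σ′ × suc v + φ′ ≤ φ) × (z ≤ y → Q σ)
    step {φ} {σ} (i , i≤N , inv , refl) = i , N , v# x (counter inv) , limit inv ,
      (λ i<N → u , (body i<N inv ⨾# λ (eq , inv′) → :=# (k# 1 +# v# x eq [ ≤-trans i<N N≤W ])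
        (_ , (suc i , i<N , inv′ , refl) , ≤-reflexive (cong (_* suc u) (sym (+-∸-assoc 1 i<N)))))) ,
      λ N≤i → end (subst (λ j → Inv j σ) (≤-antisym i≤N N≤i) inv)

-- Framing, and the layout of words and lists in memory.

-- Framing by numbering: registers and arrays are numbered such that a program touches none below
-- some bound. The side conditions compare numerals and are solved by computation.
record KV {X : Set} (N : ℕ) (v v′ : ℕ → X) : Set where
  constructor kv
  field at : ∀ x {_ : T (x <ᵇ N)} → v′ x ≡ v x
open KV public

<ᵇ-≢ : ∀ {x N y} → T (x <ᵇ N) → T (N ≤ᵇ y) → x ≢ y
<ᵇ-≢ {x} {N} {y} p q refl = <⇒≱ (<ᵇ⇒< x N p) (≤ᵇ⇒≤ N y q)

kv-refl : ∀ {X N} {v : ℕ → X} → KV N v v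
kv-refl = kv λ _ → refl

kv-trans : ∀ {X N} {v v′ v″ : ℕ → X} → KV N v v′ → KV N v′ v″ → KV N v v″
kv-trans (kv f) (kv g) = kv λ x {p} → trans (g x {p}) (f x {p})

kv-put : ∀ {N v v′ y a} {_ : T (N ≤ᵇ y)} → KV N v v′ → KV N v (v′ [ y ↦ a ])
kv-put {N} {v} {v′} {y} {a} {q} (kv f) = kv λ x {p} → trans (put-≢ v′ a (<ᵇ-≢ {x} {N} p q)) (f x {p})

ka-put : ∀ {N A A′ a i x} {_ : T (N ≤ᵇ a)} → KV N A A′ → KV N A (λ b → if b ≡ᵇ a then A′ b [ i ↦ x ] else A′ b)
ka-put {N} {A} {A′} {a} {i} {x} {q} (kv f) = kv λ b {p} → go b {p} (≢⇒≡ᵇ (<ᵇ-≢ {b} {N} p q))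
  where
  go : ∀ b {p : T (b <ᵇ N)} → (b ≡ᵇ a) ≡ false → (if b ≡ᵇ a then A′ b [ i ↦ x ] else A′ b) ≡ A b
  go b {p} eq rewrite eq = f b {p}

kv-≤ : ∀ {X N M} {v v′ : ℕ → X} {_ : T (M ≤ᵇ N)} → KV N v v′ → KV M v v′
kv-≤ {_} {N} {M} {_} {_} {le} (kv f) = kv λ x {p} → f x {<⇒<ᵇ (<-≤-trans (<ᵇ⇒< x M p) (≤ᵇ⇒≤ M N le))}

-- A word stored from cell i on; δ is the offset of the keys, 0 for the flag and 2 for pair numbers.
Stored : ℕ → (ℕ → ℕ) → ℕ → Word → Set
Stored δ f i []             = ⊤
Stored δ f i ((p , w) ∷ xs) = δ + f i ≡ p × f (suc i) ≡ w × Stored 2 f (2+ i) xs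

Stored-frame : ∀ {δ f g} i xs → (∀ {j} → i ≤ j → j < i + length xs * 2 → g j ≡ f j) → Stored δ f i xs →
  Stored δ g i xs
Stored-frame i [] _ _ = tt
Stored-frame {δ} i ((p , w) ∷ xs) eq (e , e′ , sx) =
  trans (cong (δ +_) (eq ≤-refl (m<m+n i z<s))) e ,
  trans (eq (n≤1+n i) (subst (suc i <_) (sym (two i _)) (s≤s (s≤s (m≤m+n i _))))) e′ ,
  Stored-frame (2+ i) xs (λ {j} le lt → eq (≤-trans (m≤n+m i 2) le) (subst (j <_) (sym (two i _)) lt)) sx
  where
  two : ∀ i m → i + suc (suc m) ≡ 2+ (i + m)
  two i m = trans (+-suc i (suc m)) (cong suc (+-suc i m))

Seg : List ℕ → ℕ → List ℕ → Set
Seg xs i []       = ⊤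
Seg xs i (y ∷ ys) = At xs i y × Seg xs (suc i) ys

-- A linked list in which a link to `x` is stored as `suc x`, leaving 0 for the end, the value of
-- fresh memory.
Chain : (ℕ → ℕ) → ℕ → List ℕ → Set
Chain f h []       = h ≡ 0
Chain f h (x ∷ xs) = h ≡ suc x × Chain f (f x) xs

Flag : ℕ → Set → Set
Flag b P = (b ≡ 1 × P) ⊎ (b ≡ 0 × ¬ P)

-- Vertices are numbers v < n, elements of B numbers x < Bn, and the pair (v , x) is v * Bn + x.
record Setup : Set where
  field
    input : List ℕ
    space W n k Bn offA offQ : ℕ
    n>0 : 0 < n
    k>0 : 0 < k
    Bn>0 : 0 < Bn
  S : ℕ
  S = n * Bn
  stride : ℕ
  stride = 2 + k * 2
  -- The slot beyond those of the states keeps the old rank of the state that is being raised.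
  base₀ : ℕ
  base₀ = suc S * stride
  -- The interleaved arrays all get the length of the largest one, the class table with `2 + k`
  -- entries for each state.
  L : ℕ
  L = S * (2 + k)
  field
    100≤W   : 100 ≤ W
    fits    : base₀ + L * 16 ≤ space
    space≤W : space ≤ W
    input≤W : ∀ {i x} → At input i x → x ≤ W
    length≤W : length input ≤ W
    -- `cl s p` is the class of key `p` in state `s`, and `nx s` the number of the element of `B`
    -- that every successor of `s` has. `thr v` is the number of failing successors from which a
    -- state at `v` must be raised: all of them for player 0, one for player 1. `so v` and `po v`
    -- locate the adjacency lists of `v` in the input.
    cl : ℕ → ℕ → ℕ
    nx : ℕ → ℕ
    sl pl : ℕ → List ℕ
    thr so po : ℕ → ℕ
    cl≤2 : ∀ s p → cl s p ≤ 2
    cl-0 : ∀ s → cl s 0 ≡ 2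
    cl-1 : ∀ s → cl s 1 ≡ 1
    nx< : ∀ {s} → s < S → nx s < Bn
    sl< : ∀ {v} → v < n → All (_< n) (sl v)
    pl< : ∀ {v} → v < n → All (_< n) (pl v)
    sl-unique : ∀ v → Unique (sl v)
    pl-unique : ∀ v → Unique (pl v)
    pl⇒sl : ∀ {u v} → u < n → v < n → u ∈ pl v → v ∈ sl u
    sl⇒pl : ∀ {u v} → u < n → v < n → v ∈ sl u → u ∈ pl v
    thr>0 : ∀ v → 0 < thr v
    deg-sl : ∀ {v} → v < n → At input (offA + v) (length (sl v))
    deg-pl : ∀ {v} → v < n → At input (offQ + v) (length (pl v))
    seg-sl : ∀ {v} → v < n → Seg input (so v) (sl v)
    seg-pl : ∀ {v} → v < n → Seg input (po v) (pl v)
    so-end : ∀ {v} → v < n → so v + length (sl v) ≤ length input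
    po-end : ∀ {v} → v < n → po v + length (pl v) ≤ length input

  state< : ∀ {v x} → v < n → x < Bn → v * Bn + x < S
  state< {v} {x} v<n x<B = begin-strict
    v * Bn + x  <⟨ +-monoʳ-< (v * Bn) x<B ⟩
    v * Bn + Bn ≡⟨ +-comm (v * Bn) Bn ⟩
    suc v * Bn  ≤⟨ *-monoˡ-≤ Bn v<n ⟩
    n * Bn      ∎
    where open ≤-Reasoning

  S>0 : 0 < S
  S>0 = *-mono-< n>0 Bn>0

  n≤S : n ≤ S
  n≤S = m≤m*n n Bn {{>-nonZero Bn>0}}

  Bn≤S : Bn ≤ S
  Bn≤S = m≤n*m Bn n {{>-nonZero n>0}}

  S≤L : S ≤ L
  S≤L = m≤m*n S (2 + k)

  k≤L : 2 + k ≤ L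
  k≤L = m≤n*m (2 + k) S {{>-nonZero S>0}}

  L≤W : L ≤ W
  L≤W = ≤-trans (≤-trans (m≤m*n L 16) (m≤n+m _ base₀)) (≤-trans fits space≤W)

  base₀≤W : base₀ ≤ W
  base₀≤W = ≤-trans (m≤m+n base₀ _) (≤-trans fits space≤W)

  slot : ∀ {s} → s ≤ S → s * stride + stride ≤ base₀
  slot {s} s≤S = ≤-trans (≤-reflexive (+-comm (s * stride) stride)) (*-monoˡ-≤ stride (s≤s s≤S))

  slot≤W : ∀ {s} → s ≤ S → s * stride ≤ W
  slot≤W s≤S = ≤-trans (m≤m+n _ stride) (≤-trans (slot s≤S) base₀≤W)

  row : ∀ {s p} → s < S → p < 2 + k → s * (2 + k) + p < L
  row {s} {p} s<S p<k = begin-strict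
    s * (2 + k) + p <⟨ +-monoʳ-< (s * (2 + k)) p<k ⟩
    s * (2 + k) + (2 + k) ≡⟨ +-comm (s * (2 + k)) (2 + k) ⟩
    suc s * (2 + k) ≤⟨ *-monoˡ-≤ (2 + k) s<S ⟩
    L ∎
    where open ≤-Reasoning

  record Glob (v : ℕ → ℕ) : Set where
    constructor glob
    field
      g0 : v 0 ≡ n
      g2 : v 2 ≡ k
      g3 : v 3 ≡ Bn
      g4 : v 4 ≡ base₀
      g5 : v 5 ≡ S
      g6 : v 6 ≡ stride
      g7 : v 7 ≡ offA
      g8 : v 8 ≡ offQ

  open Glob public

  glob-kv : ∀ {v v′} → KV 9 v v′ → Glob v → Glob v′
  glob-kv κ g = glob (trans (at κ 0) (g0 g)) (trans (at κ 2) (g2 g)) (trans (at κ 3) (g3 g)) (trans (at κ 4)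
    (g4 g))
    (trans (at κ 5) (g5 g)) (trans (at κ 6) (g6 g)) (trans (at κ 7) (g7 g)) (trans (at κ 8) (g8 g))

-- Comparing two stored ranks.

stop : Program
stop = 24 := const 1 ⟨+⟩ reg 2

cmpBody : Program
cmpBody =
  ifLess (mem (reg 21)) (mem (reg 20)) (23 := const 1 ⨾ stop)
  (ifLess (mem (reg 20)) (mem (reg 21)) stop
  -- The keys agree here. From the second letter on a cell holds a pair number instead of a key,
  -- which register 27 makes up for by an offset of 2.
  (25 := arrE 1 (reg 27 ⟨+⟩ mem (reg 20)) ⨾
  ifLess (const 1) (reg 25)
    (ifLess (mem (const 1 ⟨+⟩ reg 21)) (mem (const 1 ⟨+⟩ reg 20)) (23 := const 1 ⨾ stop)
    (ifLess (mem (const 1 ⟨+⟩ reg 20)) (mem (const 1 ⟨+⟩ reg 21)) stop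
    (20 := const 2 ⟨+⟩ reg 20 ⨾ 21 := const 2 ⟨+⟩ reg 21 ⨾ 27 := const 2 ⟨+⟩ reg 22 ⨾ incr 24)))
    -- With equal keys of class 0 or 1 the class is itself the verdict.
    (23 := reg 25 ⨾ stop)))

-- Compares the ranks stored at registers 20 and 21, with classes from register 22 on.
cmp : Program
cmp = 23 := const 0 ⨾ 24 := const 0 ⨾ 27 := reg 22 ⨾ whileLess (reg 24) (const 1 ⟨+⟩ reg 2) cmpBody

-- The lexicographic successor of a rank.

availFrom : (ℕ → ℕ) → ℕ → ℕ → List ℕ
availFrom f lo zero    = []
availFrom f lo (suc m) = if 0 <ᵇ f lo then 2+ lo ∷ availFrom f (suc lo) m else availFrom f (suc lo) m

availFrom-cong : ∀ f g lo m → (∀ {a} → lo ≤ a → f a ≡ g a) → availFrom f lo m ≡ availFrom g lo m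
availFrom-cong f g lo zero eq = refl
availFrom-cong f g lo (suc m) eq rewrite eq {lo} ≤-refl | availFrom-cong f g (suc lo) m (λ le → eq (<⇒≤ le)) =
  refl

availFrom-add : ∀ f g a lo m → f a ≡ 0 → 0 < g a → (∀ {b} → b ≢ a → f b ≡ g b) → lo ≤ a → a < lo + m →
                availFrom g lo m ↭ 2+ a ∷ availFrom f lo m
availFrom-add f g a lo zero _ _ _ lo≤a a< = contradiction (subst (a <_) (+-identityʳ lo) a<) (≤⇒≯ lo≤a)
availFrom-add f g a lo (suc m) fa ga eq lo≤a a< with m≤n⇒m<n∨m≡n lo≤a
... | inj₂ refl rewrite fa | availFrom-cong f g (suc lo) m (λ le → eq (>⇒≢ le)) with g lo | ga
...   | suc _ | _ = ↭-refl
availFrom-add f g a lo (suc m) fa ga eq lo≤a a< | inj₁ lt rewrite eq (<⇒≢ lt) with 0 <ᵇ g lo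
... | false = availFrom-add f g a (suc lo) m fa ga eq lt (subst (a <_) (+-suc lo m) a<)
... | true  = tran (prep (2+ lo) (availFrom-add f g a (suc lo) m fa ga eq lt (subst (a <_) (+-suc lo m) a<)))
  (swap (2+ lo) (2+ a) ↭-refl)

availFrom-≥ : ∀ f lo m → All (2+ lo ≤_) (availFrom f lo m)
availFrom-≥ f lo zero = []
availFrom-≥ f lo (suc m) with 0 <ᵇ f lo
... | true  = ≤-refl ∷ All.map <⇒≤ (availFrom-≥ f (suc lo) m)
... | false = All.map <⇒≤ (availFrom-≥ f (suc lo) m)

availFrom-ascending : ∀ f lo m → AllPairs _<_ (availFrom f lo m)
availFrom-ascending f lo zero = []
availFrom-ascending f lo (suc m) with 0 <ᵇ f lo
... | true  = availFrom-≥ f (suc lo) m ∷ availFrom-ascending f (suc lo) m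
... | false = availFrom-ascending f (suc lo) m

∈availFrom : ∀ f lo m {q} → q ∈ availFrom f lo m → ∃[ a ] q ≡ 2+ a × 0 < f a × a < lo + m
∈availFrom f lo (suc m) q∈ with f lo in eq
∈availFrom f lo (suc m) q∈ | zero with ∈availFrom f (suc lo) m q∈
... | a , e , p , lt = a , e , p , subst (a <_) (sym (+-suc lo m)) lt
∈availFrom f lo (suc m) (here refl) | suc _ = lo , refl , subst (0 <_) (sym eq) z<s , m<m+n lo z<s
∈availFrom f lo (suc m) (there q∈) | suc _ with ∈availFrom f (suc lo) m q∈
... | a , e , p , lt = a , e , p , subst (a <_) (sym (+-suc lo m)) lt

∈availFrom⁺ : ∀ f lo m {a} → lo ≤ a → a < lo + m → 0 < f a → 2+ a ∈ availFrom f lo m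
∈availFrom⁺ f lo zero {a} lo≤a a< _ = contradiction (subst (a <_) (+-identityʳ lo) a<) (≤⇒≯ lo≤a)
∈availFrom⁺ f lo (suc m) {a} lo≤a a< pos with m≤n⇒m<n∨m≡n lo≤a
∈availFrom⁺ f lo (suc m) {a} lo≤a a< pos | inj₂ refl with f lo | pos
... | suc _ | _ = here refl
∈availFrom⁺ f lo (suc m) {a} lo≤a a< pos | inj₁ lt with 0 <ᵇ f lo
... | true  = there (∈availFrom⁺ f (suc lo) m lt (subst (a <_) (+-suc lo m) a<) pos)
... | false = ∈availFrom⁺ f (suc lo) m lt (subst (a <_) (+-suc lo m) a<) pos

availFrom-none : ∀ f lo m → (∀ {a} → a < lo + m → f a ≡ 0) → availFrom f lo m ≡ []
availFrom-none f lo zero _ = refl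
availFrom-none f lo (suc m) eq rewrite eq {lo} (m<m+n lo z<s) = availFrom-none f (suc lo) m λ {a} lt →
  eq (subst (a <_) (sym (+-suc lo m)) lt)

availFrom-all : ∀ f lo m → (∀ {a} → a < lo + m → 0 < f a) → availFrom f lo m ≡ List.applyUpTo (λ i →
  2+ (lo + i)) m
availFrom-all f lo zero _ = refl
availFrom-all f lo (suc m) pos with f lo | pos {lo} (m<m+n lo z<s)
... | suc _ | _ = cong₂ _∷_ (cong 2+ (sym (+-identityʳ lo)))
  (trans (availFrom-all f (suc lo) m (λ {a} lt → pos (subst (a <_) (sym (+-suc lo m)) lt)))
    (applyUpTo-cong m λ i → cong 2+ (sym (+-suc lo i))))
  where
  applyUpTo-cong : ∀ {f g : ℕ → ℕ} m → (∀ i → f i ≡ g i) → List.applyUpTo f m ≡ List.applyUpTo g m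
  applyUpTo-cong zero _ = refl
  applyUpTo-cong (suc m) eq = cong₂ _∷_ (eq 0) (applyUpTo-cong m (eq ∘ suc))

less-cong : ∀ {p p′} qs → p ≤ p′ → All (λ q → q < p′ → q < p) qs → less p qs ≡ less p′ qs
less-cong [] _ _ = refl
less-cong {p} {p′} (q ∷ qs) le (f ∷ fs) with q <? p
... | yes lt = trans (less-yes qs lt) (trans (cong suc (less-cong qs le fs))
  (sym (less-yes qs (≤-trans lt le))))
... | no ≮ = trans (less-no qs (≮⇒≥ ≮)) (trans (less-cong qs le fs) (sym (less-no qs (≮⇒≥ (≮ ∘ f)))))

less-0 : ∀ qs → less 0 qs ≡ 0
less-0 qs = less-all≥ qs (All.universal (λ _ → z≤n) qs)

module Successor (n k : ℕ) where
  open Numbering n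

  -- The word has the greatest number of its length, so an increment must carry past it.
  Last : Word → Set
  Last xs = suc (num xs) ≡ words (length xs)

  record Inc (xs ys : Word) : Set where
    constructor inc
    field
      inc-keys  : keys ys ↭ keys xs
      inc-small : Small ys
      inc-num   : num ys ≡ suc (num xs)
  open Inc public

  num-flat : ∀ {ks} → AllPairs _<_ ks → num (flat ks) ≡ 0
  num-flat [] = refl
  num-flat {p ∷ ks} (lts ∷ asc) rewrite keys-flat ks | less-all≥ ks (All.map <⇒≤ lts) = num-flat asc

  small-flat : ∀ ks → 0 < n → Small (flat ks)
  small-flat ks n>0 = Allₚ.map⁺ (All.universal (λ _ → n>0) ks)

  Inc-∷ : ∀ {p w xs ys} → w < n → Inc xs ys → Inc ((p , w) ∷ xs) ((p , w) ∷ ys)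
  Inc-∷ {p} {w} {xs} {ys} w<n (inc ks sm eq) = inc (prep p ks) (w<n ∷ sm) (begin
    (less p (keys ys) * n + w) * words (length ys) + num ys
      ≡⟨ cong₂ (λ c l → (c * n + w) * words l + num ys) (less-↭ p ks) (↭-length-keys {ys} {xs} ks) ⟩
    (less p (keys xs) * n + w) * words (length xs) + num ys ≡⟨ cong (_ +_) eq ⟩
    (less p (keys xs) * n + w) * words (length xs) + suc (num xs) ≡⟨ +-suc _ _ ⟩
    suc (num ((p , w) ∷ xs)) ∎)
    where open ≡-Reasoning

  Inc-prefix : ∀ {xs ys} pre → Small pre → Inc xs ys → Inc (pre ++ xs) (pre ++ ys)
  Inc-prefix [] [] i = i
  Inc-prefix (_ ∷ pre) (w<n ∷ sm) i = Inc-∷ w<n (Inc-prefix pre sm i)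

  carry : ∀ {d c e} → suc e ≡ c → suc (d * c + e) ≡ suc d * c
  carry {d} {c} {e} eq = trans (sym (+-suc (d * c) e)) (trans (cong (d * c +_) eq) (+-comm (d * c) c))

  num-∷flat : ∀ {p w ks} → AllPairs _<_ ks → num ((p , w) ∷ flat ks) ≡ (less p ks * n + w) * words (length ks)
  num-∷flat {p} {w} {ks} asc rewrite keys-flat ks | Listₚ.length-map (_, 0) ks | num-flat asc = +-identityʳ _

  -- The carry of a mixed-radix counter: a suffix with the greatest number is replaced by the
  -- ascending arrangement with zero weights, whose number is 0, and the digit before it grows by
  -- one.
  Inc-weight : ∀ {p w xs ks} → suc w < n → Last xs → ks ↭ keys xs → AllPairs _<_ ks →
    Inc ((p , w) ∷ xs) ((p , suc w) ∷ flat ks)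
  Inc-weight {p} {w} {xs} {ks} lt last perm asc = inc (prep p (subst (_↭ keys xs) (sym (keys-flat ks)) perm))
    (lt ∷ small-flat ks (≤-<-trans z≤n lt)) (begin
      num ((p , suc w) ∷ flat ks) ≡⟨ num-∷flat asc ⟩
      (less p ks * n + suc w) * words (length ks)
        ≡⟨ cong₂ (λ c l → (c * n + suc w) * words l) (less-↭ p perm) (trans (↭ₚ.↭-length perm) (Listₚ.length-map
          proj₁ xs)) ⟩
      (less p (keys xs) * n + suc w) * words (length xs)
        ≡⟨ cong (_* words (length xs)) (+-suc (less p (keys xs) * n) w) ⟩
      suc (less p (keys xs) * n + w) * words (length xs) ≡⟨ carry {less p (keys xs) * n + w} last ⟨
      suc (num ((p , w) ∷ xs)) ∎)
    where open ≡-Reasoning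

  -- Once the weight has reached `n - 1`, the digit can only grow through the key. Passing to the
  -- next larger key raises the Lehmer digit by one and restarts the weight at 0, again a growth by
  -- exactly one.
  Inc-key : ∀ {p w xs p′ ks} → suc w ≡ n → Last xs → p′ ∷ ks ↭ p ∷ keys xs → AllPairs _<_ ks →
            less p′ ks ≡ suc (less p (keys xs)) → Inc ((p , w) ∷ xs) ((p′ , 0) ∷ flat ks)
  Inc-key {p} {w} {xs} {p′} {ks} refl last perm asc eq =
    inc (subst (λ qs → p′ ∷ qs ↭ p ∷ keys xs) (sym (keys-flat ks)) perm)
    (z<s ∷ small-flat ks z<s) (begin
      num ((p′ , 0) ∷ flat ks) ≡⟨ num-∷flat asc ⟩
      (less p′ ks * n + 0) * words (length ks)
        ≡⟨ cong₂ (λ c l → (c * n + 0) * words l) eq (trans (suc-injective (↭ₚ.↭-length perm)) (Listₚ.length-map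
          proj₁ xs)) ⟩
      (suc (less p (keys xs)) * n + 0) * words (length xs)
        ≡⟨ cong (_* words (length xs)) (trans (+-identityʳ _) (trans (+-comm n (less p (keys xs) * n))
          (+-suc (less p (keys xs) * n) w))) ⟩
      suc (less p (keys xs) * n + w) * words (length xs) ≡⟨ carry {less p (keys xs) * n + w} last ⟨
      suc (num ((p , w) ∷ xs)) ∎)
    where open ≡-Reasoning

  Last-[] : Last []
  Last-[] = refl

  Last-∷ : ∀ {p w xs} → suc w ≡ n → Last xs → All (_< p) (keys xs) → Last ((p , w) ∷ xs)
  Last-∷ {p} {w} {xs} refl last lts = begin
    suc ((less p (keys xs) * n + w) * words (length xs) + num xs) ≡⟨ carry {less p (keys xs) * n + w} last ⟩
    suc (less p (keys xs) * n + w) * words (length xs)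
      ≡⟨ cong (_* words (length xs)) (trans (sym (+-suc (less p (keys xs) * n) w)) (+-comm (less p (keys xs) *
        n) n)) ⟩
    (n + less p (keys xs) * n) * words (length xs)
      ≡⟨ cong (λ c → (n + c * n) * words (length xs)) (trans (less-all< (keys xs) lts) (Listₚ.length-map proj₁
        xs)) ⟩
    (n + length xs * n) * words (length xs) ∎
    where open ≡-Reasoning

  -- The number of finite tidy words: the head key 0 has Lehmer digit 0, so the head contributes
  -- only its `n` weights. Infinity is ranked just behind all of them.
  total : ℕ
  total = n * words k

  rank : Word → ℕ
  rank ((0 , w) ∷ xs) = num ((0 , w) ∷ xs)
  rank _              = total

  num<total : ∀ {w xs} → length xs ≡ k → w < n → Small xs → num ((0 , w) ∷ xs) < total
  num<total {w} {xs} refl w<n sm rewrite less-0 (keys xs) =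
    <-≤-trans (digit-lift {w} {n} (words (length xs)) {num xs} {0} (num< xs sm) w<n)
      (≤-reflexive (+-identityʳ _))

  data Result (X : Word) : Word → Set where
    within   : ∀ {w ys} → Inc X ((0 , w) ∷ ys) → Result X ((0 , w) ∷ ys)
    overflow : suc (num X) ≡ total → Result X (∞word k)

  Result-∞ : ∀ {w xs} → suc w ≡ n → length xs ≡ k → Last xs → Result ((0 , w) ∷ xs) (∞word k)
  Result-∞ {w} {xs} refl refl last = overflow (trans (cong (λ c → suc ((c * n + w) * words (length xs) +
    num xs)) (less-0 (keys xs))) (carry {w} last))

  Result-Tidy : ∀ {w xs Y} → Tidy n k ((0 , w) ∷ xs) → Result ((0 , w) ∷ xs) Y → Tidy n k Y
  Result-Tidy _ (overflow _) = infinite (keys-flat (base k))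
  Result-Tidy (finite _ _ perm) (within (inc ks (w<n ∷ sm) _)) = finite w<n sm (tran (↭ₚ.drop-∷ ks) perm)

  Result-canonical : ∀ {X Y} → Result X Y → ∀ {w xs} → Y ≡ (1 , w) ∷ xs → Y ≡ ∞word k
  Result-canonical (overflow _) _ = refl

  Result-rank : ∀ {w xs Y} → Result ((0 , w) ∷ xs) Y → rank Y ≡ suc (rank ((0 , w) ∷ xs))
  Result-rank (within (inc _ _ eq)) = eq
  Result-rank (overflow eq) = sym eq

  rank≤total : ∀ {X} → Tidy n k X → rank X ≤ total
  rank≤total (infinite _) = ≤-refl
  rank≤total t@(finite w<n sm perm) = <⇒≤ (num<total (suc-injective (Tidy-length t)) w<n sm)

  -- The increment is the immediate successor among the tidy words.
  Result-least : ∀ {w xs Y d} → Tidy n k ((0 , w) ∷ xs) → Result ((0 , w) ∷ xs) Y → Tidy n k d →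
                 (0 , w) ∷ xs ≼ d → (0 , w) ∷ xs ≢ d → Y ≼ d
  Result-least t (within _) (infinite _) _ _ = key< z<s
  Result-least t (overflow _) (infinite eq) _ _ = ∞word-≼ eq
  Result-least (finite w<n sm perm) res t′@(finite w′<n sm′ perm′) le ≢
    with ≼⇒num le (prep 0 (tran perm (↭-sym perm′))) (w<n ∷ sm)
  ... | inj₁ eq = contradiction eq ≢
  Result-least t (overflow eq) t′@(finite w′<n sm′ perm′) le ≢ | inj₂ lt =
    contradiction (≤-<-trans (≤-trans (≤-reflexive (sym eq)) lt) (num<total (suc-injective (Tidy-length t′))
      w′<n sm′)) (<-irrefl refl)
  Result-least {d = d} t@(finite w<n sm perm) (within {w₁} {ys} i@(inc ks sm₁ eq)) t′@(finite w′<n sm′ perm′) le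
    ≢ | inj₂ lt
    with ≼-total ((0 , w₁) ∷ ys) d (trans (Tidy-length (Result-Tidy t (within i))) (sym (Tidy-length t′)))
  ... | inj₁ y≼d = y≼d
  ... | inj₂ d≼y with ≼⇒num d≼y (↭-sym (tran ks (prep 0 (tran perm (↭-sym perm′))))) (w′<n ∷ sm′)
  ...   | inj₁ refl = ≼-refl _
  -- A tidy word strictly between a word and its increment would have a number strictly between two
  -- consecutive ones.
  ...   | inj₂ lt′ = contradiction (<-≤-trans lt′ (≤-trans (≤-reflexive eq) lt)) (<-irrefl refl)

  Result-above : ∀ {w xs Y} → Tidy n k ((0 , w) ∷ xs) → Result ((0 , w) ∷ xs) Y → (0 , w) ∷ xs ≼ Y
  Result-above t (overflow _) = key< z<s
  Result-above {w} {xs} t (within {w₁} {ys} i@(inc ks sm eq)) with ≼-total ((0 , w) ∷ xs) ((0 , w₁) ∷ ys)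
    (trans (Tidy-length t) (sym (Tidy-length (Result-Tidy t (within i)))))
  ... | inj₁ le = le
  ... | inj₂ ge with ≼⇒num ge ks sm
  ...   | inj₁ refl = ≼-refl _
  ...   | inj₂ lt = contradiction (subst (_< num ((0 , w) ∷ xs)) eq lt) (≤⇒≯ (n≤1+n _))

-- Register 26 receives the number of letters, head included, in front of the part to be refilled;
-- while it is 0, no position has been found. Clearing register 24 ends the scan.
found : Program
found = 26 := const 1 ⟨+⟩ reg 24 ⨾ 24 := const 0

seek : Program
seek = whileLess (arrE 15 (reg 29)) (const 1) (incr 29)

raiseKey : Program
raiseKey = 29 := const 1 ⟨+⟩ reg 28 ⨾ seek ⨾
  store (reg 27) (reg 29) ⨾ store (const 1 ⟨+⟩ reg 27) (const 0) ⨾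
  setArr 15 (reg 29) (const 0) ⨾ setArr 15 (reg 28) (const 1) ⨾ found

scan : Program
scan =
  27 := reg 20 ⟨+⟩ (reg 24 ⟨*⟩ const 2) ⨾ 28 := mem (reg 27) ⨾ 29 := const 1 ⟨+⟩ mem (const 1 ⟨+⟩ reg 27) ⨾
  ifLess (reg 29) (reg 0)
    (store (const 1 ⟨+⟩ reg 27) (reg 29) ⨾ found)
    (ifLess (const 1 ⟨+⟩ reg 28) (reg 25) raiseKey
      (setArr 15 (reg 28) (const 1) ⨾ 25 := const 1 ⟨+⟩ reg 28 ⨾ 24 := reg 24 ⟨∸⟩ const 1))

raiseHead : Program
raiseHead =
  29 := const 1 ⟨+⟩ mem (const 1 ⟨+⟩ reg 20) ⨾
  ifLess (reg 29) (reg 0) (store (const 1 ⟨+⟩ reg 20) (reg 29) ⨾ 26 := const 1)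
    -- All finite words are used up; the flag, the weight 0 and the ascending pairs that are filled
    -- in afterwards make up `∞word`.
    (store (reg 20) (const 1) ⨾ store (const 1 ⟨+⟩ reg 20) (const 0) ⨾ 26 := const 1)

-- Ascending pairs with weight 0 form the least arrangement of the marked keys. Erasing each mark
-- leaves array 15 blank for the next increment.
fill : Program
fill = ifLess (const 0) (arrE 15 (reg 31))
  (store (reg 30) (reg 31) ⨾ store (const 1 ⟨+⟩ reg 30) (const 0) ⨾ setArr 15 (reg 31) (const 0) ⨾
    30 := const 2 ⟨+⟩ reg 30) skip

-- Replaces the rank stored at register 20 by its lexicographic successor.  Array 15 marks the pairs
-- right of position register 24, and register 25 is one more than the largest of them.
bump : Program
bump = 24 := reg 2 ⨾ 25 := const 0 ⨾ 26 := const 0 ⨾ whileLess (const 0) (reg 24) scan ⨾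
  ifLess (reg 26) (const 1) raiseHead skip ⨾
  30 := reg 20 ⟨+⟩ (reg 26 ⟨*⟩ const 2) ⨾ 31 := const 0 ⨾ For 31 (reg 2) fill

Stored-++ : ∀ {f} i xs ys → Stored 2 f i (xs ++ ys) → Stored 2 f i xs × Stored 2 f (i + length xs * 2) ys
Stored-++ {f} i [] ys s = tt , subst (λ j → Stored 2 f j ys) (sym (+-identityʳ i)) s
Stored-++ {f} i (x ∷ xs) ys (e , e′ , s) with Stored-++ (2+ i) xs ys s
... | sx , sy = (e , e′ , sx) , subst (λ j → Stored 2 f j ys) (sym (trans (+-suc i _) (cong suc (+-suc i _))))
  sy

Stored-snoc : ∀ {δ f p w} i x xs → Stored δ f i (x ∷ xs) → 2 + f (i + length (x ∷ xs) * 2) ≡ p →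
  f (suc (i + length (x ∷ xs) * 2)) ≡ w →
              Stored δ f i (x ∷ xs ++ (p , w) ∷ [])
Stored-snoc {f = f} {p} {w} i x [] (e , e′ , _) a b =
  e , e′ , subst (λ j → 2 + f j ≡ p) (+-comm i 2) a , subst (λ j → f (suc j) ≡ w) (+-comm i 2) b , tt
Stored-snoc {f = f} {p} {w} i x (y ∷ xs) (e , e′ , s) a b =
  e , e′ , Stored-snoc (2+ i) y xs s (subst (λ j → 2 + f j ≡ p) (two (length (y ∷ xs) * 2)) a) (subst (λ j →
    f (suc j) ≡ w) (two (length (y ∷ xs) * 2)) b)
  where
  two : ∀ m → i + suc (suc m) ≡ 2+ (i + m)
  two m = trans (+-suc i (suc m)) (cong suc (+-suc i m))

Unique-suffix : ∀ pre {suf} → Unique (keys (pre ++ suf)) → Unique (keys suf)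
Unique-suffix []      u       = u
Unique-suffix (_ ∷ p) (_ ∷ u) = Unique-suffix p u

Tidy-finite : ∀ {n k w xs} → Tidy n k ((0 , w) ∷ xs) → w < n × All (λ a → proj₂ a < n) xs × keys xs ↭ base k
Tidy-finite (finite a b c) = a , b , c

-- Counting failures.

sumL : (ℕ → ℕ) → List ℕ → ℕ
sumL f []       = 0
sumL f (x ∷ xs) = f x + sumL f xs

sumL-cong : ∀ {f g} xs → (∀ {x} → x ∈ xs → f x ≡ g x) → sumL f xs ≡ sumL g xs
sumL-cong [] _ = refl
sumL-cong (x ∷ xs) eq = cong₂ _+_ (eq (here refl)) (sumL-cong xs (eq ∘ there))

sumL-mono : ∀ {f g} xs → (∀ {x} → x ∈ xs → f x ≤ g x) → sumL f xs ≤ sumL g xs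
sumL-mono [] _ = z≤n
sumL-mono (x ∷ xs) le = +-mono-≤ (le (here refl)) (sumL-mono xs (le ∘ there))

sumL-change : ∀ {f g y} xs → Unique xs → y ∈ xs → (∀ {x} → x ≢ y → f x ≡ g x) → sumL g xs + f y ≡ sumL f xs +
  g y
sumL-change {f} {g} {y} (x ∷ xs) (x∉ ∷ u) (here refl) eq = begin
  g x + sumL g xs + f x   ≡⟨ cong (λ z → g x + z + f x) (sumL-cong xs λ z∈ →
    sym (eq λ { refl → All.lookup x∉ z∈ refl })) ⟩
  g x + sumL f xs + f x   ≡⟨ solveℕ 3 (λ a b c → a :+ b :+ c :≡ c :+ b :+ a) refl (g x) (sumL f xs) (f x) ⟩
  f x + sumL f xs + g x   ∎
  where open ≡-Reasoning
sumL-change {f} {g} {y} (x ∷ xs) (x∉ ∷ u) (there y∈) eq = begin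
  g x + sumL g xs + f y   ≡⟨ cong (λ z → z + sumL g xs + f y) (sym (eq λ { refl → All.lookup x∉ y∈ refl })) ⟩
  f x + sumL g xs + f y   ≡⟨ +-assoc (f x) _ _ ⟩
  f x + (sumL g xs + f y) ≡⟨ cong (f x +_) (sumL-change xs u y∈ eq) ⟩
  f x + (sumL f xs + g y) ≡⟨ +-assoc (f x) _ _ ⟨
  f x + sumL f xs + g y   ∎
  where open ≡-Reasoning

put : (ℕ → Word) → ℕ → Word → ℕ → Word
put r s Y t = if t ≡ᵇ s then Y else r t

put-at : ∀ r s Y → put r s Y s ≡ Y
put-at r s Y rewrite ≡ᵇ-refl s = refl

put-off : ∀ r {s t} Y → t ≢ s → put r s Y t ≡ r t
put-off r Y t≢s rewrite ≢⇒≡ᵇ t≢s = refl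

failBit : ∀ {P : Set} → Dec P → ℕ
failBit (yes _) = 0
failBit (no _)  = 1

flag-failBit : ∀ {b} {P : Set} (d : Dec P) → Flag b P → 1 ∸ b ≡ failBit d
flag-failBit (yes _) (inj₁ (refl , _)) = refl
flag-failBit (yes p) (inj₂ (refl , ¬p)) = contradiction p ¬p
flag-failBit (no ¬p) (inj₁ (refl , p)) = contradiction p ¬p
flag-failBit (no _)  (inj₂ (refl , _)) = refl

failBit-yes : ∀ {P : Set} (d : Dec P) → P → failBit d ≡ 0
failBit-yes (yes _) _ = refl
failBit-yes (no ¬p) p = contradiction p ¬p

failBit-no : ∀ {P : Set} (d : Dec P) → ¬ P → failBit d ≡ 1
failBit-no (yes p) ¬p = contradiction p ¬p
failBit-no (no _)  _  = refl

failBit-mono : ∀ {P Q : Set} (d : Dec P) (e : Dec Q) → (Q → P) → failBit d ≤ failBit e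
failBit-mono (yes _) _       _ = z≤n
failBit-mono (no ¬p) (yes q) f = contradiction (f q) ¬p
failBit-mono (no _)  (no _)  _ = ≤-refl

failBit≤1 : ∀ {P : Set} (d : Dec P) → failBit d ≤ 1
failBit≤1 (yes _) = z≤n
failBit≤1 (no _)  = ≤-refl

sumL-≤length : ∀ {f} xs → (∀ x → f x ≤ 1) → sumL f xs ≤ length xs
sumL-≤length [] _ = z≤n
sumL-≤length (x ∷ xs) le = +-mono-≤ (le x) (sumL-≤length xs le)

Chain-frame : ∀ {f g h} xs → (∀ {x} → x ∈ xs → f x ≡ g x) → Chain f h xs → Chain g h xs
Chain-frame [] _ eq = eq
Chain-frame {g = g} (x ∷ xs) eq (refl , c) = refl , subst (λ h → Chain g h xs) (eq (here refl)) (Chain-frame xs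
  (eq ∘ there) c)

-- The programs of the main loop.

copy : Program
copy = 24 := const 0 ⨾ For 24 (reg 6) (store (reg 21 ⟨+⟩ reg 24) (mem (reg 20 ⟨+⟩ reg 24)))

setup-cmp : Expr → Program
setup-cmp t = 20 := reg 19 ⟨*⟩ reg 6 ⨾ 21 := t ⟨*⟩ reg 6 ⨾ 22 := reg 19 ⟨*⟩ (const 2 ⟨+⟩ reg 2) ⨾ cmp

recountBody : Program
recountBody = 16 := inp (reg 13) ⨾ setup-cmp ((reg 16 ⟨*⟩ reg 3) ⟨+⟩ reg 15) ⨾
  12 := reg 12 ⟨+⟩ (const 1 ⟨∸⟩ reg 23)

-- The worklist is a chain as well: register 9 and the links hold a state plus one.
push : ℕ → Program
push x = setArr 14 (reg x) (reg 9) ⨾ 9 := const 1 ⟨+⟩ reg x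

-- Counts the failing successors of the state in register 10, whose vertex is in register 11.
recount : Program
recount = 19 := reg 10 ⨾ 12 := const 0 ⨾ 13 := arrE 10 (reg 11) ⨾ 14 := reg 13 ⟨+⟩ inp (reg 7 ⟨+⟩ reg 11) ⨾
  15 := arrE 2 (reg 10) ⨾
  For 13 (reg 14) recountBody ⨾ setArr 13 (reg 10) (reg 12) ⨾
  ifLess (reg 12) (arrE 6 (reg 11)) skip (push 10)

At-< : ∀ {xs i x} → At xs i x → i < length xs
At-< (j , refl , _) = Finₚ.toℕ<n j

Stored-shift : ∀ {δ f g} i i′ xs → (∀ {j} → j < length xs * 2 → g (i′ + j) ≡ f (i + j)) → Stored δ f i xs →
  Stored δ g i′ xs
Stored-shift i i′ [] _ _ = tt
Stored-shift {δ} {f} {g} i i′ ((p , w) ∷ xs) eq (e , e′ , sx) =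
  trans (cong (δ +_) (subst₂ (λ a b → g a ≡ f b) (+-identityʳ i′) (+-identityʳ i) (eq z<s))) e ,
  trans (subst₂ (λ a b → g a ≡ f b) (+-comm i′ 1) (+-comm i 1) (eq (s<s z<s))) e′ ,
  Stored-shift (2+ i) (2+ i′) xs (λ {j} lt → subst₂ (λ a b → g a ≡ f b) (two i′ j) (two i j) (eq
    (s<s (s<s lt)))) sx
  where
  two : ∀ i j → i + suc (suc j) ≡ 2+ (i + j)
  two i j = trans (+-suc i (suc j)) (cong suc (+-suc i j))

-- By monotonicity a raised target never repairs a failure. A counter changes only if the state
-- exceeded the old rank, kept in the slot that register 5 numbers, and does not exceed the new one;
-- it then grows by one.
update : Program
update = setup-cmp (reg 5) ⨾ ifLess (const 0) (reg 23)
  (setup-cmp (reg 10) ⨾ ifLess (reg 23) (const 1)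
    (12 := const 1 ⟨+⟩ arrE 13 (reg 19) ⨾ setArr 13 (reg 19) (reg 12) ⨾
     -- The two tests together single out equality. A state is entered just when its counter arrives
     -- at the threshold, hence never while it is already listed.
     ifLess (reg 12) (arrE 6 (reg 16)) skip (ifLess (arrE 6 (reg 16)) (reg 12) skip (push 19)))
    skip)
  skip

passBody : Program
passBody = 19 := (reg 16 ⟨*⟩ reg 3) ⟨+⟩ (reg 18 ⟨∸⟩ const 1) ⨾ 18 := arrE 4 (reg 19) ⨾
  -- The sum of the two truncated differences vanishes exactly at the raised state itself, which has
  -- been recounted from scratch.
  ifLess (const 0) ((reg 19 ⟨∸⟩ reg 10) ⟨+⟩ (reg 10 ⟨∸⟩ reg 19)) update skip

passRow : Program
passRow = 16 := inp (reg 13) ⨾ 18 := arrE 3 ((reg 16 ⟨*⟩ reg 3) ⟨+⟩ reg 17) ⨾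
  whileLess (const 0) (reg 18) passBody

-- Adds the failures caused at the other predecessors of state s (register 10, vertex in 11, component
-- in 17) by the change of its rank; the old rank is in slot S.
pass : Program
pass = 13 := arrE 11 (reg 11) ⨾ 14 := reg 13 ⟨+⟩ inp (reg 8 ⟨+⟩ reg 11) ⨾ For 13 (reg 14) passRow

sumTo : (ℕ → ℕ) → ℕ → ℕ
sumTo f zero    = 0
sumTo f (suc N) = f N + sumTo f N

sumTo-mono : ∀ {f g} N → (∀ {i} → i < N → f i ≤ g i) → sumTo f N ≤ sumTo g N
sumTo-mono zero _ = z≤n
sumTo-mono (suc N) le = +-mono-≤ (le ≤-refl) (sumTo-mono N (le ∘ m≤n⇒m≤1+n))

sumTo-drop : ∀ {f g c s} N → s < N → (∀ {i} → i ≢ s → g i ≤ f i) → c + g s ≤ f s → c + sumTo g N ≤ sumTo f N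
sumTo-drop {f} {g} {c} {s} (suc N) s<N le drop with s ≟ N
... | yes refl = begin
  c + (g s + sumTo g s) ≡⟨ +-assoc c (g s) _ ⟨
  c + g s + sumTo g s   ≤⟨ +-mono-≤ drop (sumTo-mono s λ i<s → le (<⇒≢ i<s)) ⟩
  f s + sumTo f s       ∎
  where open ≤-Reasoning
... | no s≢N = begin
  c + (g N + sumTo g N) ≡⟨ solveℕ 3 (λ a b d → a :+ (b :+ d) :≡ b :+ (a :+ d)) refl c (g N) (sumTo g N) ⟩
  g N + (c + sumTo g N) ≤⟨ +-mono-≤ (le (s≢N ∘ sym)) (sumTo-drop N (≤∧≢⇒< (s≤s⁻¹ s<N) s≢N) le drop) ⟩
  f N + sumTo f N       ∎
  where open ≤-Reasoning

sumL-zero : ∀ {f} xs → (∀ {x} → x ∈ xs → f x ≡ 0) → sumL f xs ≡ 0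
sumL-zero [] _ = refl
sumL-zero (x ∷ xs) eq = cong₂ _+_ (eq (here refl)) (sumL-zero xs (eq ∘ there))

mainBody : Program
mainBody = 10 := reg 9 ⟨∸⟩ const 1 ⨾ 9 := arrE 14 (reg 10) ⨾ 11 := arrE 7 (reg 10) ⨾
  17 := reg 10 ⟨∸⟩ (reg 11 ⟨*⟩ reg 3) ⨾
  20 := reg 10 ⟨*⟩ reg 6 ⨾ 21 := reg 5 ⟨*⟩ reg 6 ⨾ copy ⨾ bump ⨾ recount ⨾ pass

mainLoop : Program
mainLoop = whileLess (const 0) (reg 9) mainBody

-- The programs of the initialisation.

readSizes : Program
readSizes = 2 := inp (const 2) ⨾ 3 := const 1 ⨾ 13 := const 0 ⨾ 10 := const 0 ⨾
  For 10 (reg 2) (11 := inp (const 3 ⟨+⟩ reg 10) ⨾ 3 := reg 3 ⟨*⟩ reg 11 ⨾ 13 := reg 13 ⟨+⟩ reg 11) ⨾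
  5 := reg 0 ⟨*⟩ reg 3 ⨾ 6 := const 2 ⟨+⟩ (reg 2 ⟨*⟩ const 2) ⨾ 4 := (const 1 ⟨+⟩ reg 5) ⟨*⟩ reg 6 ⨾
  7 := (((const 3 ⟨+⟩ reg 2) ⟨+⟩ reg 0) ⟨+⟩ (reg 2 ⟨*⟩ reg 0)) ⟨+⟩ (reg 13 ⟨*⟩ reg 0)

succOffsets : Program
succOffsets = 13 := reg 7 ⟨+⟩ reg 0 ⨾ 10 := const 0 ⨾
  For 10 (reg 0) (setArr 10 (reg 10) (reg 13) ⨾ 11 := inp (reg 7 ⟨+⟩ reg 10) ⨾ 13 := reg 13 ⟨+⟩ reg 11 ⨾
    ifLess (const 0) (inp ((const 3 ⟨+⟩ reg 2) ⟨+⟩ reg 10)) (setArr 6 (reg 10) (reg 11)) (setArr 6 (reg 10)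
      (const 1)))

predOffsets : Program
predOffsets = 8 := reg 13 ⨾ 13 := reg 13 ⟨+⟩ reg 0 ⨾ 10 := const 0 ⨾
  For 10 (reg 0) (setArr 11 (reg 10) (reg 13) ⨾ 13 := reg 13 ⟨+⟩ inp (reg 8 ⟨+⟩ reg 10))

-- The machine has no division, so the vertex of each state number is tabulated by counting.
vertices : Program
vertices = 10 := const 0 ⨾ 11 := const 0 ⨾ 12 := const 0 ⨾
  For 10 (reg 5) (setArr 7 (reg 10) (reg 11) ⨾ incr 12 ⨾ ifLess (reg 12) (reg 3) skip (12 := const 0 ⨾ incr 11))

-- A second form of framing: the arrays written during the initialisation do not lie above one bound
-- and are therefore listed.
record EX {X : Set} (p : ℕ → Bool) (A A′ : ℕ → X) : Set where
  constructor exc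
  field same : ∀ b {_ : T (p b)} → A′ b ≡ A b
open EX public

ex-refl : ∀ {X p} {A : ℕ → X} → EX p A A
ex-refl = exc λ _ → refl

ex-trans : ∀ {X p q r} {A A′ A″ : ℕ → X} → (∀ b → T (r b) → T (p b) × T (q b)) → EX p A A′ → EX q A′ A″ →
  EX r A A″
ex-trans f (exc g) (exc h) = exc λ b {t} → trans (h b {proj₂ (f b t)}) (g b {proj₁ (f b t)})

ex-put : ∀ {p} {A A′ : ℕ → ℕ → ℕ} {a i x} → p a ≡ false → EX p A A′ →
  EX p A (λ b → if b ≡ᵇ a then A′ b [ i ↦ x ] else A′ b)
ex-put {p} {A} {A′} {a} {i} {x} eq (exc f) = exc λ b {t} → go b {t} (≢⇒≡ᵇ {b} {a} λ { refl → subst T eq t })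
  where
  go : ∀ b {t : T (p b)} → (b ≡ᵇ a) ≡ false → (if b ≡ᵇ a then A′ b [ i ↦ x ] else A′ b) ≡ A b
  go b {t} e rewrite e = f b {t}

classBody : Program
classBody =
  -- Register 42 becomes the cyclic successor of the current component. It serves twice: as the
  -- component of the next index, and as the next digit when the low part of the state number wraps.
  ifLess (const 1 ⟨+⟩ reg 41) (reg 38) (42 := const 1 ⟨+⟩ reg 41) (42 := const 0) ⨾
  11 := arrE 7 (reg 10) ⨾ 15 := inp (reg 39 ⟨+⟩ reg 11) ⨾ 16 := inp (reg 35 ⟨+⟩ ((reg 41 ⟨*⟩ reg 0) ⟨+⟩ reg 11))
    ⨾
  12 := (reg 10 ⟨*⟩ (const 2 ⟨+⟩ reg 2)) ⟨+⟩ (const 2 ⟨+⟩ reg 37) ⨾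
  ifLess (const 0) (reg 15) (setArr 1 (reg 12) (const 0)) (ifLess (const 0) (reg 16) (setArr 1 (reg 12)
    (const 1)) (setArr 1 (reg 12) (const 2))) ⨾
  ifLess (const 0) (reg 16) (16 := reg 42) (16 := reg 41) ⨾
  setArr 2 (reg 10) (arrE 2 (reg 10) ⟨+⟩ (reg 16 ⟨*⟩ reg 36)) ⨾
  incr 40 ⨾ ifLess (reg 40) (reg 36) skip (40 := const 0 ⨾ 41 := reg 42)

classStep : Program
classStep = 37 := reg 37 ⟨∸⟩ const 1 ⨾ 38 := inp (const 3 ⟨+⟩ reg 37) ⨾ 35 := reg 35 ⟨∸⟩ (reg 38 ⟨*⟩ reg 0) ⨾
  39 := ((const 3 ⟨+⟩ reg 2) ⟨+⟩ reg 0) ⟨+⟩ (reg 37 ⟨*⟩ reg 0) ⨾ 40 := const 0 ⨾ 41 := const 0 ⨾ 10 := const 0 ⨾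
  For 10 (reg 5) classBody ⨾ 36 := reg 38 ⟨*⟩ reg 36

-- Components are treated from the last to the first; registers 40 and 41 count through the states with
-- 41 the current component and 36 the product of the sizes of the later ones.
classes : Program
classes = 35 := reg 7 ⨾ 36 := const 1 ⨾ 37 := reg 2 ⨾ whileLess (const 0) (reg 37) classStep

stateBody : Program
stateBody = 12 := reg 10 ⟨*⟩ (const 2 ⟨+⟩ reg 2) ⨾ setArr 1 (reg 12) (const 2) ⨾
  setArr 1 (const 1 ⟨+⟩ reg 12) (const 1) ⨾
  15 := arrE 7 (reg 10) ⟨*⟩ reg 3 ⨾ 16 := reg 15 ⟨+⟩ arrE 2 (reg 10) ⨾
  -- The component of the state is put in front of the chain for its vertex and its next index.
  setArr 4 (reg 10) (arrE 3 (reg 16)) ⨾ setArr 3 (reg 16) (const 1 ⟨+⟩ (reg 10 ⟨∸⟩ reg 15)) ⨾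
  17 := const 2 ⟨+⟩ (reg 10 ⟨*⟩ reg 6) ⨾ 18 := const 0 ⨾ For 18 (reg 2) (store (reg 17) (reg 18) ⨾
    17 := const 2 ⟨+⟩ reg 17)

states : Program
states = 10 := const 0 ⨾ For 10 (reg 5) stateBody

countAll : Program
countAll = 9 := const 0 ⨾ 10 := const 0 ⨾ For 10 (reg 5) (11 := arrE 7 (reg 10) ⨾ recount)

base-snoc : ∀ a → base (suc a) ≡ base a ++ 2+ a ∷ []
base-snoc a = trans (cong (map 2+) (sym (Listₚ.upTo-∷ʳ a))) (Listₚ.map-++ 2+ (List.upTo a) (a ∷ []))

initWord : ℕ → Word
initWord k = (0 , 0) ∷ flat (base k)

length-flat-base : ∀ k → length (flat (base k)) ≡ k
length-flat-base k = trans (Listₚ.length-map (_, 0) (base k)) (length-base k)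

solve : Program
solve = readSizes ⨾ (succOffsets ⨾ predOffsets) ⨾ vertices ⨾ classes ⨾ states ⨾ countAll ⨾ mainLoop

-- The guard leads the empty game around the main program, whose invariants presuppose a vertex.
solver : Program
solver = 0 := inp (const 0) ⨾ ifLess (const 0) (reg 0) solve skip

range : ℕ → ℕ → List ℕ
range s zero    = []
range s (suc m) = s ∷ range (suc s) m

length-range : ∀ s m → length (range s m) ≡ m
length-range s zero    = refl
length-range s (suc m) = cong suc (length-range (suc s) m)

sumL-range : ∀ f s m → sumL f (range s m) + sumTo f s ≡ sumTo f (s + m)
sumL-range f s zero = cong (sumTo f) (sym (+-identityʳ s))
sumL-range f s (suc m) = begin
  f s + sumL f (range (suc s) m) + sumTo f s ≡⟨ solveℕ 3 (λ a b c → a :+ b :+ c :≡ b :+ (a :+ c)) refl (f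
    s) (sumL f (range (suc s) m)) (sumTo f s) ⟩
  sumL f (range (suc s) m) + sumTo f (suc s) ≡⟨ sumL-range f (suc s) m ⟩
  sumTo f (suc s + m)                        ≡⟨ cong (sumTo f) (sym (+-suc s m)) ⟩
  sumTo f (s + suc m)                        ∎
  where open ≡-Reasoning

sumTo-const : ∀ c N → sumTo (λ _ → c) N ≡ N * c
sumTo-const c zero    = refl
sumTo-const c (suc N) = cong (c +_) (sumTo-const c N)

sumTo-*ʳ : ∀ f c N → sumTo (λ i → f i * c) N ≡ sumTo f N * c
sumTo-*ʳ f c zero    = refl
sumTo-*ʳ f c (suc N) = trans (cong (f N * c +_) (sumTo-*ʳ f c N)) (sym (*-distribʳ-+ c (f N) (sumTo f N)))

module Verified (P : Setup) where
  open Setup P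
  open Logic input space W base₀ L 100≤W fits space≤W input≤W
  module Num = Numbering n
  module Succ = Successor n k

  -- Correctness of the comparison.

  module Comparison where

    suc-k≤W : suc k ≤ W
    suc-k≤W = ≤-trans (n≤1+n (suc k)) (≤-trans k≤L L≤W)

    module _ {cl : ℕ → ℕ} {X Y : Word} {σ₀ : St} {cb : ℕ} (cl≤2 : ∀ p → cl p ≤ 2) (g : Glob (var σ₀))
             (table : ∀ {p} → p < 2 + k → arr σ₀ 1 (cb + p) ≡ cl p) (cb≤ : cb + (2 + k) ≤ L) where

      -- While the letters read are equal and of class 2, the answer for the whole words is the
      -- answer for what remains of them; the last two arguments of `running` record this
      -- equivalence.
      data Inv : ℕ → St → Set where
        running : ∀ {v i j l δ xs ys} → KV 20 (var σ₀) v →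
          v 20 ≡ i → v 21 ≡ j → v 22 ≡ cb → v 23 ≡ 0 → v 24 ≡ l → v 27 ≡ δ + cb → δ ≤ 2 →
          Stored δ (rnk σ₀) i xs → Stored δ (rnk σ₀) j ys → l + length xs ≡ suc k → length ys ≡ length xs →
          All (λ a → proj₁ a < 2 + k) xs → i + length xs * 2 ≤ base₀ → j + length xs * 2 ≤ base₀ →
          (Above cl xs ys → Above cl X Y) → (Above cl X Y → Above cl xs ys) →
          Inv (length xs) (st v (rnk σ₀) (arr σ₀))
        stopped : ∀ {v φ} → KV 20 (var σ₀) v → v 24 ≡ suc k → Flag (v 23) (Above cl X Y) →
          Inv φ (st v (rnk σ₀) (arr σ₀))

      Result : St → Set
      Result σ = KV 20 (var σ₀) (var σ) × rnk σ ≡ rnk σ₀ × arr σ ≡ arr σ₀ × Flag (var σ 23) (Above cl X Y)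

      next : ℕ → St → Set
      next φ σ = ∃[ φ′ ] Inv φ′ σ × 1 + φ′ ≤ φ

      stop# : ∀ {v φ} → KV 20 (var σ₀) v → Flag (v 23) (Above cl X Y) →
        Run stop (st v (rnk σ₀) (arr σ₀)) 0 (next (suc φ))
      stop# κ fl = :=# (k# 1 +# v# 2 (trans (at κ 2) (g2 g)) [ suc-k≤W ]) (0 , stopped (kv-put κ) refl fl ,
        s≤s z≤n)

      body : ∀ {φ σ} → Inv φ σ → ∃[ x ] ∃[ y ] Ev σ (reg 24) x × Ev σ (const 1 ⟨+⟩ reg 2) y ×
             (x < y → ∃[ u ] Run cmpBody σ u λ σ′ → ∃[ φ′ ] Inv φ′ σ′ × suc u + φ′ ≤ φ) × (y ≤ x → Result σ)
      body (stopped {v} κ e fl) = suc k , suc k , v# 24 e , (k# 1 +# v# 2 (trans (at κ 2) (g2 g)) [ suc-k≤W ]) ,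
        (λ lt → contradiction lt (<-irrefl refl)) , λ _ → κ , refl , refl , fl
      body (running {v} {i} {j} {l} {δ} {[]} κ e₀ e₁ e₂ e₃ e₄ e₇ δ≤ sx sy len leny bx bi bj to from) =
        l , suc k , v# 24 e₄ , (k# 1 +# v# 2 (trans (at κ 2) (g2 g)) [ suc-k≤W ]) ,
        (λ lt → contradiction (subst (_< suc k) (trans (sym (+-identityʳ l)) len) lt) (<-irrefl refl)) ,
        λ _ → κ , refl , refl , subst (λ b → Flag b (Above cl X Y)) (sym e₃) (inj₂ (refl , λ ab →
          case from ab of λ ()))
      body (running {v} {i} {j} {l} {δ} {(p , w) ∷ xs} {[]} κ e₀ e₁ e₂ e₃ e₄ e₇ δ≤ sx sy len () bx bi bj to
        from)
      body (running {v} {i} {j} {l} {δ} {(p , w) ∷ xs} {(p′ , w′) ∷ ys} κ e₀ e₁ e₂ e₃ e₄ e₇ δ≤ (ep , ew ,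
        sx) (ep′ , ew′ , sy) len leny (p< ∷ bx) bi bj to from) =
        l , suc k , v# 24 e₄ , (k# 1 +# v# 2 (trans (at κ 2) (g2 g)) [ suc-k≤W ]) ,
        (λ _ → 0 , if# (m# (v# 21 e₁) j<) (m# (v# 20 e₀) i<)
          (λ lt → :=⨾ (k# 1) (stop# (kv-put κ) (inj₁ (refl , to (key> (key lt ep′ ep))))))
          (λ ge → if# (m# (v# 20 e₀) i<) (m# (v# 21 e₁) j<)
            (λ lt → stop# κ (inj₂ (e₃ , λ ab → case from ab of λ {
                 (key> gt) → <⇒≱ gt (<⇒≤ (key lt ep ep′))
               ; (reset _) → <-irrefl refl (key lt ep ep′)
               ; (weight> _ _) → <-irrefl refl (key lt ep ep′)
               ; (deeper _ _) → <-irrefl refl (key lt ep ep′) })))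
            (λ ge′ → agree (trans (sym ep) (trans (cong (δ +_) (≤-antisym ge ge′)) ep′))))) ,
        λ le → contradiction (≤-trans (≤-trans (m≤m+n (suc l) (length xs))
          (≤-reflexive (trans (sym (+-suc l (length xs))) len))) le) (<⇒≱ ≤-refl)
        where
        key : ∀ {a b c d} → a < b → δ + a ≡ c → δ + b ≡ d → c < d
        key lt refl refl = +-monoʳ-< δ lt
        i< : i < base₀
        i< = ≤-trans (m<m+n i z<s) bi
        j< : j < base₀
        j< = ≤-trans (m<m+n j z<s) bj
        i′< : suc i < base₀
        i′< = ≤-trans (subst (2+ i ≤_) (sym (trans (+-suc i _) (cong suc (+-suc i _)))) (s≤s (s≤s (m≤m+n i _))))
          bi
        j′< : suc j < base₀
        j′< = ≤-trans (subst (2+ j ≤_) (sym (trans (+-suc j _) (cong suc (+-suc j _)))) (s≤s (s≤s (m≤m+n j _))))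
          bj
        address : δ + cb + rnk σ₀ i ≡ cb + p
        address = trans (cong (_+ rnk σ₀ i) (+-comm δ cb)) (trans (+-assoc cb δ (rnk σ₀ i)) (cong (cb +_) ep))
        address<L : δ + cb + rnk σ₀ i < L
        address<L = subst (_< L) (sym address) (<-≤-trans (+-monoʳ-< cb p<) cb≤)
        class : arr σ₀ 1 (δ + cb + rnk σ₀ i) ≡ cl p
        class = trans (cong (arr σ₀ 1) address) (table p<)
        1+i : ∀ {σ} → var σ 20 ≡ i → Ev σ (const 1 ⟨+⟩ reg 20) (suc i)
        1+i e = k# 1 +# v# 20 e [ ≤-trans (<⇒≤ i′<) base₀≤W ]
        1+j : ∀ {σ} → var σ 21 ≡ j → Ev σ (const 1 ⟨+⟩ reg 21) (suc j)
        1+j e = k# 1 +# v# 21 e [ ≤-trans (<⇒≤ j′<) base₀≤W ]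
        agree : p ≡ p′ → Run _ (st v (rnk σ₀) (arr σ₀)) 0 (next (suc (length xs)))
        agree refl = :=⨾ (ev-≡ class (a# 1 (trans (at κ 4) (g4 g)) (v# 27 e₇ +# m# (v# 20 e₀) i< [ ≤-trans
          (<⇒≤ address<L) L≤W ]) address<L))
          (if# (k# 1) (v# 25 refl)
            (λ 1<c → let c≡2 = ≤-antisym (cl≤2 p) 1<c in
              if# (m# (1+j e₁) j′<) (m# (1+i e₀) i′<)
                (λ lt → :=⨾ (k# 1) (stop# (kv-put (kv-put κ)) (inj₁ (refl ,
                  to (weight> c≡2 (subst₂ _<_ ew′ ew lt))))))
                (λ ge → if# (m# (1+i e₀) i′<) (m# (1+j e₁) j′<)
                  (λ lt → let lt′ = subst₂ _<_ ew ew′ lt in stop# (kv-put κ) (inj₂ (e₃ , λ ab →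
                    case from ab of λ {
                      (key> gt) → <-irrefl refl gt
                    ; (reset c≡1) → contradiction (trans (sym c≡1) c≡2) λ ()
                    ; (weight> _ gt) → <-asym lt′ gt
                    ; (deeper _ _) → <-irrefl refl lt′ })))
                  (λ ge′ → step c≡2 (trans (sym ew) (trans (≤-antisym ge ge′) ew′)))))
            (λ c≤1 → :=⨾ (v# 25 refl) (stop# (kv-put (kv-put κ)) (decide (cl p) refl c≤1))))
          where
          decide : ∀ c → cl p ≡ c → c ≤ 1 → Flag c (Above cl X Y)
          decide 0 c≡0 _ = inj₂ (refl , λ ab → case from ab of λ {
              (key> gt) → <-irrefl refl gt
            ; (reset c≡1) → contradiction (trans (sym c≡1) c≡0) λ ()
            ; (weight> c≡2 _) → contradiction (trans (sym c≡2) c≡0) λ ()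
            ; (deeper c≡2 _) → contradiction (trans (sym c≡2) c≡0) λ () })
          decide 1 c≡1 _ = inj₁ (refl , to (reset c≡1))
          decide (suc (suc _)) _ (s≤s ())
          step : cl p ≡ 2 → w ≡ w′ → Run (20 := const 2 ⟨+⟩ reg 20 ⨾ 21 := const 2 ⟨+⟩ reg 21 ⨾
            27 := const 2 ⟨+⟩ reg 22 ⨾ incr 24)
            (st (v [ 25 ↦ cl p ]) (rnk σ₀) (arr σ₀)) 0 (next (suc (length xs)))
          step c≡2 refl = :=⨾ (k# 2 +# v# 20 e₀ [ ≤-trans i′< base₀≤W ]) (:=⨾ (k# 2 +# v# 21 e₁ [ ≤-trans j′<
            base₀≤W ])
            (:=⨾ (k# 2 +# v# 22 e₂ [ ≤-trans (≤-trans (+-monoˡ-≤ cb (m≤m+n 2 k))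
              (≤-trans (≤-reflexive (+-comm (2 + k) cb)) cb≤)) L≤W ])
            (:=# (k# 1 +# v# 24 e₄ [ ≤-trans (≤-trans (m≤m+n (suc l) (length xs))
              (≤-reflexive (trans (sym (+-suc l (length xs))) len))) suc-k≤W ])
            (length xs , running (kv-put (kv-put (kv-put (kv-put (kv-put κ))))) refl refl e₂ e₃ refl refl ≤-refl
              sx sy
               (trans (sym (+-suc l (length xs))) len) (suc-injective leny) bx
               (subst (_≤ base₀) (trans (+-suc i _) (cong suc (+-suc i _))) bi)
               (subst (_≤ base₀) (trans (+-suc j _) (cong suc (+-suc j _))) bj)
               (to ∘ deeper c≡2) (λ ab → case from ab of λ {
                   (key> gt) → contradiction gt (<-irrefl refl)
                 ; (reset c≡1) → contradiction (trans (sym c≡1) c≡2) λ ()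
                 ; (weight> _ gt) → contradiction gt (<-irrefl refl)
                 ; (deeper _ q) → q }) , ≤-refl))))

      cmp# : ∀ {i j} → var σ₀ 20 ≡ i → var σ₀ 21 ≡ j → var σ₀ 22 ≡ cb → Stored 0 (rnk σ₀) i X →
        Stored 0 (rnk σ₀) j Y →
             length X ≡ suc k → length Y ≡ suc k → All (λ a → proj₁ a < 2 + k) X → i + stride ≤ base₀ →
               j + stride ≤ base₀ →
             Run cmp σ₀ (suc k) Result
      cmp# {i} {j} e₀ e₁ e₂ sx sy lx ly bx bi bj = :=⨾ (k# 0) (:=⨾ (k# 0) (:=⨾ (v# 22 e₂)
        (weaken# (≤-reflexive lx) (while# {Q = Result} Inv body
          (running (kv-put (kv-put (kv-put kv-refl))) e₀ e₁ e₂ refl refl refl z≤n sx sy lx (trans ly (sym lx))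
            bx
            (subst (λ m → i + m * 2 ≤ base₀) (sym lx) bi) (subst (λ m → j + m * 2 ≤ base₀) (sym lx) bj) id
              id)))))

  -- Correctness of the increment.

  module Increment where
    open Num
    open Succ

    module _ {σ₀ : St} {i₀ w₀ : ℕ} {xs : Word} (tidy : Tidy n k ((0 , w₀) ∷ xs)) (g : Glob (var σ₀))
      (e₂₀ : var σ₀ 20 ≡ i₀)
             (room : i₀ + stride ≤ base₀) (stored : Stored 0 (rnk σ₀) i₀ ((0 , w₀) ∷ xs)) (clear : ∀ {a} →
               a < k → arr σ₀ 15 a ≡ 0) where

      X : Word
      X = (0 , w₀) ∷ xs

      tidy-parts : w₀ < n × Small xs × keys xs ↭ base k
      tidy-parts = Tidy-finite tidy

      small : Small X
      small = proj₁ tidy-parts ∷ proj₁ (proj₂ tidy-parts)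

      perm : keys xs ↭ base k
      perm = proj₂ (proj₂ tidy-parts)

      length-xs : length xs ≡ k
      length-xs = suc-injective (Tidy-length tidy)

      key<k : ∀ {a} → 2+ a ∈ keys xs → a < k
      key<k q with ∈ₚ.∈-map⁻ 2+ (↭ₚ.∈-resp-↭ perm q)
      ... | _ , a∈ , refl = ∈ₚ.∈-upTo⁻ a∈

      unique : Unique (keys xs)
      unique = Unique-resp-↭ (↭-sym perm) (Uniqueₚ.map⁺ (λ { refl → refl }) (Uniqueₚ.upTo⁺ k))

      Outside : (ℕ → ℕ) → Set
      Outside r = ∀ {j} → j < i₀ ⊎ i₀ + stride ≤ j → r j ≡ rnk σ₀ j

      Outside-put : ∀ {r j x} → i₀ ≤ j → j < i₀ + stride → Outside r → Outside (r [ j ↦ x ])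
      Outside-put {r} {j} {x} le lt o {l} (inj₁ l<) = trans (put-≢ r x (<⇒≢ (<-≤-trans l< le))) (o (inj₁ l<))
      Outside-put {r} {j} {x} le lt o {l} (inj₂ l≥) = trans (put-≢ r x (>⇒≢ (<-≤-trans lt l≥))) (o (inj₂ l≥))

      free : (ℕ → ℕ → ℕ) → List ℕ
      free A = availFrom (A 15) 0 k

      -- In `running`, `suf` is the part already passed and `m` is 0 or one more than its largest
      -- pair. In `done`, `x ∷ hd` is final and the marked pairs wait to be written. The summand `k`
      -- of the potential is a reserve for the only `seek`, after which the scan ends.
      data Inv : ℕ → St → Set where
        running : ∀ {v A l m} pre suf → KV 21 (var σ₀) v → KV 15 (arr σ₀) A → v 24 ≡ l → v 25 ≡ m → v 26 ≡ 0 →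
          pre ++ suf ≡ xs → length pre ≡ l → Last suf → keys suf ↭ free A → All (_< 2 + m) (keys suf) →
          (m ≡ 0 ⊎ (∃[ a ] m ≡ suc a × 2+ a ∈ keys suf)) → Inv (l + k) (st v (rnk σ₀) A)
        done : ∀ {v r A φ} x hd → KV 21 (var σ₀) v → KV 15 (arr σ₀) A → v 24 ≡ 0 → v 26 ≡ suc (length hd) →
          Stored 0 r i₀ (x ∷ hd) → Outside r → Result X (x ∷ hd ++ flat (free A)) →
            length hd + length (free A) ≡ k → Inv φ (st v r A)

      step : ∀ {φ σ} → Inv φ σ → 0 < var σ 24 → ∃[ u ] Run scan σ u λ σ′ → ∃[ φ′ ] Inv φ′ σ′ × suc u + φ′ ≤ φ
      step (done _ _ _ _ e _ _ _ _ _) lt = contradiction e (>⇒≢ lt)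
      step (running {v} {A} {l} {m} pre suf κ α e₂₄ e₂₅ e₂₆ split len last avail bound top) lt
        with List.initLast pre
      step (running {v} {A} {l} {m} .[] suf κ α e₂₄ e₂₅ e₂₆ split len last avail bound top) lt | List.[] =
        contradiction (trans e₂₄ (sym len)) (>⇒≢ lt)
      step (running {v} {A} {.(length (pre ++ (p , w) ∷ []))} {m} .(pre ++ (p , w) ∷ []) suf κ α e₂₄ e₂₅ e₂₆
        split refl last avail bound top) lt | pre List.∷ʳ′ (p , w)
        = go (proj₁ (proj₂ pieces)) (proj₁ (proj₂ (proj₂ pieces)))
        where
        l = length pre
        l≡ : length (pre ++ (p , w) ∷ []) ≡ suc l
        l≡ = trans (Listₚ.length-++ pre) (+-comm l 1)
        split′ : pre ++ (p , w) ∷ suf ≡ xs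
        split′ = trans (sym (Listₚ.++-assoc pre _ suf)) split
        c = i₀ + suc l * 2
        c≡ : 2+ i₀ + l * 2 ≡ c
        c≡ = sym (trans (+-suc i₀ _) (cong suc (+-suc i₀ _)))
        pieces : Stored 2 (rnk σ₀) (2+ i₀) pre × 2 + rnk σ₀ c ≡ p × rnk σ₀ (suc c) ≡ w × ⊤
        pieces with Stored-++ (2+ i₀) pre ((p , w) ∷ suf) (subst (Stored 2 (rnk σ₀) (2+ i₀)) (sym split′)
          (proj₂ (proj₂ stored)))
        ... | s , e , e′ , _ = s , subst (λ j → 2 + rnk σ₀ j ≡ p) c≡ e , subst (λ j → rnk σ₀ (suc j) ≡
          w) c≡ e′ , tt
        l+ : l + suc (length suf) ≡ k
        l+ = trans (sym (Listₚ.length-++ pre)) (trans (cong length split′) length-xs)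
        l<k : suc l ≤ k
        l<k = ≤-trans (≤-trans (m≤m+n (suc l) (length suf)) (≤-reflexive (sym (+-suc l (length suf)))))
          (≤-reflexive l+)
        c< : suc c < i₀ + stride
        c< = subst (_≤ i₀ + stride) (trans (+-suc i₀ _) (cong suc (+-suc i₀ _))) (+-monoʳ-≤ i₀
          (s≤s (s≤s (*-monoˡ-≤ 2 l<k))))
        i₀≤c : i₀ ≤ c
        i₀≤c = m≤m+n i₀ _
        smalls : Small pre × Small ((p , w) ∷ suf)
        smalls = Allₚ.++⁻ pre (subst Small (sym split′) (proj₁ (proj₂ tidy-parts)))
        w<n : w < n
        w<n with proj₂ smalls
        ... | lt ∷ _ = lt
        p∉ : All (p ≢_) (keys suf)
        p∉ with Unique-suffix pre (subst (Unique ∘ keys) (sym split′) unique)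
        ... | q ∷ _ = q
        p∈ : p ∈ keys xs
        p∈ = subst (λ ys → p ∈ keys ys) split′ (∈ₚ.∈-map⁺ proj₁ (∈ₚ.∈-++⁺ʳ pre (here refl)))
        κ-≤W : ∀ {j} → j < i₀ + stride → j ≤ W
        κ-≤W lt = ≤-trans (<⇒≤ lt) (≤-trans room base₀≤W)
        go : 2 + rnk σ₀ c ≡ p → rnk σ₀ (suc c) ≡ w → _
        go refl refl = choose (suc w <? n) (suc a <? m)
          where
          a = rnk σ₀ c
          a<k : a < k
          a<k = key<k p∈
          Goal : ℕ → Set
          Goal u = Run scan (st v (rnk σ₀) A) u λ σ′ → ∃[ φ′ ] Inv φ′ σ′ × suc u + φ′ ≤ length (pre ++ (p , w) ∷
            []) + k
          v₁ v₂ v₃ : ℕ → ℕ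
          v₁ = v [ 27 ↦ c ]
          v₂ = v₁ [ 28 ↦ a ]
          v₃ = v₂ [ 29 ↦ suc w ]
          κ₃ : KV 21 (var σ₀) v₃
          κ₃ = kv-put (kv-put (kv-put κ))
          b₄ : v 4 ≡ base₀
          b₄ = trans (at κ 4) (g4 g)
          sc : ∀ {v′ r A′} → v′ 27 ≡ c → Ev (st v′ r A′) (const 1 ⟨+⟩ reg 27) (suc c)
          sc e = k# 1 +# v# 27 e [ κ-≤W c< ]
          sc<b : suc c < base₀
          sc<b = <-≤-trans c< room
          l≤W : suc (suc l) ≤ W
          l≤W = ≤-trans (s≤s l<k) (≤-trans (≤-trans (n≤1+n _) k≤L) L≤W)
          start : ∀ {u} {Q : St → Set} {q} → Run q (st v₃ (rnk σ₀) A) u Q →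
                  Run (27 := reg 20 ⟨+⟩ (reg 24 ⟨*⟩ const 2) ⨾ 28 := mem (reg 27) ⨾
                    29 := const 1 ⟨+⟩ mem (const 1 ⟨+⟩ reg 27) ⨾ q) (st v (rnk σ₀) A) u Q
          start r = :=⨾ (v# 20 (trans (at κ 20) e₂₀) +# (v# 24 (trans e₂₄ l≡) *# k# 2 [ ≤-trans (m≤n+m _ i₀)
            (κ-≤W (<-trans (n<1+n c) c<)) ]) [ κ-≤W (<-trans (n<1+n c) c<) ])
            (:=⨾ (m# (v# 27 refl) (<-trans (n<1+n c) sc<b)) (:=⨾ (k# 1 +# m# (sc refl) sc<b [ ≤-trans w<n
              (≤-trans n≤S (≤-trans S≤L L≤W)) ]) r))
          finish : ∀ {v′ r A′ u} x hd → KV 21 (var σ₀) v′ → KV 15 (arr σ₀) A′ → v′ 24 ≡ length (pre ++ (p , w) ∷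
            []) → length hd ≡ suc l → Stored 0 r i₀ (x ∷ hd) → Outside r →
                   Result X (x ∷ hd ++ flat (free A′)) → length hd + length (free A′) ≡ k → suc u ≤
                     length (pre ++ (p , w) ∷ []) + k →
                   Run found (st v′ r A′) u λ σ′ → ∃[ φ′ ] Inv φ′ σ′ × suc u + φ′ ≤ length (pre ++ (p , w) ∷
                     []) + k
          finish {u = u} x hd κ′ α′ e len′ sto out res total le = :=⨾ (k# 1 +# v# 24 (trans e l≡) [ l≤W ]) (:=#
            (k# 0)
            (0 , done x hd (kv-put (kv-put κ′)) α′ refl (cong suc (sym len′)) sto out res total ,
              ≤-trans (≤-reflexive (+-identityʳ (suc u))) le))
          snoc-length : ∀ (b : Letter) → length (pre ++ b ∷ []) ≡ suc l
          snoc-length b = trans (Listₚ.length-++ pre) (+-comm l 1)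
          avail-length : ∀ {ks} → ks ↭ keys suf → length ks ≡ length suf
          avail-length e = trans (↭ₚ.↭-length e) (Listₚ.length-map proj₁ suf)
          store-prefix : ∀ {r p′ w′} → (∀ {j} → j < c → r j ≡ rnk σ₀ j) → 2 + r c ≡ p′ → r (suc c) ≡ w′ →
            Stored 0 r i₀ ((0 , w₀) ∷ pre ++ (p′ , w′) ∷ [])
          store-prefix {r} same e e′ = Stored-snoc i₀ (0 , w₀) pre
            (Stored-frame i₀ ((0 , w₀) ∷ pre) (λ le lt → same lt) (proj₁ stored , proj₁ (proj₂ stored) ,
              proj₁ pieces)) e e′
          result : ∀ {p′ w′ ks} → Inc ((p , w) ∷ suf) ((p′ , w′) ∷ flat ks) →
            Result X ((0 , w₀) ∷ (pre ++ (p′ , w′) ∷ []) ++ flat ks)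
          result {p′} {w′} {ks} i = subst (λ ys → Result X ((0 , w₀) ∷ ys)) (sym (Listₚ.++-assoc pre _
            (flat ks)))
            (within (subst (λ ys → Inc ((0 , w₀) ∷ ys) ((0 , w₀) ∷ pre ++ (p′ , w′) ∷ flat ks)) split′
              (Inc-prefix ((0 , w₀) ∷ pre) (proj₁ tidy-parts ∷ proj₁ smalls) i)))
          choose : Dec (suc w < n) → Dec (suc a < m) → ∃ Goal
          raise : ¬ suc w < n → suc a < m → (m ≡ 0 ⊎ (∃[ a ] m ≡ suc a × 2+ a ∈ keys suf)) → ∃ Goal
          shift : ¬ suc w < n → ¬ suc a < m → ∃ Goal
          choose (yes w+1<n) _ = 0 , start (if# (v# 29 refl) (v# 0 (trans (at κ 0) (g0 g)))
            (λ _ → rnk⨾ (sc refl) sc<b (v# 29 refl) (finish (0 , w₀) (pre ++ (p , suc w) ∷ []) κ₃ α e₂₄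
              (snoc-length _)
              (store-prefix {rnk σ₀ [ suc c ↦ suc w ]} (λ lt → put-≢ (rnk σ₀) _ (<⇒≢ (m≤n⇒m≤1+n lt)))
                (cong 2+ (put-≢ (rnk σ₀) {suc c} _ (<⇒≢ (n<1+n c)))) (put-≡ (rnk σ₀) (suc c) (suc w)))
              (Outside-put (m≤n⇒m≤1+n i₀≤c) c< λ _ → refl)
              (result (Inc-weight w+1<n last (↭-sym avail) (availFrom-ascending (A 15) 0 k)))
              (trans (cong₂ _+_ (snoc-length (p , suc w)) (avail-length (↭-sym avail))) (trans (sym (+-suc l _))
                l+))
              (subst (λ z → 1 ≤ z + k) (sym l≡) (s≤s z≤n))))
            (λ le → contradiction w+1<n (≤⇒≯ le)))
          choose (no ¬lt) (yes a+1<m) = raise ¬lt a+1<m top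
          choose (no ¬lt) (no ¬ltm) = shift ¬lt ¬ltm
          raise ¬lt a+1<m (inj₁ m≡0) = contradiction (subst (suc a <_) m≡0 a+1<m) λ ()
          raise ¬lt a+1<m (inj₂ (M , m≡ , M∈)) = k , start (if# (v# 29 refl) (v# 0 (trans (at κ 0) (g0 g)))
            (λ lt → contradiction lt ¬lt)
            (λ _ → if# (k# 1 +# v# 28 refl [ ≤-trans a<k k≤W ]) (v# 25 e₂₅)
              (λ _ → :=⨾ (k# 1 +# v# 28 refl [ ≤-trans a<k k≤W ]) (seek# ⨾# λ { (v′ , b , refl , κ′ , e , a<b ,
                b≤M , none , pos) → tail κ′ e a<b b≤M none pos }))
              (λ le → contradiction a+1<m (≤⇒≯ le))))
            where
            k≤W : k ≤ W
            k≤W = ≤-trans (m≤n+m k 2) (≤-trans k≤L L≤W)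
            f = A 15
            M<k : M < k
            M<k = key<k (subst (λ ys → 2+ M ∈ keys ys) split (subst (2+ M ∈_) (sym (Listₚ.map-++ proj₁ (pre ++
              (p , w) ∷ []) suf)) (∈ₚ.∈-++⁺ʳ _ M∈)))
            fM : 0 < f M
            fM with ∈availFrom f 0 k (↭ₚ.∈-resp-↭ avail M∈)
            ... | _ , refl , pos , _ = pos
            fa : f a ≡ 0
            fa with f a in eq
            ... | zero = refl
            ... | suc _ = contradiction refl (All.lookup p∉ (↭ₚ.∈-resp-↭ (↭-sym avail) (∈availFrom⁺ f 0 k z≤n
              a<k (subst (0 <_) (sym eq) z<s))))
            v₄ : ℕ → ℕ
            v₄ = v₃ [ 29 ↦ suc a ]
            Found : St → Set
            Found σ = ∃[ v′ ] ∃[ b ] st v′ (rnk σ₀) A ≡ σ × KV 29 v₂ v′ × v′ 29 ≡ b × a < b × b ≤ M ×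
              (∀ {c} → a < c → c < b → f c ≡ 0) × 0 < f b
            -- The largest marked pair `M` lies beyond `a`, so the search ends there at the latest.
            Seeking : ℕ → St → Set
            Seeking φ σ = ∃[ v′ ] ∃[ b ] st v′ (rnk σ₀) A ≡ σ × KV 29 v₂ v′ × v′ 29 ≡ b × a < b × b ≤ M ×
              (∀ {c} → a < c → c < b → f c ≡ 0) × φ ≡ M ∸ b
            seek# : Run seek (st v₄ (rnk σ₀) A) k Found
            seek# = weaken# (≤-trans (m∸n≤m M (suc a)) (<⇒≤ M<k)) (while# {Q = Found} Seeking body
              (v₄ , suc a , refl , kv-put (kv-put kv-refl) , refl , ≤-refl , s≤s⁻¹ (subst (suc a <_) m≡ a+1<m) ,
                (λ a<c c≤a → contradiction c≤a (≤⇒≯ a<c)) , refl))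
              where
              body : ∀ {φ σ} → Seeking φ σ → ∃[ x ] ∃[ y ] Ev σ (arrE 15 (reg 29)) x × Ev σ (const 1) y ×
                (x < y → ∃[ u ] Run (incr 29) σ u λ σ′ → ∃[ φ′ ] Seeking φ′ σ′ × suc u + φ′ ≤ φ) ×
                  (y ≤ x → Found σ)
              body (v′ , b , refl , κ′ , e , a<b , b≤M , none , refl) = f b , 1 ,
                a# 15 (trans (at κ′ 4) b₄) (v# 29 e) (<-≤-trans (≤-<-trans b≤M M<k) (≤-trans (m≤n+m k 2) k≤L)) ,
                  k# 1 ,
                (λ lt → let b<M = ≤∧≢⇒< b≤M (λ { refl → <⇒≱ fM (s≤s⁻¹ lt) }) in
                  0 , :=# (k# 1 +# v# 29 e [ ≤-trans b<M (≤-trans (<⇒≤ M<k) k≤W) ])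
                    (M ∸ suc b , (_ , suc b , refl , kv-put κ′ , refl , m≤n⇒m≤1+n a<b , b<M ,
                      (λ {c} a<c c≤b → case m≤n⇒m<n∨m≡n (s≤s⁻¹ c≤b) of λ { (inj₁ c<b) → none a<c c<b ;
                        (inj₂ refl) → n<1⇒n≡0 lt }) , refl) ,
                     ≤-reflexive (sym (+-∸-assoc 1 b<M)))) ,
                λ ge → v′ , b , refl , κ′ , e , a<b , b≤M , none , ge
            tail : ∀ {v′ b} → KV 29 v₂ v′ → v′ 29 ≡ b → a < b → b ≤ M → (∀ {c} → a < c → c < b → f c ≡ 0) →
              0 < f b →
              Run (store (reg 27) (reg 29) ⨾ store (const 1 ⟨+⟩ reg 27) (const 0) ⨾
                setArr 15 (reg 29) (const 0) ⨾ setArr 15 (reg 28) (const 1) ⨾ found)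
                (st v′ (rnk σ₀) A) k λ σ′ → ∃[ φ′ ] Inv φ′ σ′ × suc k + φ′ ≤ length (pre ++ (p , w) ∷ []) + k
            tail {v′} {b} κ′ e a<b b≤M none pos =
              rnk⨾ (v# 27 (at κ′ 27)) (<-trans (n<1+n c) sc<b) (v# 29 e) (rnk⨾ (sc (at κ′ 27)) sc<b (k# 0)
              (arr⨾ 15 (trans (at κ′ 4) b₄) (v# 29 e) (k<L (≤-<-trans b≤M M<k)) (k# 0)
                (arr⨾ 15 (trans (at κ′ 4) b₄) (v# 28 (at κ′ 28)) (k<L a<k) (k# 1)
              (finish (0 , w₀) (pre ++ (2+ b , 0) ∷ []) (kv-trans κ (kv-trans (kv-put (kv-put kv-refl))
                (kv-≤ κ′))) (ka-put (ka-put α)) (trans (at κ′ 24) e₂₄) (snoc-length _)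
                (store-prefix {r₂} (λ lt → trans (put-≢ r₁ _ (<⇒≢ (m≤n⇒m≤1+n lt))) (put-≢ (rnk σ₀) _ (<⇒≢ lt)))
                  (cong 2+ (trans (put-≢ r₁ {suc c} _ (<⇒≢ (n<1+n c))) (put-≡ (rnk σ₀) c b))) (put-≡ r₁ (suc c)
                    0))
                (Outside-put {r₁} (m≤n⇒m≤1+n i₀≤c) c< (Outside-put {rnk σ₀} i₀≤c (<-trans (n<1+n c) c<) λ _ →
                  refl))
                (result (Inc-key (≤-antisym w<n (≮⇒≥ ¬lt)) last perm₂ (availFrom-ascending f₂ 0 k) count))
                (trans (cong₂ _+_ (snoc-length (2+ b , 0)) (trans (suc-injective (↭ₚ.↭-length perm₂))
                  (Listₚ.length-map proj₁ suf))) (trans (sym (+-suc l _)) l+))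
                (subst (λ z → suc k ≤ z + k) (sym l≡) (s≤s (m≤n+m k l)))))))
              where
              k<L : ∀ {j} → j < k → j < L
              k<L lt = <-≤-trans lt (≤-trans (m≤n+m k 2) k≤L)
              r₁ r₂ f₁ f₂ : ℕ → ℕ
              r₁ = rnk σ₀ [ c ↦ b ]
              r₂ = r₁ [ suc c ↦ 0 ]
              f₁ = f [ b ↦ 0 ]
              f₂ = f₁ [ a ↦ 1 ]
              f₁a : f₁ a ≡ 0
              f₁a = trans (put-≢ f 0 (<⇒≢ a<b)) fa
              -- `f₁` marks the pairs common to both suffixes: `b` completes it to the old suffix,
              -- `a` to the new one.
              add-b : availFrom f 0 k ↭ 2+ b ∷ availFrom f₁ 0 k
              add-b = availFrom-add f₁ f b 0 k (put-≡ f b 0) pos (λ ≢ → put-≢ f 0 ≢) z≤n (≤-<-trans b≤M M<k)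
              add-a : availFrom f₂ 0 k ↭ p ∷ availFrom f₁ 0 k
              add-a = availFrom-add f₁ f₂ a 0 k f₁a (subst (0 <_) (sym (put-≡ f₁ a 1)) z<s) (λ ≢ →
                sym (put-≢ f₁ 1 ≢)) z≤n a<k
              perm₂ : 2+ b ∷ availFrom f₂ 0 k ↭ p ∷ keys suf
              perm₂ = tran (prep (2+ b) add-a) (tran (swap (2+ b) p ↭-refl)
                (prep p (tran (↭-sym add-b) (↭-sym avail))))
              between : ∀ {q} → q ∈ availFrom f₁ 0 k → q < 2+ b → q < p
              between q∈ lt with ∈availFrom f₁ 0 k q∈
              ... | d , refl , pos′ , _ with <-cmp d a
              ...   | tri< d<a _ _ = s<s (s<s d<a)
              ...   | tri≈ _ refl _ = contradiction f₁a (>⇒≢ pos′)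
              ...   | tri> _ _ a<d = contradiction (trans (put-≢ f 0 (<⇒≢ (s<s⁻¹ (s<s⁻¹ lt))))
                (none a<d (s<s⁻¹ (s<s⁻¹ lt)))) (>⇒≢ pos′)
              -- Both Lehmer digits are counted over the common pairs. None of these lies between
              -- `a` and `b`, so the only additional pair below `b` is `a` itself.
              count : less (2+ b) (availFrom f₂ 0 k) ≡ suc (less p (keys suf))
              count = begin
                less (2+ b) (availFrom f₂ 0 k) ≡⟨ less-↭ (2+ b) add-a ⟩
                less (2+ b) (p ∷ availFrom f₁ 0 k) ≡⟨ less-yes (availFrom f₁ 0 k) (s<s (s<s a<b)) ⟩
                suc (less (2+ b) (availFrom f₁ 0 k)) ≡⟨ cong suc (less-cong (availFrom f₁ 0 k)
                  (<⇒≤ (s<s (s<s a<b))) (All.tabulate between)) ⟨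
                suc (less p (availFrom f₁ 0 k)) ≡⟨ cong suc (less-no (availFrom f₁ 0 k) (<⇒≤ (s<s (s<s a<b)))) ⟨
                suc (less p (2+ b ∷ availFrom f₁ 0 k)) ≡⟨ cong suc (less-↭ p (tran avail add-b)) ⟨
                suc (less p (keys suf)) ∎
                where open ≡-Reasoning
          shift ¬lt ¬ltm = 0 , start (if# (v# 29 refl) (v# 0 (trans (at κ 0) (g0 g)))
            (λ lt → contradiction lt ¬lt)
            (λ _ → if# (k# 1 +# v# 28 refl [ ≤-trans a<k k≤W ]) (v# 25 e₂₅) (λ lt → contradiction lt ¬ltm)
              (λ _ → arr⨾ 15 b₄ (v# 28 refl) (<-≤-trans a<k (≤-trans (m≤n+m k 2) k≤L)) (k# 1)
                (:=⨾ (k# 1 +# v# 28 refl [ ≤-trans a<k k≤W ]) (:=# (v# 24 (trans e₂₄ l≡) ∸# k# 1)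
                  (l + k , running pre ((p , w) ∷ suf) (kv-put (kv-put κ₃)) (ka-put α) refl refl e₂₆ split′ refl
                    (Last-∷ (≤-antisym w<n (≮⇒≥ ¬lt)) last (All.tabulate smaller))
                    (tran (prep p avail) (↭-sym (availFrom-add (A 15) (A 15 [ a ↦ 1 ]) a 0 k fa
                      (subst (0 <_) (sym (put-≡ (A 15) a 1)) z<s) (λ ≢ → sym (put-≢ (A 15) 1 ≢)) z≤n a<k)))
                    (n<1+n p ∷ All.map (λ lt → <-≤-trans lt (s≤s (s≤s (≮⇒≥ ¬ltm)))) bound)
                    (inj₂ (a , refl , here refl)) ,
                   ≤-reflexive (cong (_+ k) (sym l≡))))))))
            where
            k≤W : k ≤ W
            k≤W = ≤-trans (m≤n+m k 2) (≤-trans k≤L L≤W)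
            fa : A 15 a ≡ 0
            fa with A 15 a in eq
            ... | zero = refl
            ... | suc _ = contradiction refl (All.lookup p∉ (↭ₚ.∈-resp-↭ (↭-sym avail) (∈availFrom⁺ (A 15) 0 k
              z≤n a<k (subst (0 <_) (sym eq) z<s))))
            smaller : ∀ {q} → q ∈ keys suf → q < p
            smaller q∈ = ≤∧≢⇒< (s≤s⁻¹ (<-≤-trans (All.lookup bound q∈) (s≤s (s≤s (≮⇒≥ ¬ltm))))) (λ { refl →
              All.lookup p∉ q∈ refl })

      k≤W : k ≤ W
      k≤W = ≤-trans (m≤n+m k 2) (≤-trans k≤L L≤W)

      k<L : ∀ {j} → j < k → j < L
      k<L lt = <-≤-trans lt (≤-trans (m≤n+m k 2) k≤L)

      data Ready : St → Set where
        ready : ∀ {v r A} x hd → KV 21 (var σ₀) v → KV 15 (arr σ₀) A → v 26 ≡ suc (length hd) →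
          Stored 0 r i₀ (x ∷ hd) → Outside r → Result X (x ∷ hd ++ flat (free A)) →
            length hd + length (free A) ≡ k → Ready (st v r A)

      Scanned : St → Set
      Scanned σ = ∃[ φ ] Inv φ σ × var σ 24 ≡ 0

      scan# : ∀ {φ σ} → Inv φ σ → Run (whileLess (const 0) (reg 24) scan) σ φ Scanned
      scan# = while# {Q = Scanned} Inv λ {φ} {σ} inv → 0 , var σ 24 , k# 0 , v# 24 refl , step inv , λ le → φ ,
        inv , n≤0⇒n≡0 le

      second< : suc i₀ < i₀ + stride
      second< = subst (_≤ i₀ + stride) (trans (+-suc i₀ 1) (cong suc (+-comm i₀ 1))) (+-monoʳ-≤ i₀ (m≤m+n 2 (k *
        2)))

      first< : i₀ < i₀ + stride
      first< = <-trans (n<1+n i₀) second<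

      slot-≤W : ∀ {j} → j < i₀ + stride → j ≤ W
      slot-≤W lt = ≤-trans (<⇒≤ lt) (≤-trans room base₀≤W)

      head# : ∀ {σ} → Scanned σ → Run (ifLess (reg 26) (const 1) raiseHead skip) σ 0 Ready
      head# (_ , done x hd κ α _ e₂₆ sto out res len , _) =
        if# (v# 26 e₂₆) (k# 1) (λ { (s≤s ()) }) (λ _ → skip# (ready x hd κ α e₂₆ sto out res len))
      -- The scan has passed every letter: the whole tail is a last arrangement, all pairs are
      -- marked, and the carry reaches the head.
      head# (_ , running {v} {A} [] suf κ α e₂₄ e₂₅ e₂₆ refl len last avail bound top , _) =
        if# (v# 26 e₂₆) (k# 1)
          (λ _ → :=⨾ (k# 1 +# m# (second e₂₀′) (<-≤-trans second< room) [ ≤-trans w< n≤W ])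
            (if# (v# 29 refl) (v# 0 (trans (at κ 0) (g0 g)))
              (λ lt → rnk⨾ (second e₂₀′) (<-≤-trans second< room) (v# 29 refl) (:=# (k# 1)
                (ready {r = r₁} (0 , suc w₀) [] (kv-put (kv-put κ)) α refl
                  (trans (put-≢ (rnk σ₀) {suc i₀} _ (<⇒≢ (n<1+n i₀))) (proj₁ stored) ,
                    trans (put-≡ (rnk σ₀) (suc i₀) (suc (rnk σ₀ (suc i₀)))) (cong suc w≡) , tt)
                  (Outside-put {rnk σ₀} (n≤1+n i₀) second< λ _ → refl)
                  (within (Inc-weight (subst (λ u → suc u < n) w≡ lt) last (↭-sym avail) (availFrom-ascending
                    (A 15) 0 k)))
                  (trans (↭ₚ.↭-length (↭-sym avail)) (trans (Listₚ.length-map proj₁ xs) length-xs)))))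
              (λ le → rnk⨾ (v# 20 e₂₀′) (<-≤-trans first< room) (k# 1) (rnk⨾ (second e₂₀′) (<-≤-trans second<
                room) (k# 0) (:=# (k# 1)
                (ready {r = r₃} (1 , 0) [] (kv-put (kv-put κ)) α refl
                  (trans (put-≢ r₂ {suc i₀} 0 (<⇒≢ (n<1+n i₀))) (put-≡ (rnk σ₀) i₀ 1) , put-≡ r₂ (suc i₀) 0 ,
                    tt)
                  (Outside-put {r₂} (n≤1+n i₀) second< (Outside-put {rnk σ₀} ≤-refl first< λ _ → refl))
                  (subst (λ ks → Result X ((1 , 0) ∷ flat ks)) (sym all-free)
                    (Result-∞ (≤-antisym (proj₁ tidy-parts) (subst (λ u → n ≤ suc u) w≡ le)) length-xs last))
                  (trans (cong length all-free) (length-base k))))))))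
          (λ le → contradiction le λ ())
        where
        r₁ r₂ r₃ : ℕ → ℕ
        r₁ = rnk σ₀ [ suc i₀ ↦ suc (rnk σ₀ (suc i₀)) ]
        r₂ = rnk σ₀ [ i₀ ↦ 1 ]
        r₃ = r₂ [ suc i₀ ↦ 0 ]
        n≤W : n ≤ W
        n≤W = ≤-trans n≤S (≤-trans S≤L L≤W)
        w≡ : rnk σ₀ (suc i₀) ≡ w₀
        w≡ = proj₁ (proj₂ stored)
        w< : suc (rnk σ₀ (suc i₀)) ≤ n
        w< = subst (_< n) (sym w≡) (proj₁ tidy-parts)
        e₂₀′ : v 20 ≡ i₀
        e₂₀′ = trans (at κ 20) e₂₀
        second : ∀ {v′ r A′} → v′ 20 ≡ i₀ → Ev (st v′ r A′) (const 1 ⟨+⟩ reg 20) (suc i₀)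
        second e = k# 1 +# v# 20 e [ slot-≤W second< ]
        all-free : free A ≡ base k
        all-free = trans (availFrom-all (A 15) 0 k pos) (sym (Listₚ.map-upTo 2+ k))
          where
          pos : ∀ {a} → a < k → 0 < A 15 a
          pos a<k with ∈availFrom (A 15) 0 k (↭ₚ.∈-resp-↭ (tran (↭-sym perm) avail)
            (∈ₚ.∈-map⁺ 2+ (∈ₚ.∈-upTo⁺ a<k)))
          ... | _ , refl , p , _ = p
      head# (_ , running (_ ∷ _) suf κ α e₂₄ e₂₅ e₂₆ split refl last avail bound top , e) =
        contradiction (trans (sym e₂₄) e) λ ()

      data Filling : ℕ → St → Set where
        filling : ∀ {v r A a} x hd m → KV 21 (var σ₀) v → KV 15 (arr σ₀) A → v 30 ≡ i₀ + suc (length hd) * 2 →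
          v 31 ≡ a →
          Stored 0 r i₀ (x ∷ hd) → Outside r → Result X (x ∷ hd ++ flat (availFrom (A 15) a m)) →
          length hd + length (availFrom (A 15) a m) ≡ k → a + m ≡ k → (∀ {b} → b < a → A 15 b ≡ 0) →
            Filling a (st v r A)

      counter : ∀ {a σ} → Filling a σ → var σ 31 ≡ a
      counter (filling _ _ _ _ _ _ e _ _ _ _ _ _) = e

      limit : ∀ {a σ} → Filling a σ → Ev σ (reg 2) k
      limit (filling _ _ _ κ _ _ _ _ _ _ _ _ _) = v# 2 (trans (at κ 2) (g2 g))

      availFrom-yes : ∀ f lo m → 0 < f lo → availFrom f lo (suc m) ≡ 2+ lo ∷ availFrom f (suc lo) m
      availFrom-yes f lo m pos with f lo | pos
      ... | suc _ | _ = refl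

      availFrom-no : ∀ f lo m → f lo ≡ 0 → availFrom f lo (suc m) ≡ availFrom f (suc lo) m
      availFrom-no f lo m eq rewrite eq = refl

      fill-body : ∀ {a σ} → a < k → Filling a σ → Run fill σ 0 λ σ′ → var σ′ 31 ≡ a ×
        Filling (suc a) (σ′ ⟦ 31 ≔ suc a ⟧)
      fill-body a<k (filling {a = a} x hd zero _ _ _ _ _ _ _ _ eq _) =
        contradiction (trans (sym (+-identityʳ a)) eq) (<⇒≢ a<k)
      fill-body a<k (filling {v} {r} {A} {a} x hd (suc m) κ α e₃₀ e₃₁ sto out res len eq clr) =
        if# (k# 0) (a# 15 (trans (at κ 4) (g4 g)) (v# 31 e₃₁) (k<L a<k))
          (λ pos → rnk⨾ (v# 30 e₃₀) (<-trans (n<1+n d) (d< pos)) (v# 31 e₃₁) (rnk⨾ (k# 1 +# v# 30 e₃₀ [ ≤-trans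
            (<⇒≤ (d< pos)) base₀≤W ]) (d< pos) (k# 0)
            (arr⨾ 15 (trans (at κ 4) (g4 g)) (v# 31 e₃₁) (k<L a<k) (k# 0) (:=# (k# 2 +# v# 30 e₃₀ [ ≤-trans
              (d< pos) base₀≤W ])
              (e₃₁ , filling {r = r₂} x (hd ++ (2+ a , 0) ∷ []) m (kv-put (kv-put κ)) (ka-put α) (snoc-end
                pos) refl
                (Stored-snoc i₀ x hd (Stored-frame i₀ (x ∷ hd) (λ le lt →
                  trans (put-≢ r₁ 0 (<⇒≢ (m≤n⇒m≤1+n lt))) (put-≢ r a (<⇒≢ lt))) sto)
                  (cong 2+ (trans (put-≢ r₁ {suc d} 0 (<⇒≢ (n<1+n d))) (put-≡ r d a))) (put-≡ r₁ (suc d) 0))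
                (Outside-put {r₁} (m≤n⇒m≤1+n i₀≤d) (d<′ pos) (Outside-put {r} i₀≤d (<-trans (n<1+n d) (d<′ pos))
                  out))
                (subst (Result X) (cong (x ∷_) (trans (cong (λ ks →
                  hd ++ flat ks) (trans (availFrom-yes (A 15) a m pos) (cong (2+ a ∷_) (sym rest))))
                  (sym (Listₚ.++-assoc hd _ _)))) res)
                (trans (cong₂ _+_ (trans (Listₚ.length-++ hd) (+-comm (length hd) 1)) (cong length rest))
                  (len-eq pos))
                (trans (sym (+-suc a m)) eq)
                (λ {b} lt → case m≤n⇒m<n∨m≡n (s≤s⁻¹ lt) of λ { (inj₁ b<a) →
                  trans (put-≢ (A 15) 0 (<⇒≢ b<a)) (clr b<a) ; (inj₂ refl) → put-≡ (A 15) a 0 }))))))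
          (λ le → let f≡0 = n≤0⇒n≡0 le in
            skip# (e₃₁ , filling {r = r} x hd m (kv-put κ) α e₃₀ refl sto out
              (subst (λ ks → Result X (x ∷ hd ++ flat ks)) (availFrom-no (A 15) a m f≡0) res)
              (subst (λ ks → length hd + length ks ≡ k) (availFrom-no (A 15) a m f≡0) len)
              (trans (sym (+-suc a m)) eq)
              (λ {b} lt → case m≤n⇒m<n∨m≡n (s≤s⁻¹ lt) of λ { (inj₁ b<a) → clr b<a ; (inj₂ refl) → f≡0 })))
        where
        d = i₀ + suc (length hd) * 2
        i₀≤d : i₀ ≤ d
        i₀≤d = m≤m+n i₀ _
        r₁ r₂ : ℕ → ℕ
        r₁ = r [ d ↦ a ]
        r₂ = r₁ [ suc d ↦ 0 ]
        rest : availFrom (A 15 [ a ↦ 0 ]) (suc a) m ≡ availFrom (A 15) (suc a) m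
        rest = availFrom-cong _ _ (suc a) m λ le → put-≢ (A 15) 0 (>⇒≢ le)
        len-eq : 0 < A 15 a → suc (length hd) + length (availFrom (A 15) (suc a) m) ≡ k
        len-eq pos = trans (sym (+-suc (length hd) _)) (trans (cong (λ ks → length hd + length ks)
          (sym (availFrom-yes (A 15) a m pos))) len)
        d<′ : 0 < A 15 a → suc d < i₀ + stride
        d<′ pos = subst (_≤ i₀ + stride) (trans (+-suc i₀ _) (cong suc (+-suc i₀ _)))
          (+-monoʳ-≤ i₀ (s≤s (s≤s (*-monoˡ-≤ 2 (≤-trans (m≤m+n (suc (length hd)) _)
            (≤-reflexive (len-eq pos)))))))
        d< : 0 < A 15 a → suc d < base₀
        d< pos = <-≤-trans (d<′ pos) room
        snoc-end : 0 < A 15 a → 2 + d ≡ i₀ + suc (length (hd ++ (2+ a , 0) ∷ [])) * 2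
        snoc-end pos = trans (sym (trans (+-suc i₀ _) (cong suc (+-suc i₀ _)))) (cong (λ z →
          i₀ + suc z * 2) (sym (trans (Listₚ.length-++ hd) (+-comm (length hd) 1))))

      Bumped : St → Set
      Bumped σ = ∃[ Y ] Result X Y × Stored 0 (rnk σ) i₀ Y × Outside (rnk σ) × KV 21 (var σ₀) (var σ) ×
        KV 15 (arr σ₀) (arr σ) × (∀ {a} → a < k → arr σ 15 a ≡ 0)

      bumped : ∀ {σ} → Filling k σ → Bumped σ
      bumped (filling {A = A} x hd m κ α _ _ sto out res len eq clr) =
        x ∷ hd , subst (Result X) (cong (x ∷_) (Listₚ.++-identityʳ hd))
          (subst (λ j → Result X (x ∷ hd ++ flat (availFrom (A 15) k j))) (+-cancelˡ-≡ k m 0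
            (trans eq (sym (+-identityʳ k)))) res) ,
        sto , out , κ , α , clr

      bump# : Run bump σ₀ (2 * suc k) Bumped
      bump# = :=⨾ (v# 2 (g2 g)) (:=⨾ (k# 0) (:=⨾ (k# 0)
        (weaken# (≤-trans (+-monoʳ-≤ k (≤-trans (n≤1+n k) (m≤m+n (suc k) 0))) (n≤1+n _)) (scan# start) ⨾#
          λ scanned →
        weaken# z≤n (head# scanned) ⨾# after)))
        where
        start : Inv (k + k) (st (((var σ₀ [ 24 ↦ k ]) [ 25 ↦ 0 ]) [ 26 ↦ 0 ]) (rnk σ₀) (arr σ₀))
        start = running xs [] (kv-put (kv-put (kv-put kv-refl))) kv-refl refl refl refl (Listₚ.++-identityʳ
          xs) length-xs Last-[]
          (subst ([] ↭_) (sym (availFrom-none (arr σ₀ 15) 0 k clear)) ↭-refl) [] (inj₁ refl)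
        after : ∀ {σ} → Ready σ → Run (30 := reg 20 ⟨+⟩ (reg 26 ⟨*⟩ const 2) ⨾ 31 := const 0 ⨾
          For 31 (reg 2) fill) σ (2 * suc k) Bumped
        after (ready x hd κ α e₂₆ sto out res len) =
          :=⨾ (v# 20 (trans (at κ 20) e₂₀) +# (v# 26 e₂₆ *# k# 2 [ ≤-trans (m≤n+m _ i₀) le ]) [ le ])
            (:=⨾ (k# 0)
          (weaken# (≤-trans (≤-reflexive (*-identityʳ k)) (≤-trans (n≤1+n k) (m≤m+n (suc k) _)))
            (for# {Q = Bumped} Filling counter limit k≤W fill-body z≤n (filling x hd k (kv-put (kv-put κ)) α
              refl refl sto out res len refl λ ()) bumped)))
          where
          le : i₀ + suc (length hd) * 2 ≤ W
          le = ≤-trans (+-monoʳ-≤ i₀ (s≤s (s≤s (*-monoˡ-≤ 2 (≤-trans (m≤m+n (length hd) _)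
            (≤-reflexive len)))))) (≤-trans room base₀≤W)

  -- States, failure counts and predecessor sets.

  module Algorithm where
    open Succ using (rank; total)

    instance
      Bn≢0 : NonZero Bn
      Bn≢0 = >-nonZero Bn>0

    vt : ℕ → ℕ
    vt s = s / Bn

    xt : ℕ → ℕ
    xt s = s % Bn

    vt-xt : ∀ s → vt s * Bn + xt s ≡ s
    vt-xt s = trans (+-comm _ (xt s)) (sym (m≡m%n+[m/n]*n s Bn))

    xt< : ∀ s → xt s < Bn
    xt< s = m%n<n s Bn

    vt-≡ : ∀ {v x} → x < Bn → vt (v * Bn + x) ≡ v
    vt-≡ {v} {x} x< = proj₁ (*+-unique Bn (xt< (v * Bn + x)) x< (vt-xt (v * Bn + x)))

    xt-≡ : ∀ {v x} → x < Bn → xt (v * Bn + x) ≡ x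
    xt-≡ {v} {x} x< = proj₂ (*+-unique Bn {vt (v * Bn + x)} {v} (xt< (v * Bn + x)) x< (vt-xt (v * Bn + x)))

    vt< : ∀ {s} → s < S → vt s < n
    vt< {s} s<S = m<n*o⇒m/o<n s<S

    target : ℕ → ℕ → ℕ
    target s w = w * Bn + nx s

    target< : ∀ {s w} → s < S → w < n → target s w < S
    target< s<S w<n = state< w<n (nx< s<S)

    fails : (ℕ → Word) → ℕ → ℕ → ℕ
    fails r s w = failBit (above? (cl s) (r s) (r (target s w)))

    failures : (ℕ → Word) → ℕ → ℕ
    failures r s = sumL (fails r s) (sl (vt s))

    failures≤ : ∀ r s → failures r s ≤ length (sl (vt s))
    failures≤ r s = sumL-≤length (sl (vt s)) λ w → failBit≤1 (above? (cl s) (r s) (r (target s w)))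

    Bad : (ℕ → Word) → ℕ → Set
    Bad r s = thr (vt s) ≤ failures r s

    -- Descending, because the chains are built by putting states in ascending order at the front.
    pre : ℕ → ℕ → ℕ → List ℕ
    pre v c zero    = []
    pre v c (suc N) = if nx (v * Bn + N) ≡ᵇ c then N ∷ pre v c N else pre v c N

    ∈pre : ∀ {v c x} N → x ∈ pre v c N → x < N × nx (v * Bn + x) ≡ c
    ∈pre {v} {c} (suc N) x∈ with nx (v * Bn + N) ≡ᵇ c in eq
    ∈pre {v} {c} (suc N) (here refl) | true = ≤-refl , ≡ᵇ⇒≡ _ c (subst T (sym eq) tt)
    ∈pre {v} {c} (suc N) (there x∈) | true = let a , b = ∈pre N x∈ in m≤n⇒m≤1+n a , b
    ∈pre {v} {c} (suc N) x∈ | false = let a , b = ∈pre N x∈ in m≤n⇒m≤1+n a , b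

    pre∈ : ∀ {v c x} N → x < N → nx (v * Bn + x) ≡ c → x ∈ pre v c N
    pre∈ {v} {c} (suc N) x< e with m≤n⇒m<n∨m≡n (s≤s⁻¹ x<)
    pre∈ {v} {c} (suc N) x< refl | inj₂ refl rewrite ≡ᵇ-refl (nx (v * Bn + N)) = here refl
    ... | inj₁ x<N with nx (v * Bn + N) ≡ᵇ c
    ...   | true  = there (pre∈ N x<N e)
    ...   | false = pre∈ N x<N e

    pre-unique : ∀ v c N → Unique (pre v c N)
    pre-unique v c zero = []
    pre-unique v c (suc N) with nx (v * Bn + N) ≡ᵇ c
    ... | true  = All.tabulate (λ x∈ → >⇒≢ (proj₁ (∈pre N x∈))) ∷ pre-unique v c N
    ... | false = pre-unique v c N

    -- Arrays 13 and 14 hold the numbers of failing successors and the links of the worklist.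
    record Tables (A : ℕ → ℕ → ℕ) : Set where
      constructor tables
      field
        class#  : ∀ {s p} → s < S → p < 2 + k → A 1 (s * (2 + k) + p) ≡ cl s p
        next#   : ∀ {s} → s < S → A 2 s ≡ nx s
        chain#  : ∀ {v c} → v < n → c < Bn → Chain (λ x → A 4 (v * Bn + x)) (A 3 (v * Bn + c)) (pre v c Bn)
        thr#    : ∀ {v} → v < n → A 6 v ≡ thr v
        vertex# : ∀ {s} → s < S → A 7 s ≡ vt s
        so#     : ∀ {v} → v < n → A 10 v ≡ so v
        po#     : ∀ {v} → v < n → A 11 v ≡ po v
        clear#  : ∀ {a} → a < k → A 15 a ≡ 0
    open Tables public

    Tables-kv : ∀ {A A′} → KV 13 A A′ → (∀ {a} → a < k → A′ 15 a ≡ 0) → Tables A → Tables A′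
    Tables-kv {A} {A′} α clr t = tables
      (λ {s} {p} a b → trans (cong (λ f → f (s * (2 + k) + p)) (at α 1)) (class# t a b))
      (λ {s} a → trans (cong (λ f → f s) (at α 2)) (next# t a))
      (λ {v} {c} a b → subst₂ (λ f h → Chain (λ x → f (v * Bn + x)) h (pre v c Bn)) (sym (at α 4)) (cong (λ f →
        f (v * Bn + c)) (sym (at α 3))) (chain# t a b))
      (λ {v} a → trans (cong (λ f → f v) (at α 6)) (thr# t a))
      (λ {v} a → trans (cong (λ f → f v) (at α 7)) (vertex# t a))
      (λ {v} a → trans (cong (λ f → f v) (at α 10)) (so# t a))
      (λ {v} a → trans (cong (λ f → f v) (at α 11)) (po# t a))
      clr

    Ranks : (ℕ → ℕ) → (ℕ → Word) → Set
    Ranks f r = ∀ {s} → s < S → Stored 0 f (s * stride) (r s)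

    Good-words : (ℕ → Word) → Set
    Good-words r = ∀ {s} → s < S → Tidy n k (r s)

    Tidy-keys : ∀ {x} → Tidy n k x → All (λ a → proj₁ a < 2 + k) x
    Tidy-keys t = Allₚ.map⁻ (go t)
      where
      in-base : All (_< 2 + k) (base k)
      in-base = Allₚ.map⁺ (All.tabulate λ i∈ → s<s (s<s (∈ₚ.∈-upTo⁻ i∈)))
      go : ∀ {x} → Tidy n k x → All (_< 2 + k) (keys x)
      go (infinite eq) = s<s z<s ∷ subst (All (_< 2 + k)) (sym eq) in-base
      go (finite _ _ perm) = z<s ∷ ↭ₚ.All-resp-↭ (↭-sym perm) in-base

    -- Each element carries its own cost. A uniform bound would charge `|B|` for the row of every
    -- predecessor in every step, and the amortisation over the components would be lost.
    each# : ∀ {x e p σ E} {Q : St → Set} (U : ℕ → ℕ) (Inv : List ℕ → St → Set) →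
      (∀ {zs σ} → Inv zs σ → var σ x + length zs ≡ E) → (∀ {zs σ} → Inv zs σ → Ev σ e E) → E ≤ W →
      (∀ {z zs σ} → Inv (z ∷ zs) σ → Run p σ (U z) λ σ′ → var σ′ x + suc (length zs) ≡ E ×
        Inv zs (σ′ ⟦ x ≔ suc (var σ′ x) ⟧)) →
      ∀ {zs} → Inv zs σ → (∀ {σ′} → Inv [] σ′ → Q σ′) → Run (For x e p) σ (sumL (suc ∘ U) zs) Q
    each# {x} {e} {p} {σ} {E} {Q} U Inv pos limit E≤W body {zs} inv end = while# {Q = Q} Inv′ step (zs , inv ,
      refl)
      where
      Inv′ : ℕ → St → Set
      Inv′ φ σ = ∃[ zs ] Inv zs σ × φ ≡ sumL (suc ∘ U) zs
      step : ∀ {φ σ} → Inv′ φ σ → ∃[ y ] ∃[ z ] Ev σ (reg x) y × Ev σ e z ×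
        (y < z → ∃[ u ] Run (p ⨾ incr x) σ u λ σ′ → ∃[ φ′ ] Inv′ φ′ σ′ × suc u + φ′ ≤ φ) × (z ≤ y → Q σ)
      step {φ} {σ} ([] , inv , refl) = var σ x , E , v# x refl , limit inv ,
        (λ lt → contradiction (trans (sym (+-identityʳ _)) (pos inv)) (<⇒≢ lt)) , λ _ → end inv
      step {φ} {σ} (z ∷ zs , inv , refl) = var σ x , E , v# x refl , limit inv ,
        (λ _ → U z , (body inv ⨾# λ {σ′} (eq , inv′) →
          :=# (k# 1 +# v# x refl [ ≤-trans (≤-trans (m≤m+n _ (length zs)) (≤-reflexive (trans (sym (+-suc _ _))
            eq))) E≤W ])
          (_ , (zs , inv′ , refl) , ≤-refl))) ,
        λ le → contradiction (≤-trans (m<m+n (var σ x) z<s) (≤-reflexive (pos inv))) (≤⇒≯ le)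

  -- Copying, comparing and recounting.

  module Macros where
    open Algorithm public
    open Comparison using (cmp#)

    length*2 : ∀ {x} → Tidy n k x → length x * 2 ≡ stride
    length*2 t = cong (_* 2) (Tidy-length t)

    At-≤W : ∀ {i x} → At input i x → i ≤ W
    At-≤W q = ≤-trans (<⇒≤ (At-< {input} q)) length≤W

    state≤W : ∀ {v x} → v < n → x < Bn → v * Bn + x ≤ W
    state≤W v< x< = ≤-trans (<⇒≤ (state< v< x<)) (≤-trans S≤L L≤W)

    vBn≤W : ∀ {v} → v < n → v * Bn ≤ W
    vBn≤W v< = ≤-trans (*-monoˡ-≤ Bn (<⇒≤ v<)) (≤-trans S≤L L≤W)

    n≤W : n ≤ W
    n≤W = ≤-trans n≤S (≤-trans S≤L L≤W)

    module _ {σ : St} {i j : ℕ} (g : Glob (var σ)) (e₂₀ : var σ 20 ≡ i) (e₂₁ : var σ 21 ≡ j) (apart : i +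
      stride ≤ j) (room : j + stride ≤ base₀) where

      Copied : St → Set
      Copied σ′ = KV 24 (var σ) (var σ′) × arr σ′ ≡ arr σ × (∀ {a} → a < j → rnk σ′ a ≡ rnk σ a) ×
        (∀ {a} → a < stride → rnk σ′ (j + a) ≡ rnk σ (i + a))

      data Copying (c : ℕ) : St → Set where
        copying : ∀ {v r} → KV 24 (var σ) v → v 24 ≡ c → (∀ {a} → a < j → r a ≡ rnk σ a) → (∀ {a} → a < c →
          r (j + a) ≡ rnk σ (i + a)) → Copying c (st v r (arr σ))

      stride≤W : stride ≤ W
      stride≤W = ≤-trans (m≤n+m stride j) (≤-trans room base₀≤W)

      copy-body : ∀ {c σ′} → c < stride → Copying c σ′ →
        Run (store (reg 21 ⟨+⟩ reg 24) (mem (reg 20 ⟨+⟩ reg 24))) σ′ 0 λ σ″ → var σ″ 24 ≡ c ×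
          Copying (suc c) (σ″ ⟦ 24 ≔ suc c ⟧)
      copy-body {c} c< (copying {v} {r} κ e low same) =
        rnk:=# (v# 21 (trans (at κ 21) e₂₁) +# v# 24 e [ ≤-trans (<⇒≤ dst<) base₀≤W ]) dst<
          (m# (v# 20 (trans (at κ 20) e₂₀) +# v# 24 e [ ≤-trans (<⇒≤ src<j) (≤-trans (m≤m+n j stride)
            (≤-trans room base₀≤W)) ]) (<-≤-trans src<j (≤-trans (m≤m+n j stride) room)))
          (e , copying {r = r′} (kv-put κ) refl (λ a< → trans (put-≢ r _ (<⇒≢ (<-≤-trans a< (m≤m+n j c)))) (low
            a<)) copied)
        where
        dst< : j + c < base₀
        dst< = <-≤-trans (+-monoʳ-< j c<) room
        src<j : i + c < j
        src<j = <-≤-trans (+-monoʳ-< i c<) apart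
        r′ : ℕ → ℕ
        r′ = r [ j + c ↦ r (i + c) ]
        copied : ∀ {a} → a < suc c → r′ (j + a) ≡ rnk σ (i + a)
        copied {a} a≤c with m≤n⇒m<n∨m≡n (s≤s⁻¹ a≤c)
        ... | inj₁ a<c = trans (put-≢ r _ (<⇒≢ (+-monoʳ-< j a<c))) (same a<c)
        ... | inj₂ refl = trans (put-≡ r (j + a) _) (low src<j)

      copy# : Run copy σ stride Copied
      copy# = :=⨾ (k# 0) (weaken# (≤-reflexive (*-identityʳ stride)) (for# {Q = Copied} Copying
        (λ { (copying _ e _ _) → e })
        (λ { (copying κ _ _ _) → v# 6 (trans (at κ 6) (g6 g)) }) stride≤W copy-body z≤n
          (copying (kv-put kv-refl) refl (λ _ → refl) (λ ()))
        λ { (copying κ _ low same) → κ , refl , low , same }))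

    module _ {σ : St} {s j : ℕ} {t : Expr} {X Y : Word} (g : Glob (var σ)) (tb : Tables (arr σ)) (e₁₉ : var σ 19
      ≡ s) (s< : s < S) (j≤ : j ≤ S)
             (et : ∀ {a} → Ev (σ ⟦ 20 ≔ a ⟧) t j) (tX : Tidy n k X) (tY : Tidy n k Y) (sX : Stored 0 (rnk σ)
               (s * stride) X) (sY : Stored 0 (rnk σ) (j * stride) Y) where

      Compared : St → Set
      Compared σ′ = KV 20 (var σ) (var σ′) × rnk σ′ ≡ rnk σ × arr σ′ ≡ arr σ ×
        Flag (var σ′ 23) (Above (cl s) X Y)

      compare# : Run (setup-cmp t) σ (suc k) Compared
      compare# = :=⨾ (v# 19 e₁₉ *# v# 6 (g6 g) [ slot≤W (<⇒≤ s<) ]) (:=⨾ (et *# v# 6 (g6 g) [ slot≤W j≤ ])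
        (:=⨾ (v# 19 e₁₉ *# (k# 2 +# v# 2 (g2 g) [ ≤-trans k≤L L≤W ]) [ ≤-trans (≤-trans (m≤m+n _ 0)
          (<⇒≤ (row s< z<s))) L≤W ])
        (post# (cmp# (cl≤2 s) (glob-kv (kv-put (kv-put (kv-put kv-refl))) g) (class# tb s<)
          (≤-trans (≤-reflexive (+-comm (s * (2 + k)) (2 + k))) (*-monoˡ-≤ (2 + k) s<))
          refl refl refl sX sY (Tidy-length tX) (Tidy-length tY) (Tidy-keys tX) (slot (<⇒≤ s<)) (slot j≤))
          λ { (κ , er , ea , fl) → kv-trans (kv-put (kv-put (kv-put kv-refl))) κ , er , ea , fl })))

    -- The list contains precisely the bad states, each once: a popped state really has to be
    -- raised, and an empty list proves that no state is bad.
    record Work (f : ℕ → ℕ) (h : ℕ) (bad : ℕ → Set) : Set where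
      constructor work
      field
        list     : List ℕ
        chain    : Chain f h list
        unique   : Unique list
        sound    : ∀ {s} → s ∈ list → s < S × bad s
        complete : ∀ {s} → s < S → bad s → s ∈ list

    Work-push : ∀ {f h bad bad′ s} → Work f h bad → s < S → ¬ bad s → bad′ s → (∀ {t} → t ≢ s → bad t →
      bad′ t) → (∀ {t} → t ≢ s → bad′ t → bad t) →
                Work (f [ s ↦ h ]) (suc s) bad′
    Work-push {f} {h} {bad} {bad′} {s} (work ws ch u so co) s< ¬bad bad′s to from =
      work (s ∷ ws) (refl , subst (λ i → Chain (f [ s ↦ h ]) i ws) (sym (put-≡ f s h)) (Chain-frame ws (λ t∈ →
        sym (put-≢ f h (off t∈))) ch))
        (All.tabulate (λ t∈ eq → off t∈ (sym eq)) ∷ u)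
        (λ { (here refl) → s< , bad′s ; (there t∈) → proj₁ (so t∈) , to (off t∈) (proj₂ (so t∈)) })
        λ {t} t< b → case t ≟ s of λ { (yes refl) → here refl ; (no t≢s) → there (co t< (from t≢s b)) }
      where
      off : ∀ {t} → t ∈ ws → t ≢ s
      off t∈ refl = ¬bad (proj₂ (so t∈))

    Work-map : ∀ {f h bad bad′} → Work f h bad → (∀ {t} → t < S → bad t → bad′ t) → (∀ {t} → t < S → bad′ t →
      bad t) → Work f h bad′
    Work-map (work ws ch u so co) to from = work ws ch u (λ t∈ → let t< , b = so t∈ in t< , to t< b) (λ t< b →
      co t< (from t< b))

    module _ {σ : St} {s : ℕ} {r : ℕ → Word} (g : Glob (var σ)) (tb : Tables (arr σ)) (e₁₀ : var σ 10 ≡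
      s) (e₁₁ : var σ 11 ≡ vt s) (s< : s < S)
             (ranks : Ranks (rnk σ) r) (tidy : Good-words r)
             (wk : Work (arr σ 14) (var σ 9) λ t → t ≢ s × thr (vt t) ≤ arr σ 13 t) where

      data Recounted : St → Set where
        recounted : ∀ {v A} → KV 9 (var σ) v → v 10 ≡ s → v 11 ≡ vt s → v 17 ≡ var σ 17 → KV 13 (arr σ) A →
          A 15 ≡ arr σ 15 →
          A 13 ≡ arr σ 13 [ s ↦ failures r s ] → Work (A 14) (v 9) (λ t → thr (vt t) ≤ A 13 t) →
            Recounted (st v (rnk σ) A)

      v₀ = vt s
      E = so v₀ + length (sl v₀)

      data Counting : List ℕ → St → Set where
        counting : ∀ {v zs} → KV 12 (var σ) v → v 17 ≡ var σ 17 → v 19 ≡ s → v 15 ≡ nx s → v 14 ≡ E →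
          v 13 + length zs ≡ E → Seg input (v 13) zs → All (_< n) zs →
          v 12 + sumL (fails r s) zs ≡ failures r s → Counting zs (st v (rnk σ) (arr σ))

      E≤W : E ≤ W
      E≤W = ≤-trans (so-end (vt< s<)) length≤W

      length-sl≤W : failures r s ≤ W
      length-sl≤W = ≤-trans (failures≤ r s) (≤-trans (m≤n+m _ (so v₀)) E≤W)

      count-body : ∀ {z zs σ′} → Counting (z ∷ zs) σ′ → Run recountBody σ′ (suc k) λ σ″ →
        var σ″ 13 + suc (length zs) ≡ E × Counting zs (σ″ ⟦ 13 ≔ suc (var σ″ 13) ⟧)
      count-body {z} {zs} (counting {v} κ e₁₇ e₁₉ e₁₅ e₁₄ pos (at-z , seg) (z< ∷ zs<) sum) =
        :=⨾ (i# (v# 13 refl) at-z) (compare# {s = s} {j = target s z} (glob-kv (kv-put (kv-≤ κ)) g) tb e₁₉ s<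
          (<⇒≤ (target< s< z<))
          ((v# 16 refl *# v# 3 (trans (at κ 3) (g3 g)) [ vBn≤W z< ]) +# v# 15 e₁₅ [ state≤W z< (nx< s<) ])
          (tidy s<) (tidy (target< s< z<)) (ranks s<) (ranks (target< s< z<))
        ⨾# λ { {st v′ _ _} (κ′ , refl , refl , fl) →
          let bit = flag-failBit (above? (cl s) (r s) (r (target s z))) fl
              sum′ = trans (cong₂ (λ a b → a + b + sumL (fails r s) zs) (at κ′ 12) bit) (trans (+-assoc (v 12) _
                _) sum) in
          :=# (v# 12 refl +# (k# 1 ∸# v# 23 refl) [ ≤-trans (m≤m+n _ (sumL (fails r s) zs))
            (≤-trans (≤-reflexive sum′) length-sl≤W) ])
          (trans (cong (_+ suc (length zs)) (at κ′ 13)) pos ,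
           counting (kv-put (kv-put (kv-trans κ (kv-trans (kv-put kv-refl) (kv-≤ κ′))))) (trans (at κ′ 17) e₁₇)
             (trans (at κ′ 19) e₁₉) (trans (at κ′ 15) e₁₅) (trans (at κ′ 14) e₁₄)
             (trans (sym (+-suc _ (length zs))) (trans (cong (_+ suc (length zs)) (at κ′ 13)) pos))
               (subst (λ i → Seg input (suc i) zs) (sym (at κ′ 13)) seg) zs< sum′) })

      -- The worklist is assumed exact only away from `s`, which has just been taken off it or has
      -- not been counted so far; the new count decides whether `s` is entered.
      recount# : Run recount σ (length (sl v₀) * suc (suc k)) Recounted
      recount# = :=⨾ (v# 10 e₁₀) (:=⨾ (k# 0) (:=⨾ (ev-≡ (so# tb v<) (a# 10 (g4 g) (v# 11 e₁₁) v<L))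
        (:=⨾ (v# 13 refl +# i# (v# 7 (g7 g) +# v# 11 e₁₁ [ At-≤W (deg-sl v<) ]) (deg-sl v<) [ E≤W ])
        (:=⨾ (ev-≡ (next# tb s<) (a# 2 (g4 g) (v# 10 e₁₀) (<-≤-trans s< S≤L)))
        (weaken# (≤-reflexive (sumL-const (sl v₀))) (each# {Q = Counting []} (λ _ →
          suc k) Counting (λ { (counting _ _ _ _ _ e _ _ _) → e }) (λ { (counting _ _ _ _ e _ _ _ _) →
            v# 14 e }) E≤W
          count-body (counting (kv-put (kv-put (kv-put (kv-put (kv-put kv-refl))))) refl refl refl refl refl
            (seg-sl v<) (sl< v<) refl) id)
        ⨾# finish)))))
        where
        v< : v₀ < n
        v< = vt< s<
        v<L : v₀ < L
        v<L = <-≤-trans v< (≤-trans n≤S S≤L)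
        sumL-const : ∀ zs → sumL (λ _ → suc (suc k)) zs ≡ length zs * suc (suc k)
        sumL-const [] = refl
        sumL-const (z ∷ zs) = cong (suc (suc k) +_) (sumL-const zs)
        F = failures r s
        f₁ : ℕ → ℕ
        f₁ = arr σ 13 [ s ↦ F ]
        finish : ∀ {σ′ u} → Counting [] σ′ → Run (setArr 13 (reg 10) (reg 12) ⨾
          ifLess (reg 12) (arrE 6 (reg 11)) skip (push 10)) σ′ u Recounted
        finish (counting {v} κ e₁₇ _ _ _ _ _ _ sum) = arr⨾ 13 e₄ (v# 10 (trans (at κ 10) e₁₀)) (<-≤-trans s<
          S≤L) (v# 12 (trans (sym (+-identityʳ _)) sum))
          (if# (v# 12 (trans (sym (+-identityʳ _)) sum)) (ev-≡ (thr# tb v<)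
            (a# 6 e₄ (v# 11 (trans (at κ 11) e₁₁)) v<L))
            (λ lt → skip# (recounted (kv-≤ κ) (trans (at κ 10) e₁₀) (trans (at κ 11) e₁₁) e₁₇ (ka-put kv-refl)
              refl refl
              (subst (λ h → Work (arr σ 14) h _) (sym (at κ 9)) (Work-map wk
                (λ _ (t≢s , b) → subst (_ ≤_) (sym (put-≢ (arr σ 13) F t≢s)) b)
                (λ {t} _ b → let t≢s : t ≢ s
                                 t≢s = λ { refl → <⇒≱ lt (subst (thr v₀ ≤_) (put-≡ (arr σ 13) s F) b) }
                             in t≢s , subst (thr (vt t) ≤_) (put-≢ (arr σ 13) F t≢s) b)))))
            (λ le → arr⨾ 14 e₄ (v# 10 (trans (at κ 10) e₁₀)) (<-≤-trans s< S≤L) (v# 9 (at κ 9))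
              (:=# (k# 1 +# v# 10 (trans (at κ 10) e₁₀) [ ≤-trans s< (≤-trans S≤L L≤W) ])
              (recounted (kv-put (kv-≤ κ)) (trans (at κ 10) e₁₀) (trans (at κ 11) e₁₁) e₁₇
                (ka-put (ka-put kv-refl)) refl refl
                (Work-push {bad′ = λ t → thr (vt t) ≤ f₁ t} wk s< (λ (≢ , _) →
                  ≢ refl) (subst (thr v₀ ≤_) (sym (put-≡ (arr σ 13) s F)) le)
                  (λ {t} t≢s (_ , b) → subst (thr (vt t) ≤_) (sym (put-≢ (arr σ 13) F t≢s)) b)
                  (λ {t} t≢s b → t≢s , subst (thr (vt t) ≤_) (put-≢ (arr σ 13) F t≢s) b))))))
          where
          e₄ : v 4 ≡ base₀
          e₄ = trans (at κ 4) (g4 g)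

  -- Propagating a raised rank to the predecessors.

  module Propagation where
    open Macros public

    module _ {σ : St} {s : ℕ} {r : ℕ → Word} {Y : Word} (g : Glob (var σ)) (tb : Tables (arr σ))
             (e₁₀ : var σ 10 ≡ s) (e₁₁ : var σ 11 ≡ vt s) (e₁₇ : var σ 17 ≡ xt s) (s< : s < S)
             (tidy : Good-words r) (tidyY : Tidy n k Y) (ranks : Ranks (rnk σ) (put r s Y)) (old : Stored 0
               (rnk σ) (S * stride) (r s)) (rs≼Y : r s ≼ Y)
             (count : ∀ {t} → t < S → t ≢ s → arr σ 13 t ≡ failures r t) (count-s : arr σ 13 s ≡
               failures (put r s Y) s)
             (wk : Work (arr σ 14) (var σ 9) λ t → thr (vt t) ≤ arr σ 13 t) where

      r′ : ℕ → Word
      r′ = put r s Y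

      tidy′ : Good-words r′
      tidy′ {t} t< with t ≟ s
      ... | yes refl = subst (Tidy n k) (sym (put-at r s Y)) tidyY
      ... | no t≢s = subst (Tidy n k) (sym (put-off r Y t≢s)) (tidy t<)

      target-s : ∀ {t w} → t < S → target t w ≡ s → w ≡ vt s × nx t ≡ xt s
      target-s {t} {w} t< eq = trans (sym (vt-≡ (nx< t<))) (cong vt eq) ,
        trans (sym (xt-≡ {w} (nx< t<))) (cong xt eq)

      fails-same : ∀ {t w} → t ≢ s → target t w ≢ s → fails r t w ≡ fails r′ t w
      fails-same {t} t≢s w≢ = cong₂ (λ x y → failBit (above? (cl t) x y)) (sym (put-off r Y t≢s)) (sym
        (put-off r Y w≢))

      failures-same : ∀ {t} → t < S → t ≢ s → ¬ (vt s ∈ sl (vt t) × nx t ≡ xt s) → failures r t ≡ failures r′ t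
      failures-same {t} t< t≢s no-edge = sumL-cong (sl (vt t)) λ {w} w∈ → fails-same {t} {w} t≢s λ eq →
        let w≡ , nx≡ = target-s t< eq in
        no-edge (subst (_∈ sl (vt t)) w≡ w∈ , nx≡)

      module _ {t : ℕ} (t< : t < S) (t≢s : t ≢ s) (edge : vt s ∈ sl (vt t)) (nx≡ : nx t ≡ xt s) where

        target≡ : target t (vt s) ≡ s
        target≡ = trans (cong (vt s * Bn +_) nx≡) (vt-xt s)

        -- Successors of `t` share one index, so at most one of them is `s` and a single term of the
        -- sum changes. The old and the new term stand on opposite sides to avoid subtraction.
        balance : failures r′ t + failBit (above? (cl t) (r t) (r s)) ≡ failures r t +
          failBit (above? (cl t) (r t) Y)
        balance = trans (cong (λ u → failures r′ t + failBit (above? (cl t) (r t) (r u))) (sym target≡))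
          (trans (sumL-change (sl (vt t)) (sl-unique (vt t)) edge (λ {w} w≢ → fails-same {t} {w} t≢s λ eq →
            w≢ (proj₁ (target-s t< eq))))
          (cong (failures r t +_) (trans (cong (λ u → failBit (above? (cl t) (r′ t) (r′ u))) target≡)
            (cong₂ (λ x y → failBit (above? (cl t) x y)) (put-off r Y t≢s) (put-at r s Y)))))

        still-failing : ¬ Above (cl t) (r t) (r s) → failures r t ≡ failures r′ t
        still-failing ¬ab = sym (+-cancelʳ-≡ 1 _ _ (subst₂ (λ a b → failures r′ t + a ≡ failures r t + b)
          (failBit-no (above? (cl t) (r t) (r s)) ¬ab) (failBit-no (above? (cl t) (r t) Y) λ ab →
            ¬ab (Above-mono ab rs≼Y)) balance))

        still-above : Above (cl t) (r t) (r s) → Above (cl t) (r t) Y → failures r t ≡ failures r′ t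
        still-above ab ab′ = sym (+-cancelʳ-≡ 0 _ _ (subst₂ (λ a b → failures r′ t + a ≡ failures r t + b)
          (failBit-yes (above? (cl t) (r t) (r s)) ab) (failBit-yes (above? (cl t) (r t) Y) ab′) balance))

        newly-failing : Above (cl t) (r t) (r s) → ¬ Above (cl t) (r t) Y → suc (failures r t) ≡ failures r′ t
        newly-failing ab ¬ab′ = trans (+-comm 1 _) (trans (sym (subst₂ (λ a b → failures r′ t + a ≡
          failures r t + b)
          (failBit-yes (above? (cl t) (r t) (r s)) ab) (failBit-no (above? (cl t) (r t) Y) ¬ab′) balance))
            (+-identityʳ _))

      -- In the middle of the pass the counters mix two rankings: states still to be visited are
      -- counted under the old one, all others under the new one.
      record Counts (f : ℕ → ℕ) (todo : ℕ → Set) : Set where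
        constructor counts
        field
          pending : ∀ {t} → t < S → t ≢ s → todo t → f t ≡ failures r t
          updated : ∀ {t} → t < S → t ≢ s → ¬ todo t → f t ≡ failures r′ t
          own     : f s ≡ failures r′ s
      open Counts

      PE : ℕ
      PE = po (vt s) + length (pl (vt s))

      record Mid (v : ℕ → ℕ) (A : ℕ → ℕ → ℕ) (todo : ℕ → Set) : Set where
        constructor mid
        field
          κ   : KV 9 (var σ) v
          m10 : v 10 ≡ s
          m14 : v 14 ≡ PE
          m17 : v 17 ≡ xt s
          α   : KV 13 (arr σ) A
          a15 : A 15 ≡ arr σ 15
          cnt : Counts (A 13) todo
          wkl : Work (A 14) (v 9) λ t → thr (vt t) ≤ A 13 t
      open Mid

      -- The rest `xs` of the chain at the current predecessor `u`, and the full chains at the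
      -- predecessors `zs` to come.
      Todo : ℕ → List ℕ → List ℕ → ℕ → Set
      Todo u xs zs t = (vt t ≡ u × xt t ∈ xs) ⊎ (vt t ∈ zs × xt t ∈ pre (vt t) (xt s) Bn)

      data Row (u : ℕ) (zs : List ℕ) (i : ℕ) : ℕ → St → Set where
        row-inv : ∀ {v A} xs → Mid v A (Todo u xs zs) → v 16 ≡ u → v 13 ≡ i →
          Chain (λ x → arr σ 4 (u * Bn + x)) (v 18) xs →
          (∀ {x} → x ∈ xs → x < Bn × nx (u * Bn + x) ≡ xt s) → Unique xs →
            Row u zs i (length xs * suc (suc k)) (st v (rnk σ) A)

      RowDone : ℕ → List ℕ → ℕ → St → Set
      RowDone u zs i σ′ = ∃[ v ] ∃[ A ] st v (rnk σ) A ≡ σ′ × Mid v A (Todo u [] zs) × v 13 ≡ i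

      module _ {u : ℕ} {zs : List ℕ} {i : ℕ} (u< : u < n) (u∉ : u ∉ zs) (edge : vt s ∈ sl u) where

        advance : ∀ {f x xs} → x < Bn → x ∉ xs → Counts f (Todo u (x ∷ xs) zs) → (u * Bn + x ≢ s →
          f (u * Bn + x) ≡ failures r′ (u * Bn + x)) → Counts f (Todo u xs zs)
        advance {f} {x} {xs} x< x∉ c new = counts
          (λ t< t≢s → λ { (inj₁ (e , x∈)) → pending c t< t≢s (inj₁ (e , there x∈)) ; (inj₂ q) →
            pending c t< t≢s (inj₂ q) })
          (λ {t} t< t≢s ¬todo → case t ≟ u * Bn + x of λ
            { (yes refl) → new t≢s
            ; (no t≢) → updated c t< t≢s λ { (inj₁ (e , here refl)) →
              t≢ (trans (sym (vt-xt t)) (cong (λ z → z * Bn + xt t) e))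
                                          ; (inj₁ (e , there x∈)) → ¬todo (inj₁ (e , x∈)) ; (inj₂ q) →
                                            ¬todo (inj₂ q) } })
          (own c)

        -- A counter is only incremented at a state of the to-do list.
        advance-suc : ∀ {f x xs} → x < Bn → x ∉ xs → u * Bn + x ≢ s → Counts f (Todo u (x ∷ xs) zs) →
          suc (failures r (u * Bn + x)) ≡ failures r′ (u * Bn + x) →
                      Counts (f [ u * Bn + x ↦ suc (failures r (u * Bn + x)) ]) (Todo u xs zs)
        advance-suc {f} {x} {xs} x< x∉ t₀≢s c eq = counts
          (λ {t} t< t≢s todo → trans (put-≢ f _ (off todo)) (case todo of λ { (inj₁ (e , x∈)) →
            pending c t< t≢s (inj₁ (e , there x∈)) ; (inj₂ q) → pending c t< t≢s (inj₂ q) }))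
          (λ {t} t< t≢s ¬todo → case t ≟ u * Bn + x of λ
            { (yes refl) → trans (put-≡ f _ _) eq
            ; (no t≢) → trans (put-≢ f _ t≢) (updated c t< t≢s λ { (inj₁ (e , here refl)) →
              t≢ (trans (sym (vt-xt t)) (cong (λ z → z * Bn + xt t) e))
                                          ; (inj₁ (e , there x∈)) → ¬todo (inj₁ (e , x∈)) ; (inj₂ q) →
                                            ¬todo (inj₂ q) }) })
          (trans (put-≢ f _ (t₀≢s ∘ sym)) (own c))
          where
          off : ∀ {t} → Todo u xs zs t → t ≢ u * Bn + x
          off (inj₁ (e , x∈)) refl = x∉ (subst (_∈ xs) (xt-≡ {u} x<) x∈)
          off (inj₂ (u∈ , _)) refl = u∉ (subst (_∈ zs) (vt-≡ x<) u∈)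

        row-step : ∀ {φ σ′} → Row u zs i φ σ′ → ∃[ y ] ∃[ z ] Ev σ′ (const 0) y × Ev σ′ (reg 18) z ×
          (y < z → ∃[ w ] Run passBody σ′ w λ σ″ → ∃[ φ′ ] Row u zs i φ′ σ″ × suc w + φ′ ≤ φ) ×
            (z ≤ y → RowDone u zs i σ′)
        row-step (row-inv {v} {A} [] m e₁₆ e₁₃ ch in-pre uq) = 0 , 0 , k# 0 , v# 18 ch , (λ ()) , λ _ → v , A ,
          refl , m , e₁₃
        row-step (row-inv {v} {A} (x ∷ xs) m e₁₆ e₁₃ (h≡ , ch) in-pre (x∉ ∷ uq)) = 0 , suc x , k# 0 , v# 18 h≡ ,
          (λ _ → suc k , :=⨾ ((v# 16 e₁₆ *# v# 3 (trans (at (κ m) 3) (g3 g)) [ vBn≤W u< ]) +# (v# 18 h≡ ∸# k# 1)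
            [ state≤W u< x< ])
            (:=⨾ (ev-≡ (cong (λ f → f t) (at (α m) 4)) (a# 4 e₄ (v# 19 refl) t<L))
            (if# (k# 0) ((v# 19 refl ∸# v# 10 (m10 m)) +# (v# 10 (m10 m) ∸# v# 19 refl) [ distance≤W ])
              (λ lt → update# (λ t≡s → contradiction (distance-0 t≡s) (>⇒≢ lt)))
              (λ le → skip# (next-row (m′ (advance x< x∉′ (cnt m) λ t≢s →
                contradiction (distance⁻ (n≤0⇒n≡0 le)) t≢s)) e₁₆ e₁₃ refl))))) ,
          λ ()
          where
          t = u * Bn + x
          x< : x < Bn
          x< = proj₁ (in-pre (here refl))
          nx≡ : nx t ≡ xt s
          nx≡ = proj₂ (in-pre (here refl))
          x∉′ : x ∉ xs
          x∉′ x∈ = All.lookup x∉ x∈ refl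
          t< : t < S
          t< = state< u< x<
          t<L : t < L
          t<L = <-≤-trans t< S≤L
          vt≡ : vt t ≡ u
          vt≡ = vt-≡ x<
          e₄ : v 4 ≡ base₀
          e₄ = trans (at (κ m) 4) (g4 g)
          distance≤W : (t ∸ s) + (s ∸ t) ≤ W
          distance≤W = ≤-trans (+-mono-≤ (≤-trans (m∸n≤m t s) (<⇒≤ t<)) (≤-trans (m∸n≤m s t) (<⇒≤ s<))) (≤-trans
            (≤-reflexive (cong (S +_) (sym (+-identityʳ S)))) (≤-trans (≤-trans (≤-reflexive (*-comm 2 S))
              (*-monoʳ-≤ S (m≤m+n 2 k))) L≤W))
          distance-0 : t ≡ s → (t ∸ s) + (s ∸ t) ≡ 0
          distance-0 eq = cong₂ _+_ (m≤n⇒m∸n≡0 (≤-reflexive eq)) (m≤n⇒m∸n≡0 (≤-reflexive (sym eq)))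
          distance⁻ : (t ∸ s) + (s ∸ t) ≡ 0 → t ≡ s
          distance⁻ eq = ≤-antisym (m∸n≡0⇒m≤n (m+n≡0⇒m≡0 (t ∸ s) eq)) (m∸n≡0⇒m≤n (m+n≡0⇒n≡0 (t ∸ s) eq))
          v₂ : ℕ → ℕ
          v₂ = (v [ 19 ↦ t ]) [ 18 ↦ arr σ 4 t ]
          m′ : ∀ {todo} → Counts (A 13) todo → Mid v₂ A todo
          m′ c = mid (kv-put (kv-put (κ m))) (m10 m) (m14 m) (m17 m) (α m) (a15 m) c (wkl m)
          NextRow : St → Set
          NextRow σ″ = ∃[ φ′ ] Row u zs i φ′ σ″ × suc (suc k) + φ′ ≤ suc (length xs) * suc (suc k)
          next-row : ∀ {v′ A′} → Mid v′ A′ (Todo u xs zs) → v′ 16 ≡ u → v′ 13 ≡ i → v′ 18 ≡ arr σ 4 t →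
            NextRow (st v′ (rnk σ) A′)
          next-row {v′} m″ a b c = _ , row-inv xs m″ a b (subst (λ h → Chain (λ x → arr σ 4 (u * Bn + x)) h xs)
            (sym c) ch) (in-pre ∘ there) uq , ≤-refl
          update# : t ≢ s → Run update (st v₂ (rnk σ) A) (suc k) NextRow
          F = failures r t
          f′ : ℕ → ℕ
          f′ = A 13 [ t ↦ suc F ]
          edge′ : vt s ∈ sl (vt t)
          edge′ = subst (λ z → vt s ∈ sl z) (sym vt≡) edge
          tb′ : Tables A
          tb′ = Tables-kv (α m) (λ {a} a< → trans (cong (λ f → f a) (a15 m)) (clear# tb a<)) tb
          keep : ∀ {v′ todo} → KV 20 v₂ v′ → Mid v₂ A todo → Mid v′ A todo
          keep {v′} κ′ m″ = mid (kv-trans (κ m″) (kv-≤ κ′)) (trans (at κ′ 10) (m10 m″)) (trans (at κ′ 14)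
            (m14 m″)) (trans (at κ′ 17) (m17 m″)) (α m″) (a15 m″) (cnt m″)
            (subst (λ h → Work (A 14) h _) (sym (at κ′ 9)) (wkl m″))
          glob₂ : Glob v₂
          glob₂ = glob-kv (kv-put (kv-put (κ m))) g
          unchanged : ∀ {v′ p} → KV 20 v₂ v′ → t ≢ s → failures r t ≡ failures r′ t →
            Run skip (st v′ (rnk σ) A) p NextRow
          unchanged κ′ t≢s eq = skip# (next-row (keep κ′ (m′ (advance x< x∉′ (cnt m) λ _ →
            trans (pending (cnt m) t< t≢s (inj₁ (vt≡ , here (xt-≡ {u} x<)))) eq)))
            (trans (at κ′ 16) e₁₆) (trans (at κ′ 13) e₁₃) (at κ′ 18))
          raised : ∀ {v′ p} → KV 20 v₂ v′ → t ≢ s → suc F ≡ failures r′ t →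
            Run (12 := const 1 ⟨+⟩ arrE 13 (reg 19) ⨾ setArr 13 (reg 19) (reg 12) ⨾
              ifLess (reg 12) (arrE 6 (reg 16)) skip (ifLess (arrE 6 (reg 16)) (reg 12) skip (push 19)))
                (st v′ (rnk σ) A) p NextRow
          raised {v′} κ′ t≢s eq = :=⨾ (ev-≡ (cong suc f≡) (k# 1 +# a# 13 e₄′ (v# 19 (at κ′ 19)) t<L [ subst
            (_≤ W) (cong suc (sym f≡)) sucF≤W ]))
            (arr⨾ 13 e₄′ (v# 19 (at κ′ 19)) t<L (v# 12 refl) (if# (v# 12 refl) thr-ev
              (λ lt → skip# (finish (Work-map wk′
                (λ {t′} _ b → off-t (λ { refl → contradiction (subst (thr (vt t) ≤_) f≡ b) (<⇒≱
                  (<-trans (n<1+n F) (subst (suc F <_) thr≡ lt))) }) b)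
                (λ {t′} _ b → off-t′ (λ { refl → contradiction (subst (thr (vt t) ≤_) (put-≡ (A 13) t (suc F))
                  b) (<⇒≱ (subst (suc F <_) thr≡ lt)) }) b))))
              (λ ge → if# thr-ev (v# 12 refl)
                (λ lt → skip# (finish (Work-map wk′
                  (λ {t′} _ b → case t′ ≟ t of λ { (yes refl) →
                    subst (thr (vt t) ≤_) (sym (put-≡ (A 13) t (suc F))) (subst (_≤ suc F) thr≡ ge) ; (no t≢) →
                      off-t t≢ b })
                  (λ {t′} _ b → case t′ ≟ t of λ { (yes refl) →
                    subst (thr (vt t) ≤_) (sym f≡) (s≤s⁻¹ (subst (_< suc F) thr≡ lt)) ; (no t≢) →
                      off-t′ t≢ b }))))
                (λ le → let F<thr = subst (suc F ≤_) thr≡ le in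
                  arr⨾ 14 e₄′ (v# 19 (at κ′ 19)) t<L (v# 9 refl) (:=# (k# 1 +# v# 19 (at κ′ 19) [ ≤-trans t<L
                    L≤W ])
                  (next-row (mid (kv-put (kv-put (kv-trans (kv-trans (κ m) (kv-put (kv-put kv-refl)))
                    (kv-≤ κ′)))) (trans (at κ′ 10) (m10 m)) (trans (at κ′ 14) (m14 m)) (trans (at κ′ 17)
                      (m17 m)) (ka-put (ka-put (α m))) (a15 m) new-counts
                    (Work-push {bad′ = λ t → thr (vt t) ≤ f′ t} wk′ t< (λ b →
                      contradiction (subst (thr (vt t) ≤_) f≡ b) (<⇒≱ F<thr))
                      (subst (thr (vt t) ≤_) (sym (put-≡ (A 13) t (suc F))) (subst (_≤ suc F) thr≡ ge)) off-t
                        off-t′))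
                    (trans (at κ′ 16) e₁₆) (trans (at κ′ 13) e₁₃) (at κ′ 18)))))))
            where
            e₄′ : v′ 4 ≡ base₀
            e₄′ = trans (at κ′ 4) e₄
            f≡ : A 13 t ≡ F
            f≡ = pending (cnt m) t< t≢s (inj₁ (vt≡ , here (xt-≡ {u} x<)))
            sucF≤W : suc F ≤ W
            sucF≤W = ≤-trans (≤-reflexive eq) (≤-trans (failures≤ r′ t) (≤-trans (m≤n+m _ (so (vt t)))
              (≤-trans (so-end (vt< t<)) length≤W)))
            wk′ : Work (A 14) (v′ 9) λ t → thr (vt t) ≤ A 13 t
            wk′ = subst (λ h → Work (A 14) h _) (sym (at κ′ 9)) (wkl m)
            thr≡ : thr u ≡ thr (vt t)
            thr≡ = cong thr (sym vt≡)
            thr-ev : ∀ {a} → Ev (st (v′ [ 12 ↦ a ]) (rnk σ) (λ b → if b ≡ᵇ 13 then A b [ t ↦ suc F ] else A b))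
              (arrE 6 (reg 16)) (thr u)
            thr-ev = ev-≡ (trans (cong (λ f → f u) (at (α m) 6)) (thr# tb u<)) (a# 6 e₄′
              (v# 16 (trans (at κ′ 16) e₁₆)) (<-≤-trans u< (≤-trans n≤S S≤L)))
            off-t : ∀ {t′} → t′ ≢ t → thr (vt t′) ≤ A 13 t′ → thr (vt t′) ≤ f′ t′
            off-t {t′} t≢ b = subst (thr (vt t′) ≤_) (sym (put-≢ (A 13) (suc F) t≢)) b
            off-t′ : ∀ {t′} → t′ ≢ t → thr (vt t′) ≤ f′ t′ → thr (vt t′) ≤ A 13 t′
            off-t′ {t′} t≢ b = subst (thr (vt t′) ≤_) (put-≢ (A 13) (suc F) t≢) b
            new-counts : Counts f′ (Todo u xs zs)
            new-counts = advance-suc x< x∉′ t≢s (cnt m) eq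
            finish : Work (A 14) (v′ 9) (λ t → thr (vt t) ≤ f′ t) →
              NextRow (st (v′ [ 12 ↦ suc F ]) (rnk σ) (λ b → if b ≡ᵇ 13 then A b [ t ↦ suc F ] else A b))
            finish w = next-row (mid (kv-put (kv-trans (kv-trans (κ m) (kv-put (kv-put kv-refl))) (kv-≤ κ′)))
              (trans (at κ′ 10) (m10 m)) (trans (at κ′ 14) (m14 m)) (trans (at κ′ 17) (m17 m)) (ka-put (α m))
                (a15 m) new-counts w)
              (trans (at κ′ 16) e₁₆) (trans (at κ′ 13) e₁₃) (at κ′ 18)
          -- As `t` differs from `s`, its own rank is the same before and after; only its target
          -- changes, from `r s`, preserved in slot `S`, to `Y`.
          update# t≢s = compare# {s = t} {j = S} {X = r′ t} {Y = r s} glob₂ tb′ refl t< ≤-refl (v# 5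
            (g5 glob₂)) (tidy′ t<) (tidy s<) (ranks t<) old ⨾# λ
            { {st v₃ _ _} (κ₃ , refl , refl , fl) → if# (k# 0) (v# 23 refl)
              (λ pos → case fl of λ
                { (inj₂ (eq , _)) → contradiction eq (>⇒≢ pos)
                ; (inj₁ (_ , ab)) → compare# {s = t} {j = s} {X = r′ t} {Y = r′ s} (glob-kv (kv-≤ κ₃)
                  glob₂) tb′ (at κ₃ 19) t< (<⇒≤ s<)
                    (v# 10 (trans (at κ₃ 10) (m10 m))) (tidy′ t<) (tidy′ s<) (ranks t<) (ranks s<) ⨾# λ
                  { {st v₄ _ _} (κ₄ , refl , refl , fl′) → if# (v# 23 refl) (k# 1)
                    (λ lt → case fl′ of λ
                      { (inj₁ (eq , _)) → contradiction eq (<⇒≢ lt)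
                      ; (inj₂ (_ , ¬ab)) → raised (kv-trans κ₃ κ₄) t≢s (newly-failing t< t≢s edge′ nx≡
                        (old-above t≢s ab) λ ab′ → ¬ab (subst₂ (Above (cl t)) (sym (put-off r Y t≢s))
                          (sym (put-at r s Y)) ab′)) })
                    (λ ge → case fl′ of λ
                      { (inj₂ (eq , _)) → contradiction eq (>⇒≢ ge)
                      ; (inj₁ (_ , ab′)) → unchanged (kv-trans κ₃ κ₄) t≢s (still-above t< t≢s edge′ nx≡
                        (old-above t≢s ab) (subst₂ (Above (cl t)) (put-off r Y t≢s) (put-at r s Y) ab′)) }) } })
              (λ le → case fl of λ
                { (inj₁ (eq , _)) → contradiction (n≤0⇒n≡0 le) λ e → contradiction (trans (sym e) eq) λ ()
                ; (inj₂ (_ , ¬ab)) → unchanged κ₃ t≢s (still-failing t< t≢s edge′ nx≡ λ ab →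
                  ¬ab (subst (λ x → Above (cl t) x (r s)) (sym (put-off r Y t≢s)) ab)) }) }
            where
            old-above : t ≢ s → Above (cl t) (r′ t) (r s) → Above (cl t) (r t) (r s)
            old-above t≢s ab = subst (λ x → Above (cl t) x (r s)) (put-off r Y t≢s) ab

      Row# : ∀ {u zs i φ σ′} → u < n → u ∉ zs → vt s ∈ sl u → Row u zs i φ σ′ →
        Run (whileLess (const 0) (reg 18) passBody) σ′ φ (RowDone u zs i)
      Row# {u} {zs} {i} u< u∉ edge = while# {Q = RowDone u zs i} (Row u zs i) (row-step u< u∉ edge)

      Left : List ℕ → ℕ → Set
      Left zs t = vt t ∈ zs × xt t ∈ pre (vt t) (xt s) Bn

      Counts-map : ∀ {f todo todo′} → (∀ {t} → todo′ t → todo t) → (∀ {t} → todo t → todo′ t) → Counts f todo →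
        Counts f todo′
      Counts-map from to c = counts (λ a b q → pending c a b (from q)) (λ a b ¬q →
        updated c a b (¬q ∘ to)) (own c)

      Mid-map : ∀ {v A todo todo′} → (∀ {t} → todo′ t → todo t) → (∀ {t} → todo t → todo′ t) → Mid v A todo →
        Mid v A todo′
      Mid-map from to (mid a b c d e f g h) = mid a b c d e f (Counts-map from to g) h

      data Passing (zs : List ℕ) : St → Set where
        passing : ∀ {v A} → Mid v A (Left zs) → v 13 + length zs ≡ PE → Seg input (v 13) zs → All (_< n) zs →
          Unique zs → All (λ u → vt s ∈ sl u) zs →
          Passing zs (st v (rnk σ) A)

      row-cost : ℕ → ℕ
      row-cost u = length (pre u (xt s) Bn) * suc (suc k)

      pass-row# : ∀ {u zs σ′} → Passing (u ∷ zs) σ′ → Run passRow σ′ (row-cost u) λ σ″ →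
        var σ″ 13 + suc (length zs) ≡ PE × Passing zs (σ″ ⟦ 13 ≔ suc (var σ″ 13) ⟧)
      pass-row# {u} {zs} (passing {v} {A} m pos (at-u , seg) (u< ∷ zs<) (u∉ ∷ uq) (edge ∷ edges)) =
        :=⨾ (i# (v# 13 refl) at-u) (:=⨾ (a# 3 (trans (at (κ m) 4) (g4 g))
          ((v# 16 refl *# v# 3 (trans (at (κ m) 3) (g3 g)) [ vBn≤W u< ]) +# v# 17 (m17 m) [ state≤W u< (xt< s)
            ]) (<-≤-trans (state< u< (xt< s)) S≤L))
        (Row# u< u∉′ edge (row-inv (pre u (xt s) Bn)
          (Mid-map (λ { (inj₁ (refl , x∈)) → here refl , x∈ ; (inj₂ (z∈ , x∈)) → there z∈ , x∈ })
                   (λ { (here e , x∈) → inj₁ (e , subst (λ w → _ ∈ pre w (xt s) Bn) e x∈) ; (there z∈ , x∈) →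
                     inj₂ (z∈ , x∈) }) m₂)
          refl refl (subst (λ h → Chain (λ x → arr σ 4 (u * Bn + x)) h (pre u (xt s) Bn)) (cong (λ f →
            f (u * Bn + xt s)) (sym (at (α m) 3))) (chain# tb u< (xt< s)))
          (∈pre Bn) (pre-unique u (xt s) Bn))
        ⟫# λ { (v′ , A′ , refl , m′ , e₁₃) → trans (cong (_+ suc (length zs)) e₁₃) pos ,
          passing (mid (kv-put (κ m′)) (m10 m′) (m14 m′) (m17 m′) (α m′) (a15 m′) (Counts-map (λ (z∈ , x∈) →
            inj₂ (z∈ , x∈)) (λ { (inj₁ (_ , ())) ; (inj₂ q) → q }) (cnt m′)) (wkl m′))
            (trans (sym (+-suc _ (length zs))) (trans (cong (_+ suc (length zs)) e₁₃) pos)) (subst (λ i →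
              Seg input (suc i) zs) (sym e₁₃) seg) zs< uq edges }))
        where
        u∉′ : u ∉ zs
        u∉′ u∈ = All.lookup u∉ u∈ refl
        m₂ : ∀ {a b} → Mid ((v [ 16 ↦ a ]) [ 18 ↦ b ]) A (Left (u ∷ zs))
        m₂ = mid (kv-put (kv-put (κ m))) (m10 m) (m14 m) (m17 m) (α m) (a15 m) (cnt m) (wkl m)
        infixl 4 _⟫#_
        _⟫#_ : ∀ {p σ′ w P Q} → Run p σ′ w P → (∀ {σ″} → P σ″ → Q σ″) → Run p σ′ w Q
        r ⟫# f = post# r f

      data Propagated : St → Set where
        propagated : ∀ {v A} → KV 9 (var σ) v → KV 13 (arr σ) A → A 15 ≡ arr σ 15 → (∀ {t} → t < S → A 13 t ≡
          failures r′ t) →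
          Work (A 14) (v 9) (λ t → thr (vt t) ≤ A 13 t) → Propagated (st v (rnk σ) A)

      pass# : Run pass σ (sumL (λ u → suc (row-cost u)) (pl (vt s))) Propagated
      pass# = :=⨾ (ev-≡ (po# tb v<) (a# 11 (g4 g) (v# 11 e₁₁) (<-≤-trans v< (≤-trans n≤S S≤L))))
        (:=⨾ (v# 13 refl +# i# (v# 8 (g8 g) +# v# 11 e₁₁ [ At-≤W (deg-pl v<) ]) (deg-pl v<) [ PE≤W ])
        (each# {Q = Propagated} row-cost Passing (λ { (passing _ e _ _ _ _) → e }) (λ { (passing m _ _ _ _ _) →
          v# 14 (m14 m) }) PE≤W pass-row#
          (passing (mid (kv-put (kv-put kv-refl)) e₁₀ refl e₁₇ kv-refl refl (counts (λ a b _ →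
            count a b) at-start count-s) wk) refl (seg-pl v<) (pl< v<) (pl-unique (vt s))
            (All.tabulate λ {u} u∈ → pl⇒sl (All.lookup (pl< v<) u∈) v< u∈))
          λ { (passing m _ _ _ _ _) → propagated (κ m) (α m) (a15 m) (final (cnt m)) (wkl m) }))
        where
        v< : vt s < n
        v< = vt< s<
        PE≤W : PE ≤ W
        PE≤W = ≤-trans (po-end v<) length≤W
        at-start : ∀ {t} → t < S → t ≢ s → ¬ Left (pl (vt s)) t → arr σ 13 t ≡ failures r′ t
        -- A state that is not to be visited has no edge into `s`, so both rankings give it the same
        -- count.
        at-start {t} t< t≢s ¬left = trans (count t< t≢s) (failures-same t< t≢s λ (edge , nx≡) →
          ¬left (sl⇒pl (vt< t<) v< edge , pre∈ Bn (xt< t) (trans (cong nx (vt-xt t)) nx≡)))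
        final : ∀ {f} → Counts f (Left []) → ∀ {t} → t < S → f t ≡ failures r′ t
        final c {t} t< with t ≟ s
        ... | yes refl = own c
        ... | no t≢s = updated c t< t≢s λ { (() , _) }

  -- The main loop and its potential.

  module Main where
    open Propagation public
    open Succ
    open Increment using (bump#)

    -- The summands pay for copying the old rank, for the increment, for the recount and for the
    -- pass over the predecessors.
    cost : ℕ → ℕ
    cost s = stride + (2 * suc k + (length (sl (vt s)) * suc (suc k) + sumL (λ u →
      suc (length (pre u (xt s) Bn) * suc (suc k))) (pl (vt s))))

    Φ : (ℕ → Word) → ℕ
    Φ r = sumTo (λ s → suc (cost s) * (total ∸ rank (r s))) S

    -- The competitors are words without bad states, not rankings, so that capped rankings can be
    -- inserted directly.
    Lower : (ℕ → Word) → Set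
    Lower r = ∀ d → Good-words d → (∀ {s} → s < S → ¬ Bad d s) → ∀ {s} → s < S → r s ≼ d s

    -- An infinite tidy word may carry weights that no element of `R` can express; the words
    -- produced by the algorithm do not.
    Canonical : (ℕ → Word) → Set
    Canonical r = ∀ {s w xs} → s < S → r s ≡ (1 , w) ∷ xs → r s ≡ ∞word k

    data MainInv : ℕ → St → Set where
      main-inv : ∀ {v R A} r → Glob v → Tables A → Ranks R r → Good-words r → Canonical r → (∀ {s} → s < S →
        A 13 s ≡ failures r s) →
        Work (A 14) (v 9) (λ t → thr (vt t) ≤ A 13 t) → Lower r → MainInv (Φ r) (st v R A)

    record Final (σ : St) : Set where
      constructor final
      field
        result    : ℕ → Word
        stored    : Ranks (rnk σ) result
        tidied    : Good-words result
        canonical : Canonical result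
        good      : ∀ {s} → s < S → ¬ Bad result s
        lower     : Lower result

    ∞-Above : ∀ s {w xs y} → Tidy n k y → Above (cl s) ((1 , w) ∷ xs) y
    ∞-Above s (infinite _) = reset (cl-1 s)
    ∞-Above s (finite _ _ _) = key> z<s

    -- An infinite word exceeds every tidy word and has no failures at all, while thresholds are
    -- positive. Hence only finite words are ever incremented.
    Bad-finite : ∀ {r s} → Good-words r → s < S → Bad r s → ∃[ w ] ∃[ xs ] r s ≡ (0 , w) ∷ xs
    Bad-finite {r} {s} tidy s< bad = go (r s) refl (tidy s<)
      where
      go : ∀ x → r s ≡ x → Tidy n k x → ∃[ w ] ∃[ xs ] r s ≡ (0 , w) ∷ xs
      go _ eq (finite _ _ _) = _ , _ , eq
      go ((1 , w) ∷ xs) eq (infinite _) = contradiction bad (<⇒≱ (subst (_< thr (vt s)) (sym none)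
        (thr>0 (vt s))))
        where
        none : failures r s ≡ 0
        none = sumL-zero (sl (vt s)) λ {w′} w∈ → failBit-yes (above? (cl s) (r s) (r (target s w′)))
          (subst (λ z → Above (cl s) z (r (target s w′))) (sym eq)
            (∞-Above s (tidy (target< s< (All.lookup (sl< (vt< s<)) w∈)))))

    Bad-mono : ∀ {r d s} → s < S → (∀ {t} → t < S → r t ≼ d t) → r s ≡ d s → Bad r s → Bad d s
    Bad-mono {r} {d} {s} s< below eq bad = ≤-trans bad (sumL-mono (sl (vt s)) λ {w} w∈ →
      failBit-mono (above? (cl s) (r s) (r (target s w))) (above? (cl s) (d s) (d (target s w)))
        λ ab → Above-mono (subst (λ x → Above (cl s) x (d (target s w))) (sym eq) ab) (below
          (target< s< (All.lookup (sl< (vt< s<)) w∈))))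

    module _ {r : ℕ → Word} {s w : ℕ} {xs : Word} {Y : Word} (s< : s < S) (tidy : Good-words r) (eq : r s ≡
      (0 , w) ∷ xs) (res : Result ((0 , w) ∷ xs) Y) where

      tidy-s : Tidy n k ((0 , w) ∷ xs)
      tidy-s = subst (Tidy n k) eq (tidy s<)

      -- If `r s` were equal to `d s`, its failures would persist under `d`, which is nowhere below
      -- `r`, and `s` would be bad for `d` too. So `r s` lies strictly below `d s`, and its
      -- immediate successor does not overshoot.
      Lower-put : Lower r → Bad r s → Lower (put r s Y)
      Lower-put lower bad d tidy-d good {t} t< with t ≟ s
      ... | no t≢s = subst (_≼ d t) (sym (put-off r Y t≢s)) (lower d tidy-d good t<)
      ... | yes refl = subst (_≼ d t) (sym (put-at r t Y)) (Result-least tidy-s res (tidy-d t<) (subst (_≼ d t)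
        eq (lower d tidy-d good t<))
        λ e → good t< (Bad-mono t< (lower d tidy-d good) (trans eq e) bad))

      Canonical-put : Canonical r → Canonical (put r s Y)
      Canonical-put can {t} t< e with t ≟ s
      ... | no t≢s = trans (put-off r Y t≢s) (can t< (trans (sym (put-off r Y t≢s)) e))
      ... | yes refl = trans (put-at r t Y) (Result-canonical res (trans (sym (put-at r t Y)) e))

      Good-put : Good-words (put r s Y)
      Good-put {t} t< with t ≟ s
      ... | no t≢s = subst (Tidy n k) (sym (put-off r Y t≢s)) (tidy t<)
      ... | yes refl = subst (Tidy n k) (sym (put-at r t Y)) (Result-Tidy tidy-s res)

      -- The number of the rank grows by exactly one, so one full instalment of `suc (cost s)` is
      -- released.
      Φ-drop : suc (cost s) + Φ (put r s Y) ≤ Φ r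
      Φ-drop = sumTo-drop S s< (λ {t} t≢s → ≤-reflexive (cong (λ x → suc (cost t) * (total ∸ rank x))
        (put-off r Y t≢s)))
        (≤-reflexive (begin
          suc (cost s) + suc (cost s) * (total ∸ rank (put r s Y s)) ≡⟨ cong (λ x →
            suc (cost s) + suc (cost s) * (total ∸ rank x)) (put-at r s Y) ⟩
          suc (cost s) + suc (cost s) * (total ∸ rank Y) ≡⟨ *-suc (suc (cost s)) (total ∸ rank Y) ⟨
          suc (cost s) * suc (total ∸ rank Y) ≡⟨ cong (λ x → suc (cost s) * suc (total ∸ x)) (Result-rank res) ⟩
          suc (cost s) * suc (total ∸ suc (rank ((0 , w) ∷ xs)))
            ≡⟨ cong (suc (cost s) *_) (+-∸-assoc 1 (≤-trans (≤-reflexive (sym (Result-rank res)))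
              (rank≤total (Result-Tidy tidy-s res)))) ⟨
          suc (cost s) * (total ∸ rank ((0 , w) ∷ xs)) ≡⟨ cong (λ x → suc (cost s) * (total ∸ rank x)) eq ⟨
          suc (cost s) * (total ∸ rank (r s)) ∎))
        where open ≡-Reasoning

    slot-disjoint : ∀ {t s j} → t ≢ s → t * stride ≤ j → j < t * stride + stride → j < s * stride ⊎ s * stride +
      stride ≤ j
    slot-disjoint {t} {s} {j} t≢s le lt with <-cmp t s
    ... | tri< t<s _ _ = inj₁ (<-≤-trans lt (≤-trans (≤-reflexive (+-comm (t * stride) stride))
      (*-monoˡ-≤ stride t<s)))
    ... | tri≈ _ t≡s _ = contradiction t≡s t≢s
    ... | tri> _ _ s<t = inj₂ (≤-trans (≤-reflexive (+-comm (s * stride) stride))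
      (≤-trans (*-monoˡ-≤ stride s<t) le))

    Stored-slot : ∀ {f g t x} → Tidy n k x → (∀ {j} → t * stride ≤ j → j < t * stride + stride → g j ≡ f j) →
      Stored 0 f (t * stride) x → Stored 0 g (t * stride) x
    Stored-slot {t = t} {x} tx eq = Stored-frame (t * stride) x (λ {j} le lt →
      eq le (subst (λ m → j < t * stride + m) (length*2 tx) lt))

    main-body : ∀ {φ σ} → MainInv φ σ → ∃[ y ] ∃[ z ] Ev σ (const 0) y × Ev σ (reg 9) z ×
      (y < z → ∃[ u ] Run mainBody σ u λ σ′ → ∃[ φ′ ] MainInv φ′ σ′ × suc u + φ′ ≤ φ) × (z ≤ y → Final σ)
    main-body (main-inv {v} {R} {A} r g tb ranks tidy can count (work [] ch uq so co) lower) = 0 , 0 , k# 0 ,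
      v# 9 ch , (λ ()) ,
      λ _ → final r ranks tidy can (λ s< bad → case co s< (subst (_ ≤_) (sym (count s<)) bad) of λ ()) lower
    main-body (main-inv {v} {R} {A} r g tb ranks tidy can count (work (s ∷ ws) (h≡ , ch) (s∉ ∷ uq) so co)
      lower) = 0 , suc s , k# 0 , v# 9 h≡ ,
      (λ _ → cost s , body) , λ ()
      where
      s< : s < S
      s< = proj₁ (so (here refl))
      bad : Bad r s
      bad = subst (thr (vt s) ≤_) (count s<) (proj₂ (so (here refl)))
      w = proj₁ (Bad-finite {r} tidy s< bad)
      xs = proj₁ (proj₂ (Bad-finite {r} tidy s< bad))
      eq : r s ≡ (0 , w) ∷ xs
      eq = proj₂ (proj₂ (Bad-finite {r} tidy s< bad))
      s<L : s < L
      s<L = <-≤-trans s< S≤L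
      popped : Work (A 14) (A 14 s) λ t → t ≢ s × thr (vt t) ≤ A 13 t
      popped = work ws ch uq (λ t∈ → proj₁ (so (there t∈)) , (λ { refl → All.lookup s∉ t∈ refl }) ,
        proj₂ (so (there t∈)))
        λ t< (t≢s , b) → case co t< b of λ { (here e) → contradiction e t≢s ; (there t∈) → t∈ }
      Next : St → Set
      Next σ′ = ∃[ φ′ ] MainInv φ′ σ′ × suc (cost s) + φ′ ≤ Φ r
      v₄ : ℕ → ℕ
      v₄ = (((v [ 10 ↦ s ]) [ 9 ↦ A 14 s ]) [ 11 ↦ vt s ]) [ 17 ↦ xt s ]
      v₆ : ℕ → ℕ
      v₆ = (v₄ [ 20 ↦ s * stride ]) [ 21 ↦ S * stride ]
      κ₆ : KV 9 v v₆
      κ₆ = kv-put (kv-put (kv-put (kv-put (kv-put (kv-put kv-refl)))))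
      component : s ∸ vt s * Bn ≡ xt s
      component = trans (cong (_∸ vt s * Bn) (sym (vt-xt s))) (m+n∸m≡n (vt s * Bn) (xt s))
      apart : s * stride + stride ≤ S * stride
      apart = ≤-trans (≤-reflexive (+-comm (s * stride) stride)) (*-monoˡ-≤ stride s<)
      body : Run mainBody (st v R A) (cost s) Next
      body = :=⨾ (v# 9 h≡ ∸# k# 1) (:=⨾ (a# 14 (g4 g) (v# 10 refl) s<L)
        (:=⨾ (ev-≡ (vertex# tb s<) (a# 7 (g4 g) (v# 10 refl) s<L))
        (:=⨾ (ev-≡ component (v# 10 refl ∸# (v# 11 refl *# v# 3 (g3 g) [ vBn≤W (vt< s<) ])))
        (:=⨾ (v# 10 refl *# v# 6 (g6 g) [ slot≤W (<⇒≤ s<) ]) (:=⨾ (v# 5 (g5 g) *# v# 6 (g6 g) [ slot≤W ≤-refl ])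
        (weaken# (m≤m+n stride _) (copy# {i = s * stride} {S * stride} (glob-kv κ₆ g) refl refl apart
          (slot ≤-refl)) ⨾# λ { {st v₇ R₇ _} (κ₇ , refl , below , copied) →
          after-copy κ₇ below copied }))))))
        where
        after-copy : ∀ {v₇ R₇} → KV 24 v₆ v₇ → (∀ {a} → a < S * stride → R₇ a ≡ R a) → (∀ {a} → a < stride →
          R₇ (S * stride + a) ≡ R (s * stride + a)) →
          Run (bump ⨾ recount ⨾ pass) (st v₇ R₇ A) (cost s) Next
        after-copy {v₇} {R₇} κ₇ below copied =
          weaken# (≤-trans (m≤m+n (2 * suc k) _) (m≤n+m _ stride)) (bump# tidy-eq g₇ (at κ₇ 20) (slot (<⇒≤ s<))
            (subst (Stored 0 R₇ (s * stride)) eq (ranks₇ s<)) (clear# tb))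
          ⨾# λ { {st v₈ R₈ A₈} (Y , res , stored , out , κ₈ , α₈ , clear₈) →
            after-bump res stored out κ₈ α₈ clear₈ }
          where
          tidy-eq : Tidy n k ((0 , w) ∷ xs)
          tidy-eq = subst (Tidy n k) eq (tidy s<)
          g₇ : Glob v₇
          g₇ = glob-kv (kv-trans κ₆ (kv-≤ κ₇)) g
          ranks₇ : Ranks R₇ r
          ranks₇ {t} t< = Stored-slot {t = t} (tidy t<) (λ le lt →
            below (<-≤-trans lt (≤-trans (≤-reflexive (+-comm (t * stride) stride)) (*-monoˡ-≤ stride t<))))
              (ranks t<)
          old₇ : Stored 0 R₇ (S * stride) (r s)
          old₇ = Stored-shift (s * stride) (S * stride) (r s) (λ {j} lt →
            copied (subst (j <_) (length*2 (tidy s<)) lt)) (ranks s<)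
          after-bump : ∀ {v₈ R₈ A₈ Y} → Result ((0 , w) ∷ xs) Y → Stored 0 R₈ (s * stride) Y →
            (∀ {j} → j < s * stride ⊎ s * stride + stride ≤ j → R₈ j ≡ R₇ j) →
            KV 21 v₇ v₈ → KV 15 A A₈ → (∀ {a} → a < k → A₈ 15 a ≡ 0) → Run (recount ⨾
              pass) (st v₈ R₈ A₈) (cost s) Next
          after-bump {v₈} {R₈} {A₈} {Y} res stored out κ₈ α₈ clear₈ =
            weaken# (≤-trans (m≤m+n (length (sl (vt s)) * suc (suc k)) _) (≤-trans (m≤n+m _ (2 * suc k))
              (m≤n+m _ stride)))
              (recount# {r = r⁺} g₈ tb₈ (trans (at κ₈ 10) (at κ₇ 10)) (trans (at κ₈ 11) (at κ₇ 11)) s< ranks₈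
                (Good-put s< tidy eq res) wk₈)
            ⨾# λ { (recounted {v₉} {A₉} κ₉ e₁₀ e₁₁ e₁₇ α₉ a15 a13 wk₉) →
              after-recount κ₉ e₁₀ e₁₁ e₁₇ α₉ a15 a13 wk₉ }
            where
            r⁺ : ℕ → Word
            r⁺ = put r s Y
            g₈ : Glob v₈
            g₈ = glob-kv (kv-≤ κ₈) g₇
            tb₈ : Tables A₈
            tb₈ = Tables-kv (kv-≤ α₈) clear₈ tb
            ranks₈ : Ranks R₈ r⁺
            ranks₈ {t} t< with t ≟ s
            ... | yes refl = subst (Stored 0 R₈ (t * stride)) (sym (put-at r t Y)) stored
            ... | no t≢s = subst (Stored 0 R₈ (t * stride)) (sym (put-off r Y t≢s)) (Stored-slot {t = t}
              (tidy t<) (λ le lt → out (slot-disjoint {t} t≢s le lt)) (ranks₇ t<))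
            old₈ : Stored 0 R₈ (S * stride) (r s)
            old₈ = Stored-slot {t = S} (tidy s<) (λ le lt → out (slot-disjoint {S} (>⇒≢ s<) le lt)) old₇
            wk₈ : Work (A₈ 14) (v₈ 9) λ t → t ≢ s × thr (vt t) ≤ A₈ 13 t
            wk₈ = subst₂ (λ f h → Work f h λ t → t ≢ s × thr (vt t) ≤ A₈ 13 t) (sym (at α₈ 14)) (sym
              (trans (at κ₈ 9) (at κ₇ 9)))
              (subst (λ f → Work (A 14) (A 14 s) λ t → t ≢ s × thr (vt t) ≤ f t) (sym (at α₈ 13)) popped)
            after-recount : ∀ {v₉ A₉} → KV 9 v₈ v₉ → v₉ 10 ≡ s → v₉ 11 ≡ vt s → v₉ 17 ≡ v₈ 17 → KV 13 A₈ A₉ →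
              A₉ 15 ≡ A₈ 15 → A₉ 13 ≡ A₈ 13 [ s ↦ failures r⁺ s ] →
              Work (A₉ 14) (v₉ 9) (λ t → thr (vt t) ≤ A₉ 13 t) → Run pass (st v₉ R₈ A₉) (cost s) Next
            after-recount {v₉} {A₉} κ₉ e₁₀ e₁₁ e₁₇ α₉ a15 a13 wk₉ =
              weaken# (≤-trans (m≤n+m _ (length (sl (vt s)) * suc (suc k))) (≤-trans (m≤n+m _ (2 * suc k))
                (m≤n+m _ stride)))
              (post# (pass# {r = r} {Y} g₉ tb₉ e₁₀ e₁₁ (trans e₁₇ (trans (at κ₈ 17) (at κ₇ 17))) s< tidy
                (Result-Tidy tidy-eq res) ranks₈ old₈
                (subst (_≼ Y) (sym eq) (Result-above tidy-eq res))
                (λ {t} t< t≢s → trans (cong (λ f → f t) a13) (trans (put-≢ (A₈ 13) _ t≢s) (trans (cong (λ f →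
                  f t) (at α₈ 13)) (count t<))))
                (trans (cong (λ f → f s) a13) (put-≡ (A₈ 13) s _)) wk₉)
              λ { (propagated κ α b15 count′ wk′) → Φ r⁺ , main-inv r⁺ (glob-kv κ g₉) (Tables-kv α (λ {a} a< →
                trans (cong (λ f → f a) b15) (clear# tb₉ a<)) tb₉)
                    ranks₈ (Good-put s< tidy eq res) (Canonical-put s< tidy eq res can) count′ wk′ (Lower-put s<
                      tidy eq res lower bad) , Φ-drop s< tidy eq res })
              where
              g₉ : Glob v₉
              g₉ = glob-kv κ₉ g₈
              tb₉ : Tables A₉
              tb₉ = Tables-kv α₉ (λ {a} a< → trans (cong (λ f → f a) a15) (clear₈ a<)) tb₈

    mainLoop# : ∀ {φ σ} → MainInv φ σ → Run mainLoop σ φ Final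
    mainLoop# = while# {Q = Final} MainInv main-body

  -- Reading the sizes, the offsets and the vertices of states.

  -- The input as the initialisation reads it.  dg i s is the i-th component of the element of B in state s
  -- and part i s the contribution to nx s of the components from i on.
  record Source : Set where
    open Algorithm
    offF : ℕ
    offF = 3 + k + n
    offI : ℕ
    offI = offF + k * n
    field
      lf Pf Qf v0 : ℕ → ℕ
      fb dg part : ℕ → ℕ → ℕ
      ib : ℕ → ℕ → ℕ → ℕ
      at-k : At input 2 k
      at-ℓ : ∀ {i} → i < k → At input (3 + i) (lf i)
      Pf-k : Pf k ≡ 1
      Pf-step : ∀ {i} → i < k → Pf i ≡ lf i * Pf (suc i)
      Pf-0 : Pf 0 ≡ Bn
      Qf-0 : Qf 0 ≡ 0
      Qf-suc : ∀ i → Qf (suc i) ≡ Qf i + lf i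
      offA≡ : offA ≡ offI + Qf k * n
      offA≤ : offA + n ≤ W
      offQ≤ : offQ + n ≤ W
      so-0 : so 0 ≡ offA + n
      so-suc : ∀ {v} → v < n → so (suc v) ≡ so v + length (sl v)
      so-n : so n ≡ offQ
      po-0 : po 0 ≡ offQ + n
      po-suc : ∀ {v} → v < n → po (suc v) ≡ po v + length (pl v)
      at-v0 : ∀ {v} → v < n → At input (3 + k + v) (v0 v)
      thr-0 : ∀ {v} → v < n → 0 < v0 v → thr v ≡ length (sl v)
      thr-1 : ∀ {v} → v < n → v0 v ≡ 0 → thr v ≡ 1
      at-fb : ∀ {i v} → i < k → v < n → At input (offF + (i * n + v)) (fb i v)
      at-ib : ∀ {i d v} → i < k → d < lf i → v < n → At input (offI + ((Qf i + d) * n + v)) (ib i d v)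
      dg-unique : ∀ {i s h d lo} → i < k → s < S → s ≡ (h * lf i + d) * Pf (suc i) + lo → d < lf i →
        lo < Pf (suc i) → dg i s ≡ d
      cl-F : ∀ {i s} → i < k → s < S → 0 < fb i (vt s) → cl s (2+ i) ≡ 0
      cl-I : ∀ {i s} → i < k → s < S → fb i (vt s) ≡ 0 → 0 < ib i (dg i s) (vt s) → cl s (2+ i) ≡ 1
      cl-O : ∀ {i s} → i < k → s < S → fb i (vt s) ≡ 0 → ib i (dg i s) (vt s) ≡ 0 → cl s (2+ i) ≡ 2
      part-k : ∀ s → part k s ≡ 0
      part-suc : ∀ {i s} → i < k → s < S → 0 < ib i (dg i s) (vt s) → suc (dg i s) < lf i → part i s ≡
        part (suc i) s + suc (dg i s) * Pf (suc i)
      part-wrap : ∀ {i s} → i < k → s < S → 0 < ib i (dg i s) (vt s) → suc (dg i s) ≡ lf i → part i s ≡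
        part (suc i) s + 0 * Pf (suc i)
      part-keep : ∀ {i s} → i < k → s < S → ib i (dg i s) (vt s) ≡ 0 → part i s ≡ part (suc i) s + dg i s *
        Pf (suc i)
      part-0 : ∀ {s} → s < S → part 0 s ≡ nx s
      part≤ : ∀ {i s} → s < S → part i s ≤ Bn
      lf>0 : ∀ {i} → i < k → 0 < lf i

  module _ (Q : Source) where
    open Source Q

    module Initial where
      open Main public

      -- The sizes are read from the first component on, so the running product is over a prefix,
      -- whereas the numbering of `B` uses the suffix products `Pf`; the two meet in `pp-Pf`.
      pp : ℕ → ℕ
      pp zero    = 1
      pp (suc i) = pp i * lf i

      pp-Pf : ∀ i → i ≤ k → pp i * Pf i ≡ Bn
      pp-Pf zero _ = trans (+-identityʳ _) Pf-0
      pp-Pf (suc i) i<k = trans (*-assoc (pp i) (lf i) _) (trans (cong (pp i *_) (sym (Pf-step i<k)))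
        (pp-Pf i (<⇒≤ i<k)))

      pp≤Bn : ∀ {i} → i ≤ k → pp i ≤ Bn
      pp≤Bn {i} i≤k = ≤-trans (m≤m*n (pp i) (Pf i) {{≢-nonZero λ eq →
        <⇒≢ Bn>0 (sym (trans (sym (pp-Pf i i≤k)) (trans (cong (pp i *_) eq) (*-zeroʳ (pp i)))))}})
          (≤-reflexive (pp-Pf i i≤k))

      pp-k : pp k ≡ Bn
      pp-k = trans (sym (*-identityʳ (pp k))) (trans (cong (pp k *_) (sym Pf-k)) (pp-Pf k ≤-refl))

      Qf-mono : ∀ {i j} → i ≤ j → Qf i ≤ Qf j
      Qf-mono {j = zero} z≤n = ≤-refl
      Qf-mono {i} {suc j} le with m≤n⇒m<n∨m≡n le
      ... | inj₂ refl = ≤-refl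
      ... | inj₁ (s≤s lt) = ≤-trans (Qf-mono lt) (≤-trans (m≤m+n _ (lf j)) (≤-reflexive (sym (Qf-suc j))))

      offA≤W : offA ≤ W
      offA≤W = ≤-trans (m≤m+n offA n) offA≤

      Bn≤W : Bn ≤ W
      Bn≤W = ≤-trans Bn≤S (≤-trans S≤L L≤W)

      S≤W : S ≤ W
      S≤W = ≤-trans S≤L L≤W

      k≤W : k ≤ W
      k≤W = ≤-trans (m≤n+m k 2) (≤-trans k≤L L≤W)

      Qf≤W : ∀ {i} → i ≤ k → Qf i ≤ W
      Qf≤W i≤k = ≤-trans (Qf-mono i≤k) (≤-trans (m≤m*n (Qf k) n {{>-nonZero n>0}}) (≤-trans (m≤n+m _ offI)
        (≤-trans (≤-reflexive (sym offA≡)) offA≤W)))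

      offI≤W : offI ≤ W
      offI≤W = ≤-trans (m≤m+n offI _) (≤-trans (≤-reflexive (sym offA≡)) offA≤W)

      offF≤W : offF ≤ W
      offF≤W = ≤-trans (m≤m+n offF _) offI≤W

      3+k≤W : 3 + k ≤ W
      3+k≤W = ≤-trans (m≤m+n (3 + k) n) offF≤W

      module _ {r₀ : ℕ → ℕ} {A₀ : ℕ → ℕ → ℕ} where

        data Sizing (i : ℕ) : St → Set where
          sizing : ∀ {v} → v 0 ≡ n → v 2 ≡ k → v 3 ≡ pp i → v 13 ≡ Qf i → v 10 ≡ i → Sizing i (st v r₀ A₀)

        data Sized : St → Set where
          sized : ∀ {v} → v 0 ≡ n → v 2 ≡ k → v 3 ≡ Bn → v 4 ≡ base₀ → v 5 ≡ S → v 6 ≡ stride → v 7 ≡ offA →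
            Sized (st v r₀ A₀)

        readSizes# : ∀ {v} → v 0 ≡ n → Run readSizes (st v r₀ A₀) k Sized
        readSizes# e₀ = :=⨾ (i# (k# 2) at-k) (:=⨾ (k# 1) (:=⨾ (k# 0) (:=⨾ (k# 0)
          (weaken# (≤-reflexive (*-identityʳ k)) (for# {Q = Sizing k} Sizing (λ { (sizing _ _ _ _ e) → e })
            (λ { (sizing _ e _ _ _) → v# 2 e }) k≤W
            (λ { {i} i<k (sizing {v} e₀ e₂ e₃ e₁₃ e₁₀) → :=⨾ (i# (k# 3 +# v# 10 e₁₀ [ At-≤W (at-ℓ i<k) ])
              (at-ℓ i<k))
              (:=⨾ (v# 3 e₃ *# v# 11 refl [ ≤-trans (pp≤Bn i<k) Bn≤W ])
              (:=# (v# 13 e₁₃ +# v# 11 refl [ ≤-trans (≤-reflexive (sym (Qf-suc i))) (Qf≤W i<k) ])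
              (e₁₀ , sizing e₀ e₂ refl (sym (Qf-suc i)) refl))) })
            z≤n (sizing e₀ refl refl (sym Qf-0) refl) id)
          ⨾# λ { (sizing {v} e₀ e₂ e₃ e₁₃ e₁₀) →
            :=⨾ (v# 0 e₀ *# v# 3 (trans e₃ pp-k) [ S≤W ]) (:=⨾ (k# 2 +# (v# 2 e₂ *# k# 2 [ ≤-trans (m≤n+m _ 2)
              stride≤W′ ]) [ stride≤W′ ])
            (:=⨾ ((k# 1 +# v# 5 refl [ ≤-trans (m≤m*n (suc S) stride) base₀≤W ]) *# v# 6 refl [ base₀≤W ])
            (:=# ((((k# 3 +# v# 2 e₂ [ 3+k≤W ]) +# v# 0 e₀ [ offF≤W ]) +# (v# 2 e₂ *# v# 0 e₀ [ ≤-trans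
              (m≤n+m _ offF) offI≤W ]) [ offI≤W ])
                  +# (v# 13 e₁₃ *# v# 0 e₀ [ ≤-trans (m≤n+m _ offI) (≤-trans (≤-reflexive (sym offA≡)) offA≤W)
                    ]) [ ≤-trans (≤-reflexive (sym offA≡)) offA≤W ])
            (sized e₀ e₂ (trans e₃ pp-k) refl refl refl (sym offA≡))))) }))))
          where
          stride≤W′ : stride ≤ W
          stride≤W′ = ≤-trans (m≤m+n stride _) base₀≤W

      outside : List ℕ → ℕ → Bool
      outside [] _ = true
      outside (a ∷ as) b = if b ≡ᵇ a then false else outside as b

      n≤L : ∀ {v} → v < n → v < L
      n≤L v< = <-≤-trans v< (≤-trans n≤S S≤L)

      module _ {σ : St} (e₀ : var σ 0 ≡ n) (e₂ : var σ 2 ≡ k) (e₃ : var σ 3 ≡ Bn) (e₄ : var σ 4 ≡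
        base₀) (e₅ : var σ 5 ≡ S) (e₆ : var σ 6 ≡ stride) (e₇ : var σ 7 ≡ offA) where

        data Offsets (u : ℕ) : St → Set where
          offsets : ∀ {v A} → KV 8 (var σ) v → EX (outside (6 ∷ 10 ∷ [])) (arr σ) A → v 13 ≡ so u → v 10 ≡ u →
            (∀ {w} → w < u → A 10 w ≡ so w) → (∀ {w} → w < u → A 6 w ≡ thr w) → Offsets u (st v (rnk σ) A)

        data Offset : St → Set where
          offset : ∀ {v A} → Glob v → EX (outside (6 ∷ 10 ∷ 11 ∷ [])) (arr σ) A →
            (∀ {w} → w < n → A 10 w ≡ so w) → (∀ {w} → w < n → A 6 w ≡ thr w) → (∀ {w} → w < n → A 11 w ≡
              po w) → Offset (st v (rnk σ) A)

        data Offsets′ (B : ℕ → ℕ → ℕ) (u : ℕ) : St → Set where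
          offsets′ : ∀ {v A} → Glob v → EX (outside (11 ∷ [])) B A → v 13 ≡ po u → v 10 ≡ u → (∀ {w} → w < u →
            A 11 w ≡ po w) → Offsets′ B u (st v (rnk σ) A)

        extend : ∀ {f g : ℕ → ℕ} {u} → (∀ {w} → w < u → f w ≡ g w) → ∀ {w} → w < suc u → (f [ u ↦ g u ]) w ≡ g w
        extend {f} {g} {u} old {w} w≤u with m≤n⇒m<n∨m≡n (s≤s⁻¹ w≤u)
        ... | inj₁ w<u = trans (put-≢ f _ (<⇒≢ w<u)) (old w<u)
        ... | inj₂ refl = put-≡ f u _

        so-n≤W : ∀ {u} → u < n → so u + length (sl u) ≤ W
        so-n≤W u< = ≤-trans (so-end u<) length≤W

        succ-body : ∀ {u σ′} → u < n → Offsets u σ′ → Run (setArr 10 (reg 10) (reg 13) ⨾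
          11 := inp (reg 7 ⟨+⟩ reg 10) ⨾ 13 := reg 13 ⟨+⟩ reg 11 ⨾
          ifLess (const 0) (inp ((const 3 ⟨+⟩ reg 2) ⟨+⟩ reg 10)) (setArr 6 (reg 10) (reg 11))
            (setArr 6 (reg 10) (const 1))) σ′ 0
          λ σ″ → var σ″ 10 ≡ u × Offsets (suc u) (σ″ ⟦ 10 ≔ suc u ⟧)
        succ-body {u} u< (offsets {v} {A} κ ε e₁₃ e₁₀ d₁₀ d₆) =
          arr⨾ 10 f₄ (v# 10 e₁₀) (n≤L u<) (v# 13 e₁₃) (:=⨾ (i# (v# 7 (trans (at κ 7) e₇) +# v# 10 e₁₀ [ At-≤W
            (deg-sl u<) ]) (deg-sl u<))
          (:=⨾ (v# 13 e₁₃ +# v# 11 refl [ so-n≤W u< ])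
            (if# (k# 0) (i# ((k# 3 +# v# 2 (trans (at κ 2) e₂) [ 3+k≤W ]) +# v# 10 e₁₀ [ At-≤W (at-v0 u<) ])
              (at-v0 u<))
            (λ pos → arr:=# 6 f₄ (v# 10 e₁₀) (n≤L u<) (v# 11 refl) (next (sym (thr-0 u< pos))))
            (λ le → arr:=# 6 f₄ (v# 10 e₁₀) (n≤L u<) (k# 1) (next (sym (thr-1 u< (n≤0⇒n≡0 le))))))))
          where
          f₄ : v 4 ≡ base₀
          f₄ = trans (at κ 4) e₄
          next : ∀ {x} → x ≡ thr u → v 10 ≡ u × Offsets (suc u) (st (((v [ 11 ↦ length (sl u) ]) [ 13 ↦ so u +
            length (sl u) ]) [ 10 ↦ suc u ]) (rnk σ)
            (λ b → if b ≡ᵇ 6 then (if b ≡ᵇ 10 then A b [ u ↦ so u ] else A b) [ u ↦ x ] else (if b ≡ᵇ 10 then A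
              b [ u ↦ so u ] else A b)))
          next refl = e₁₀ , offsets (kv-put (kv-put (kv-put κ))) (ex-put refl (ex-put refl ε)) (sym
            (so-suc u<)) refl (extend {A 10} d₁₀) (extend {A 6} d₆)

        offsets# : Run (succOffsets ⨾ predOffsets) σ n Offset
        offsets# = (:=⨾ (v# 7 e₇ +# v# 0 e₀ [ offA≤ ]) (:=⨾ (k# 0) (weaken# (≤-reflexive (*-identityʳ n))
          (for# {Q = Offsets n} Offsets
            (λ { (offsets _ _ _ e _ _) → e }) (λ { (offsets κ _ _ _ _ _) → v# 0 (trans (at κ 0) e₀) }) n≤W
              succ-body z≤n
            (offsets (kv-put (kv-put kv-refl)) ex-refl (sym so-0) refl (λ ()) (λ ())) id))))
          ⨾# λ { (offsets {v} {A} κ ε e₁₃ e₁₀ d₁₀ d₆) →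
            :=⨾ (v# 13 (trans e₁₃ so-n)) (:=⨾ (v# 13 (trans e₁₃ so-n) +# v# 0 (trans (at κ 0) e₀) [ offQ≤ ])
              (:=⨾ (k# 0)
            (weaken# (≤-reflexive (*-identityʳ n)) (for# {Q = Offset} (Offsets′ A)
              (λ { (offsets′ _ _ _ e _) → e }) (λ { (offsets′ g _ _ _ _) → v# 0 (g0 g) }) n≤W
              (λ { {u} u< (offsets′ {v′} {A′} g ε′ e₁₃ e₁₀ d₁₁) →
                arr⨾ 11 (g4 g) (v# 10 e₁₀) (n≤L u<) (v# 13 e₁₃)
                (:=# (v# 13 e₁₃ +# i# (v# 8 (g8 g) +# v# 10 e₁₀ [ At-≤W (deg-pl u<) ]) (deg-pl u<) [ ≤-trans
                  (po-end u<) length≤W ])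
                (e₁₀ , offsets′ (glob-kv (kv-put (kv-put kv-refl)) g) (ex-put refl ε′) (sym
                  (po-suc u<)) refl (extend {A′ 11} d₁₁))) })
              z≤n (offsets′ (glob (trans (at κ 0) e₀) (trans (at κ 2) e₂) (trans (at κ 3) e₃) (trans (at κ 4)
                e₄) (trans (at κ 5) e₅) (trans (at κ 6) e₆) (trans (at κ 7) e₇) refl) ex-refl (sym po-0) refl
                  (λ ()))
              λ { (offsets′ {A = A′} g ε′ _ _ d₁₁) → offset g (ex-trans both ε ε′) (λ {w} w< →
                trans (cong (λ f → f w) (same ε′ 10)) (d₁₀ w<)) (λ {w} w< →
                  trans (cong (λ f → f w) (same ε′ 6)) (d₆ w<)) d₁₁ })))) }
          where
          both : ∀ b → T (outside (6 ∷ 10 ∷ 11 ∷ []) b) → T (outside (6 ∷ 10 ∷ []) b) × T (outside (11 ∷ []) b)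
          both b t with b ≡ᵇ 6 | b ≡ᵇ 10 | b ≡ᵇ 11
          ... | false | false | false = tt , tt

      module _ {σ : St} (g : Glob (var σ)) where

        data Labelling (s : ℕ) : St → Set where
          labelling : ∀ {v A u x} → KV 9 (var σ) v → EX (outside (7 ∷ [])) (arr σ) A → v 10 ≡ s → v 11 ≡ u →
            v 12 ≡ x → s ≡ u * Bn + x → x < Bn →
            (∀ {t} → t < s → A 7 t ≡ vt t) → Labelling s (st v (rnk σ) A)

        data Labelled : St → Set where
          labelled : ∀ {v A} → KV 9 (var σ) v → EX (outside (7 ∷ [])) (arr σ) A → (∀ {t} → t < S → A 7 t ≡
            vt t) → Labelled (st v (rnk σ) A)

        label-body : ∀ {s σ′} → s < S → Labelling s σ′ → Run (setArr 7 (reg 10) (reg 11) ⨾ incr 12 ⨾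
          ifLess (reg 12) (reg 3) skip (12 := const 0 ⨾ incr 11)) σ′ 0
          λ σ″ → var σ″ 10 ≡ s × Labelling (suc s) (σ″ ⟦ 10 ≔ suc s ⟧)
        label-body {s} s< (labelling {v} {A} {u} {x} κ ε e₁₀ e₁₁ e₁₂ s≡ x< d) =
          arr⨾ 7 (trans (at κ 4) (g4 g)) (v# 10 e₁₀) (<-≤-trans s< S≤L) (v# 11 e₁₁)
            (:=⨾ (k# 1 +# v# 12 e₁₂ [ ≤-trans x< Bn≤W ])
          (if# (v# 12 refl) (v# 3 (trans (at κ 3) (g3 g)))
            (λ lt → skip# (e₁₀ , labelling (kv-put (kv-put κ)) (ex-put refl ε) refl e₁₁ refl (trans
              (cong suc s≡) (sym (+-suc _ x))) lt step))
            (λ ge → :=⨾ (k# 0) (:=# (k# 1 +# v# 11 e₁₁ [ ≤-trans u<n n≤W ])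
              (e₁₀ , labelling (kv-put (kv-put (kv-put (kv-put κ)))) (ex-put refl ε) refl refl refl
                (trans (cong suc s≡) (trans (sym (+-suc _ x)) (trans (cong (u * Bn +_) (≤-antisym x< ge))
                  (trans (+-comm (u * Bn) Bn) (sym (+-identityʳ _)))))) Bn>0 step)))))
          where
          vt≡ : vt s ≡ u
          vt≡ = trans (cong vt s≡) (vt-≡ x<)
          u<n : u < n
          u<n = subst (_< n) vt≡ (vt< s<)
          step : ∀ {t} → t < suc s → (A 7 [ s ↦ u ]) t ≡ vt t
          step {t} t≤s with m≤n⇒m<n∨m≡n (s≤s⁻¹ t≤s)
          ... | inj₁ t<s = trans (put-≢ (A 7) _ (<⇒≢ t<s)) (d t<s)
          ... | inj₂ refl = trans (put-≡ (A 7) s _) (sym vt≡)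

        vertices# : Run vertices σ S Labelled
        vertices# = :=⨾ (k# 0) (:=⨾ (k# 0) (:=⨾ (k# 0) (weaken# (≤-reflexive (*-identityʳ S))
          (for# {Q = Labelled} Labelling
          (λ { (labelling _ _ e _ _ _ _ _) → e }) (λ { (labelling κ _ _ _ _ _ _ _) →
            v# 5 (trans (at κ 5) (g5 g)) }) S≤W label-body z≤n
          (labelling (kv-put (kv-put (kv-put kv-refl))) ex-refl refl refl refl refl Bn>0 (λ ()))
          λ { (labelling κ ε _ _ _ _ _ d) → labelled κ ε d }))))

    -- Classes and next indices from the digits of state numbers.

    module Classes where
      open Initial public

      Cell : (ℕ → ℕ → ℕ) → ℕ → ℕ → Set
      Cell A j s = A 2 s ≡ part j s × (∀ {i} → j ≤ i → i < k → A 1 (s * (2 + k) + 2+ i) ≡ cl s (2+ i))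

      Cell-frame : ∀ {A A′ j t} → A′ 2 t ≡ A 2 t → (∀ {i} → i < k → A′ 1 (t * (2 + k) + 2+ i) ≡
        A 1 (t * (2 + k) + 2+ i)) → Cell A j t → Cell A′ j t
      Cell-frame e e′ (a , b) = trans e a , λ le lt → trans (e′ lt) (b le lt)

      Pf≤Bn : ∀ {i} → i ≤ k → Pf i ≤ Bn
      Pf≤Bn {zero} _ = ≤-reflexive Pf-0
      Pf≤Bn {suc i} i<k = ≤-trans (≤-trans (m≤n*m (Pf (suc i)) (lf i) {{>-nonZero (lf>0 i<k)}})
        (≤-reflexive (sym (Pf-step i<k)))) (Pf≤Bn (<⇒≤ i<k))

      Pf>0 : ∀ {i} → i ≤ k → 0 < Pf i
      Pf>0 {zero} _ = subst (0 <_) (sym Pf-0) Bn>0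
      Pf>0 {suc i} i<k with Pf (suc i) in eq
      ... | zero = contradiction (trans (trans (Pf-step i<k) (cong (lf i *_) eq)) (*-zeroʳ (lf i))) (>⇒≢
        (Pf>0 (<⇒≤ i<k)))
      ... | suc _ = z<s

      module _ {σ : St} (g : Glob (var σ)) (label : ∀ {t} → t < S → arr σ 7 t ≡ vt t) where

        ε-list : List ℕ
        ε-list = 1 ∷ 2 ∷ []

        -- Without division the machine finds the digit `d` of `s` by counting along: `lo` runs
        -- below the product of the later sizes, and `d` advances when `lo` wraps. The quotient `h`,
        -- which collects the vertex and the earlier components, is never stored.
        data Digits (i : ℕ) (s : ℕ) : St → Set where
          digits : ∀ {v A h d lo} → KV 9 (var σ) v → EX (outside ε-list) (arr σ) A →
            v 35 ≡ offI + Qf i * n → v 36 ≡ Pf (suc i) → v 37 ≡ i → v 38 ≡ lf i → v 39 ≡ offF + i * n → v 40 ≡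
              lo → v 41 ≡ d → v 10 ≡ s →
            s ≡ (h * lf i + d) * Pf (suc i) + lo → d < lf i → lo < Pf (suc i) →
            (∀ {t} → t < s → Cell A i t) → (∀ {t} → s ≤ t → t < S → Cell A (suc i) t) →
              Digits i s (st v (rnk σ) A)

        digit-body : ∀ {i s σ′} → i < k → s < S → Digits i s σ′ → Run classBody σ′ 0 λ σ″ → var σ″ 10 ≡ s ×
          Digits i (suc s) (σ″ ⟦ 10 ≔ suc s ⟧)
        digit-body {i} {s} i<k s< (digits {v} {A} {h} {d} {lo} κ ε e₃₅ e₃₆ e₃₇ e₃₈ e₃₉ e₄₀ e₄₁ e₁₀ s≡ d< lo<
          done todo) = go (suc d <? lf i) (fb i u) refl (ib i d u) refl
          where
          u = vt s
          u< : u < n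
          u< = vt< s<
          ℓ = lf i
          p = Pf (suc i)
          dg≡ : dg i s ≡ d
          dg≡ = dg-unique {h = h} {lo = lo} i<k s< s≡ d< lo<
          f₄ : v 4 ≡ base₀
          f₄ = trans (at κ 4) (g4 g)
          f₀ : v 0 ≡ n
          f₀ = trans (at κ 0) (g0 g)
          f₂ : v 2 ≡ k
          f₂ = trans (at κ 2) (g2 g)
          idx = s * (2 + k) + 2+ i
          idx<L : idx < L
          idx<L = row s< (s<s (s<s i<k))
          at-F : At input (offF + i * n + u) (fb i u)
          at-F = subst (λ j → At input j (fb i u)) (sym (+-assoc offF (i * n) u)) (at-fb i<k u<)
          at-I : At input (offI + Qf i * n + (d * n + u)) (ib i d u)
          at-I = subst (λ j → At input j (ib i d u)) (trans (cong (offI +_)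
            (trans (cong (_+ u) (*-distribʳ-+ n (Qf i) d)) (+-assoc (Qf i * n) (d * n) u)))
              (sym (+-assoc offI (Qf i * n) (d * n + u)))) (at-ib i<k d< u<)
          ℓ≤Bn : ℓ ≤ Bn
          ℓ≤Bn = ≤-trans (m≤m*n ℓ p {{>-nonZero (Pf>0 i<k)}}) (≤-trans (≤-reflexive (sym (Pf-step i<k)))
            (Pf≤Bn (<⇒≤ i<k)))
          Goal : Set
          Goal = Run classBody (st v (rnk σ) A) 0 λ σ″ → var σ″ 10 ≡ s × Digits i (suc s) (σ″ ⟦ 10 ≔ suc s ⟧)
          A₁ : ℕ → ℕ → ℕ
          A₁ b = if b ≡ᵇ 1 then A b [ idx ↦ cl s (2+ i) ] else A b
          A₂ : ℕ → ℕ → ℕ → ℕ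
          A₂ x b = if b ≡ᵇ 2 then A₁ b [ s ↦ x ] else A₁ b
          other : ∀ {t x j} → t ≢ s → Cell A j t → Cell (A₂ x) j t
          other {t} {x} t≢s = Cell-frame {A} {A₂ x} (put-≢ (A 2) x t≢s) λ {i′} i′<k → put-≢ (A 1) _ λ eq →
            t≢s (proj₁ (*+-unique (2 + k) {t} {s} (s<s (s<s i′<k)) (s<s (s<s i<k)) eq))
          new : ∀ {x} → x ≡ part i s → Cell (A₂ x) i s
          new {x} eq = trans (put-≡ (A 2) s x) eq , λ {i′} le lt → case m≤n⇒m<n∨m≡n le of λ
            { (inj₂ refl) → put-≡ (A 1) idx _
            ; (inj₁ i<i′) → trans (put-≢ (A 1) _ (λ e →
              <⇒≢ i<i′ (sym (suc-injective (suc-injective (+-cancelˡ-≡ (s * (2 + k)) _ _ e))))))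
                (proj₂ (todo ≤-refl s<) i<i′ lt) }
          -- nd is the cyclic successor of the component, nv the component of the successor.
          main : ∀ nd nv → (suc d < ℓ → nd ≡ suc d) → (ℓ ≤ suc d → nd ≡ 0) → (0 < ib i d u → nv ≡ nd) →
            (ib i d u ≡ 0 → nv ≡ d) →
            part i s ≡ part (suc i) s + nv * p → nd < ℓ → (∃[ h′ ] suc ((h * ℓ + d) * p + lo) ≡ (h′ * ℓ + nd) *
              p + 0 ⊎ suc lo < p) → Goal
          main nd nv nd-suc nd-0 nv-nd nv-d part≡ nd< wrap =
            if# {Q = st v₁ (rnk σ) A ≡_} (k# 1 +# v# 41 e₄₁ [ ≤-trans d< (≤-trans ℓ≤Bn Bn≤W) ]) (v# 38 e₃₈)
              (λ lt → :=# (ev-≡ (sym (nd-suc lt)) (k# 1 +# v# 41 e₄₁ [ ≤-trans d< (≤-trans ℓ≤Bn Bn≤W) ])) refl)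
              (λ ge → :=# (ev-≡ (sym (nd-0 ge)) (k# 0)) refl)
            ⨾# λ { refl → :=⨾ (ev-≡ (trans (cong (λ f → f s) (same ε 7)) (label s<)) (a# 7 f₄ (v# 10 e₁₀)
              (<-≤-trans s< S≤L)))
              (:=⨾ (i# (v# 39 e₃₉ +# v# 11 refl [ At-≤W at-F ]) at-F)
              (:=⨾ (i# (v# 35 e₃₅ +# ((v# 41 e₄₁ *# v# 0 f₀ [ ≤-trans (≤-trans (m≤m+n _ u) (m≤n+m _ (offI +
                Qf i * n))) (At-≤W at-I) ]) +# v# 11 refl [ ≤-trans (m≤n+m _ (offI + Qf i * n)) (At-≤W at-I) ])
                  [ At-≤W at-I ]) at-I)
              (:=⨾ ((v# 10 e₁₀ *# (k# 2 +# v# 2 f₂ [ ≤-trans k≤L L≤W ]) [ ≤-trans (m≤m+n _ (2+ i))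
                (≤-trans (<⇒≤ idx<L) L≤W) ]) +# (k# 2 +# v# 37 e₃₇ [ ≤-trans (m≤n+m _ (s * (2 + k)))
                  (≤-trans (<⇒≤ idx<L) L≤W) ]) [ ≤-trans (<⇒≤ idx<L) L≤W ])
              (if# {Q = st v₅ (rnk σ) A₁ ≡_} (k# 0) (v# 15 refl)
                (λ pos → arr:=# 1 f₄ (v# 12 refl) idx<L (ev-≡ (sym (cl-F i<k s< pos)) (k# 0)) refl)
                (λ f0 → if# (k# 0) (v# 16 refl)
                  (λ pos → arr:=# 1 f₄ (v# 12 refl) idx<L (ev-≡ (sym (cl-I i<k s< (n≤0⇒n≡0 f0) (subst (λ z →
                    0 < ib i z u) (sym dg≡) pos))) (k# 1)) refl)
                  (λ i0 → arr:=# 1 f₄ (v# 12 refl) idx<L (ev-≡ (sym (cl-O i<k s< (n≤0⇒n≡0 f0) (subst (λ z →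
                    ib i z u ≡ 0) (sym dg≡) (n≤0⇒n≡0 i0)))) (k# 2)) refl))
              ⨾# λ { refl → if# {Q = st v₆ (rnk σ) A₁ ≡_} (k# 0) (v# 16 refl)
                  (λ pos → :=# (ev-≡ (sym (nv-nd pos)) (v# 42 refl)) refl)
                  (λ i0 → :=# (ev-≡ (sym (nv-d (n≤0⇒n≡0 i0))) (v# 41 e₄₁)) refl)
              ⨾# λ { refl → arr⨾ 2 f₄ (v# 10 e₁₀) (<-≤-trans s< S≤L)
                  (ev-≡ (trans (cong (_+ nv * p) (proj₁ (todo ≤-refl s<))) (sym part≡)) (a# 2 f₄ (v# 10 e₁₀)
                    (<-≤-trans s< S≤L) +# (v# 16 refl *# v# 36 e₃₆ [ nvp≤W ]) [ subst (_≤ W)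
                      (sym (trans (cong (_+ nv * p) (proj₁ (todo ≤-refl s<))) (sym part≡))) part≤W ]))
                  (:=⨾ (k# 1 +# v# 40 e₄₀ [ ≤-trans lo< (≤-trans (Pf≤Bn i<k) Bn≤W) ])
                  (if# (v# 40 refl) (v# 36 e₃₆)
                    (λ lt → skip# (e₁₀ , digits {h = h} {d} {suc lo} (kv-put κ₇) ε₂ e₃₅ e₃₆ e₃₇ e₃₈ e₃₉ refl e₄₁
                      refl (trans (cong suc s≡) (sym (+-suc _ lo))) d< lt done′ todo′))
                    (λ ge → :=⨾ (k# 0) (:=# (v# 42 refl) (case wrap of λ
                      { (inj₂ lt) → contradiction lt (≤⇒≯ ge)
                      ; (inj₁ (h′ , eq)) → e₁₀ , digits {h = h′} {nd} {0} (kv-put (kv-put (kv-put κ₇))) ε₂ e₃₅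
                        e₃₆ e₃₇ e₃₈ e₃₉ refl refl refl (trans (cong suc s≡) eq) nd< (Pf>0 i<k) done′ todo′
                          }))))) } })))) }
            where
            v₁ v₅ v₆ : ℕ → ℕ
            v₁ = v [ 42 ↦ nd ]
            v₅ = (((v₁ [ 11 ↦ u ]) [ 15 ↦ fb i u ]) [ 16 ↦ ib i d u ]) [ 12 ↦ idx ]
            v₆ = v₅ [ 16 ↦ nv ]
            part≤W : part i s ≤ W
            part≤W = ≤-trans (part≤ s<) Bn≤W
            nvp≤W : nv * p ≤ W
            nvp≤W = ≤-trans (m≤n+m _ (part (suc i) s)) (≤-trans (≤-reflexive (sym part≡)) part≤W)
            κ₇ : ∀ {a} → KV 9 (var σ) (v₆ [ 40 ↦ a ])
            κ₇ = kv-put (kv-put (kv-put (kv-put (kv-put (kv-put (kv-put κ))))))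
            ε₂ : EX (outside ε-list) (arr σ) (A₂ (part i s))
            ε₂ = ex-put {outside ε-list} refl (ex-put {outside ε-list} refl ε)
            done′ : ∀ {t} → t < suc s → Cell (A₂ (part i s)) i t
            done′ {t} t≤s = case m≤n⇒m<n∨m≡n (s≤s⁻¹ t≤s) of λ { (inj₁ t<s) → other (<⇒≢ t<s) (done t<s) ;
              (inj₂ refl) → new refl }
            todo′ : ∀ {t} → suc s ≤ t → t < S → Cell (A₂ (part i s)) (suc i) t
            todo′ s<t t< = other (>⇒≢ s<t) (todo (<⇒≤ s<t) t<)
          up : suc d < ℓ → ∃[ h′ ] suc ((h * ℓ + d) * p + lo) ≡ (h′ * ℓ + suc d) * p + 0 ⊎ suc lo < p
          up _ with m≤n⇒m<n∨m≡n lo<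
          ... | inj₁ lt = inj₂ lt
          ... | inj₂ eq = inj₁ (h , trans (sym (+-suc _ lo)) (trans (cong ((h * ℓ + d) * p +_) eq)
            (trans (+-comm _ p) (trans (cong (_* p) (sym (+-suc (h * ℓ) d))) (sym (+-identityʳ _))))))
          around : suc d ≡ ℓ → ∃[ h′ ] suc ((h * ℓ + d) * p + lo) ≡ (h′ * ℓ + 0) * p + 0 ⊎ suc lo < p
          around eq′ with m≤n⇒m<n∨m≡n lo<
          ... | inj₁ lt = inj₂ lt
          ... | inj₂ eq = inj₁ (suc h , trans (sym (+-suc _ lo)) (trans (cong ((h * ℓ + d) * p +_) eq)
            (trans (+-comm _ p)
              (trans (cong (_* p) (trans (sym (+-suc (h * ℓ) d)) (trans (cong (h * ℓ +_) eq′)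
                (trans (+-comm (h * ℓ) ℓ) (sym (+-identityʳ _)))))) (sym (+-identityʳ _))))))
          go : Dec (suc d < ℓ) → ∀ f → fb i u ≡ f → ∀ b → ib i d u ≡ b → Goal
          go (yes lt) _ _ zero b≡ = main (suc d) d (λ _ → refl) (λ ge → contradiction lt (≤⇒≯ ge)) (λ pos →
            contradiction b≡ (>⇒≢ pos)) (λ _ → refl)
            (subst (λ z → part i s ≡ part (suc i) s + z * p) dg≡ (part-keep i<k s< (trans (cong (λ z →
              ib i z u) dg≡) b≡))) lt (up lt)
          go (yes lt) _ _ (suc b) b≡ = main (suc d) (suc d) (λ _ → refl) (λ ge →
            contradiction lt (≤⇒≯ ge)) (λ _ → refl) (λ e → contradiction (trans (sym b≡) e) λ ())
            (subst (λ z → part i s ≡ part (suc i) s + suc z * p) dg≡ (part-suc i<k s<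
              (subst (0 <_) (sym (trans (cong (λ z → ib i z u) dg≡) b≡)) z<s) (subst (λ z → suc z < ℓ) (sym dg≡)
                lt))) lt (up lt)
          go (no ≮) _ _ zero b≡ = main 0 d (λ lt → contradiction lt ≮) (λ _ → refl) (λ pos →
            contradiction b≡ (>⇒≢ pos)) (λ _ → refl)
            (subst (λ z → part i s ≡ part (suc i) s + z * p) dg≡ (part-keep i<k s< (trans (cong (λ z →
              ib i z u) dg≡) b≡))) (≤-<-trans z≤n d<) (around (≤-antisym d< (≮⇒≥ ≮)))
          go (no ≮) _ _ (suc b) b≡ = main 0 0 (λ lt → contradiction lt ≮) (λ _ → refl) (λ _ → refl) (λ e →
            contradiction (trans (sym b≡) e) λ ())
            (part-wrap i<k s< (subst (0 <_) (sym (trans (cong (λ z → ib i z u) dg≡) b≡)) z<s)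
              (trans (cong suc dg≡) (≤-antisym d< (≮⇒≥ ≮)))) (≤-<-trans z≤n d<) (around (≤-antisym d< (≮⇒≥ ≮)))

        data Classing : ℕ → St → Set where
          classing : ∀ {v A} i → i ≤ k → KV 9 (var σ) v → EX (outside ε-list) (arr σ) A → v 35 ≡ offI + Qf i *
            n → v 36 ≡ Pf i → v 37 ≡ i →
            (∀ {t} → t < S → Cell A i t) → Classing (i * suc S) (st v (rnk σ) A)

        data Classed : St → Set where
          classed : ∀ {v A} → KV 9 (var σ) v → EX (outside ε-list) (arr σ) A → (∀ {t} → t < S → Cell A 0 t) →
            Classed (st v (rnk σ) A)

        class-step : ∀ {φ σ′} → Classing φ σ′ → ∃[ y ] ∃[ z ] Ev σ′ (const 0) y × Ev σ′ (reg 37) z ×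
          (y < z → ∃[ w ] Run classStep σ′ w λ σ″ → ∃[ φ′ ] Classing φ′ σ″ × suc w + φ′ ≤ φ) ×
            (z ≤ y → Classed σ′)
        class-step (classing zero _ κ ε _ _ e₃₇ cells) = 0 , 0 , k# 0 , v# 37 e₃₇ , (λ ()) , λ _ →
          classed κ ε cells
        class-step (classing {v} {A} (suc i) i<k κ ε e₃₅ e₃₆ e₃₇ cells) = 0 , suc i , k# 0 , v# 37 e₃₇ ,
          (λ _ → S , :=⨾ (v# 37 e₃₇ ∸# k# 1) (:=⨾ (i# (k# 3 +# v# 37 refl [ At-≤W (at-ℓ i<k) ]) (at-ℓ i<k))
            (:=⨾ (ev-≡ back (v# 35 e₃₅ ∸# (v# 38 refl *# v# 0 f₀ [ ≤-trans (m≤n+m _ (Qf i * n))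
              (≤-trans (≤-reflexive (sym Qn)) Qn≤W) ])))
            (:=⨾ (((k# 3 +# v# 2 (trans (at κ 2) (g2 g)) [ 3+k≤W ]) +# v# 0 f₀ [ offF≤W ]) +# (v# 37 refl *# v#
              0 f₀ [ ≤-trans (m≤n+m _ offF) offFi≤W ]) [ offFi≤W ])
            (:=⨾ (k# 0) (:=⨾ (k# 0) (:=⨾ (k# 0)
            (weaken# (≤-reflexive (*-identityʳ S)) (for# {Q = Digits i S} (Digits i)
              (λ { (digits _ _ _ _ _ _ _ _ _ e _ _ _ _ _) → e })
              (λ { (digits κ _ _ _ _ _ _ _ _ _ _ _ _ _ _) → v# 5 (trans (at κ 5) (g5 g)) }) S≤W (digit-body i<k)
                z≤n
              (digits {h = 0} {0} {0} (kv-put (kv-put (kv-put (kv-put (kv-put (kv-put (kv-put κ))))))) ε refl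
                e₃₆ refl refl refl refl refl refl refl (lf>0 i<k) (Pf>0 i<k) (λ ()) (λ _ t< → cells t<)) id)
            ⨾# λ { (digits {v′} {A′} κ′ ε′ e₃₅ e₃₆ e₃₇ e₃₈ e₃₉ e₄₀ e₄₁ e₁₀ _ _ _ done _) →
              :=# (v# 38 e₃₈ *# v# 36 e₃₆ [ ≤-trans (≤-reflexive (sym (Pf-step i<k))) (≤-trans (Pf≤Bn (<⇒≤ i<k))
                Bn≤W) ])
                (i * suc S , classing i (<⇒≤ i<k) (kv-put κ′) ε′ e₃₅ (sym (Pf-step i<k)) e₃₇ done ,
                  ≤-refl) })))))))) , λ ()
          where
          f₀ : v 0 ≡ n
          f₀ = trans (at κ 0) (g0 g)
          Qn : Qf (suc i) * n ≡ Qf i * n + lf i * n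
          Qn = trans (cong (_* n) (Qf-suc i)) (*-distribʳ-+ n (Qf i) (lf i))
          Qn≤W : Qf (suc i) * n ≤ W
          Qn≤W = ≤-trans (*-monoˡ-≤ n (Qf-mono i<k)) (≤-trans (m≤n+m _ offI) (≤-trans (≤-reflexive (sym offA≡))
            offA≤W))
          back : offI + Qf (suc i) * n ∸ lf i * n ≡ offI + Qf i * n
          back = trans (cong (λ z → offI + z ∸ lf i * n) Qn) (trans (cong (_∸ lf i * n)
            (sym (+-assoc offI (Qf i * n) (lf i * n)))) (m+n∸n≡m _ (lf i * n)))
          offFi≤W : offF + i * n ≤ W
          offFi≤W = ≤-trans (+-monoʳ-≤ offF (*-monoˡ-≤ n (<⇒≤ i<k))) offI≤W

        classes# : (∀ t → arr σ 2 t ≡ 0) → Run classes σ (k * suc S) Classed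
        classes# zeros = :=⨾ (v# 7 (g7 g)) (:=⨾ (k# 1) (:=⨾ (v# 2 (g2 g)) (while# {Q = Classed} Classing
          class-step
          (classing k ≤-refl (kv-put (kv-put (kv-put kv-refl))) ex-refl offA≡ (sym Pf-k) refl (λ {t} _ →
            trans (zeros t) (sym (part-k t)) , λ le lt → contradiction lt (≤⇒≯ le))))))

    -- Predecessor chains and initial ranks.

    module States where
      open Classes public
      open Num
      open Succ

      -- How many states at vertex `v` are among the first `s` states.
      cut : ℕ → ℕ → ℕ
      cut v s = (s ∸ v * Bn) ⊓ Bn

      module _ {s : ℕ} (s< : s < S) where

        xt≡ : s ∸ vt s * Bn ≡ xt s
        xt≡ = trans (cong (_∸ vt s * Bn) (sym (vt-xt s))) (m+n∸m≡n (vt s * Bn) (xt s))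

        cut-here : cut (vt s) s ≡ xt s
        cut-here = trans (cong (_⊓ Bn) xt≡) (m≤n⇒m⊓n≡m (<⇒≤ (xt< s)))

        cut-suc : cut (vt s) (suc s) ≡ suc (xt s)
        cut-suc = trans (cong (_⊓ Bn) (trans (+-∸-assoc 1 (≤-trans (m≤m+n (vt s * Bn) (xt s))
          (≤-reflexive (vt-xt s)))) (cong suc xt≡))) (m≤n⇒m⊓n≡m (xt< s))

        cut-off : ∀ {v} → v ≢ vt s → cut v (suc s) ≡ cut v s
        cut-off {v} v≢ with <-cmp v (vt s)
        ... | tri≈ _ eq _ = contradiction eq v≢
        ... | tri< lt _ _ = trans (m≥n⇒m⊓n≡n (≤-trans full (∸-monoˡ-≤ (v * Bn) (n≤1+n s)))) (sym
          (m≥n⇒m⊓n≡n full))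
          where
          full : Bn ≤ s ∸ v * Bn
          full = ≤-trans (≤-reflexive (sym (m+n∸n≡m Bn (v * Bn)))) (∸-monoˡ-≤ (v * Bn)
            (≤-trans (*-monoˡ-≤ Bn lt) (≤-trans (m≤m+n _ (xt s)) (≤-reflexive (vt-xt s)))))
        ... | tri> _ _ gt = cong (_⊓ Bn) (trans (m≤n⇒m∸n≡0 le) (sym (m≤n⇒m∸n≡0 (<⇒≤ le))))
          where
          le : suc s ≤ v * Bn
          le = ≤-trans (≤-trans (≤-reflexive (cong suc (sym (vt-xt s))))
            (≤-trans (≤-reflexive (sym (+-suc _ (xt s)))) (≤-trans (+-monoʳ-≤ (vt s * Bn) (xt< s))
              (≤-reflexive (+-comm _ Bn))))) (*-monoˡ-≤ Bn gt)

      cut-0 : ∀ v → cut v 0 ≡ 0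
      cut-0 v = cong (_⊓ Bn) (0∸n≡0 (v * Bn))

      cut-S : ∀ {v} → v < n → cut v S ≡ Bn
      cut-S {v} v< = m≥n⇒m⊓n≡n (≤-trans (≤-reflexive (sym (m+n∸n≡m Bn (v * Bn)))) (∸-monoˡ-≤ (v * Bn)
        (*-monoˡ-≤ Bn v<)))

      Chains : (ℕ → ℕ → ℕ) → ℕ → Set
      Chains A s = ∀ {v c} → v < n → c < Bn → Chain (λ x → A 4 (v * Bn + x)) (A 3 (v * Bn + c)) (pre v c
        (cut v s))

      -- State `s` enters one chain only, that of its vertex for `nx s`. Since `pre` runs downwards,
      -- a new front element is exactly what extending `cut` by one requires; all other chains stay
      -- intact because their cells are not written.
      Chains-step : ∀ {f g s} → s < S →
        (∀ {v c} → v < n → c < Bn → Chain (λ x → f (v * Bn + x)) (g (v * Bn + c)) (pre v c (cut v s))) →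
        ∀ {v c} → v < n → c < Bn →
        Chain (λ x → (f [ s ↦ g (vt s * Bn + nx s) ]) (v * Bn + x)) ((g [ vt s * Bn + nx s ↦ suc (xt s) ]) (v *
          Bn + c)) (pre v c (cut v (suc s)))
      Chains-step {f} {g} {s} s< chains {v} {c} v< c< with v ≟ vt s
      ... | no v≢ rewrite cut-off s< v≢ | put-≢ g {vt s * Bn + nx s} {v * Bn + c} (suc (xt s)) (λ eq →
        v≢ (proj₁ (*+-unique Bn {v} {vt s} c< (nx< s<) eq)))
        = Chain-frame (pre v c (cut v s)) (λ {x} x∈ → sym (put-≢ f _ λ eq → v≢ (proj₁ (*+-unique Bn {v} {vt s}
            (<-≤-trans (proj₁ (∈pre _ x∈)) (m⊓n≤n (s ∸ v * Bn) Bn)) (xt< s) (trans eq (sym (vt-xt s)))))))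
              (chains v< c<)
      ... | yes refl rewrite cut-suc s< with chains (vt< s<) c<
      ...   | old rewrite cut-here s< with nx (vt s * Bn + xt s) ≡ᵇ c in e
      ...     | true  = trans (cong (λ j → (g [ vt s * Bn + nx s ↦ suc (xt s) ]) (vt s * Bn + j))
        (sym c≡)) (put-≡ g _ _) ,
        subst (λ h → Chain (λ x → (f [ s ↦ g (vt s * Bn + nx s) ]) (vt s * Bn + x)) h (pre (vt s) c (xt s)))
          (trans (cong (λ j → g (vt s * Bn + j)) (sym c≡)) (sym (trans (cong (f [ s ↦ g (vt s * Bn + nx s) ])
            (vt-xt s)) (put-≡ f s _)))) frame
        where
        c≡ : nx s ≡ c
        c≡ = trans (cong nx (sym (vt-xt s))) (≡ᵇ⇒≡ _ c (subst T (sym e) tt))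
        frame : Chain (λ x → (f [ s ↦ g (vt s * Bn + nx s) ]) (vt s * Bn + x)) (g (vt s * Bn + c))
          (pre (vt s) c (xt s))
        frame = Chain-frame _ (λ {x} x∈ → sym (put-≢ f _ λ eq → <⇒≢ (proj₁ (∈pre _ x∈)) (+-cancelˡ-≡ (vt s * Bn)
          x (xt s) (trans eq (sym (vt-xt s)))))) old
      ...     | false = subst (λ h → Chain (λ x → (f [ s ↦ g (vt s * Bn + nx s) ]) (vt s * Bn + x)) h (pre
        (vt s) c (xt s)))
          (sym (put-≢ g _ λ eq → subst T (trans (cong (λ z → nx z ≡ᵇ c) (sym (vt-xt s))) e) (≡⇒≡ᵇ (nx s) c
            (sym (+-cancelˡ-≡ (vt s * Bn) c (nx s) eq)))))
          (Chain-frame _ (λ {x} x∈ → sym (put-≢ f _ λ eq → <⇒≢ (proj₁ (∈pre _ x∈)) (+-cancelˡ-≡ (vt s * Bn) x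
            (xt s) (trans eq (sym (vt-xt s)))))) old)

      module _ {σ : St} (g : Glob (var σ)) (label : ∀ {t} → t < S → arr σ 7 t ≡ vt t) (cells : ∀ {t} → t < S →
        Cell (arr σ) 0 t)
               (zero-rnk : ∀ j → rnk σ j ≡ 0) (zero-3 : ∀ j → arr σ 3 j ≡ 0) where

        -- The class table is already complete for the keys of pairs, those above 1; only the two
        -- head keys are entered state by state.
        data Laying (s : ℕ) : St → Set where
          laying : ∀ {v R A} → KV 9 (var σ) v → EX (outside (1 ∷ 3 ∷ 4 ∷ [])) (arr σ) A → v 10 ≡ s →
            (∀ {t p} → t < S → p < 2 + k → t < s ⊎ 1 < p → A 1 (t * (2 + k) + p) ≡ cl t p) → Chains A s →
            (∀ {t} → t < s → Stored 0 R (t * stride) (initWord k)) → (∀ {j} → s * stride ≤ j → R j ≡ 0) →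
              Laying s (st v R A)

        state-body : ∀ {s σ′} → s < S → Laying s σ′ → Run stateBody σ′ k λ σ″ → var σ″ 10 ≡ s ×
          Laying (suc s) (σ″ ⟦ 10 ≔ suc s ⟧)
        state-body {s} s< (laying {v} {R} {A} κ ε e₁₀ keys chains ranks zeros) =
          :=⨾ (v# 10 e₁₀ *# (k# 2 +# v# 2 f₂ [ ≤-trans k≤L L≤W ]) [ ≤-trans (m≤m+n c0 0)
            (≤-trans (<⇒≤ (row s< z<s)) L≤W) ])
          (arr⨾ 1 f₄ (v# 12 refl) c0<L (k# 2) (arr⨾ 1 f₄ (k# 1 +# v# 12 refl [ ≤-trans (<⇒≤ c1<L) L≤W ]) c1<L
            (k# 1)
          (:=⨾ (ev-≡ vtB (a# 7 f₄ (v# 10 e₁₀) s<L *# v# 3 f₃ [ subst (_≤ W) (sym vtB) (vBn≤W (vt< s<)) ]))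
          (:=⨾ (ev-≡ (cong (vt s * Bn +_) nx≡) (v# 15 refl +# a# 2 f₄ (v# 10 e₁₀) s<L [ subst (λ z →
            vt s * Bn + z ≤ W) (sym nx≡) (state≤W (vt< s<) (nx< s<)) ]))
          (arr⨾ 4 f₄ (v# 10 e₁₀) s<L (a# 3 f₄ (v# 16 refl) tgt<L)
          (arr⨾ 3 f₄ (v# 16 refl) tgt<L (ev-≡ (cong suc (xt≡ s<)) (k# 1 +# (v# 10 e₁₀ ∸# v# 15 refl) [ subst
            (λ z → suc z ≤ W) (sym (xt≡ s<)) (≤-trans (xt< s) Bn≤W) ]))
          (:=⨾ (k# 2 +# (v# 10 e₁₀ *# v# 6 (trans (at κ 6) (g6 g)) [ slot≤W (<⇒≤ s<) ]) [ subst (_≤ W)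
            (+-comm i₀ 2) (≤-trans (two-in 0 z≤n) base₀≤W) ]) (:=⨾ (k# 0)
          (weaken# (≤-reflexive (*-identityʳ k)) (for# {Q = λ σ″ → var σ″ 10 ≡ s ×
            Laying (suc s) (σ″ ⟦ 10 ≔ suc s ⟧)} Filling
            (λ { (filling _ _ _ e _ _ _) → e }) (λ { (filling κ′ _ _ _ _ _ _) → v# 2 (trans (at κ′ 2) (g2 g)) })
              k≤W
            fill-body z≤n (filling {v′ = v₉} {R} (kv-put (kv-put (kv-put (kv-put (kv-put κ))))) e₁₀
              (sym (+-comm i₀ 2)) refl (zeros ≤-refl , zeros (n≤1+n i₀) , tt) (λ le →
                zeros (≤-trans (m≤m+n i₀ 2) le)) (λ _ → refl))
            finish))))))))))
          where
          f₄ : v 4 ≡ base₀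
          f₄ = trans (at κ 4) (g4 g)
          f₂ : v 2 ≡ k
          f₂ = trans (at κ 2) (g2 g)
          f₃ : v 3 ≡ Bn
          f₃ = trans (at κ 3) (g3 g)
          s<L : s < L
          s<L = <-≤-trans s< S≤L
          c0 = s * (2 + k)
          i₀ = s * stride
          tgt = vt s * Bn + nx s
          tgt<L : tgt < L
          tgt<L = <-≤-trans (state< (vt< s<) (nx< s<)) S≤L
          c0<L : c0 < L
          c0<L = subst (_< L) (+-identityʳ c0) (row s< z<s)
          c1<L : suc c0 < L
          c1<L = subst (_< L) (+-comm c0 1) (row s< (s<s z<s))
          vtB : A 7 s * Bn ≡ vt s * Bn
          vtB = cong (_* Bn) (trans (cong (λ f → f s) (same ε 7)) (label s<))
          nx≡ : A 2 s ≡ nx s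
          nx≡ = trans (cong (λ f → f s) (same ε 2)) (trans (proj₁ (cells s<)) (part-0 s<))
          two-in : ∀ a → a ≤ k → i₀ + suc a * 2 ≤ base₀
          A₁ A₂ : ℕ → ℕ
          A₁ = A 1 [ c0 ↦ 2 ]
          A₂ = A₁ [ suc c0 ↦ 1 ]
          A′ : ℕ → ℕ → ℕ
          A′ b = if b ≡ᵇ 3 then A⁗ b [ tgt ↦ suc (xt s) ] else A⁗ b
            where
            A″ A‴ A⁗ : ℕ → ℕ → ℕ
            A″ b = if b ≡ᵇ 1 then A b [ c0 ↦ 2 ] else A b
            A‴ b = if b ≡ᵇ 1 then A″ b [ suc c0 ↦ 1 ] else A″ b
            A⁗ b = if b ≡ᵇ 4 then A‴ b [ s ↦ A 3 tgt ] else A‴ b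
          v₉ : ℕ → ℕ
          v₉ = ((((v [ 12 ↦ c0 ]) [ 15 ↦ vt s * Bn ]) [ 16 ↦ tgt ]) [ 17 ↦ 2 + i₀ ]) [ 18 ↦ 0 ]
          two-in a a≤k = ≤-trans (+-monoʳ-≤ i₀ (s≤s (s≤s (*-monoˡ-≤ 2 a≤k)))) (slot (<⇒≤ s<))
          data Filling (a : ℕ) : St → Set where
            filling : ∀ {v′ R′} → KV 9 (var σ) v′ → v′ 10 ≡ s → v′ 17 ≡ i₀ + suc a * 2 → v′ 18 ≡ a →
              Stored 0 R′ i₀ ((0 , 0) ∷ flat (base a)) →
              (∀ {j} → i₀ + suc a * 2 ≤ j → R′ j ≡ 0) → (∀ {j} → j < i₀ → R′ j ≡ R j) → Filling a (st v′ R′ A′)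
          fill-body : ∀ {a σ′} → a < k → Filling a σ′ → Run (store (reg 17) (reg 18) ⨾
            17 := const 2 ⟨+⟩ reg 17) σ′ 0 λ σ″ → var σ″ 18 ≡ a × Filling (suc a) (σ″ ⟦ 18 ≔ suc a ⟧)
          fill-body {a} a<k (filling {v′} {R′} κ′ e₁₀ e₁₇ e₁₈ sto z low) =
            rnk⨾ (v# 17 e₁₇) d< (v# 18 e₁₈) (:=# (k# 2 +# v# 17 e₁₇ [ ≤-trans (≤-reflexive end)
              (≤-trans (two-in (suc a) a<k) base₀≤W) ])
            (e₁₈ , filling (kv-put (kv-put κ′)) e₁₀ end refl
              (subst (λ ks → Stored 0 R″ i₀ ((0 , 0) ∷ ks)) (sym (trans (cong flat (base-snoc a))
                (Listₚ.map-++ (_, 0) (base a) (2+ a ∷ []))))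
                (Stored-snoc i₀ (0 , 0) (flat (base a))
                  (Stored-frame i₀ ((0 , 0) ∷ flat (base a)) (λ {j} _ lt →
                    put-≢ R′ a (<⇒≢ (subst (λ m → j < i₀ + suc m * 2) (length-flat-base a) lt))) sto)
                  (subst (λ m → 2 + R″ (i₀ + suc m * 2) ≡ 2+ a) (sym (length-flat-base a))
                    (cong 2+ (put-≡ R′ d a)))
                  (subst (λ m → R″ (suc (i₀ + suc m * 2)) ≡ 0) (sym (length-flat-base a))
                    (trans (put-≢ R′ {d} a (>⇒≢ (n<1+n d))) (z (n≤1+n d))))))
              (λ le → trans (put-≢ R′ a (>⇒≢ (<-≤-trans (≤-trans (n<1+n d) (≤-trans (n≤1+n (suc d))
                (≤-reflexive end))) le))) (z (≤-trans (≤-trans (m≤n+m d 2) (≤-reflexive end)) le)))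
              λ lt → trans (put-≢ R′ a (<⇒≢ (<-≤-trans lt (m≤m+n i₀ _)))) (low lt)))
            where
            d = i₀ + suc a * 2
            R″ : ℕ → ℕ
            R″ = R′ [ d ↦ a ]
            end : 2 + d ≡ i₀ + suc (suc a) * 2
            end = sym (trans (+-suc i₀ _) (cong suc (+-suc i₀ _)))
            d< : d < base₀
            d< = ≤-trans (≤-trans (n≤1+n (suc d)) (≤-reflexive end)) (two-in (suc a) a<k)
          finish : ∀ {σ′} → Filling k σ′ → var σ′ 10 ≡ s × Laying (suc s) (σ′ ⟦ 10 ≔ suc s ⟧)
          finish (filling {v′} {R′} κ′ e₁₀ _ _ sto z low) = e₁₀ ,
            laying (kv-put κ′) (ex-put refl (ex-put refl (ex-put refl (ex-put refl ε)))) refl keys′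
            (Chains-step {A 4} {A 3} s< chains)
            (λ {t} t≤s → case m≤n⇒m<n∨m≡n (s≤s⁻¹ t≤s) of λ
              { (inj₁ t<s) → Stored-slot {t = t} tidy-init (λ {j} le lt →
                low (<-≤-trans lt (≤-trans (≤-reflexive (+-comm (t * stride) stride)) (*-monoˡ-≤ stride t<s))))
                  (ranks t<s)
              ; (inj₂ refl) → sto })
            (λ le → z (≤-trans (≤-reflexive (+-comm i₀ stride)) le))
            where
            tidy-init : Tidy n k (initWord k)
            tidy-init = finite n>0 (Allₚ.map⁺ (All.universal (λ _ → n>0) (base k))) (subst (_↭ base k)
              (sym (keys-flat (base k))) ↭-refl)
            keys′ : ∀ {t p} → t < S → p < 2 + k → t < suc s ⊎ 1 < p → A₂ (t * (2 + k) + p) ≡ cl t p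
            keys′ {t} {p} t< p< q with t ≟ s
            ... | no t≢s = trans (put-≢ A₁ 1 (λ eq →
              t≢s (proj₁ (*+-unique (2 + k) {t} {s} p< (s<s z<s) (trans eq (+-comm 1 c0))))))
                  (trans (put-≢ (A 1) 2 (λ eq → t≢s (proj₁ (*+-unique (2 + k) {t} {s} p< z<s
                    (trans eq (sym (+-identityʳ c0)))))))
                  (keys t< p< (case q of λ { (inj₁ t≤s) → inj₁ (≤∧≢⇒< (s≤s⁻¹ t≤s) t≢s) ; (inj₂ r) → inj₂ r })))
            keys′ {t} {0} t< p< q | yes refl = trans (cong A₂ (+-identityʳ c0)) (trans (put-≢ A₁ {suc c0} 1
              (<⇒≢ (n<1+n c0))) (trans (put-≡ (A 1) c0 2) (sym (cl-0 t))))
            keys′ {t} {1} t< p< q | yes refl = trans (cong A₂ (+-comm c0 1)) (trans (put-≡ A₁ (suc c0) 1)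
              (sym (cl-1 t)))
            keys′ {t} {suc (suc p)} t< p< q | yes refl =
              trans (put-≢ A₁ 1 (λ eq → contradiction (+-cancelˡ-≡ c0 (2+ p) 1 (trans eq (+-comm 1 c0))) λ ()))
                  (trans (put-≢ (A 1) 2 (λ eq → contradiction (+-cancelˡ-≡ c0 (2+ p) 0
                    (trans eq (sym (+-identityʳ c0)))) λ ())) (keys t< p< (inj₂ (s≤s (s≤s z≤n)))))

        data Laid : St → Set where
          laid : ∀ {v R A} → KV 9 (var σ) v → EX (outside (1 ∷ 3 ∷ 4 ∷ [])) (arr σ) A → (∀ {t p} → t < S →
            p < 2 + k → A 1 (t * (2 + k) + p) ≡ cl t p) →
            (∀ {v c} → v < n → c < Bn → Chain (λ x → A 4 (v * Bn + x)) (A 3 (v * Bn + c)) (pre v c Bn)) →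
              Ranks R (λ _ → initWord k) → Laid (st v R A)

        states# : Run states σ (S * suc k) Laid
        states# = :=⨾ (k# 0) (for# {Q = Laid} Laying (λ { (laying _ _ e _ _ _ _) → e })
          (λ { (laying κ _ _ _ _ _ _) → v# 5 (trans (at κ 5) (g5 g)) }) S≤W state-body z≤n
          (laying (kv-put kv-refl) ex-refl refl keys₀ (λ {v} {c} _ _ →
            subst (λ N → Chain (λ x → arr σ 4 (v * Bn + x)) (arr σ 3 (v * Bn + c)) (pre v c N)) (sym (cut-0 v))
              (zero-3 _)) (λ ()) (λ {j} _ → zero-rnk j))
          λ { (laying {A = A} κ ε _ keys chains ranks _) → laid κ ε (λ t< p< → keys t< p< (inj₁ t<))
            (λ {v} {c} v< c< → subst (λ N → Chain (λ x → A 4 (v * Bn + x)) (A 3 (v * Bn + c)) (pre v c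
              N)) (cut-S v<) (chains v< c<)) ranks })
          where
          keys₀ : ∀ {t p} → t < S → p < 2 + k → t < 0 ⊎ 1 < p → arr σ 1 (t * (2 + k) + p) ≡ cl t p
          keys₀ {t} {suc (suc p)} t< p< _ = proj₂ (cells t<) z≤n (s<s⁻¹ (s<s⁻¹ p<))
          keys₀ {p = 1} _ _ (inj₂ (s≤s ()))
          keys₀ {p = 0} _ _ (inj₂ ())

    -- The complete program and its running time.

    module Solver where
      open States public
      open Num
      open Succ

      r₀ : ℕ → Word
      r₀ _ = initWord k

      base-ascending : AllPairs _<_ (base k)
      base-ascending = subst (AllPairs _<_) (trans (availFrom-all (λ _ → 1) 0 k (λ _ → z<s))
        (sym (Listₚ.map-upTo 2+ k))) (availFrom-ascending (λ _ → 1) 0 k)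

      tidy₀ : Tidy n k (initWord k)
      tidy₀ = finite n>0 (small-flat (base k) n>0) (subst (_↭ base k) (sym (keys-flat (base k))) ↭-refl)

      num₀ : num (initWord k) ≡ 0
      num₀ rewrite keys-flat (base k) | less-0 (base k) = num-flat base-ascending

      -- The initial word has number 0, so no finite tidy word lies strictly below it.
      initWord-≼ : ∀ {x} → Tidy n k x → initWord k ≼ x
      initWord-≼ (infinite _) = key< z<s
      initWord-≼ {x} t@(finite w<n sm perm) with ≼-total (initWord k) x (trans (Tidy-length tidy₀)
        (sym (Tidy-length t)))
      ... | inj₁ le = le
      ... | inj₂ ge with ≼⇒num ge (prep 0 (tran perm (subst (base k ↭_) (sym (keys-flat (base k))) ↭-refl)))
        (w<n ∷ sm)
      ...   | inj₁ refl = ≼-refl _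
      ...   | inj₂ lt = contradiction (subst (num x <_) num₀ lt) λ ()

      count-cost : ℕ → ℕ
      count-cost s = length (sl (vt s)) * suc (suc k)

      module _ {σ : St} (g : Glob (var σ)) (tb : Tables (arr σ)) (ranks : Ranks (rnk σ) r₀) (zero-13 : ∀ t →
        arr σ 13 t ≡ 0) where

        -- States not counted so far have counter 0, below every threshold. With this reading the
        -- worklist is exact from the empty list on.
        data Tallying (zs : List ℕ) : St → Set where
          tallying : ∀ {v A} s m → KV 9 (var σ) v → KV 13 (arr σ) A → A 15 ≡ arr σ 15 → v 10 ≡ s →
            zs ≡ range s m → s + m ≡ S →
            (∀ {t} → t < s → A 13 t ≡ failures r₀ t) → (∀ {t} → s ≤ t → A 13 t ≡ 0) → Work (A 14) (v 9) (λ t →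
              thr (vt t) ≤ A 13 t) →
            Tallying zs (st v (rnk σ) A)

        tally-body : ∀ {z zs σ′} → Tallying (z ∷ zs) σ′ → Run (11 := arrE 7 (reg 10) ⨾
          recount) σ′ (count-cost z) λ σ″ →
          var σ″ 10 + suc (length zs) ≡ S × Tallying zs (σ″ ⟦ 10 ≔ suc (var σ″ 10) ⟧)
        tally-body (tallying s zero κ α a15 e₁₀ () eq done todo wk)
        tally-body (tallying {v} {A} s (suc m) κ α a15 e₁₀ refl eq done todo wk) =
          :=⨾ (ev-≡ (vertex# tb′ s<) (a# 7 (trans (at κ 4) (g4 g)) (v# 10 e₁₀) (<-≤-trans s< S≤L)))
            (post# (recount# {r = r₀} (glob-kv (kv-put κ) g) tb′ e₁₀ refl s< (λ t< → ranks t<) (λ _ → tidy₀)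
              (Work-map wk (λ {t} _ b → (λ { refl → <⇒≱ (thr>0 (vt t)) (subst (thr (vt t) ≤_) (todo ≤-refl)
                b) }) , b) (λ _ → proj₂)))
            λ { (recounted {v′} {A′} κ′ e₁₀′ _ _ α′ a15′ a13 wk′) →
              trans (cong (λ z → z + suc (length (range (suc s) m))) e₁₀′) (trans (cong (λ l →
                s + suc l) (length-range (suc s) m)) eq) ,
              tallying (suc s) m (kv-put (kv-trans κ (kv-trans (kv-put kv-refl) κ′))) (kv-trans α α′)
                (trans a15′ a15) (cong suc e₁₀′) refl (trans (sym (+-suc s m)) eq)
                (λ {t} t≤s → trans (cong (λ f → f t) a13) (case m≤n⇒m<n∨m≡n (s≤s⁻¹ t≤s) of λ
                  { (inj₁ t<s) → trans (put-≢ (A 13) _ (<⇒≢ t<s)) (done t<s) ; (inj₂ refl) →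
                    put-≡ (A 13) s _ }))
                (λ {t} s<t → trans (cong (λ f → f t) a13) (trans (put-≢ (A 13) _ (>⇒≢ s<t)) (todo (<⇒≤ s<t))))
                  wk′ })
          where
          s< : s < S
          s< = ≤-trans (m≤m+n (suc s) m) (≤-reflexive (trans (sym (+-suc s m)) eq))
          tb′ : Tables A
          tb′ = Tables-kv α (λ {a} a< → trans (cong (λ f → f a) a15) (clear# tb a<)) tb

        countAll# : Run countAll σ (sumTo (λ s → suc (count-cost s)) S) (MainInv (Φ r₀))
        countAll# = :=⨾ (k# 0) (:=⨾ (k# 0) (weaken# (≤-reflexive (trans (sym (+-identityʳ _)) (sumL-range (λ s →
          suc (count-cost s)) 0 S)))
          (each# {Q = MainInv (Φ r₀)} count-cost Tallying
            (λ { (tallying s m _ _ _ e refl eq _ _ _) → trans (cong₂ _+_ e (length-range s m)) eq })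
            (λ { (tallying _ _ κ _ _ _ _ _ _ _ _) → v# 5 (trans (at κ 5) (g5 g)) }) S≤W tally-body
            (tallying 0 S (kv-put (kv-put kv-refl)) kv-refl refl refl refl refl (λ ()) (λ {t} _ → zero-13 t)
              (work [] refl [] (λ ()) (λ {t} _ b → contradiction (subst (thr (vt t) ≤_) (zero-13 t) b) (<⇒≱
                (thr>0 (vt t))))))
            finish)))
          where
          finish : ∀ {σ′} → Tallying [] σ′ → MainInv (Φ r₀) σ′
          finish (tallying s zero κ α a15 _ _ eq done _ wk) = main-inv r₀ (glob-kv κ g)
            (Tables-kv α (λ {a} a< → trans (cong (λ f → f a) a15) (clear# tb a<)) tb) (λ t< → ranks t<) (λ _ →
              tidy₀) (λ _ ())
            (λ t< → done (subst (_ <_) (trans (sym eq) (+-identityʳ s)) t<)) wk (λ d td _ t< →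
              initWord-≼ (td t<))

      Tot : ℕ
      Tot = sumTo (λ s → suc (cost s)) S

      words>0 : ∀ j → 0 < words j
      words>0 zero    = z<s
      words>0 (suc j) = *-mono-< {0} {suc j * n} (*-mono-< {0} {suc j} z<s n>0) (words>0 j)

      total>0 : 0 < total
      total>0 = *-mono-< n>0 (words>0 k)

      Φ₀≤ : Φ r₀ ≤ Tot * total
      Φ₀≤ = ≤-trans (sumTo-mono S λ {s} _ → *-monoʳ-≤ (suc (cost s)) (m∸n≤m total (rank (initWord k))))
        (≤-reflexive (sumTo-*ʳ (λ s → suc (cost s)) total S))

      Tot≤ : Tot ≤ Tot * total
      Tot≤ = m≤m*n Tot total {{>-nonZero total>0}}

      S*stride≤ : S * stride ≤ Tot
      S*stride≤ = ≤-trans (≤-reflexive (sym (sumTo-const stride S))) (sumTo-mono S λ _ →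
        ≤-trans (m≤m+n stride _) (n≤1+n _))

      suc-k≤stride : suc k ≤ stride
      suc-k≤stride = s≤s (≤-trans (≤-reflexive (sym (*-identityʳ k))) (≤-trans (*-monoʳ-≤ k (n≤1+n 1))
        (n≤1+n (k * 2))))

      -- All phases are measured against one bound. Each phase of the initialisation is dominated by
      -- a single step at every state, and the main loop by such a sum for each possible value of
      -- the ranks.
      solve# : ∀ {v} → v 0 ≡ n → Run solve (st v (λ _ → 0) (λ _ _ → 0)) (Tot * total) Final
      solve# {v} e₀ = weaken# k≤U (readSizes# {A₀ = λ _ _ → 0} e₀) ⨾# λ { (sized e₀ e₂ e₃ e₄ e₅ e₆ e₇) →
        weaken# (≤-trans n≤S S≤U) (offsets# e₀ e₂ e₃ e₄ e₅ e₆ e₇) ⨾# λ { (offset {v₁} {A₁} g₁ ε₁ d₁₀ d₆ d₁₁) →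
        weaken# S≤U (vertices# g₁) ⨾# λ { (labelled {v₂} {A₂} κ₂ ε₂ d₇) →
        weaken# kS≤U (classes# (glob-kv κ₂ g₁) d₇ (λ t → trans (cong (λ f → f t) (same ε₂ 2)) (cong (λ f →
          f t) (same ε₁ 2)))) ⨾# λ { (classed {v₃} {A₃} κ₃ ε₃ cells) →
        weaken# Sk≤U (states# (glob-kv κ₃ (glob-kv κ₂ g₁)) (λ {t} t< →
          trans (cong (λ f → f t) (same ε₃ 7)) (d₇ t<)) cells (λ _ → refl)
          (λ t → trans (cong (λ f → f t) (same ε₃ 3)) (trans (cong (λ f → f t) (same ε₂ 3)) (cong (λ f →
            f t) (same ε₁ 3))))) ⨾# λ { (laid {v₄} {R₄} {A₄} κ₄ ε₄ keys chains ranks) →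
        weaken# count≤U (countAll# (glob-kv κ₄ (glob-kv κ₃ (glob-kv κ₂ g₁)))
          (tables keys (λ {s} s< → trans (cong (λ f → f s) (same ε₄ 2)) (trans (proj₁ (cells s<)) (part-0 s<)))
            chains
            (λ {w} w< → trans (cong (λ f → f w) (same ε₄ 6)) (trans (cong (λ f → f w) (same ε₃ 6))
              (trans (cong (λ f → f w) (same ε₂ 6)) (d₆ w<))))
            (λ {t} t< → trans (cong (λ f → f t) (same ε₄ 7)) (trans (cong (λ f → f t) (same ε₃ 7)) (d₇ t<)))
            (λ {w} w< → trans (cong (λ f → f w) (same ε₄ 10)) (trans (cong (λ f → f w) (same ε₃ 10))
              (trans (cong (λ f → f w) (same ε₂ 10)) (d₁₀ w<))))
            (λ {w} w< → trans (cong (λ f → f w) (same ε₄ 11)) (trans (cong (λ f → f w) (same ε₃ 11))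
              (trans (cong (λ f → f w) (same ε₂ 11)) (d₁₁ w<))))
            (λ {a} _ → trans (cong (λ f → f a) (same ε₄ 15)) (trans (cong (λ f → f a) (same ε₃ 15))
              (trans (cong (λ f → f a) (same ε₂ 15)) (cong (λ f → f a) (same ε₁ 15))))))
          ranks (λ a → trans (cong (λ f → f a) (same ε₄ 13)) (trans (cong (λ f → f a) (same ε₃ 13))
            (trans (cong (λ f → f a) (same ε₂ 13)) (cong (λ f → f a) (same ε₁ 13))))))
        ⨾# λ inv → weaken# Φ₀≤ (mainLoop# inv) } } } } }
        where
        U : ℕ
        U = Tot * total
        Sk≤U : S * suc k ≤ U
        Sk≤U = ≤-trans (≤-trans (*-monoʳ-≤ S suc-k≤stride) S*stride≤) Tot≤
        S≤U : S ≤ U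
        S≤U = ≤-trans (m≤m*n S (suc k)) Sk≤U
        k≤U : k ≤ U
        k≤U = ≤-trans (≤-trans (n≤1+n k) (m≤n*m (suc k) S {{>-nonZero S>0}})) Sk≤U
        kS≤U : k * suc S ≤ U
        kS≤U = ≤-trans (≤-trans (*-monoʳ-≤ k (≤-trans (s≤s (m≤m+n S 0)) (≤-trans (+-monoˡ-≤ (S + 0) S>0)
          ≤-refl))) (≤-trans (≤-reflexive kS) (*-monoʳ-≤ S (m≤n+m (k * 2) 2)))) (≤-trans S*stride≤ Tot≤)
          where
          kS : k * (2 * S) ≡ S * (k * 2)
          kS = solveℕ 2 (λ a b → a :* (con 2 :* b) :≡ b :* (a :* con 2)) refl k S
        count≤U : sumTo (λ s → suc (count-cost s)) S ≤ U
        count≤U = ≤-trans (sumTo-mono S λ {s} _ → s≤s (≤-trans (m≤m+n (count-cost s) _)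
          (≤-trans (m≤n+m _ (2 * suc k)) (m≤n+m _ stride)))) Tot≤

      solver-runs : At input 0 n → ∃[ t ] ∃[ M ] Σ[ σ ∈ St ] t ≤ weight solver * suc (Tot * total) ×
                    Machine.Exec input space W solver initial t ⟨ var σ , M ⟩ × (∀ {i} → i < base₀ → M i ≡
                      rnk σ i) × Final σ
      solver-runs at-n = let t , M , σ , t≤ , runs , rep , f = exec solver# (λ _ → 0) ((λ _ → refl) , λ _ _ _ →
                               refl)
                         in t , M , σ , t≤ , runs , proj₁ rep , f
        where
        solver# : Run solver (st (λ _ → 0) (λ _ → 0) (λ _ _ → 0)) (Tot * total) Final
        solver# = :=⨾ (i# (k# 0) at-n) (if# (k# 0) (v# 0 refl) (λ _ → solve# refl) (λ le →
          contradiction n>0 (≤⇒≯ le)))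

-- Segments of the encoded input.

Sub : List ℕ → ℕ → List ℕ → Set
Sub is p xs = ∃[ pre ] ∃[ post ] is ≡ pre ++ xs ++ post × length pre ≡ p

Sub-self : ∀ is → Sub is 0 is
Sub-self is = [] , [] , sym (Listₚ.++-identityʳ is) , refl

Sub-++ : ∀ {is p} xs ys → Sub is p (xs ++ ys) → Sub is p xs × Sub is (p + length xs) ys
Sub-++ xs ys (pre , post , eq , refl) =
  (pre , ys ++ post , trans eq (cong (pre ++_) (Listₚ.++-assoc xs ys post)) , refl) ,
  (pre ++ xs , post , trans eq (trans (cong (pre ++_) (Listₚ.++-assoc xs ys post))
    (sym (Listₚ.++-assoc pre xs (ys ++ post)))) , Listₚ.length-++ pre)

Sub-length : ∀ {is p xs} → Sub is p xs → p + length xs ≤ length is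
Sub-length {xs = xs} (pre , post , refl , refl) =
  ≤-trans (+-monoʳ-≤ (length pre) (≤-trans (m≤m+n (length xs) (length post))
    (≤-reflexive (sym (Listₚ.length-++ xs)))))
  (≤-reflexive (sym (Listₚ.length-++ pre)))

At-middle : ∀ pre x post → At (pre ++ x ∷ post) (length pre) x
At-middle []        x post = zero , refl , refl
At-middle (_ ∷ pre) x post = let j , e , e′ = At-middle pre x post in suc j , cong suc e , e′

Sub-∷ : ∀ {is p x xs} → Sub is p (x ∷ xs) → At is p x × Sub is (suc p) xs
Sub-∷ {x = x} {xs} s@(pre , post , refl , refl) = At-middle pre x (xs ++ post) ,
  subst (λ q → Sub (pre ++ x ∷ xs ++ post) q xs) (+-comm (length pre) 1) (proj₂ (Sub-++ (x ∷ []) xs s))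

Sub-Seg : ∀ {is p} xs → Sub is p xs → Seg is p xs
Sub-Seg [] _ = tt
Sub-Seg (x ∷ xs) s = let a , s′ = Sub-∷ s in a , Sub-Seg xs s′

Sub-toList : ∀ {is p k} (xs : Vec ℕ k) → Sub is p (Vec.toList xs) → ∀ i → At is (p + toℕ i) (lookup xs i)
Sub-toList {is} {p} (x ∷ xs) s zero = subst (λ q → At is q x) (sym (+-identityʳ p)) (proj₁ (Sub-∷ s))
Sub-toList {is} {p} (x ∷ xs) s (suc i) = subst (λ q → At is q (lookup xs i)) (sym (+-suc p (toℕ i))) (Sub-toList
  xs (proj₂ (Sub-∷ s)) i)

Sub-tabulate : ∀ {is p k} (f : Fin k → ℕ) → Sub is p (List.tabulate f) → ∀ i → At is (p + toℕ i) (f i)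
Sub-tabulate {is} {p} f s zero = subst (λ q → At is q (f zero)) (sym (+-identityʳ p)) (proj₁ (Sub-∷ s))
Sub-tabulate {is} {p} f s (suc i) = subst (λ q → At is q (f (suc i))) (sym (+-suc p (toℕ i))) (Sub-tabulate (f ∘
  suc) (proj₂ (Sub-∷ s)) i)

-- The positions of the blocks are given by a function `o`, so that they come out in the closed or
-- recursive form in which the program computes them.
Sub-concatMap : ∀ {is p k} {X : Set} (g : Fin k → X) (f : X → List ℕ) (o : ℕ → ℕ) → o 0 ≡ 0 →
  (∀ i → o (suc (toℕ i)) ≡ o (toℕ i) + length (f (g i))) →
  Sub is p (concatMap f (List.tabulate g)) → ∀ i → Sub is (p + o (toℕ i)) (f (g i))
Sub-concatMap {is} {p} g f o o0 o+ s = go g o o+ (subst (λ q →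
  Sub is q _) (sym (trans (cong (p +_) o0) (+-identityʳ p))) s)
  where
  go : ∀ {k} (g : Fin k → _) (o : ℕ → ℕ) → (∀ i → o (suc (toℕ i)) ≡ o (toℕ i) + length (f (g i))) →
       Sub is (p + o 0) (concatMap f (List.tabulate g)) → ∀ i → Sub is (p + o (toℕ i)) (f (g i))
  go {suc k} g o o+ s zero = proj₁ (Sub-++ (f (g zero)) _ s)
  go {suc k} g o o+ s (suc i) = go (g ∘ suc) (o ∘ suc) (o+ ∘ suc)
    (subst (λ q → Sub is q (concatMap f (List.tabulate (g ∘ suc))))
      (trans (+-assoc p (o 0) (length (f (g zero)))) (cong (p +_) (sym (o+ zero))))
        (proj₂ (Sub-++ (f (g zero)) _ s))) i

length-concatMap-tabulate : ∀ {k} {X : Set} (g : Fin k → X) (f : X → List ℕ) (o : ℕ → ℕ) →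
  (∀ i → o (suc (toℕ i)) ≡ o (toℕ i) + length (f (g i))) →
  o 0 + length (concatMap f (List.tabulate g)) ≡ o k
length-concatMap-tabulate {zero} g f o o+ = +-identityʳ (o 0)
length-concatMap-tabulate {suc k} g f o o+ = trans (cong (o 0 +_) (Listₚ.length-++ (f (g zero)))) (trans
  (sym (+-assoc (o 0) _ _))
  (trans (cong (_+ length (concatMap f (List.tabulate (g ∘ suc)))) (sym (o+ zero))) (length-concatMap-tabulate
    (g ∘ suc) f (o ∘ suc) (o+ ∘ suc))))

bit : Bool → ℕ
bit b = if b then 1 else 0

length-bits : ∀ {n} (s : Subset n) → length (bits s) ≡ n
length-bits s = trans (Listₚ.length-map _ (Vec.toList s)) (length-toList s)

Sub-bits : ∀ {is p n} (s : Subset n) → Sub is p (bits s) → ∀ i → At is (p + toℕ i) (bit (lookup s i))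
Sub-bits {is} {p} s sub i = subst (At is (p + toℕ i)) (lookup-map i bit s) (Sub-toList (Vec.map bit s)
  (subst (Sub is p) (sym (toList-map bit s)) sub) i)

bit-∈ : ∀ {n} {s : Subset n} {i} → 0 < bit (lookup s i) → i Subset.∈ s
bit-∈ {s = s} {i} lt with lookup s i in eq
... | true  = lookup⇒[]= i s eq
... | false = contradiction lt λ ()

bit-∉ : ∀ {n} {s : Subset n} {i} → bit (lookup s i) ≡ 0 → i Subset.∉ s
bit-∉ {s = s} {i} eq i∈ with lookup s i | []=⇒lookup i∈
bit-∉ () _ | true | _
... | false | ()

-- Finite sums and the numbering of the degeneralization domain.

sumF : ∀ {k} → (Fin k → ℕ) → ℕ
sumF {zero}  f = 0
sumF {suc k} f = f zero + sumF (f ∘ suc)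

sumF-cong : ∀ {k} {f g : Fin k → ℕ} → (∀ i → f i ≡ g i) → sumF f ≡ sumF g
sumF-cong {zero} eq = refl
sumF-cong {suc k} eq = cong₂ _+_ (eq zero) (sumF-cong (eq ∘ suc))

sumF-+ : ∀ {k} (f g : Fin k → ℕ) → sumF (λ i → f i + g i) ≡ sumF f + sumF g
sumF-+ {zero} f g = refl
sumF-+ {suc k} f g = trans (cong (f zero + g zero +_) (sumF-+ (f ∘ suc) (g ∘ suc)))
  (solveℕ 4 (λ a b c d → (a :+ b) :+ (c :+ d) :≡ (a :+ c) :+ (b :+ d)) refl (f zero) (g zero) (sumF (f ∘ suc))
    (sumF (g ∘ suc)))

sumF-0 : ∀ k → sumF {k} (λ _ → 0) ≡ 0
sumF-0 zero    = refl
sumF-0 (suc k) = sumF-0 k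

sumF-swap : ∀ {j k} (f : Fin j → Fin k → ℕ) → sumF (λ i → sumF (f i)) ≡ sumF (λ l → sumF (λ i → f i l))
sumF-swap {zero} {k} f = sym (sumF-0 k)
sumF-swap {suc j} {k} f = trans (cong (sumF (f zero) +_) (sumF-swap (f ∘ suc))) (sym (sumF-+ (f zero) (λ l →
  sumF (λ i → f (suc i) l))))

sumTo-suc : ∀ f k → sumTo f (suc k) ≡ f 0 + sumTo (f ∘ suc) k
sumTo-suc f zero    = refl
sumTo-suc f (suc k) = trans (cong (f (suc k) +_) (sumTo-suc f k)) (solveℕ 3 (λ a b c →
  a :+ (b :+ c) :≡ b :+ (a :+ c)) refl (f (suc k)) (f 0) (sumTo (f ∘ suc) k))

sumTo-sumF : ∀ f k → sumTo f k ≡ sumF {k} (f ∘ toℕ)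
sumTo-sumF f zero    = refl
sumTo-sumF f (suc k) = trans (sumTo-suc f k) (cong (f 0 +_) (sumTo-sumF (f ∘ suc) k))

length-filter-tabulate : ∀ {k} {X : Set} {P : X → Set} (P? : ∀ x → Dec (P x)) (g : Fin k → X) →
  length (filter P? (List.tabulate g)) ≡ sumF (λ i → bit (does (P? (g i))))
length-filter-tabulate {zero} P? g = refl
length-filter-tabulate {suc k} P? g with does (P? (g zero))
... | true  = cong suc (length-filter-tabulate P? (g ∘ suc))
... | false = length-filter-tabulate P? (g ∘ suc)

∣∣-sumF : ∀ {n} (s : Subset n) → Subset.∣ s ∣ ≡ sumF (λ i → bit (lookup s i))
∣∣-sumF []          = refl
∣∣-sumF (true ∷ s)  = cong suc (∣∣-sumF s)
∣∣-sumF (false ∷ s) = ∣∣-sumF s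

does-lookup : ∀ {n} (s : Subset n) i → does (i ∈? s) ≡ lookup s i
does-lookup s i with i ∈? s
... | yes i∈ = sym ([]=⇒lookup i∈)
... | no i∉ with lookup s i in eq
...   | false = refl
...   | true  = contradiction (lookup⇒[]= i s eq) i∉

sum-map-tabulate : ∀ {k} {X : Set} (f : X → ℕ) (g : Fin k → X) → sum (map f (List.tabulate g)) ≡ sumF (f ∘ g)
sum-map-tabulate {zero} f g = refl
sum-map-tabulate {suc k} f g = cong (f (g zero) +_) (sum-map-tabulate f (g ∘ suc))

sumTo-+ : ∀ f g N → sumTo (λ i → f i + g i) N ≡ sumTo f N + sumTo g N
sumTo-+ f g zero = refl
sumTo-+ f g (suc N) = trans (cong (f N + g N +_) (sumTo-+ f g N))
  (solveℕ 4 (λ a b c d → (a :+ b) :+ (c :+ d) :≡ (a :+ c) :+ (b :+ d)) refl (f N) (g N) (sumTo f N) (sumTo g N))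

sumTo-cong : ∀ {f g} N → (∀ {i} → i < N → f i ≡ g i) → sumTo f N ≡ sumTo g N
sumTo-cong zero _ = refl
sumTo-cong (suc N) eq = cong₂ _+_ (eq ≤-refl) (sumTo-cong N (eq ∘ m≤n⇒m≤1+n))

sumTo-append : ∀ f M N → sumTo f (M + N) ≡ sumTo (λ x → f (M + x)) N + sumTo f M
sumTo-append f M zero = cong (sumTo f) (+-identityʳ M)
sumTo-append f M (suc N) = trans (cong (sumTo f) (+-suc M N)) (trans (cong (f (M + N) +_) (sumTo-append f M N))
  (sym (+-assoc (f (M + N)) _ _)))

sumTo-split : ∀ f M N → sumTo f (M * N) ≡ sumTo (λ v → sumTo (λ x → f (v * N + x)) N) M
sumTo-split f zero N = refl
sumTo-split f (suc M) N = trans (cong (sumTo f) (+-comm N (M * N))) (trans (sumTo-append f (M * N) N)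
  (cong (sumTo (λ x → f (M * N + x)) N +_) (sumTo-split f M N)))

sumTo-sumL : ∀ (h : ℕ → ℕ → ℕ) us N → sumTo (λ x → sumL (λ u → h u x) us) N ≡ sumL (λ u → sumTo (h u) N) us
sumTo-sumL h us zero = sym (sumL-zero us (λ _ → refl))
sumTo-sumL h us (suc N) = trans (cong (sumL (λ u → h u N) us +_) (sumTo-sumL h us N)) (sumL-+ us)
  where
  sumL-+ : ∀ us → sumL (λ u → h u N) us + sumL (λ u → sumTo (h u) N) us ≡ sumL (λ u → h u N + sumTo (h u) N) us
  sumL-+ [] = refl
  sumL-+ (u ∷ us) = trans (solveℕ 4 (λ a b c d → (a :+ b) :+ (c :+ d) :≡ (a :+ c) :+ (b :+ d)) refl (h u N)
    (sumL (λ u → h u N) us) (sumTo (h u) N) (sumL (λ u → sumTo (h u) N) us))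
    (cong (h u N + sumTo (h u) N +_) (sumL-+ us))

sumL-≤ : ∀ {f c} xs → (∀ x → f x ≤ c) → sumL f xs ≤ length xs * c
sumL-≤ [] _ = z≤n
sumL-≤ (x ∷ xs) le = +-mono-≤ (le x) (sumL-≤ xs le)

indicator≤1 : ∀ a N → sumTo (λ c → bit (a ≡ᵇ c)) N ≤ 1
indicator≤1 a zero = z≤n
indicator≤1 a (suc N) with a ≡ᵇ N in eq
... | false = indicator≤1 a N
... | true  = s≤s (≤-reflexive (trans (sumTo-cong {g = λ _ → 0} N λ {c} c<N → cong bit (≢⇒≡ᵇ {a} {c} λ { refl →
  <⇒≢ c<N (≡ᵇ⇒≡ a N (subst T (sym eq) tt)) })) (trans (sumTo-const 0 N) (*-zeroʳ N))))

-- Mixed-radix numbering of Domain ℓ: products of the sizes from component i on, and the number formed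
-- by the components from i on.
sufProd : ∀ {k} → Vec ℕ k → ℕ → ℕ
sufProd ℓ       zero    = ∣Domain∣ ℓ
sufProd []      (suc i) = 1
sufProd (_ ∷ ℓ) (suc i) = sufProd ℓ i

sufIndex : ∀ {k} {ℓ : Vec ℕ k} → Domain ℓ → ℕ → ℕ
sufIndex b                zero    = toℕ (index b)
sufIndex VecAll.[]        (suc i) = 0
sufIndex (_ VecAll.∷ b)   (suc i) = sufIndex b i

sufProd-end : ∀ {k} (ℓ : Vec ℕ k) → sufProd ℓ k ≡ 1
sufProd-end []      = refl
sufProd-end (_ ∷ ℓ) = sufProd-end ℓ

sufProd-step : ∀ {k} (ℓ : Vec ℕ k) i → sufProd ℓ (toℕ i) ≡ lookup ℓ i * sufProd ℓ (suc (toℕ i))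
sufProd-step (l ∷ ℓ) zero    = refl
sufProd-step (l ∷ ℓ) (suc i) = sufProd-step ℓ i

sufIndex-end : ∀ {k} {ℓ : Vec ℕ k} (b : Domain ℓ) → sufIndex b k ≡ 0
sufIndex-end VecAll.[]      = refl
sufIndex-end (_ VecAll.∷ b) = sufIndex-end b

toℕ-combine′ : ∀ {m n} (i : Fin m) (j : Fin n) → toℕ (combine i j) ≡ toℕ i * n + toℕ j
toℕ-combine′ {m} {n} i j = trans (Finₚ.toℕ-combine i j) (cong (_+ toℕ j) (*-comm n (toℕ i)))

sufIndex-step : ∀ {k} {ℓ : Vec ℕ k} (b : Domain ℓ) i → sufIndex b (toℕ i) ≡ sufIndex b (suc (toℕ i)) +
  toℕ (lookup⁺ b i) * sufProd ℓ (suc (toℕ i))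
sufIndex-step {ℓ = l ∷ ℓ} (a VecAll.∷ b) zero = trans (toℕ-combine′ a (index b)) (+-comm _ (toℕ (index b)))
sufIndex-step (a VecAll.∷ b) (suc i) = sufIndex-step b i

sufIndex≤ : ∀ {k} {ℓ : Vec ℕ k} (b : Domain ℓ) i → sufIndex b i ≤ toℕ (index b)
sufIndex≤ b zero = ≤-refl
sufIndex≤ VecAll.[] (suc i) = z≤n
sufIndex≤ (a VecAll.∷ b) (suc i) = ≤-trans (sufIndex≤ b i) (≤-trans (m≤n+m _ _)
  (≤-reflexive (sym (toℕ-combine′ a (index b)))))

sufIndex< : ∀ {k} {ℓ : Vec ℕ k} (b : Domain ℓ) i → sufIndex b i < sufProd ℓ i
sufIndex< b zero = Finₚ.toℕ<n (index b)
sufIndex< VecAll.[] (suc i) = z<s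
sufIndex< (_ VecAll.∷ b) (suc i) = sufIndex< b i

Domain-split : ∀ {k} (ℓ : Vec ℕ k) (i : Fin k) → ∃[ q ] ∣Domain∣ ℓ ≡ q * sufProd ℓ (toℕ i)
Domain-split ℓ zero = 1 , sym (+-identityʳ _)
Domain-split (l ∷ ℓ) (suc i) = let q , e = Domain-split ℓ i in l * q ,
  trans (cong (l *_) e) (sym (*-assoc l q _))

index-split : ∀ {k} {ℓ : Vec ℕ k} (b : Domain ℓ) (i : Fin k) → ∃[ h ] toℕ (index b) ≡ h * sufProd ℓ (toℕ i) +
  sufIndex b (toℕ i)
index-split b zero = 0 , refl
index-split {ℓ = l ∷ ℓ} (a VecAll.∷ b) (suc i) with index-split b i | Domain-split ℓ i
... | h , e | q , e′ = toℕ a * q + h , (begin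
  toℕ (combine a (index b)) ≡⟨ toℕ-combine′ a (index b) ⟩
  toℕ a * ∣Domain∣ ℓ + toℕ (index b) ≡⟨ cong₂ (λ x y → toℕ a * x + y) e′ e ⟩
  toℕ a * (q * sufProd ℓ (toℕ i)) + (h * sufProd ℓ (toℕ i) + sufIndex b (toℕ i))
    ≡⟨ solveℕ 5 (λ a q p h s → a :* (q :* p) :+ (h :* p :+ s) :≡ (a :* q :+ h) :* p :+ s) refl (toℕ
      a) q (sufProd ℓ (toℕ i)) h (sufIndex b (toℕ i)) ⟩
  (toℕ a * q + h) * sufProd ℓ (toℕ i) + sufIndex b (toℕ i) ∎)
  where open ≡-Reasoning

unindex : ∀ {k} {ℓ : Vec ℕ k} → Fin (∣Domain∣ ℓ) → Domain ℓ
unindex {ℓ = []}    _ = VecAll.[]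
unindex {ℓ = l ∷ ℓ} i = proj₁ (remQuot {l} (∣Domain∣ ℓ) i) VecAll.∷ unindex (proj₂ (remQuot {l} (∣Domain∣ ℓ) i))

unindex-index : ∀ {k} {ℓ : Vec ℕ k} (b : Domain ℓ) → unindex (index b) ≡ b
unindex-index VecAll.[] = refl
unindex-index {ℓ = l ∷ ℓ} (a VecAll.∷ b) =
  trans (cong (λ q → proj₁ q VecAll.∷ unindex (proj₂ q)) (Finₚ.remQuot-combine a (index b))) (cong (a VecAll.∷_)
    (unindex-index b))

index-unindex : ∀ {k} {ℓ : Vec ℕ k} (i : Fin (∣Domain∣ ℓ)) → index {ℓ = ℓ} (unindex i) ≡ i
index-unindex {ℓ = []}    zero = refl
index-unindex {ℓ = l ∷ ℓ} i = trans (cong (combine (proj₁ (remQuot {l} (∣Domain∣ ℓ) i))) (index-unindex {ℓ = ℓ}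
  (proj₂ (remQuot {l} (∣Domain∣ ℓ) i))))
  (Finₚ.combine-remQuot {l} (∣Domain∣ ℓ) i)

lookup⁺-lookup⁻ : ∀ {X : Set} {P : X → Set} {k} {xs : Vec X k} (f : ∀ i → P (lookup xs i)) i →
                  lookup⁺ (lookup⁻ {P = P} {xs = xs} f) i ≡ f i
lookup⁺-lookup⁻ {P = P} {xs = _ ∷ xs} f zero    = refl
lookup⁺-lookup⁻ {P = P} {xs = _ ∷ xs} f (suc i) = lookup⁺-lookup⁻ {P = P} {xs = xs} (f ∘ suc) i

-- From lexicographic vectors to words.

Lex≤ : ∀ {j} → Vec ℕ j → Vec ℕ j → Set
Lex≤ = LexCore.Lex {A = ℕ} ⊤ _≡_ _<_

rows : ∀ {j} → (Fin j → ℕ) → (Fin j → ℕ) → Vec ℕ (j * 2)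
rows f g = Vec.concat (Vec.tabulate λ i → f i ∷ g i ∷ [])

pairs : ∀ {j} → (Fin j → ℕ) → (Fin j → ℕ) → Word
pairs f g = List.tabulate λ i → 2+ (f i) , g i

rows⇒pairs : ∀ {j} (f g f′ g′ : Fin j → ℕ) → Lex≤ (rows f g) (rows f′ g′) → pairs f g ≼ pairs f′ g′
rows⇒pairs {zero} f g f′ g′ _ = []
rows⇒pairs {suc j} f g f′ g′ (LexCore.this lt _) = key< (s<s (s<s lt))
rows⇒pairs {suc j} f g f′ g′ (LexCore.next eq (LexCore.this lt _)) rewrite eq = weight< lt
rows⇒pairs {suc j} f g f′ g′ (LexCore.next eq (LexCore.next eq′ le)) rewrite eq | eq′ =
  _ ∷≼ rows⇒pairs (f ∘ suc) (g ∘ suc) (f′ ∘ suc) (g′ ∘ suc) le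

pairs⇒rows : ∀ {j} (f g f′ g′ : Fin j → ℕ) → pairs f g ≼ pairs f′ g′ → Lex≤ (rows f g) (rows f′ g′)
pairs⇒rows {zero} f g f′ g′ _ = LexCore.base tt
pairs⇒rows {suc j} f g f′ g′ le = go (f zero) (f′ zero) (g zero) (g′ zero) le
  where
  go : ∀ p p′ w w′ → (2+ p , w) ∷ pairs (f ∘ suc) (g ∘ suc) ≼ (2+ p′ , w′) ∷ pairs (f′ ∘ suc) (g′ ∘ suc) →
       Lex≤ (p ∷ w ∷ rows (f ∘ suc) (g ∘ suc)) (p′ ∷ w′ ∷ rows (f′ ∘ suc) (g′ ∘ suc))
  go p p′ w w′ (key< lt) = LexCore.this (s<s⁻¹ (s<s⁻¹ lt)) refl
  go p .p w w′ (weight< lt) = LexCore.next refl (LexCore.this lt refl)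
  go p .p w .w (_ ∷≼ le) = LexCore.next refl (LexCore.next refl (pairs⇒rows (f ∘ suc) (g ∘ suc) (f′ ∘ suc) (g′ ∘
    suc) le))

sumL<length : ∀ {f} xs → (∀ x → f x ≤ 1) → sumL f xs < length xs → ∃[ x ] x ∈ xs × f x ≡ 0
sumL<length {f} (x ∷ xs) le lt with f x in eq | le x
... | 0 | _ = x , here refl , eq
... | 1 | _ = let y , y∈ , e = sumL<length xs le (s<s⁻¹ lt) in y , there y∈ , e
... | suc (suc _) | s≤s ()

sumL≡0 : ∀ {f} xs → sumL f xs ≡ 0 → ∀ {x} → x ∈ xs → f x ≡ 0
sumL≡0 {f} (x ∷ xs) eq (here refl) = m+n≡0⇒m≡0 (f x) eq
sumL≡0 {f} (x ∷ xs) eq (there x∈)  = sumL≡0 xs (m+n≡0⇒n≡0 (f x) eq) x∈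

sumL-<length : ∀ {f} xs → (∀ x → f x ≤ 1) → (∃[ x ] x ∈ xs × f x ≡ 0) → sumL f xs < length xs
sumL-<length {f} (x ∷ xs) le (_ , here refl , eq) = s≤s (subst (λ z → z + sumL f xs ≤ length xs) (sym eq)
  (sumL-≤length xs le))
sumL-<length {f} (x ∷ xs) le (y , there y∈ , eq) = ≤-trans (≤-reflexive (sym (+-suc (f x) _))) (+-mono-≤ (le x)
  (sumL-<length xs le (y , y∈ , eq)))

failBit≡0 : ∀ {P : Set} (d : Dec P) → failBit d ≡ 0 → P
failBit≡0 (yes p) _ = p

numbers : ℕ → Word → List ℕ
numbers δ []             = []
numbers δ ((p , w) ∷ xs) = p ∸ δ ∷ w ∷ numbers 2 xs

Stored-numbers : ∀ {δ f} i xs → Stored δ f i xs → ∀ j → f (i + toℕ j) ≡ List.lookup (numbers δ xs) j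
Stored-numbers {δ} {f} i ((p , w) ∷ xs) (e , e′ , s) zero =
  trans (cong f (+-identityʳ i)) (trans (sym (m+n∸m≡n δ (f i))) (cong (_∸ δ) e))
Stored-numbers {δ} {f} i ((p , w) ∷ xs) (e , e′ , s) (suc zero) = trans (cong f (+-comm i 1)) e′
Stored-numbers {δ} {f} i ((p , w) ∷ xs) (e , e′ , s) (suc (suc j)) =
  trans (cong f (trans (+-suc i _) (cong suc (+-suc i (toℕ j))))) (Stored-numbers (2+ i) xs s j)

numbers-pairs : ∀ {j} (f g : Fin j → ℕ) → Vec.toList (rows f g) ≡ numbers 2 (pairs f g)
numbers-pairs {zero} f g = refl
numbers-pairs {suc j} f g = cong (λ xs → f zero ∷ g zero ∷ xs) (numbers-pairs (f ∘ suc) (g ∘ suc))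

words-! : ∀ n k → Numbering.words n k ≡ k ! * n ^ k
words-! n zero    = refl
words-! n (suc k) = trans (cong (suc k * n *_) (words-! n k)) (solveℕ 4 (λ s n f p →
  s :* n :* (f :* p) :≡ s :* f :* (n :* p)) refl (suc k) n (k !) (n ^ k))

-- Good rankings in terms of words.

module Correctness {n k : ℕ} (G : Game n) (Ω : GenRabin n k) where
  open Game G
  open GenRabin Ω
  module Rk = Rankings G Ω
  open Rk hiding (Above)

  tail : Finite n k → Word
  tail (π , w₀ ∷ w) = pairs (λ l → toℕ (π ⟨$⟩ʳ l)) (λ l → toℕ (lookup w l))

  letters : R n k → Word
  letters ⊤⁺                  = ∞word k
  letters [ x@(_ , w₀ ∷ _) ] = (0 , toℕ w₀) ∷ tail x

  code : Fin n → B → Fin k → ℕ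
  code v b i = if does (v ∈? F i) then 0 else if does (v ∈? I i (b ! i)) then 1 else 2

  class : Fin n → B → ℕ → ℕ
  class v b 0             = 2
  class v b 1             = 1
  class v b (suc (suc p)) = ext (code v b) 2 p

  data Coded (v : Fin n) (b : B) (i : Fin k) : ℕ → Set where
    bad   : v Subset.∈ F i → Coded v b i 0
    reset : v Subset.∉ F i → v Subset.∈ I i (b ! i) → Coded v b i 1
    plain : v Subset.∉ F i → v Subset.∉ I i (b ! i) → Coded v b i 2

  coded : ∀ v b i → Coded v b i (code v b i)
  coded v b i with v ∈? F i
  ... | yes p = bad p
  ... | no ¬p with v ∈? I i (b ! i)
  ...   | yes q = reset ¬p q
  ...   | no ¬q = plain ¬p ¬q

  class-key : ∀ v b i → class v b (2+ (toℕ i)) ≡ code v b i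
  class-key v b i = ext-toℕ (code v b) 2 i

  nextB-! : ∀ v b i → nextB v b ! i ≡ (if does (v ∈? I i (b ! i)) then (b ! i) ⊕1 else b ! i)
  nextB-! v b i = lookup⁺-lookup⁻ {P = Fin} {xs = ℓ} (λ i →
    if does (v ∈? I i (b ! i)) then (b ! i) ⊕1 else b ! i) i

  nextB-keep : ∀ {v b i} → v Subset.∉ I i (b ! i) → nextB v b ! i ≡ b ! i
  nextB-keep {v} {b} {i} v∉ with v ∈? I i (b ! i) | nextB-! v b i
  ... | yes v∈ | _ = contradiction v∈ v∉
  ... | no _  | eq = eq

  nextB-step : ∀ {v b i} → v Subset.∈ I i (b ! i) → nextB v b ! i ≡ (b ! i) ⊕1
  nextB-step {v} {b} {i} v∈ with v ∈? I i (b ! i) | nextB-! v b i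
  ... | yes _ | eq = eq
  ... | no v∉ | _ = contradiction v∈ v∉

  Rk⇒Above : ∀ v b (π π′ : Permutation′ k) (w₀ w₀′ : Fin (suc n)) w w′ {j} (h : Fin j → Fin k) →
    Rk.Above v b (List.tabulate h) (π , w₀ ∷ w) (π′ , w₀′ ∷ w′) →
    Above (class v b) (pairs (λ l → toℕ (π ⟨$⟩ʳ h l)) (λ l → toℕ (lookup w (h l))))
                      (pairs (λ l → toℕ (π′ ⟨$⟩ʳ h l)) (λ l → toℕ (lookup w′ (h l))))
  Rk⇒Above v b π π′ w₀ w₀′ w w′ {suc j} h (inj₁ gt) = key> (s<s (s<s gt))
  Rk⇒Above v b π π′ w₀ w₀′ w w′ {suc j} h (inj₂ (inj₁ (eq , v∉ , gt))) rewrite sym eq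
    with code v b (π ⟨$⟩ʳ h zero) | coded v b (π ⟨$⟩ʳ h zero) | class-key v b (π ⟨$⟩ʳ h zero)
  ... | _ | bad v∈    | _ = contradiction v∈ v∉
  ... | _ | reset _ _ | c = reset c
  ... | _ | plain _ _ | c = weight> c gt
  Rk⇒Above v b π π′ w₀ w₀′ w w′ {suc j} h (inj₂ (inj₂ (inj₁ (eq , v∉ , v∈I)))) rewrite sym eq
    with code v b (π ⟨$⟩ʳ h zero) | coded v b (π ⟨$⟩ʳ h zero) | class-key v b (π ⟨$⟩ʳ h zero)
  ... | _ | bad v∈     | _ = contradiction v∈ v∉
  ... | _ | reset _ _  | c = reset c
  ... | _ | plain _ v∉I | _ = contradiction v∈I v∉I
  Rk⇒Above v b π π′ w₀ w₀′ w w′ {suc j} h (inj₂ (inj₂ (inj₂ (eq , v∉ , weq , ab)))) rewrite sym eq | sym weq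
    with code v b (π ⟨$⟩ʳ h zero) | coded v b (π ⟨$⟩ʳ h zero) | class-key v b (π ⟨$⟩ʳ h zero)
  ... | _ | bad v∈    | _ = contradiction v∈ v∉
  ... | _ | reset _ _ | c = reset c
  ... | _ | plain _ _ | c = deeper c (Rk⇒Above v b π π′ w₀ w₀′ w w′ (h ∘ suc) ab)

  Above⇒Rk : ∀ v b (π π′ : Permutation′ k) (w₀ w₀′ : Fin (suc n)) w w′ {j} (h : Fin j → Fin k) →
    Above (class v b) (pairs (λ l → toℕ (π ⟨$⟩ʳ h l)) (λ l → toℕ (lookup w (h l))))
                      (pairs (λ l → toℕ (π′ ⟨$⟩ʳ h l)) (λ l → toℕ (lookup w′ (h l)))) →
    Rk.Above v b (List.tabulate h) (π , w₀ ∷ w) (π′ , w₀′ ∷ w′)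
  Above⇒Rk v b π π′ w₀ w₀′ w w′ {suc j} h ab =
    go refl refl refl refl (coded v b (π ⟨$⟩ʳ h zero)) (class-key v b (π ⟨$⟩ʳ h zero)) ab
    where
    go : ∀ {p p′ u u′ c} → p ≡ toℕ (π ⟨$⟩ʳ h zero) → p′ ≡ toℕ (π′ ⟨$⟩ʳ h zero) →
         u ≡ toℕ (lookup w (h zero)) → u′ ≡ toℕ (lookup w′ (h zero)) →
         Coded v b (π ⟨$⟩ʳ h zero) c → class v b (2+ p) ≡ c →
         Above (class v b) ((2+ p , u) ∷ pairs (λ l → toℕ (π ⟨$⟩ʳ h (suc l))) (λ l →
           toℕ (lookup w (h (suc l)))))
                           ((2+ p′ , u′) ∷ pairs (λ l → toℕ (π′ ⟨$⟩ʳ h (suc l))) (λ l →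
                             toℕ (lookup w′ (h (suc l))))) →
         Rk.Above v b (List.tabulate h) (π , w₀ ∷ w) (π′ , w₀′ ∷ w′)
    go e₀ q _ _ cd c (key> gt) = inj₁ (subst₂ _<_ q e₀ (s<s⁻¹ (s<s⁻¹ gt)))
    go e₀ q _ _ (reset v∉ v∈) c (reset _) = inj₂ (inj₂ (inj₁ (Finₚ.toℕ-injective (trans (sym e₀) q) , v∉ , v∈)))
    go e₀ q _ _ (bad _) c (reset c′) = contradiction (trans (sym c) c′) λ ()
    go e₀ q _ _ (plain _ _) c (reset c′) = contradiction (trans (sym c) c′) λ ()
    go e₀ q e e′ (plain v∉ _) c (weight> _ gt) = inj₂ (inj₁ (Finₚ.toℕ-injective (trans (sym e₀) q) , v∉ ,
      subst₂ _<_ e′ e gt))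
    go e₀ q _ _ (bad _) c (weight> c′ _) = contradiction (trans (sym c) c′) λ ()
    go e₀ q _ _ (reset _ _) c (weight> c′ _) = contradiction (trans (sym c) c′) λ ()
    go e₀ q e e′ (plain v∉ _) c (deeper _ ab) =
      inj₂ (inj₂ (inj₂ (Finₚ.toℕ-injective (trans (sym e₀) q) , v∉ , Finₚ.toℕ-injective (trans (sym e) e′) ,
        Above⇒Rk v b π π′ w₀ w₀′ w w′ (h ∘ suc) ab)))
    go e₀ q _ _ (bad _) c (deeper c′ _) = contradiction (trans (sym c) c′) λ ()
    go e₀ q _ _ (reset _ _) c (deeper c′ _) = contradiction (trans (sym c) c′) λ ()

  Exceeds⇒Above : ∀ v b x y → Exceeds v b x y → Above (class v b) (letters [ x ]) (letters y)
  Exceeds⇒Above v b (π , w₀ ∷ w) [ π′ , w₀′ ∷ w′ ] (inj₁ gt) = weight> refl gt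
  Exceeds⇒Above v b (π , w₀ ∷ w) [ π′ , .w₀ ∷ w′ ] (inj₂ (refl , ab)) =
    deeper refl (Rk⇒Above v b π π′ w₀ w₀ w w′ id ab)

  Above⇒Exceeds : ∀ v b x y → Above (class v b) (letters [ x ]) (letters y) → Exceeds v b x y
  Above⇒Exceeds v b (π , w₀ ∷ w) ⊤⁺ (key> ())
  Above⇒Exceeds v b (π , w₀ ∷ w) [ π′ , w₀′ ∷ w′ ] ab = go refl refl ab
    where
    go : ∀ {a a′} → a ≡ toℕ w₀ → a′ ≡ toℕ w₀′ → Above (class v b) ((0 , a) ∷ tail (π , w₀ ∷ w)) ((0 , a′) ∷
      tail (π′ , w₀′ ∷ w′)) →
         Exceeds v b (π , w₀ ∷ w) [ π′ , w₀′ ∷ w′ ]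
    go e e′ (weight> _ gt) = inj₁ (subst₂ _<_ e′ e gt)
    go e e′ (deeper _ ab) = inj₂ (Finₚ.toℕ-injective (trans (sym e) e′) , Above⇒Rk v b π π′ w₀ w₀′ w w′ id ab)

  letters-mono : ∀ {x y} → x ≤lg y → letters x ≼ letters y
  letters-mono {⊤⁺} (_ ≤⊤⁺) = ≼-refl _
  letters-mono {[ _ , _ ∷ _ ]} (_ ≤⊤⁺) = key< z<s
  letters-mono {[ π , w₀ ∷ w ]} {[ π′ , w₀′ ∷ w′ ]} [ LexCore.this lt _ ] = weight< lt
  letters-mono {[ π , w₀ ∷ w ]} {[ π′ , w₀′ ∷ w′ ]} [ LexCore.next eq le ] rewrite eq =
    _ ∷≼ rows⇒pairs _ _ _ _ le

  letters-cancel : ∀ x y → letters x ≼ letters y → x ≤lg y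
  letters-cancel x ⊤⁺ _ = _ ≤⊤⁺
  letters-cancel ⊤⁺ [ _ , _ ∷ _ ] (key< ())
  letters-cancel [ π , w₀ ∷ w ] [ π′ , w₀′ ∷ w′ ] le = [ go _ _ le ]
    where
    go : ∀ a a′ → (0 , a) ∷ tail (π , w₀ ∷ w) ≼ (0 , a′) ∷ tail (π′ , w₀′ ∷ w′) →
         Lex≤ (a ∷ rows (λ i → toℕ (π ⟨$⟩ʳ i)) (λ i → toℕ (lookup w i))) (a′ ∷ rows (λ i →
           toℕ (π′ ⟨$⟩ʳ i)) (λ i → toℕ (lookup w′ i)))
    go a a′ (weight< lt) = LexCore.this lt refl
    go a a′ (_ ∷≼ le) = LexCore.next refl (pairs⇒rows _ _ _ _ le)

  -- `next` without its extremum: as `Above` is monotone, exceeding a minimum means exceeding some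
  -- successor, and exceeding a maximum means exceeding all.
  Safe : Fin n → (Fin n → Set) → Set
  Safe v P = (v Subset.∈ V₀ → ∃[ w ] w ∈ succs v × P w) × (v Subset.∉ V₀ → ∀ w → w ∈ succs v → P w)

  GoodWords : (Fin n → B → Word) → Set
  GoodWords c = ∀ v b → Safe v λ w → Above (class v b) (c v b) (c w (nextB v b))

  Candidate : (Fin n → B → Word) → Set
  Candidate c = GoodWords c × ∀ v b → Tidy n k (c v b)

  ∞-Above : ∀ v b y → Above (class v b) (∞word k) (letters y)
  ∞-Above v b ⊤⁺            = reset refl
  ∞-Above v b [ _ , _ ∷ _ ] = key> z<s

  serial-succs : ∀ v → ∃[ w ] w ∈ succs v
  serial-succs v = proj₁ (serial v) , ∈ₚ.∈-filter⁺ (_∈? E v) (∈ₚ.∈-allFin _) (proj₂ (serial v))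

  -- `Good` demands nothing of infinite ranks, but the condition on words holds for them anyway:
  -- `∞word` exceeds every word, and player 0 has a successor because the graph is serial.
  Good⇒GoodWords : ∀ r → Good r → GoodWords (λ v b → letters (r v b))
  Good⇒GoodWords r good v b = go (r v b) refl
    where
    go : ∀ x → r v b ≡ x → Safe v λ w → Above (class v b) (letters x) (letters (r w (nextB v b)))
    go ⊤⁺ _ = (λ _ → let w , w∈ = serial-succs v in w , w∈ , ∞-Above v b _) , (λ _ w _ → ∞-Above v b _)
    go [ x ] eq with v ∈? V₀ | Exceeds⇒Above v b x _ (good v b x eq)
    ... | yes v∈ | ab = (λ _ → pick) , (λ v∉ → contradiction v∈ v∉)
      where
      pick : ∃[ w ] w ∈ succs v × Above (class v b) (letters [ x ]) (letters (r w (nextB v b)))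
      pick with Extrema.argmin-sel (lg-totalOrder n k) id (r (proj₁ (serial v)) (nextB v b)) (map (λ w →
        r w (nextB v b)) (succs v))
      ... | inj₁ e = proj₁ (serial v) , proj₂ (serial-succs v) ,
        subst (λ z → Above (class v b) (letters [ x ]) (letters z)) e ab
      ... | inj₂ m with ∈ₚ.∈-map⁻ (λ w → r w (nextB v b)) m
      ...   | w , w∈ , e = w , w∈ , subst (λ z → Above (class v b) (letters [ x ]) (letters z)) e ab
    ... | no v∉ | ab = (λ v∈ → contradiction v∈ v∉) , λ _ w w∈ → Above-mono ab (letters-mono
      (All.lookup (Extrema.xs≤max (lg-totalOrder n k) _ (map (λ w → r w (nextB v b)) (succs v)))
        (∈ₚ.∈-map⁺ (λ w → r w (nextB v b)) w∈)))

  GoodWords⇒Good : ∀ r → GoodWords (λ v b → letters (r v b)) → Good r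
  GoodWords⇒Good r good v b x eq with v ∈? V₀ | subst (λ y → Safe v λ w →
    Above (class v b) (letters y) (letters (r w (nextB v b)))) eq (good v b)
  ... | yes v∈ | safe , _ = let w , w∈ , ab = safe v∈ in Above⇒Exceeds v b x _ (Above-mono ab (letters-mono
      (All.lookup (Extrema.min≤xs (lg-totalOrder n k) _ (map (λ w → r w (nextB v b)) (succs v)))
        (∈ₚ.∈-map⁺ (λ w → r w (nextB v b)) w∈))))
  ... | no v∉ | _ , safe = Above⇒Exceeds v b x _ pick
      where
      pick : Above (class v b) (letters [ x ]) (letters (Extrema.max (lg-totalOrder n k) (r (proj₁ (serial v))
        (nextB v b)) (map (λ w → r w (nextB v b)) (succs v))))
      pick with Extrema.argmax-sel (lg-totalOrder n k) id (r (proj₁ (serial v)) (nextB v b)) (map (λ w →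
        r w (nextB v b)) (succs v))
      ... | inj₁ e = subst (λ z → Above (class v b) (letters [ x ]) (letters z)) (sym e) (safe v∉ _
        (proj₂ (serial-succs v)))
      ... | inj₂ m with ∈ₚ.∈-map⁻ (λ w → r w (nextB v b)) m
      ...   | w , w∈ , e = subst (λ z → Above (class v b) (letters [ x ]) (letters z)) (sym e) (safe v∉ w w∈)

  -- The head keys belong to no pair; a constant value makes all indices agree on them.
  val : B → ℕ → ℕ
  val b (suc (suc p)) = ext (λ i → toℕ (b ! i)) 0 p
  val b _             = 0

  dist : B → B → ℕ → ℕ
  dist b c (suc (suc p)) = ext (λ i → cyc (b ! i) (c ! i)) 0 p
  dist b c _             = 0

  -- Classes and distances of keys that encode no pair are never compared, so only indices matter.
  byKey : ∀ (P : ℕ → Set) → P 0 → P 1 → (∀ (i : Fin k) → P (2+ (toℕ i))) → (∀ {p} → ¬ p < k → P (2+ p)) → ∀ p →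
    P p
  byKey P p₀ p₁ pi pk 0 = p₀
  byKey P p₀ p₁ pi pk 1 = p₁
  byKey P p₀ p₁ pi pk (suc (suc p)) with p <? k
  ... | yes p<k = byFin (λ j → P (2+ j)) pi p<k
  ... | no ≮ = pk ≮

  ext-out : ∀ {X : Set} (f : Fin k → X) d {p} → ¬ p < k → ext f d p ≡ d
  ext-out f d {p} ≮ with p <? k
  ... | yes p<k = contradiction p<k ≮
  ... | no _ = refl

  class≤2 : ∀ v b p → class v b p ≤ 2
  class≤2 v b 0 = ≤-refl
  class≤2 v b 1 = s≤s z≤n
  class≤2 v b (suc (suc p)) = ext-elim (_≤ 2) (code v b) 2 (λ i → code≤2 i (coded v b i)) ≤-refl p
    where
    code≤2 : ∀ i {c} → Coded v b i c → c ≤ 2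
    code≤2 i (bad _)     = z≤n
    code≤2 i (reset _ _) = s≤s z≤n
    code≤2 i (plain _ _) = ≤-refl

  class-0 : ∀ v b b′ p → class v b p ≡ 0 → class v b′ p ≡ 0
  class-0 v b b′ = byKey _ (λ ()) (λ ()) go λ ≮ eq → contradiction (trans (sym (ext-out (code v b) 2 ≮))
    eq) λ ()
    where
    go : ∀ i → class v b (2+ (toℕ i)) ≡ 0 → class v b′ (2+ (toℕ i)) ≡ 0
    go i eq with code v b i | coded v b i | class-key v b i | code v b′ i | coded v b′ i | class-key v b′ i
    ... | _ | bad v∈ | _ | _ | bad _ | eq′ = eq′
    ... | _ | bad v∈ | _ | _ | reset v∉ _ | _ = contradiction v∈ v∉
    ... | _ | bad v∈ | _ | _ | plain v∉ _ | _ = contradiction v∈ v∉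
    ... | _ | reset _ _ | c | _ | _ | _ = contradiction (trans (sym eq) c) λ ()
    ... | _ | plain _ _ | c | _ | _ | _ = contradiction (trans (sym eq) c) λ ()

  class-2 : ∀ v b i → class v b (2+ (toℕ i)) ≡ 2 → nextB v b ! i ≡ b ! i
  class-2 v b i eq with code v b i | coded v b i | class-key v b i
  ... | _ | bad _ | c = contradiction (trans (sym eq) c) λ ()
  ... | _ | reset _ _ | c = contradiction (trans (sym eq) c) λ ()
  ... | _ | plain _ v∉ | _ = nextB-keep {v} {b} {i} v∉

  -- At one vertex, classes 1 and 2 of the same pair differ only in membership in the current member
  -- of its `I`, so the components must differ. This is what makes the distance drop strictly when
  -- one index resets and the other does not.
  class-1 : ∀ v b i → class v b (2+ (toℕ i)) ≡ 1 → nextB v b ! i ≡ (b ! i) ⊕1 × (∀ c → class v c (2+ (toℕ i)) ≡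
    2 → b ! i ≢ c ! i)
  class-1 v b i eq with code v b i | coded v b i | class-key v b i
  ... | _ | bad _ | c = contradiction (trans (sym eq) c) λ ()
  ... | _ | plain _ _ | c = contradiction (trans (sym eq) c) λ ()
  ... | _ | reset _ v∈ | _ = nextB-step {v} {b} {i} v∈ , go
    where
    go : ∀ c → class v c (2+ (toℕ i)) ≡ 2 → b ! i ≢ c ! i
    go c eq′ b≡c with code v c i | coded v c i | class-key v c i
    ... | _ | bad _ | d = contradiction (trans (sym eq′) d) λ ()
    ... | _ | reset _ _ | d = contradiction (trans (sym eq′) d) λ ()
    ... | _ | plain _ v∉ | _ = v∉ (subst (λ j → v Subset.∈ I i j) b≡c v∈)

  val-key : ∀ b i → val b (2+ (toℕ i)) ≡ toℕ (b ! i)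
  val-key b i = ext-toℕ (λ i → toℕ (b ! i)) 0 i

  dist-key : ∀ b c i → dist b c (2+ (toℕ i)) ≡ cyc (b ! i) (c ! i)
  dist-key b c i = ext-toℕ (λ i → cyc (b ! i) (c ! i)) 0 i

  val-keep : ∀ v b p → class v b p ≡ 2 → val (nextB v b) p ≡ val b p
  val-keep v b = byKey _ (λ _ → refl) (λ _ → refl)
    (λ i eq → trans (val-key (nextB v b) i) (trans (cong toℕ (class-2 v b i eq)) (sym (val-key b i))))
    (λ ≮ _ → trans (ext-out _ 0 ≮) (sym (ext-out _ 0 ≮)))

  dist-refl : ∀ b p → dist b b p ≡ 0
  dist-refl b = byKey _ refl refl (λ i → trans (dist-key b b i) (cyc-refl (b ! i))) (λ ≮ → ext-out _ 0 ≮)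

  dist-val : ∀ b c c′ p → val c p ≡ val c′ p → dist b c p ≡ dist b c′ p
  dist-val b c c′ = byKey _ (λ _ → refl) (λ _ → refl)
    (λ i eq → trans (dist-key b c i) (trans
      (cong (cyc (b ! i)) (Finₚ.toℕ-injective (trans (sym (val-key c i)) (trans eq (val-key c′ i)))))
        (sym (dist-key b c′ i))))
    (λ ≮ _ → trans (ext-out _ 0 ≮) (sym (ext-out _ 0 ≮)))

  dist-keep : ∀ v b c p → class v b p ≡ 2 → class v c p ≡ 2 → dist (nextB v b) (nextB v c) p ≡ dist b c p
  dist-keep v b c = byKey _ (λ _ _ → refl) (λ _ _ → refl)
    (λ i eq eq′ → trans (dist-key (nextB v b) (nextB v c) i) (trans (cong₂ cyc (class-2 v b i eq) (class-2 v c i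
      eq′)) (sym (dist-key b c i))))
    (λ ≮ _ _ → trans (ext-out _ 0 ≮) (sym (ext-out _ 0 ≮)))

  dist-drop : ∀ v b c p → class v b p ≡ 1 → class v c p ≡ 2 → dist (nextB v b) (nextB v c) p < dist b c p
  dist-drop v b c = byKey _ (λ ()) (λ _ ())
    (λ i eq eq′ → let step , ≢ = class-1 v b i eq in
      subst₂ _<_ (sym (trans (dist-key (nextB v b) (nextB v c) i) (cong₂ cyc step (class-2 v c i eq′))))
        (sym (dist-key b c i)) (cyc-⊕1 (b ! i) (c ! i) (≢ c eq′)))
    (λ ≮ eq → contradiction (trans (sym eq) (ext-out _ 2 ≮)) λ ())

  allB : List B
  allB = map unindex (allFin ∣B∣)

  ∈allB : ∀ b → b ∈ allB
  ∈allB b = subst (_∈ allB) (unindex-index b) (∈ₚ.∈-map⁺ unindex (∈ₚ.∈-allFin (index b)))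

  keys-tail : ∀ x → keys (tail x) ↭ base k
  keys-tail (π , _ ∷ _) = subst (_↭ base k) (sym (Listₚ.map-tabulate _ proj₁)) (tabulate-permutation π)

  length-letters : ∀ x → length (letters x) ≡ suc k
  length-letters ⊤⁺ = cong suc (trans (Listₚ.length-map _ (base k)) (length-base k))
  length-letters [ _ , _ ∷ _ ] = cong suc (Listₚ.length-tabulate _)

  letters-bound : ∀ x → All (λ a → proj₂ a < suc n) (letters x)
  letters-bound ⊤⁺ = s≤s z≤n ∷ Allₚ.map⁺ (All.universal (λ _ → s≤s z≤n) (base k))
  letters-bound [ _ , w₀ ∷ w ] = Finₚ.toℕ<n w₀ ∷ Allₚ.tabulate⁺ (λ i → Finₚ.toℕ<n (lookup w i))

  tidy : ∀ x {y} → keys y ≡ keys (letters x) → All (λ a → proj₂ a < n) y → Tidy n k y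
  tidy ⊤⁺ {(_ , _) ∷ xs} eq small with Listₚ.∷-injective eq
  ... | refl , eq′ = infinite (trans eq′ (keys-flat (base k)))
  tidy [ x@(_ , _ ∷ _) ] {(_ , _) ∷ xs} eq (w<n ∷ small) with Listₚ.∷-injective eq
  ... | refl , eq′ = finite w<n small (subst (_↭ base k) (sym eq′) (keys-tail x))

  capped-candidate : ∀ r → Good r → ∃[ c ] Candidate c × ∀ v b → c v b ≼ letters (r v b)
  capped-candidate r good = Capped.capped , (goodWords , λ v b →
    tidy (r v (Capped.pretend v b)) (Capped.keys-capped v b) (Capped.capped-small v b)) , Capped.capped-≼
    where
    words : Fin n → B → Word
    words v b = letters (r v b)
    -- The weights of a rank run from 0 to `n` inclusive, whence the bound `suc n` to begin with.
    module Capped = Cap (suc n) allB ∈allB val dist class nextB class≤2 class-0 val-keep dist-refl dist-val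
      dist-keep dist-drop
      words (λ v b v′ b′ → trans (length-letters (r v b)) (sym (length-letters (r v′ b′)))) (λ v b →
        letters-bound (r v b))
    goodWords : GoodWords Capped.capped
    goodWords v b with Good⇒GoodWords r good v (Capped.pretend v b)
    ... | safe₀ , safe₁ = (λ v∈ → let w , w∈ , ab = safe₀ v∈ in w , w∈ , Capped.capped-Above v b w ab) ,
                          (λ v∉ w w∈ → Capped.capped-Above v b w (safe₁ v∉ w w∈))

  Canonical : Word → Set
  Canonical x = ∀ {w xs} → x ≡ (1 , w) ∷ xs → x ≡ ∞word k

  fromWord : ∀ x → Tidy n k x → Canonical x → Σ[ y ∈ R n k ] letters y ≡ x
  fromWord _ (infinite _) can = ⊤⁺ , sym (can refl)
  fromWord _ t@(finite w<n small perm) _ with permutation-of n _ (suc-injective (sym (Tidy-length t))) perm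
    small
  ... | π , ws , eq = [ π , fromℕ< (m≤n⇒m≤1+n w<n) ∷ ws ] , cong₂ (λ w xs → (0 , w) ∷ xs) (Finₚ.toℕ-fromℕ< _) eq

  -- It suffices to be least among the candidates: below every good ranking lies a candidate, namely
  -- its capped form, even though the ranking itself may use the weight `n`.
  smallestGood : ∀ c → Candidate c → (∀ v b → Canonical (c v b)) → (∀ d → Candidate d → ∀ v b → c v b ≼ d v b) →
                 Σ[ r ∈ Ranking ] SmallestGood r × ∀ v b → letters (r v b) ≡ c v b
  smallestGood c (good , tidy) canonical least = r , (GoodWords⇒Good r good′ , smallest) , eq
    where
    r : Ranking
    r v b = proj₁ (fromWord (c v b) (tidy v b) (canonical v b))
    eq : ∀ v b → letters (r v b) ≡ c v b
    eq v b = proj₂ (fromWord (c v b) (tidy v b) (canonical v b))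
    good′ : GoodWords λ v b → letters (r v b)
    good′ v b with good v b
    ... | safe₀ , safe₁ = (λ v∈ → let w , w∈ , ab = safe₀ v∈ in w , w∈ ,
      subst₂ (Above _) (sym (eq v b)) (sym (eq w _)) ab) ,
                          (λ v∉ w w∈ → subst₂ (Above _) (sym (eq v b)) (sym (eq w _)) (safe₁ v∉ w w∈))
    smallest : ∀ r′ → Good r′ → ∀ v b → r v b ≤lg r′ v b
    smallest r′ g v b with capped-candidate r′ g
    ... | d , cand , d≼ = letters-cancel _ _ (≼-trans (subst (_≼ d v b) (sym (eq v b)) (least d cand v b))
      (d≼ v b))

  -- For infinity only the flag is part of the output; the tail of `∞word` lies in cells that are
  -- not inspected.
  cells-stored : ∀ {f i} (x : R n k) → Stored 0 f i (letters x) → ∀ (j : Fin (length (cells x))) →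
    f (i + toℕ j) ≡ List.lookup (cells x) j
  cells-stored {f} {i} ⊤⁺ (e , _) zero = trans (cong f (+-identityʳ i)) e
  cells-stored {f} {i} [ π , w₀ ∷ w ] s = subst (λ xs → ∀ (j : Fin (length xs)) → f (i + toℕ j) ≡
    List.lookup xs j)
    (cong (λ xs → 0 ∷ toℕ w₀ ∷ xs) (sym (numbers-pairs (λ l → toℕ (π ⟨$⟩ʳ l)) (λ l → toℕ (lookup w l)))))
      (Stored-numbers i _ s)

  cells-length : ∀ (x : R n k) → length (cells x) ≤ 2 + k * 2
  cells-length ⊤⁺ = s≤s z≤n
  cells-length [ x ] = ≤-reflexive (cong suc (length-toList (word x)))

  -- The encoded game as an instance of the verified program.

  module _ (n>0 : 0 < n) (C : ℕ) (100≤C : 100 ≤ C) where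

    Bn inputSize : ℕ
    Bn = ∣B∣
    input : List ℕ
    input = encode G Ω
    inputSize = length input

    D space W : ℕ
    D     = suc (inputSize + n * k * Bn)
    space = C * suc (n * k * Bn)
    W     = C * D

    k≥1 : 0 < k
    k≥1 = >-nonZero⁻¹ k {{k>0}}

    Domain>0 : ∀ {j} (l : Vec ℕ j) → (∀ i → NonZero (lookup l i)) → 0 < ∣Domain∣ l
    Domain>0 [] _ = z<s
    Domain>0 (x ∷ l) nz = *-mono-< {0} {x} (>-nonZero⁻¹ x {{nz zero}}) (Domain>0 l (nz ∘ suc))

    Bn>0 : 0 < Bn
    Bn>0 = Domain>0 ℓ ℓ>0

    onStates : ∀ {X : Set} → (Fin n → B → X) → X → ℕ → X
    onStates f d = ext {k = n * Bn} (λ i → f (proj₁ (remQuot {n} Bn i)) (unindex (proj₂ (remQuot {n} Bn i)))) d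

    state : Fin n → B → ℕ
    state v b = toℕ v * Bn + toℕ (index b)

    onStates-state : ∀ {X : Set} (f : Fin n → B → X) d v b → onStates f d (state v b) ≡ f v b
    onStates-state f d v b = trans (cong (onStates f d) (sym (toℕ-combine′ v (index b))))
      (trans (ext-toℕ {k = n * Bn} _ d (combine v (index b)))
      (trans (cong (λ q → f (proj₁ q) (unindex (proj₂ q))) (Finₚ.remQuot-combine v (index b)))
        (cong (f v) (unindex-index b))))

    onStates-elim : ∀ {X : Set} (P : X → Set) (f : Fin n → B → X) d → (∀ v b → P (f v b)) → P d → ∀ s →
      P (onStates f d s)
    onStates-elim P f d pf = ext-elim {k = n * Bn} P _ d (λ i → pf _ _)

    byState : ∀ (P : ℕ → Set) → (∀ v b → P (state v b)) → ∀ {s} → s < n * Bn → P s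
    byState P f = byFin {n * Bn} P λ i → subst P
      (trans (cong (λ x → toℕ (proj₁ (remQuot {n} Bn i)) * Bn + toℕ x) (index-unindex {ℓ = ℓ}
        (proj₂ (remQuot {n} Bn i))))
        (trans (sym (toℕ-combine′ (proj₁ (remQuot {n} Bn i)) (proj₂ (remQuot {n} Bn i))))
          (cong toℕ (Finₚ.combine-remQuot {n} Bn i))))
      (f (proj₁ (remQuot {n} Bn i)) (unindex (proj₂ (remQuot {n} Bn i))))

    lf Qf : ℕ → ℕ
    lf = ext (lookup ℓ) 0
    Qf zero    = 0
    Qf (suc i) = Qf i + lf i

    sl pl : ℕ → List ℕ
    sl = ext (λ v → map toℕ (succs v)) []
    pl = ext (λ v → map toℕ (preds v)) []

    offF offI offA offQ : ℕ
    so po : ℕ → ℕ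
    offF = 3 + k + n
    offI = offF + k * n
    offA = offI + Qf k * n
    so v = offA + n + sumTo (length ∘ sl) v
    offQ = so n
    po v = offQ + n + sumTo (length ∘ pl) v

    sl-at : ∀ v → sl (toℕ v) ≡ map toℕ (succs v)
    sl-at = ext-toℕ (λ v → map toℕ (succs v)) []

    pl-at : ∀ v → pl (toℕ v) ≡ map toℕ (preds v)
    pl-at = ext-toℕ (λ v → map toℕ (preds v)) []

    length-sl : ∀ v → length (sl (toℕ v)) ≡ length (succs v)
    length-sl v = trans (cong length (sl-at v)) (Listₚ.length-map toℕ (succs v))

    length-pl : ∀ v → length (pl (toℕ v)) ≡ length (preds v)
    length-pl v = trans (cong length (pl-at v)) (Listₚ.length-map toℕ (preds v))

    afterHeader : Sub input 3 (Vec.toList ℓ ++ _)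
    afterHeader = proj₂ (Sub-++ (n ∷ ∣E∣ ∷ k ∷ []) _ (Sub-self input))

    at-n : At input 0 n
    at-n = proj₁ (Sub-∷ (Sub-self input))

    at-k : At input 2 k
    at-k = proj₁ (Sub-∷ (proj₂ (Sub-∷ (proj₂ (Sub-∷ (Sub-self input))))))

    Fs Is : List ℕ
    Fs = concatMap (λ i → bits (F i)) (allFin k)
    Is = concatMap (λ i → concatMap (λ j → bits (I i j)) (allFin (lookup ℓ i))) (allFin k)

    sub-V₀ : Sub input (3 + k) (bits V₀ ++ Fs ++ Is ++ adjacency succs ++ adjacency preds)
    sub-V₀ = subst (λ q → Sub input q (bits V₀ ++ Fs ++ Is ++ adjacency succs ++ adjacency preds)) (cong (3 +_)
      (length-toList ℓ)) (proj₂ (Sub-++ (Vec.toList ℓ) _ afterHeader))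

    sub-F : Sub input offF (Fs ++ Is ++ adjacency succs ++ adjacency preds)
    sub-F = subst (λ q → Sub input q (Fs ++ Is ++ adjacency succs ++ adjacency preds)) (cong (3 + k +_)
      (length-bits V₀)) (proj₂ (Sub-++ (bits V₀) _ sub-V₀))

    step-n : ∀ {j} (S : Fin j → Subset n) (i : Fin j) → suc (toℕ i) * n ≡ toℕ i * n + length (bits (S i))
    step-n S i = trans (+-comm n (toℕ i * n)) (cong (toℕ i * n +_) (sym (length-bits (S i))))

    length-block : ∀ i → length (concatMap (λ j → bits (I i j)) (allFin (lookup ℓ i))) ≡ lookup ℓ i * n
    length-block i = length-concatMap-tabulate id (λ j → bits (I i j)) (_* n) (step-n (I i))

    step-Q : ∀ i → Qf (suc (toℕ i)) * n ≡ Qf (toℕ i) * n + length (concatMap (λ j →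
      bits (I i j)) (allFin (lookup ℓ i)))
    step-Q i = trans (cong (λ l → (Qf (toℕ i) + l) * n) (ext-toℕ (lookup ℓ) 0 i)) (trans (*-distribʳ-+ n
      (Qf (toℕ i)) (lookup ℓ i)) (cong (Qf (toℕ i) * n +_) (sym (length-block i))))

    sub-I : Sub input offI (Is ++ adjacency succs ++ adjacency preds)
    sub-I = subst (λ q → Sub input q (Is ++ adjacency succs ++ adjacency preds)) (cong (offF +_)
      (length-concatMap-tabulate id (λ i → bits (F i)) (_* n) (step-n F))) (proj₂ (Sub-++ Fs _ sub-F))

    sub-A : Sub input offA (adjacency succs ++ adjacency preds)
    sub-A = subst (λ q → Sub input q (adjacency succs ++ adjacency preds)) (cong (offI +_)
      (length-concatMap-tabulate id _ (λ i → Qf i * n) step-Q)) (proj₂ (Sub-++ Is _ sub-I))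

    module Adjacency (f : Fin n → List (Fin n)) (off : ℕ) (as : ℕ → List ℕ) (as-at : ∀ v → as (toℕ v) ≡
      map toℕ (f v)) (sub : Sub input off (adjacency f)) where

      degrees lists : List ℕ
      degrees = map (λ v → length (f v)) (allFin n)
      lists = concatMap (λ v → map toℕ (f v)) (allFin n)

      length-degrees : length degrees ≡ n
      length-degrees = trans (Listₚ.length-map _ (allFin n)) (Listₚ.length-tabulate {n = n} id)

      sub-degrees : Sub input off degrees
      sub-degrees = proj₁ (Sub-++ degrees lists sub)

      sub-lists : Sub input (off + n) lists
      sub-lists = subst (λ q → Sub input (off + q) lists) length-degrees (proj₂ (Sub-++ degrees lists sub))

      step : ∀ v → sumTo (length ∘ as) (suc (toℕ v)) ≡ sumTo (length ∘ as) (toℕ v) + length (map toℕ (f v))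
      step v = trans (cong (λ l → length l + sumTo (length ∘ as) (toℕ v)) (as-at v)) (+-comm
        (length (map toℕ (f v))) _)

      length-lists : length lists ≡ sumTo (length ∘ as) n
      length-lists = length-concatMap-tabulate id (λ v → map toℕ (f v)) (sumTo (length ∘ as)) step

      length-adjacency : length (adjacency f) ≡ n + sumTo (length ∘ as) n
      length-adjacency = trans (Listₚ.length-++ degrees) (cong₂ _+_ length-degrees length-lists)

      at-degree : ∀ {v} → v < n → At input (off + v) (length (as v))
      at-degree = byFin (λ v → At input (off + v) (length (as v))) λ v →
        subst (At input (off + toℕ v)) (trans (sym (Listₚ.length-map toℕ (f v))) (cong length (sym (as-at v))))
        (Sub-tabulate (λ v → length (f v)) (subst (Sub input off) (Listₚ.map-tabulate id (λ v → length (f v)))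
          sub-degrees) v)

      sub-list : ∀ v → Sub input (off + n + sumTo (length ∘ as) (toℕ v)) (as (toℕ v))
      sub-list v = subst (Sub input (off + n + sumTo (length ∘ as) (toℕ v))) (sym (as-at v)) (Sub-concatMap id
        (λ v → map toℕ (f v)) (sumTo (length ∘ as)) refl step sub-lists v)

      seg-list : ∀ {v} → v < n → Seg input (off + n + sumTo (length ∘ as) v) (as v)
      seg-list = byFin (λ v → Seg input (off + n + sumTo (length ∘ as) v) (as v)) λ v → Sub-Seg _ (sub-list v)

      list-end : ∀ {v} → v < n → off + n + sumTo (length ∘ as) v + length (as v) ≤ inputSize
      list-end = byFin (λ v → off + n + sumTo (length ∘ as) v + length (as v) ≤ inputSize) λ v →
        Sub-length (sub-list v)

      off+n≤ : off + n ≤ inputSize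
      off+n≤ = ≤-trans (≤-reflexive (cong (off +_) (sym length-degrees))) (Sub-length sub-degrees)

      edges≤ : sumTo (length ∘ as) n ≤ inputSize
      edges≤ = ≤-trans (≤-reflexive (sym length-lists)) (≤-trans (m≤n+m _ (off + n)) (Sub-length sub-lists))

    module Succ = Adjacency succs offA sl sl-at (proj₁ (Sub-++ (adjacency succs) _ sub-A))

    sub-Q : Sub input offQ (adjacency preds)
    sub-Q = subst (λ q → Sub input q (adjacency preds)) (trans (cong (offA +_) Succ.length-adjacency)
      (sym (+-assoc offA n _))) (proj₂ (Sub-++ (adjacency succs) _ sub-A))

    module Pred = Adjacency preds offQ pl pl-at sub-Q

    ind : Fin n → Fin n → ℕ
    ind v w = bit (lookup (E v) w)

    length-succs : ∀ v → length (succs v) ≡ sumF (ind v)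
    length-succs v = trans (length-filter-tabulate (_∈? E v) id) (sumF-cong λ w →
      cong bit (does-lookup (E v) w))

    length-preds : ∀ w → length (preds w) ≡ sumF (λ v → ind v w)
    length-preds w = trans (length-filter-tabulate (λ v → w ∈? E v) id) (sumF-cong λ v →
      cong bit (does-lookup (E v) w))

    edges-sl : sumTo (length ∘ sl) n ≡ ∣E∣
    edges-sl = trans (sumTo-sumF (length ∘ sl) n) (trans (sumF-cong λ v →
      trans (length-sl v) (trans (length-succs v) (sym (∣∣-sumF (E v))))) (sym (sum-map-tabulate (λ v →
        Subset.∣ E v ∣) id)))

    edges-pl : sumTo (length ∘ pl) n ≡ ∣E∣
    edges-pl = trans (sumTo-sumF (length ∘ pl) n) (trans (sumF-cong λ w → trans (length-pl w) (length-preds w))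
      (trans (sym (sumF-swap ind))
      (trans (sumF-cong λ v → sym (∣∣-sumF (E v))) (sym (sum-map-tabulate (λ v → Subset.∣ E v ∣) id)))))

    D≤W : D ≤ W
    D≤W = m≤n*m D C {{>-nonZero (≤-trans (s≤s z≤n) 100≤C)}}

    size≤D : inputSize ≤ D
    size≤D = ≤-trans (m≤m+n inputSize _) (n≤1+n _)

    nkB≤D : n * k * Bn ≤ D
    nkB≤D = ≤-trans (m≤n+m _ inputSize) (n≤1+n _)

    nk>0 : 0 < n * k
    nk>0 = *-mono-< n>0 k≥1

    nk≤D : n * k ≤ D
    nk≤D = ≤-trans (m≤m*n (n * k) Bn {{>-nonZero Bn>0}}) nkB≤D

    n≤D : n ≤ D
    n≤D = ≤-trans (m≤m*n n k {{k>0}}) nk≤D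

    Bn≤D : Bn ≤ D
    Bn≤D = ≤-trans (m≤n*m Bn (n * k) {{>-nonZero nk>0}}) nkB≤D

    ℓ≤Bn : ∀ {j} (l : Vec ℕ j) → (∀ i → NonZero (lookup l i)) → All (_≤ ∣Domain∣ l) (Vec.toList l)
    ℓ≤Bn [] _ = []
    ℓ≤Bn (x ∷ l) nz = m≤m*n x (∣Domain∣ l) {{>-nonZero (Domain>0 l (nz ∘ suc))}} ∷ All.map (λ le →
      ≤-trans le (m≤n*m (∣Domain∣ l) x {{nz zero}})) (ℓ≤Bn l (nz ∘ suc))

    All-concatMap : ∀ {X : Set} {P : ℕ → Set} (f : X → List ℕ) xs → (∀ x → All P (f x)) → All P (concatMap f xs)
    All-concatMap f xs pf = Allₚ.concat⁺ (Allₚ.map⁺ (All.universal pf xs))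

    bits≤D : ∀ {j} (S : Subset j) → All (_≤ D) (bits S)
    bits≤D S = Allₚ.map⁺ (All.universal (λ { true → s≤s z≤n ; false → z≤n }) (Vec.toList S))

    adjacency≤D : ∀ f → (∀ v → length (f v) ≤ n) → All (_≤ D) (adjacency f)
    adjacency≤D f le = Allₚ.++⁺ (Allₚ.map⁺ (All.universal (λ v → ≤-trans (le v) n≤D) (allFin n)))
      (All-concatMap (λ v → map toℕ (f v)) (allFin n) λ v → Allₚ.map⁺ (All.universal (λ w →
        ≤-trans (<⇒≤ (Finₚ.toℕ<n w)) n≤D) (f v)))

    length-filter≤n : ∀ {P : Fin n → Set} (P? : ∀ v → Dec (P v)) → length (filter P? (allFin n)) ≤ n
    length-filter≤n P? = ≤-trans (Listₚ.length-filter P? (allFin n)) (≤-reflexive (Listₚ.length-tabulate {n = n}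
      id))

    All-input : All (_≤ D) input
    All-input = n≤D ∷ ≤-trans (≤-reflexive (sym edges-sl)) (≤-trans Succ.edges≤ size≤D) ∷
      ≤-trans (m≤n*m k n {{>-nonZero n>0}}) nk≤D ∷
      Allₚ.++⁺ (All.map (λ le → ≤-trans le Bn≤D) (ℓ≤Bn ℓ ℓ>0)) (Allₚ.++⁺ (bits≤D V₀)
        (Allₚ.++⁺ (All-concatMap _ (allFin k) (λ i → bits≤D (F i)))
      (Allₚ.++⁺ (All-concatMap _ (allFin k) λ i → All-concatMap _ (allFin (lookup ℓ i)) λ j → bits≤D (I i j))
      (Allₚ.++⁺ (adjacency≤D succs λ v → length-filter≤n (_∈? E v)) (adjacency≤D preds λ w →
        length-filter≤n (λ v → w ∈? E v))))))

    input≤W : ∀ {i x} → At input i x → x ≤ W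
    input≤W (j , _ , refl) = ≤-trans (All.lookup All-input (∈ₚ.∈-lookup j)) D≤W

    -- With `S` and `k` positive, the slots take at most `2 * S * (4 * k)` cells and the sixteen
    -- arrays `16 * (3 * S * k)`: 8 and 48 make the 56.
    fits : suc (n * Bn) * (2 + k * 2) + n * Bn * (2 + k) * 16 ≤ space
    fits = begin
      suc S * (2 + k * 2) + S * (2 + k) * 16
        ≤⟨ +-mono-≤ (*-mono-≤ (+-monoˡ-≤ S S>0) (+-monoˡ-≤ (k * 2) (*-monoˡ-≤ 2 k≥1))) (*-monoˡ-≤ 16
          (*-monoʳ-≤ S (+-monoˡ-≤ k (*-monoʳ-≤ 2 k≥1)))) ⟩
      (S + S) * (k * 2 + k * 2) + S * (2 * k + k) * 16 ≡⟨ solveℕ 2 (λ s k →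
        (s :+ s) :* (k :* con 2 :+ k :* con 2) :+ s :* (con 2 :* k :+ k) :* con 16 :≡ con 56 :* (s :* k)) refl S
          k ⟩
      56 * (S * k) ≤⟨ *-mono-≤ (≤-trans (≤ᵇ⇒≤ 56 100 tt) 100≤C) (≤-trans (≤-reflexive (solveℕ 3 (λ a b c →
        a :* b :* c :≡ a :* c :* b) refl n Bn k)) (n≤1+n (n * k * Bn))) ⟩
      space ∎
      where
      open ≤-Reasoning
      S = n * Bn
      S>0 : 0 < S
      S>0 = *-mono-< n>0 Bn>0

    -- Chosen such that the classes of the head keys are right for every number, state or not.
    default : ℕ → ℕ
    default 1 = 1
    default _ = 2

    cl : ℕ → ℕ → ℕ
    cl s p = onStates (λ v b → class v b p) (default p) s

    default≤2 : ∀ p → default p ≤ 2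
    default≤2 0 = ≤-refl
    default≤2 1 = s≤s z≤n
    default≤2 (suc (suc _)) = ≤-refl

    thrF : Fin n → ℕ
    thrF v = if lookup V₀ v then length (succs v) else 1

    degree>0 : ∀ v → 0 < length (succs v)
    degree>0 v with succs v | proj₂ (serial-succs v)
    ... | _ ∷ _ | _ = z<s

    thrF>0 : ∀ v → 0 < thrF v
    thrF>0 v with lookup V₀ v
    ... | true  = degree>0 v
    ... | false = z<s

    pl-sl : ∀ {u v} → u < n → v < n → (u ∈ pl v → v ∈ sl u) × (v ∈ sl u → u ∈ pl v)
    pl-sl = λ u< v< → byFin (λ u → ∀ {v} → v < n → (u ∈ pl v → v ∈ sl u) × (v ∈ sl u → u ∈ pl v))
      (λ u → byFin (λ v → (toℕ u ∈ pl v → v ∈ sl (toℕ u)) × (v ∈ sl (toℕ u) → toℕ u ∈ pl v)) (go u)) u< v<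
      where
      unmap : ∀ {u : Fin n} {xs} → toℕ u ∈ map toℕ xs → u ∈ xs
      unmap {u} {xs} u∈ with ∈ₚ.∈-map⁻ toℕ u∈
      ... | w , w∈ , eq = subst (_∈ xs) (sym (Finₚ.toℕ-injective eq)) w∈
      go : ∀ u v → (toℕ u ∈ pl (toℕ v) → toℕ v ∈ sl (toℕ u)) × (toℕ v ∈ sl (toℕ u) → toℕ u ∈ pl (toℕ v))
      go u v rewrite sl-at u | pl-at v =
        (λ u∈ → ∈ₚ.∈-map⁺ toℕ (∈ₚ.∈-filter⁺ (_∈? E u) (∈ₚ.∈-allFin v) (proj₂ (∈ₚ.∈-filter⁻ (λ u →
          v ∈? E u) {xs = allFin n} (unmap u∈))))) ,
        (λ v∈ → ∈ₚ.∈-map⁺ toℕ (∈ₚ.∈-filter⁺ (λ u → v ∈? E u) (∈ₚ.∈-allFin u)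
          (proj₂ (∈ₚ.∈-filter⁻ (_∈? E u) {xs = allFin n} (unmap v∈)))))

    setup : Setup
    setup = record
      { input = input ; space = space ; W = W ; n = n ; k = k ; Bn = Bn ; offA = offA ; offQ = offQ
      ; n>0 = n>0 ; k>0 = k≥1 ; Bn>0 = Bn>0
      ; 100≤W = ≤-trans 100≤C (m≤m*n C D)
      ; fits = fits
      ; space≤W = *-monoʳ-≤ C (s≤s (m≤n+m _ inputSize))
      ; input≤W = input≤W
      ; length≤W = ≤-trans size≤D D≤W
      ; cl = cl
      ; nx = onStates (λ v b → toℕ (index (nextB v b))) 0
      ; sl = sl ; pl = pl ; thr = ext thrF 1 ; so = so ; po = po
      ; cl≤2 = λ s p → onStates-elim (_≤ 2) (λ v b → class v b p) (default p) (λ v b →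
        class≤2 v b p) (default≤2 p) s
      ; cl-0 = λ s → onStates-elim (_≡ 2) (λ v b → class v b 0) 2 (λ _ _ → refl) refl s
      ; cl-1 = λ s → onStates-elim (_≡ 1) (λ v b → class v b 1) 1 (λ _ _ → refl) refl s
      ; nx< = λ {s} _ → onStates-elim (_< Bn) (λ v b → toℕ (index (nextB v b))) 0 (λ v b →
        Finₚ.toℕ<n (index (nextB v b))) Bn>0 s
      ; sl< = λ {v} _ → ext-elim (All (_< n)) _ [] (λ v → Allₚ.map⁺ (All.universal Finₚ.toℕ<n (succs v))) [] v
      ; pl< = λ {v} _ → ext-elim (All (_< n)) _ [] (λ v → Allₚ.map⁺ (All.universal Finₚ.toℕ<n (preds v))) [] v
      ; sl-unique = λ v → ext-elim Unique _ [] (λ v → Uniqueₚ.map⁺ Finₚ.toℕ-injective (Uniqueₚ.filter⁺ (_∈? E v)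
        (Uniqueₚ.allFin⁺ n))) [] v
      ; pl-unique = λ v → ext-elim Unique _ [] (λ v → Uniqueₚ.map⁺ Finₚ.toℕ-injective (Uniqueₚ.filter⁺ (λ u →
        v ∈? E u) (Uniqueₚ.allFin⁺ n))) [] v
      ; pl⇒sl = λ u< v< → proj₁ (pl-sl u< v<)
      ; sl⇒pl = λ u< v< → proj₂ (pl-sl u< v<)
      ; thr>0 = λ v → ext-elim (0 <_) thrF 1 thrF>0 z<s v
      ; deg-sl = Succ.at-degree ; deg-pl = Pred.at-degree ; seg-sl = Succ.seg-list ; seg-pl = Pred.seg-list
      ; so-end = Succ.list-end ; po-end = Pred.list-end
      }

    vt : ℕ → ℕ
    vt = Verified.Algorithm.vt setup

    fb dg part : ℕ → ℕ → ℕ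
    ib : ℕ → ℕ → ℕ → ℕ
    fb i v   = ext (λ ι → ext (λ ν → bit (lookup (F ι) ν)) 0 v) 0 i
    ib i d v = ext (λ ι → ext (λ δ → ext (λ ν → bit (lookup (I ι δ) ν)) 0 v) 0 d) 0 i
    dg i s   = ext (λ ι → onStates (λ v b → toℕ (b ! ι)) 0 s) 0 i
    part i s = onStates (λ v b → sufIndex (nextB v b) i) 0 s

    vt-state : ∀ v b → vt (state v b) ≡ toℕ v
    vt-state v b = Verified.Algorithm.vt-≡ setup (Finₚ.toℕ<n (index b))

    lf-at : ∀ ι → lf (toℕ ι) ≡ lookup ℓ ι
    lf-at = ext-toℕ (lookup ℓ) 0

    fb-at : ∀ ι ν → fb (toℕ ι) (toℕ ν) ≡ bit (lookup (F ι) ν)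
    fb-at ι ν = trans (ext-toℕ (λ ι → ext (λ ν → bit (lookup (F ι) ν)) 0 (toℕ ν)) 0 ι) (ext-toℕ (λ ν →
      bit (lookup (F ι) ν)) 0 ν)

    ib-at : ∀ ι δ ν → ib (toℕ ι) (toℕ δ) (toℕ ν) ≡ bit (lookup (I ι δ) ν)
    ib-at ι δ ν = trans (ext-toℕ (λ ι → ext (λ δ → ext (λ ν → bit (lookup (I ι δ) ν)) 0 (toℕ ν)) 0 (toℕ δ)) 0 ι)
      (trans (ext-toℕ (λ δ → ext (λ ν → bit (lookup (I ι δ) ν)) 0 (toℕ ν)) 0 δ) (ext-toℕ (λ ν →
        bit (lookup (I ι δ) ν)) 0 ν))

    dg-at : ∀ ι v b → dg (toℕ ι) (state v b) ≡ toℕ (b ! ι)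
    dg-at ι v b = trans (ext-toℕ (λ ι → onStates (λ v b → toℕ (b ! ι)) 0 (state v b)) 0 ι) (onStates-state
      (λ v b → toℕ (b ! ι)) 0 v b)

    fb-state : ∀ ι v b → fb (toℕ ι) (vt (state v b)) ≡ bit (lookup (F ι) v)
    fb-state ι v b = trans (cong (fb (toℕ ι)) (vt-state v b)) (fb-at ι v)

    ib-state : ∀ ι v b → ib (toℕ ι) (dg (toℕ ι) (state v b)) (vt (state v b)) ≡ bit (lookup (I ι (b ! ι)) v)
    ib-state ι v b = trans (cong₂ (ib (toℕ ι)) (dg-at ι v b) (vt-state v b)) (ib-at ι (b ! ι) v)

    cl-state : ∀ ι v b → cl (state v b) (2+ (toℕ ι)) ≡ code v b ι
    cl-state ι v b = trans (onStates-state (λ v b → class v b (2+ (toℕ ι))) 2 v b) (class-key v b ι)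

    onBoth : ∀ (P : ℕ → ℕ → Set) → (∀ ι v b → P (toℕ {k} ι) (state v b)) → ∀ {i s} → i < k → s < n * Bn → P i s
    onBoth P f i<k s< = byFin (λ i → ∀ {s} → s < n * Bn → P i s) (λ ι → byState (P (toℕ ι)) (f ι)) i<k s<

    part-state : ∀ ι v b → part (toℕ ι) (state v b) ≡ part (suc (toℕ ι)) (state v b) + toℕ (nextB v b ! ι) *
      sufProd ℓ (suc (toℕ ι))
    part-state ι v b = trans (onStates-state (λ v b → sufIndex (nextB v b) (toℕ ι)) 0 v b) (trans (sufIndex-step
      (nextB v b) ι)
      (cong (_+ toℕ (nextB v b ! ι) * sufProd ℓ (suc (toℕ ι))) (sym (onStates-state (λ v b →
        sufIndex (nextB v b) (suc (toℕ ι))) 0 v b))))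

    -- Division with remainder twice, by the product of the later sizes and then by the size of the
    -- component itself.
    dg-unique : ∀ ι v b {h d lo} → state v b ≡ (h * lf (toℕ ι) + d) * sufProd ℓ (suc (toℕ ι)) + lo →
      d < lf (toℕ ι) → lo < sufProd ℓ (suc (toℕ ι)) → dg (toℕ ι) (state v b) ≡ d
    dg-unique ι v b {h} {d} {lo} eq d< lo< = trans (dg-at ι v b) (proj₂ (*+-unique l {toℕ v * q + h′} {h}
      (Finₚ.toℕ<n (b ! ι)) (subst (d <_) (lf-at ι) d<)
      (proj₁ (*+-unique p {(toℕ v * q + h′) * l + toℕ (b ! ι)} {h * l + d} (sufIndex< b (suc (toℕ ι))) lo<
        (trans (sym expand) (trans eq (cong (λ z → (h * z + d) * p + lo) (lf-at ι))))))))
      where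
      l = lookup ℓ ι
      p = sufProd ℓ (suc (toℕ ι))
      q = proj₁ (Domain-split ℓ ι)
      h′ = proj₁ (index-split b ι)
      expand : state v b ≡ ((toℕ v * q + h′) * l + toℕ (b ! ι)) * p + sufIndex b (suc (toℕ ι))
      expand = begin
        toℕ v * Bn + toℕ (index b)
          ≡⟨ cong₂ (λ x y → toℕ v * x + y) (trans (proj₂ (Domain-split ℓ ι)) (cong (q *_) (sufProd-step ℓ ι)))
               (trans (proj₂ (index-split b ι)) (cong₂ (λ x y → h′ * x + y) (sufProd-step ℓ ι) (sufIndex-step b
                 ι))) ⟩
        toℕ v * (q * (l * p)) + (h′ * (l * p) + (sufIndex b (suc (toℕ ι)) + toℕ (b ! ι) * p))
          ≡⟨ solveℕ 7 (λ v q l p h s d → v :* (q :* (l :* p)) :+ (h :* (l :* p) :+ (s :+ d :* p)) :≡ ((v :* q :+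
            h) :* l :+ d) :* p :+ s) refl (toℕ v) q l p h′ (sufIndex b (suc (toℕ ι))) (toℕ (b ! ι)) ⟩
        ((toℕ v * q + h′) * l + toℕ (b ! ι)) * p + sufIndex b (suc (toℕ ι)) ∎
        where open ≡-Reasoning

    code-F : ∀ v b ι → v Subset.∈ F ι → code v b ι ≡ 0
    code-F v b ι v∈ with code v b ι | coded v b ι
    ... | _ | bad _ = refl
    ... | _ | reset v∉ _ = contradiction v∈ v∉
    ... | _ | plain v∉ _ = contradiction v∈ v∉

    code-I : ∀ v b ι → v Subset.∉ F ι → v Subset.∈ I ι (b ! ι) → code v b ι ≡ 1
    code-I v b ι v∉ v∈ with code v b ι | coded v b ι
    ... | _ | bad v∈F = contradiction v∈F v∉
    ... | _ | reset _ _ = refl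
    ... | _ | plain _ v∉I = contradiction v∈ v∉I

    code-O : ∀ v b ι → v Subset.∉ F ι → v Subset.∉ I ι (b ! ι) → code v b ι ≡ 2
    code-O v b ι v∉ v∉I with code v b ι | coded v b ι
    ... | _ | bad v∈F = contradiction v∈F v∉
    ... | _ | reset _ v∈ = contradiction v∈ v∉I
    ... | _ | plain _ _ = refl

    thr-V₀ : ∀ v → 0 < bit (lookup V₀ v) → ext thrF 1 (toℕ v) ≡ length (sl (toℕ v))
    thr-V₀ v pos with ext-toℕ thrF 1 v
    ... | eq with lookup V₀ v
    ...   | true = trans eq (sym (length-sl v))

    thr-V₁ : ∀ v → bit (lookup V₀ v) ≡ 0 → ext thrF 1 (toℕ v) ≡ 1
    thr-V₁ v zero≡ with ext-toℕ thrF 1 v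
    ... | eq with lookup V₀ v
    ...   | false = eq

    v0 : ℕ → ℕ
    v0 = ext (λ ν → bit (lookup V₀ ν)) 0

    v0-at : ∀ v → v0 (toℕ v) ≡ bit (lookup V₀ v)
    v0-at = ext-toℕ (λ ν → bit (lookup V₀ ν)) 0

    at-fb : ∀ ι v → At input (offF + (toℕ ι * n + toℕ v)) (fb (toℕ ι) (toℕ v))
    at-fb ι v = subst₂ (At input) (+-assoc offF (toℕ ι * n) (toℕ v)) (sym (fb-at ι v))
      (Sub-bits (F ι) (Sub-concatMap id (λ i → bits (F i)) (_* n) refl (step-n F) (proj₁ (Sub-++ Fs _ sub-F)) ι)
        v)

    at-ib : ∀ ι δ v → At input (offI + ((Qf (toℕ ι) + toℕ δ) * n + toℕ v)) (ib (toℕ ι) (toℕ δ) (toℕ v))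
    at-ib ι δ v = subst₂ (At input)
      (solveℕ 5 (λ o q d n v → o :+ q :* n :+ d :* n :+ v :≡ o :+ ((q :+ d) :* n :+ v)) refl offI (Qf (toℕ ι))
        (toℕ δ) n (toℕ v)) (sym (ib-at ι δ v))
      (Sub-bits (I ι δ) (Sub-concatMap id (λ j → bits (I ι j)) (_* n) refl (step-n (I ι))
        (Sub-concatMap id _ (λ i → Qf i * n) refl step-Q (proj₁ (Sub-++ Is _ sub-I)) ι) δ) v)

    source : Verified.Source setup
    source = record
      { lf = lf ; Pf = sufProd ℓ ; Qf = Qf ; v0 = v0 ; fb = fb ; dg = dg ; part = part ; ib = ib
      ; at-k = at-k
      ; at-ℓ = byFin (λ i → At input (3 + i) (lf i)) λ ι →
        subst (At input (3 + toℕ ι)) (sym (lf-at ι)) (Sub-toList ℓ (proj₁ (Sub-++ (Vec.toList ℓ) _ afterHeader))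
          ι)
      ; Pf-k = sufProd-end ℓ
      ; Pf-step = byFin (λ i → sufProd ℓ i ≡ lf i * sufProd ℓ (suc i)) λ ι →
        trans (sufProd-step ℓ ι) (cong (_* sufProd ℓ (suc (toℕ ι))) (sym (lf-at ι)))
      ; Pf-0 = refl ; Qf-0 = refl ; Qf-suc = λ _ → refl ; offA≡ = refl
      ; offA≤ = ≤-trans Succ.off+n≤ (≤-trans size≤D D≤W)
      ; offQ≤ = ≤-trans Pred.off+n≤ (≤-trans size≤D D≤W)
      ; so-0 = +-identityʳ _ ; so-suc = λ {v} _ → shift (offA + n) (length (sl v)) _ ; so-n = refl
      ; po-0 = +-identityʳ _ ; po-suc = λ {v} _ → shift (offQ + n) (length (pl v)) _
      ; at-v0 = byFin (λ v → At input (3 + k + v) (v0 v)) λ v →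
        subst (At input (3 + k + toℕ v)) (sym (v0-at v)) (Sub-bits V₀ (proj₁ (Sub-++ (bits V₀) _ sub-V₀)) v)
      ; thr-0 = byFin (λ v → 0 < v0 v → ext thrF 1 v ≡ length (sl v)) λ v pos →
        thr-V₀ v (subst (0 <_) (v0-at v) pos)
      ; thr-1 = byFin (λ v → v0 v ≡ 0 → ext thrF 1 v ≡ 1) λ v e → thr-V₁ v (trans (sym (v0-at v)) e)
      ; at-fb = λ i< v< → byFin (λ i → ∀ {v} → v < n → At input (offF + (i * n + v)) (fb i v)) (λ ι →
        byFin (λ v → At input (offF + (toℕ ι * n + v)) (fb (toℕ ι) v)) (at-fb ι)) i< v<
      ; at-ib = λ i< d< v< → byFin (λ i → ∀ {d v} → d < lf i → v < n →
        At input (offI + ((Qf i + d) * n + v)) (ib i d v))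
          (λ ι d< v< → byFin (λ d → ∀ {v} → v < n → At input (offI + ((Qf (toℕ ι) + d) * n + v)) (ib (toℕ ι) d
            v))
            (λ δ → byFin (λ v → At input (offI + ((Qf (toℕ ι) + toℕ δ) * n + v)) (ib (toℕ ι) (toℕ δ) v)) (at-ib
              ι δ)) (subst (_ <_) (lf-at ι) d<) v<) i< d< v<
      ; dg-unique = λ {_} {_} {h} {d} {lo} i< s< → onBoth (λ i s → s ≡ (h * lf i + d) * sufProd ℓ (suc i) + lo →
        d < lf i → lo < sufProd ℓ (suc i) → dg i s ≡ d) (λ ι v b → dg-unique ι v b {h}) i< s<
      ; cl-F = onBoth (λ i s → 0 < fb i (vt s) → cl s (2+ i) ≡ 0) λ ι v b pos →
        trans (cl-state ι v b) (code-F v b ι (bit-∈ (subst (0 <_) (fb-state ι v b) pos)))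
      ; cl-I = onBoth (λ i s → fb i (vt s) ≡ 0 → 0 < ib i (dg i s) (vt s) → cl s (2+ i) ≡ 1) λ ι v b f0 pos →
        trans (cl-state ι v b)
          (code-I v b ι (bit-∉ (trans (sym (fb-state ι v b)) f0)) (bit-∈ (subst (0 <_) (ib-state ι v b) pos)))
      ; cl-O = onBoth (λ i s → fb i (vt s) ≡ 0 → ib i (dg i s) (vt s) ≡ 0 → cl s (2+ i) ≡ 2) λ ι v b f0 i0 →
        trans (cl-state ι v b)
          (code-O v b ι (bit-∉ (trans (sym (fb-state ι v b)) f0)) (bit-∉ (trans (sym (ib-state ι v b)) i0)))
      ; part-k = onStates-elim (_≡ 0) (λ v b → sufIndex (nextB v b) k) 0 (λ v b → sufIndex-end (nextB v b)) refl
      ; part-suc = onBoth (λ i s → 0 < ib i (dg i s) (vt s) → suc (dg i s) < lf i → part i s ≡ part (suc i) s +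
        suc (dg i s) * sufProd ℓ (suc i)) λ ι v b pos lt →
          trans (part-state ι v b) (cong (λ z → part (suc (toℕ ι)) (state v b) + z * sufProd ℓ (suc (toℕ ι)))
            (trans (cong toℕ (nextB-step {v} {b} {ι} (bit-∈ (subst (0 <_) (ib-state ι v b) pos))))
              (trans (toℕ-⊕1-< (b ! ι) (subst₂ (λ x y → suc x < y) (dg-at ι v b) (lf-at ι) lt))
                (cong suc (sym (dg-at ι v b))))))
      ; part-wrap = onBoth (λ i s → 0 < ib i (dg i s) (vt s) → suc (dg i s) ≡ lf i → part i s ≡ part (suc i) s +
        0 * sufProd ℓ (suc i)) λ ι v b pos e →
          trans (part-state ι v b) (cong (λ z → part (suc (toℕ ι)) (state v b) + z * sufProd ℓ (suc (toℕ ι)))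
            (trans (cong toℕ (nextB-step {v} {b} {ι} (bit-∈ (subst (0 <_) (ib-state ι v b) pos))))
              (toℕ-⊕1-≡ (b ! ι) (trans (cong suc (sym (dg-at ι v b))) (trans e (lf-at ι))))))
      ; part-keep = onBoth (λ i s → ib i (dg i s) (vt s) ≡ 0 → part i s ≡ part (suc i) s + dg i s *
        sufProd ℓ (suc i)) λ ι v b e →
          trans (part-state ι v b) (cong (λ z → part (suc (toℕ ι)) (state v b) + z * sufProd ℓ (suc (toℕ ι)))
            (trans (cong toℕ (nextB-keep {v} {b} {ι} (bit-∉ (trans (sym (ib-state ι v b)) e))))
              (sym (dg-at ι v b))))
      ; part-0 = λ _ → refl
      ; part≤ = λ {i} {s} _ → onStates-elim (_≤ Bn) (λ v b → sufIndex (nextB v b) i) 0 (λ v b →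
        ≤-trans (sufIndex≤ (nextB v b) i) (<⇒≤ (Finₚ.toℕ<n (index (nextB v b))))) z≤n s
      ; lf>0 = byFin (λ i → 0 < lf i) λ ι → subst (0 <_) (sym (lf-at ι)) (>-nonZero⁻¹ _ {{ℓ>0 ι}})
      }
      where
      shift : ∀ o l s → o + (l + s) ≡ o + s + l
      shift = solveℕ 3 (λ o l s → o :+ (l :+ s) :≡ o :+ s :+ l) refl

    target : ℕ → ℕ → ℕ
    target = Verified.Algorithm.target setup

    fails : (ℕ → Word) → ℕ → ℕ → ℕ
    fails = Verified.Algorithm.fails setup

    failures : (ℕ → Word) → ℕ → ℕ
    failures = Verified.Algorithm.failures setup

    Bad : (ℕ → Word) → ℕ → Set
    Bad = Verified.Algorithm.Bad setup

    Final : St → Set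
    Final = Verified.Main.Final setup

    target-state : ∀ v b w → target (state v b) (toℕ w) ≡ state w (nextB v b)
    target-state v b w = cong (toℕ w * Bn +_) (onStates-state (λ v b → toℕ (index (nextB v b))) 0 v b)

    Above-state : ∀ v b {x y} → Above (class v b) x y → Above (cl (state v b)) x y
    Above-state v b = convert λ p → onStates-state (λ v b → class v b p) (default p) v b
      where
      convert : ∀ {c d x y} → (∀ p → d p ≡ c p) → Above c x y → Above d x y
      convert e (key> lt) = key> lt
      convert e (reset q) = reset (trans (e _) q)
      convert e (weight> q lt) = weight> (trans (e _) q) lt
      convert e (deeper q ab) = deeper (trans (e _) q) (convert e ab)

    state-Above : ∀ v b {x y} → Above (cl (state v b)) x y → Above (class v b) x y
    state-Above v b = convert λ p → onStates-state (λ v b → class v b p) (default p) v b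
      where
      convert : ∀ {c d x y} → (∀ p → d p ≡ c p) → Above d x y → Above c x y
      convert e (key> lt) = key> lt
      convert e (reset q) = reset (trans (sym (e _)) q)
      convert e (weight> q lt) = weight> (trans (sym (e _)) q) lt
      convert e (deeper q ab) = deeper (trans (sym (e _)) q) (convert e ab)

    sl-state : ∀ v b → sl (vt (state v b)) ≡ map toℕ (succs v)
    sl-state v b = trans (cong sl (vt-state v b)) (sl-at v)

    thr-state : ∀ v b → ext thrF 1 (vt (state v b)) ≡ thrF v
    thr-state v b = trans (cong (ext thrF 1) (vt-state v b)) (ext-toℕ thrF 1 v)

    module _ (r : ℕ → Word) (v : Fin n) (b : B) where
      s = state v b

      fails-Above : ∀ w → fails r s (toℕ w) ≡ 0 → Above (class v b) (r s) (r (state w (nextB v b)))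
      fails-Above w eq = state-Above v b (subst (λ t → Above (cl s) (r s) (r t)) (target-state v b w)
        (failBit≡0 (above? (cl s) (r s) (r (target s (toℕ w)))) eq))

      Above-fails : ∀ w → Above (class v b) (r s) (r (state w (nextB v b))) → fails r s (toℕ w) ≡ 0
      Above-fails w ab = failBit-yes (above? (cl s) (r s) (r (target s (toℕ w)))) (subst (λ t →
        Above (cl s) (r s) (r t)) (sym (target-state v b w)) (Above-state v b ab))

      fails≤1 : ∀ w → fails r s w ≤ 1
      fails≤1 w = failBit≤1 (above? (cl s) (r s) (r (target s w)))

      failures-state : failures r s ≡ sumL (fails r s) (map toℕ (succs v))
      failures-state = cong (sumL (fails r s)) (sl-state v b)

      -- Fewer failures than the threshold: for player 0 not all successors fail, so one succeeds;
      -- for player 1 the count is below one, so none fails.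
      notBad⇒Safe : ¬ Bad r s → Safe v λ w → Above (class v b) (r s) (r (state w (nextB v b)))
      notBad⇒Safe ¬bad = some , every
        where
        lt : sumL (fails r s) (map toℕ (succs v)) < thrF v
        lt = subst₂ _<_ failures-state (thr-state v b) (≰⇒> ¬bad)
        some : v Subset.∈ V₀ → ∃[ w ] w ∈ succs v × Above (class v b) (r s) (r (state w (nextB v b)))
        some v∈ with lookup V₀ v | []=⇒lookup v∈ | lt
        ... | true | _ | lt′ with sumL<length {f = fails r s} (map toℕ (succs v)) fails≤1 (subst
          (sumL (fails r s) (map toℕ (succs v)) <_) (sym (Listₚ.length-map toℕ (succs v))) lt′)
        ...   | x , x∈ , eq with ∈ₚ.∈-map⁻ toℕ x∈
        ...     | w , w∈ , refl = w , w∈ , fails-Above w eq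
        every : v Subset.∉ V₀ → ∀ w → w ∈ succs v → Above (class v b) (r s) (r (state w (nextB v b)))
        every v∉ w w∈ = fails-Above w (sumL≡0 {f = fails r s} (map toℕ (succs v)) (none (lookup V₀ v) refl)
          (∈ₚ.∈-map⁺ toℕ w∈))
          where
          none : ∀ c → lookup V₀ v ≡ c → sumL (fails r s) (map toℕ (succs v)) ≡ 0
          none true e = contradiction (lookup⇒[]= v V₀ e) v∉
          none false e = n<1⇒n≡0 (subst (λ c → sumL (fails r s) (map toℕ (succs v)) <
            (if c then length (succs v) else 1)) e lt)

      Safe⇒notBad : Safe v (λ w → Above (class v b) (r s) (r (state w (nextB v b)))) → ¬ Bad r s
      Safe⇒notBad (some , every) is-bad = contradiction (subst₂ _≤_ (thr-state v b) failures-state is-bad) (<⇒≱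
        (go (lookup V₀ v) refl))
        where
        go : ∀ c → lookup V₀ v ≡ c → sumL (fails r s) (map toℕ (succs v)) <
          (if lookup V₀ v then length (succs v) else 1)
        go true e rewrite e = let w , w∈ , ab = some (lookup⇒[]= v V₀ e) in
          subst (sumL (fails r s) (map toℕ (succs v)) <_) (Listₚ.length-map toℕ (succs v))
            (sumL-<length {f = fails r s} (map toℕ (succs v)) fails≤1 (toℕ w , ∈ₚ.∈-map⁺ toℕ w∈ ,
              Above-fails w ab))
        go false e rewrite e = s≤s (≤-reflexive (sumL-zero {f = fails r s} (map toℕ (succs v)) λ x∈ → all x∈))
          where
          all : ∀ {x} → x ∈ map toℕ (succs v) → fails r s x ≡ 0
          all x∈ with ∈ₚ.∈-map⁻ toℕ x∈
          ... | w , w∈ , refl = Above-fails w (every (λ v∈ → contradiction (trans (sym e) ([]=⇒lookup v∈)) λ ())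
            w w∈)

    smallest : ∀ {σ} (f : Final σ) → Σ[ r ∈ Ranking ] SmallestGood r × ∀ v b → letters (r v b) ≡
      Verified.Main.Final.result f (state v b)
    smallest f = smallestGood (λ v b → Verified.Main.Final.result f (state v b)) ((λ v b →
      notBad⇒Safe (Verified.Main.Final.result f) v b (Verified.Main.Final.good f (in-range v b))) , λ v b →
        Verified.Main.Final.tidied f (in-range v b))
      (λ v b eq → Verified.Main.Final.canonical f (in-range v b) eq) lower
      where
      in-range : ∀ v b → state v b < n * Bn
      in-range v b = Setup.state< setup (Finₚ.toℕ<n v) (Finₚ.toℕ<n (index b))
      lower : ∀ d → Candidate d → ∀ v b → Verified.Main.Final.result f (state v b) ≼ d v b
      lower d (good , tidy) v b = subst (Verified.Main.Final.result f (state v b) ≼_) (same-d v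
        b) (Verified.Main.Final.lower f flat-d (λ {s} _ →
          onStates-elim (Tidy n k) d (initWord k) tidy (Verified.Solver.tidy₀ setup source) s)
        (λ {s} s< → byState (λ s → ¬ Bad flat-d s) (λ v b → Safe⇒notBad flat-d v b (safe v b)) s<)
          (in-range v b))
        where
        flat-d : ℕ → Word
        flat-d = onStates d (initWord k)
        same-d : ∀ v b → flat-d (state v b) ≡ d v b
        same-d = onStates-state d (initWord k)
        safe : ∀ v b → Safe v λ w → Above (class v b) (flat-d (state v b)) (flat-d (state w (nextB v b)))
        safe v b with good v b
        ... | some , every = (λ v∈ → let w , w∈ , ab = some v∈ in w , w∈ ,
          subst₂ (Above (class v b)) (sym (same-d v b)) (sym (same-d w (nextB v b))) ab) ,
                             λ v∉ w w∈ → subst₂ (Above (class v b)) (sym (same-d v b)) (sym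
                               (same-d w (nextB v b))) (every v∉ w w∈)

    holds : ∀ {M σ r} (f : Final σ) → (∀ {i} → i < Setup.base₀ setup → M i ≡ rnk σ i) →
            (∀ v b → letters (r v b) ≡ Verified.Main.Final.result f (state v b)) → Holds G Ω M r
    holds {M} {σ} {r} f rep eq v b j = subst (λ s → M (s * (2 + k * 2) + toℕ j) ≡
      List.lookup (cells (r v b)) j) (sym (toℕ-combine′ v (index b)))
      (trans (rep (<-≤-trans (+-monoʳ-< (state v b * (2 + k * 2)) (<-≤-trans (Finₚ.toℕ<n j)
        (cells-length (r v b)))) (Setup.slot setup (<⇒≤ in-range))))
        (cells-stored (r v b) (subst (Stored 0 (rnk σ) (state v b * (2 + k * 2))) (sym (eq v b))
          (Verified.Main.Final.stored f in-range)) j))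
      where
      in-range : state v b < n * Bn
      in-range = Setup.state< setup (Finₚ.toℕ<n v) (Finₚ.toℕ<n (index b))

    computes : ∀ {time} → weight solver * suc (Verified.Solver.Tot setup source * Successor.total n k) ≤ time →
      ComputesSmallestGood G Ω solver time space W
    computes le =
      let t , M , σ , t≤ , exec , rep , f = Verified.Solver.solver-runs setup source at-n
          r , small , eq = smallest f
      in r , small , t , ⟨ var σ , M ⟩ , ≤-trans t≤ le , exec , holds f rep eq

    -- The total cost.

    pre : ℕ → ℕ → ℕ → List ℕ
    pre = Verified.Algorithm.pre setup

    cost : ℕ → ℕ
    cost = Verified.Main.cost setup

    Tot : ℕ
    Tot = Verified.Solver.Tot setup source

    K c : ℕ
    K = suc (suc k)
    c = suc (2 + k * 2 + 2 * suc k)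

    -- Each component has one image under `nx`, so the preimages of different images are disjoint
    -- and their sizes add up to at most the number of components.
    pre-total : ∀ u N M → sumTo (λ y → length (pre u y N)) M ≤ N
    pre-total u zero M = ≤-reflexive (trans (sumTo-const 0 M) (*-zeroʳ M))
    pre-total u (suc N) M = ≤-trans (≤-reflexive (trans (sumTo-cong M λ {y} _ →
      length-if (nx (u * Bn + N) ≡ᵇ y)) (sumTo-+ _ _ M)))
      (+-mono-≤ (indicator≤1 (nx (u * Bn + N)) M) (pre-total u N M))
      where
      open Setup setup using (nx)
      length-if : ∀ {y} b → length (if b then N ∷ pre u y N else pre u y N) ≡ bit b + length (pre u y N)
      length-if true  = refl
      length-if false = refl

    -- The amortisation: one row may be as long as `|B|`, but over all `x` the rows at `u` cost only
    -- `O(k * |B|)`.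
    rows-total : ∀ u → sumTo (λ x → suc (length (pre u x Bn) * K)) Bn ≤ Bn * suc K
    rows-total u = begin
      sumTo (λ x → 1 + length (pre u x Bn) * K) Bn ≡⟨ sumTo-+ (λ _ → 1) _ Bn ⟩
      sumTo (λ _ → 1) Bn + sumTo (λ x → length (pre u x Bn) * K) Bn
        ≡⟨ cong₂ _+_ (sumTo-const 1 Bn) (sumTo-*ʳ (λ x → length (pre u x Bn)) K Bn) ⟩
      Bn * 1 + sumTo (λ x → length (pre u x Bn)) Bn * K
        ≤⟨ +-monoʳ-≤ (Bn * 1) (*-monoˡ-≤ K (pre-total u Bn Bn)) ⟩
      Bn * 1 + Bn * K ≡⟨ *-distribˡ-+ Bn 1 K ⟨
      Bn * suc K ∎
      where open ≤-Reasoning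

    vertex-cost : ∀ v → sumTo (λ x → suc (cost (v * Bn + x))) Bn ≤ Bn * c + length (sl v) * (Bn * K) +
      length (pl v) * (Bn * suc K)
    vertex-cost v = begin
      sumTo (λ x → suc (cost (v * Bn + x))) Bn
        ≡⟨ sumTo-cong Bn (λ {x} x< → trans (cong₂ (λ w y →
          suc (2 + k * 2 + (2 * suc k + (length (sl w) * K + sumL (λ u → suc (length (pre u y Bn) * K)) (pl
            w))))) (Verified.Algorithm.vt-≡ setup x<) (Verified.Algorithm.xt-≡ setup {v} x<))
             (cong suc (rearrange (2 + k * 2) (2 * suc k) (length (sl v) * K) _))) ⟩
      sumTo (λ x → c + length (sl v) * K + sumL (λ u → suc (length (pre u x Bn) * K)) (pl v)) Bn
        ≡⟨ sumTo-+ (λ _ → c + length (sl v) * K) _ Bn ⟩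
      sumTo (λ _ → c + length (sl v) * K) Bn + sumTo (λ x → sumL (λ u → suc (length (pre u x Bn) * K)) (pl
        v)) Bn
        ≡⟨ cong₂ _+_ (sumTo-const _ Bn) (sumTo-sumL (λ u x → suc (length (pre u x Bn) * K)) (pl v) Bn) ⟩
      Bn * (c + length (sl v) * K) + sumL (λ u → sumTo (λ x → suc (length (pre u x Bn) * K)) Bn) (pl v)
        ≤⟨ +-mono-≤ (≤-reflexive (solveℕ 4 (λ b c l k → b :* (c :+ l :* k) :≡ b :* c :+ l :* (b :* k)) refl Bn c
          (length (sl v)) K)) (sumL-≤ (pl v) rows-total) ⟩
      Bn * c + length (sl v) * (Bn * K) + length (pl v) * (Bn * suc K) ∎
      where
      open ≤-Reasoning
      rearrange : ∀ a b d e → a + (b + (d + e)) ≡ a + b + d + e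
      rearrange = solveℕ 4 (λ a b d e → a :+ (b :+ (d :+ e)) :≡ a :+ b :+ d :+ e) refl

    -- Every vertex has an outgoing edge. This lets the edges pay for the work that arises once per
    -- state, such as copying and incrementing.
    n≤∣E∣ : n ≤ ∣E∣
    n≤∣E∣ = ≤-trans (≤-reflexive (trans (sym (*-identityʳ n)) (sym (sumTo-const 1 n))))
      (≤-trans (sumTo-mono n (byFin (λ v → 1 ≤ length (sl v)) λ v →
        subst (1 ≤_) (sym (length-sl v)) (degree>0 v))) (≤-reflexive edges-sl))

    Tot≤ : Tot ≤ 16 * (∣E∣ * k * Bn)
    Tot≤ = begin
      Tot ≡⟨ sumTo-split (λ s → suc (cost s)) n Bn ⟩
      sumTo (λ v → sumTo (λ x → suc (cost (v * Bn + x))) Bn) n ≤⟨ sumTo-mono n (λ {v} _ → vertex-cost v) ⟩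
      sumTo (λ v → Bn * c + length (sl v) * (Bn * K) + length (pl v) * (Bn * suc K)) n ≡⟨ sumTo-+ _ _ n ⟩
      sumTo (λ v → Bn * c + length (sl v) * (Bn * K)) n + sumTo (λ v → length (pl v) * (Bn * suc K)) n
        ≡⟨ cong₂ _+_ (trans (sumTo-+ _ _ n) (cong₂ _+_ (sumTo-const _ n) (trans (sumTo-*ʳ (length ∘ sl) _ n)
          (cong (_* (Bn * K)) edges-sl))))
             (trans (sumTo-*ʳ (length ∘ pl) _ n) (cong (_* (Bn * suc K)) edges-pl)) ⟩
      n * (Bn * c) + ∣E∣ * (Bn * K) + ∣E∣ * (Bn * suc K)
        ≤⟨ +-monoˡ-≤ _ (+-monoˡ-≤ _ (*-monoˡ-≤ (Bn * c) n≤∣E∣)) ⟩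
      ∣E∣ * (Bn * c) + ∣E∣ * (Bn * K) + ∣E∣ * (Bn * suc K)
        ≡⟨ solveℕ 3 (λ m b k → m :* (b :* (con 1 :+ (con 2 :+ k :* con 2 :+ con 2 :* (con 1 :+ k)))) :+ m :* (b
          :* (con 2 :+ k)) :+ m :* (b :* (con 3 :+ k))
                       :≡ m :* b :* (con 10 :+ con 6 :* k)) refl ∣E∣ Bn k ⟩
      -- The terms `5 + 4 * k` for a state, `2 + k` for an outgoing and `3 + k` for an incoming edge
      -- add up to `10 + 6 * k`, at most `16 * k` as `k` is positive.
      ∣E∣ * Bn * (10 + 6 * k) ≤⟨ *-monoʳ-≤ (∣E∣ * Bn) (+-monoˡ-≤ (6 * k) (*-monoʳ-≤ 10 k≥1)) ⟩
      ∣E∣ * Bn * (10 * k + 6 * k) ≡⟨ solveℕ 3 (λ m b k → m :* b :* (con 10 :* k :+ con 6 :* k) :≡ con 16 :* (m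
        :* k :* b)) refl ∣E∣ Bn k ⟩
      16 * (∣E∣ * k * Bn) ∎
      where open ≤-Reasoning

    steps≤ : Tot * Successor.total n k ≤ 16 * (∣E∣ * n ^ (k + 1) * k * k ! * Bn)
    steps≤ = begin
      Tot * (n * Numbering.words n k) ≤⟨ *-monoˡ-≤ _ Tot≤ ⟩
      16 * (∣E∣ * k * Bn) * (n * Numbering.words n k) ≡⟨ cong (λ w → 16 * (∣E∣ * k * Bn) * (n * w)) (words-! n
        k) ⟩
      16 * (∣E∣ * k * Bn) * (n * (k ! * n ^ k))
        ≡⟨ solveℕ 6 (λ m k b n f p → con 16 :* (m :* k :* b) :* (n :* (f :* p)) :≡ con 16 :* (m :* (n :* p) :* k
          :* f :* b)) refl ∣E∣ k Bn n (k !) (n ^ k) ⟩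
      16 * (∣E∣ * n ^ suc k * k * k ! * Bn) ≡⟨ cong (λ e → 16 * (∣E∣ * n ^ e * k * k ! * Bn)) (+-comm 1 k) ⟩
      16 * (∣E∣ * n ^ (k + 1) * k * k ! * Bn) ∎
      where open ≤-Reasoning

-- The constant and the empty game.

constant-absorbs : ∀ w {u x} → u ≤ 16 * x → w * suc u ≤ 100 * suc w * suc x
constant-absorbs w {u} {x} le = begin
  w * suc u ≤⟨ *-mono-≤ (n≤1+n w) (s≤s le) ⟩
  suc w * suc (16 * x) ≤⟨ *-monoʳ-≤ (suc w) (+-monoˡ-≤ (16 * x) (≤ᵇ⇒≤ 1 16 tt)) ⟩
  suc w * (16 + 16 * x) ≡⟨ cong (suc w *_) (*-suc 16 x) ⟨
  suc w * (16 * suc x) ≡⟨ *-assoc (suc w) 16 (suc x) ⟨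
  suc w * 16 * suc x ≤⟨ *-monoˡ-≤ (suc x) (≤-trans (*-monoʳ-≤ (suc w) (≤ᵇ⇒≤ 16 100 tt))
    (≤-reflexive (*-comm (suc w) 100))) ⟩
  100 * suc w * suc x ∎
  where open ≤-Reasoning

empty-game : ∀ {k} (G : Game 0) (Ω : GenRabin 0 k) C x y → 100 ≤ C → ComputesSmallestGood G Ω solver (C *
  suc x) y (C * suc (length (encode G Ω) + 0))
empty-game {k} G Ω C x y 100≤C = (λ ()) , ((λ ()) , λ _ _ ()) , _ , _ ,
  -- Three steps for reading `n` and three for the test that fails.
  ≤-trans (≤ᵇ⇒≤ 6 100 tt) (≤-trans 100≤C (m≤m*n C (suc x))) ,
  seq (assign (inp zero (const z≤n) z≤n)) (if-false (const z≤n) reg ≤-refl skip) , λ ()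
  where open Machine (encode G Ω) y (C * suc (length (encode G Ω) + 0))

solver-correct : ∀ C → 100 * suc (weight solver) ≤ C → ∀ {n k : ℕ} (G : Game n) (Ω : GenRabin n k) →
  ComputesSmallestGood G Ω solver
    (C * suc (Game.∣E∣ G * n ^ (k + 1) * k * k ! * Rankings.∣B∣ G Ω))
    (C * suc (n * k * Rankings.∣B∣ G Ω))
    (C * suc (length (encode G Ω) + n * k * Rankings.∣B∣ G Ω))
solver-correct C le {zero} G Ω = empty-game G Ω C _ _ (≤-trans (m≤m*n 100 (suc (weight solver))) le)
solver-correct C le {suc n} G Ω = Correctness.computes G Ω z<s C (≤-trans (m≤m*n 100 (suc (weight solver))) le)
  (≤-trans (constant-absorbs (weight solver) (Correctness.steps≤ G Ω z<s C
    (≤-trans (m≤m*n 100 (suc (weight solver))) le))) (*-monoˡ-≤ _ le))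

theorem18 : ∃[ p ] ∃[ C ] ∀ {n k : ℕ} (G : Game n) (Ω : GenRabin n k) →
    let m = Game.∣E∣ G
        ∣B∣ = Rankings.∣B∣ G Ω
    in ComputesSmallestGood G Ω p
         -- time; the added 1 here and below only matters for the empty game
         (C * suc (m * n ^ (k + 1) * k * k ! * ∣B∣))
         -- space
         (C * suc (n * k * ∣B∣))
         -- largest word: word length is logarithmic in input and memory size
         (C * suc (length (encode G Ω) + n * k * ∣B∣))
-- The factor 100 covers the 56 of the space bound and the 16 of the step count, and makes every
-- constant in the program a legal word; the other factor is the time spent per unit of potential.
theorem18 = solver , 100 * suc (weight solver) , solver-correct _ ≤-refl
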